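{- Let $0<\varepsilon<1/6$. If $k$ and $\ell$ are positive integers with $k\geq 1/\varepsilon$ and $\ell\geq 16k/\varepsilon$, then $\mathrm{ex}(n,H_{k,\ell})=O(n^{4/3+\varepsilon})$ (the implied constant depending on $\varepsilon,k,\ell$).
   Context: $\mathrm{ex}(n,H)$ is the maximum number of edges in an $n$-vertex graph with no subgraph isomorphic to $H$. For integers $k\geq 1$ and $\ell\geq 2$, $H_{k,\ell}$ is the graph with vertex set $\{x_{i,j}:1\leq i\leq 4k,\ 1\leq j\leq 2\ell\}$ (all distinct) and edge set consisting of: $x_{2i-1,j}x_{2i,j}$ for $1\leq i\leq 2k$, $1\leq j\leq 2\ell$; $x_{1,j}x_{1,j+1}$ and $x_{4k,j}x_{4k,j+1}$ for $1\leq j\leq 2\ell$; $x_{2i,j}x_{2i+1,j+1}$ and $x_{2i+1,j}x_{2i,j+1}$ for $1\leq i\leq 2k-1$, $1\leq j\leq 2\ell$; where $x_{i,2\ell+1}:=x_{i,1}$. This graph is $3$-regular and bipartite. -}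

module Defs where

open import Data.Nat as ℕ using (ℕ; zero; suc; NonZero)
import Data.Nat.Properties as ℕₚ
open import Data.Integer as ℤ using (+_)
open import Data.Rational as ℚ using (ℚ; 0ℚ; 1ℚ)
import Data.Rational.Properties as ℚₚ
open import Data.Bool using (true)
import Data.Bool.Properties as Boolₚ
open import Data.Fin using (Fin; toℕ; combine; remQuot; finToFun; funToFin)
import Data.Fin.Properties as Finₚ
open import Data.Fin.Subset using (Subset)
open import Data.Fin.Subset.Properties using (anySubset?)
open import Data.Vec using (lookup; tabulate)
open import Data.Vec.Properties using (lookup∘tabulate)
open import Data.List using (List; length; filter; allFin; cartesianProduct)
open import Data.List.Properties using (length-filter; filter-≐)
open import Data.Product using (Σ; ∃; ∃-syntax; _×_; _,_; proj₁; proj₂)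
open import Data.Sum as Sum using (_⊎_; inj₁; inj₂; [_,_]′)
open import Data.Empty using (⊥; ⊥-elim)
open import Function using (_∘_; const; _↔_; Inverse)
open import Function.Definitions using (Injective)
open import Relation.Nullary using (¬_; Dec; yes; no; does)
open import Relation.Nullary.Decidable
  using (map′; ¬?; _×-dec_; _⊎-dec_; _→-dec_; dec-true)
open import Relation.Binary using (tri<; tri≈; tri>)
open import Relation.Binary.PropositionalEquality
  using (_≡_; _≢_; refl; sym; trans; cong; subst; subst₂)

------------------------------------------------------------------------
-- Real numbers, as located two-sided Dedekind cuts of ℚ

record ℝ : Set₁ where
  field
    L U       : ℚ → Set                     -- L q : q < x,   U q : x < q
    inhabL    : ∃ L
    inhabU    : ∃ U
    closedL   : ∀ {p q} → p ℚ.< q → L q → L p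
    closedU   : ∀ {p q} → p ℚ.< q → U p → U q
    roundedL  : ∀ {q} → L q → ∃[ r ] q ℚ.< r × L r
    roundedU  : ∀ {q} → U q → ∃[ r ] r ℚ.< q × U r
    disjoint  : ∀ {q} → L q → U q → ⊥
    located   : ∀ {p q} → p ℚ.< q → L p ⊎ U q

  L<U : ∀ {p q} → L p → U q → p ℚ.< q
  L<U {p} {q} Lp Uq with p ℚₚ.<? q
  ... | yes p<q = p<q
  ... | no  p≮q with ℚₚ.<-cmp p q
  ...   | tri< p<q _ _ = p<q
  ...   | tri≈ _ refl _ = ⊥-elim (disjoint Lp Uq)
  ...   | tri> _ _ q<p = ⊥-elim (disjoint (closedL q<p Lp) Uq)

open ℝ

infix 4 _<ᵣ_ _≤ᵣ_

_<ᵣ_ : ℝ → ℝ → Set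
x <ᵣ y = ∃[ q ] U x q × L y q

_≤ᵣ_ : ℝ → ℝ → Set
x ≤ᵣ y = ∀ q → L x q → L y q

private
  p-1<p : ∀ p → p ℚ.- 1ℚ ℚ.< p
  p-1<p p = subst (p ℚ.- 1ℚ ℚ.<_) (ℚₚ.+-identityʳ p)
              (ℚₚ.+-monoʳ-< p (ℚ.*<* ℤ.-<+))

  p<p+1 : ∀ p → p ℚ.< p ℚ.+ 1ℚ
  p<p+1 p = subst (ℚ._< p ℚ.+ 1ℚ) (ℚₚ.+-identityʳ p)
              (ℚₚ.+-monoʳ-< p (ℚ.*<* (ℤ.+<+ (ℕ.s≤s ℕ.z≤n))))

fromℚ : ℚ → ℝ
fromℚ p .L q = q ℚ.< p
fromℚ p .U q = p ℚ.< q
fromℚ p .inhabL = p ℚ.- 1ℚ , p-1<p p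
fromℚ p .inhabU = p ℚ.+ 1ℚ , p<p+1 p
fromℚ p .closedL = ℚₚ.<-trans
fromℚ p .closedU q<r p<q = ℚₚ.<-trans p<q q<r
fromℚ p .roundedL q<p = ℚₚ.<-dense q<p
fromℚ p .roundedU p<q with r , p<r , r<q ← ℚₚ.<-dense p<q = r , r<q , p<r
fromℚ p .disjoint q<p p<q = ℚₚ.<-asym q<p p<q
fromℚ p .located {q} {r} q<r with q ℚₚ.<? p
... | yes q<p = inj₁ q<p
... | no  q≮p = inj₂ (ℚₚ.≤-<-trans (ℚₚ.≮⇒≥ q≮p) q<r)

fromℕ : ℕ → ℝ
fromℕ n = fromℚ (+ n ℚ./ 1)

0ᵣ : ℝ
0ᵣ = fromℚ 0ℚ

private
  cancel⁺ : ∀ q p → (q ℚ.+ p) ℚ.- p ≡ q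
  cancel⁺ q p = trans (ℚₚ.+-assoc q p (ℚ.- p))
                (trans (cong (q ℚ.+_) (ℚₚ.+-inverseʳ p)) (ℚₚ.+-identityʳ q))

  cancel⁻ : ∀ q p → (q ℚ.- p) ℚ.+ p ≡ q
  cancel⁻ q p = trans (ℚₚ.+-assoc q (ℚ.- p) p)
                (trans (cong (q ℚ.+_) (ℚₚ.+-inverseˡ p)) (ℚₚ.+-identityʳ q))

infixr 6 _⊕_

_⊕_ : ℚ → ℝ → ℝ
(p ⊕ x) .L q = L x (q ℚ.- p)
(p ⊕ x) .U q = U x (q ℚ.- p)
(p ⊕ x) .inhabL with q , Lq ← inhabL x = q ℚ.+ p , subst (L x) (sym (cancel⁺ q p)) Lq
(p ⊕ x) .inhabU with q , Uq ← inhabU x = q ℚ.+ p , subst (U x) (sym (cancel⁺ q p)) Uq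
(p ⊕ x) .closedL q<r = closedL x (ℚₚ.+-monoˡ-< (ℚ.- p) q<r)
(p ⊕ x) .closedU q<r = closedU x (ℚₚ.+-monoˡ-< (ℚ.- p) q<r)
(p ⊕ x) .roundedL {q} Lq with r , q-p<r , Lr ← roundedL x Lq =
  r ℚ.+ p , subst (ℚ._< r ℚ.+ p) (cancel⁻ q p) (ℚₚ.+-monoˡ-< p q-p<r)
          , subst (L x) (sym (cancel⁺ r p)) Lr
(p ⊕ x) .roundedU {q} Uq with r , r<q-p , Ur ← roundedU x Uq =
  r ℚ.+ p , subst (r ℚ.+ p ℚ.<_) (cancel⁻ q p) (ℚₚ.+-monoˡ-< p r<q-p)
          , subst (U x) (sym (cancel⁺ r p)) Ur
(p ⊕ x) .disjoint = disjoint x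
(p ⊕ x) .located q<r = located x (ℚₚ.+-monoˡ-< (ℚ.- p) q<r)

private
  -- a / r for positive r
  quot : (a r : ℚ) → 0ℚ ℚ.< r → ∃[ v ] v ℚ.* r ≡ a
  quot a r 0<r = a ℚ.* ℚ.1/ r , trans (ℚₚ.*-assoc a (ℚ.1/ r) r)
                     (trans (cong (a ℚ.*_) (ℚₚ.*-inverseˡ r)) (ℚₚ.*-identityʳ a))
    where instance
      r≢0 : ℚ.NonZero r
      r≢0 = ℚₚ.pos⇒nonZero r {{ℚ.positive 0<r}}

  mono : ∀ {p q r} → 0ℚ ℚ.< r → p ℚ.< q → p ℚ.* r ℚ.< q ℚ.* r
  mono {r = r} 0<r = ℚₚ.*-monoˡ-<-pos r {{ℚ.positive 0<r}}

  cancel : ∀ {p q r} → 0ℚ ℚ.< r → p ℚ.* r ℚ.< q ℚ.* r → p ℚ.< q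
  cancel {r = r} 0<r = ℚₚ.*-cancelʳ-<-nonNeg r {{ℚₚ.pos⇒nonNeg r {{ℚ.positive 0<r}}}}

  monoʳ : ∀ {p q r} → 0ℚ ℚ.< r → p ℚ.< q → r ℚ.* p ℚ.< r ℚ.* q
  monoʳ {r = r} 0<r = ℚₚ.*-monoʳ-<-pos r {{ℚ.positive 0<r}}

  cancelʳ₀ : ∀ {q r} → 0ℚ ℚ.< r → 0ℚ ℚ.< q ℚ.* r → 0ℚ ℚ.< q
  cancelʳ₀ {q} {r} 0<r h = cancel 0<r (subst (ℚ._< q ℚ.* r) (sym (ℚₚ.*-zeroˡ r)) h)

  neg* : ∀ {s r} → 0ℚ ℚ.< r → s ℚ.< 0ℚ → s ℚ.* r ℚ.< 0ℚ
  neg* {s} {r} 0<r s<0 = subst (s ℚ.* r ℚ.<_) (ℚₚ.*-zeroˡ r) (mono 0<r s<0)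

  0≤ℕ : ∀ n → 0ℚ ℚ.≤ + n ℚ./ 1
  0≤ℕ n = ℚₚ.nonNegative⁻¹ (+ n ℚ./ 1) {{ℚₚ.normalize-nonNeg n 1}}

  pos-L : (x : ℝ) → 0ᵣ <ᵣ x → ∃[ r ] 0ℚ ℚ.< r × L x r
  pos-L x (r , 0<r , Lr) = r , 0<r , Lr

  pos-U : (x : ℝ) → 0ᵣ <ᵣ x → ∀ {r} → U x r → 0ℚ ℚ.< r
  pos-U x (q , 0<q , Lq) Ur = ℚₚ.<-trans 0<q (L<U x Lq Ur)

-- The quotient c / x for c ≥ 0 and x > 0:  s < c / x  iff  s r < c for some
-- rational r > x, and  c / x < s  iff  c < s r for some rational 0 < r < x.

ratio : (c : ℚ) → 0ℚ ℚ.≤ c → (x : ℝ) → 0ᵣ <ᵣ x → ℝ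
ratio c 0≤c x 0<x .L s = ∃[ r ] U x r × s ℚ.* r ℚ.< c
ratio c 0≤c x 0<x .U s = ∃[ r ] 0ℚ ℚ.< r × L x r × c ℚ.< s ℚ.* r
ratio c 0≤c x 0<x .inhabL with r , Ur ← inhabU x =
  ℚ.- 1ℚ , r , Ur ,
  ℚₚ.<-≤-trans (neg* {ℚ.- 1ℚ} (pos-U x 0<x Ur) (ℚ.*<* ℤ.-<+)) 0≤c
ratio c 0≤c x 0<x .inhabU
  with r , 0<r , Lr ← pos-L x 0<x
  with v , vr≡ ← quot (c ℚ.+ 1ℚ) r 0<r =
  v , r , 0<r , Lr , subst (c ℚ.<_) (sym vr≡) (p<p+1 _)
ratio c 0≤c x 0<x .closedL p<q (r , Ur , qr<c) =
  r , Ur , ℚₚ.<-trans (mono (pos-U x 0<x Ur) p<q) qr<c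
ratio c 0≤c x 0<x .closedU p<q (r , 0<r , Lr , c<pr) =
  r , 0<r , Lr , ℚₚ.<-trans c<pr (mono 0<r p<q)
ratio c 0≤c x 0<x .roundedL {q} (r , Ur , qr<c)
  with 0<r ← pos-U x 0<x Ur
  with v , vr≡c ← quot c r 0<r
  with t , q<t , t<v ← ℚₚ.<-dense (cancel {q} {v} 0<r (subst (q ℚ.* r ℚ.<_) (sym vr≡c) qr<c)) =
  t , q<t , r , Ur , subst (t ℚ.* r ℚ.<_) vr≡c (mono 0<r t<v)
ratio c 0≤c x 0<x .roundedU {q} (r , 0<r , Lr , c<qr)
  with v , vr≡c ← quot c r 0<r
  with t , v<t , t<q ← ℚₚ.<-dense (cancel {v} {q} 0<r (subst (ℚ._< q ℚ.* r) (sym vr≡c) c<qr)) =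
  t , t<q , r , 0<r , Lr , subst (ℚ._< t ℚ.* r) vr≡c (mono 0<r v<t)
ratio c 0≤c x 0<x .disjoint {q} (r , Ur , qr<c) (s , 0<s , Ls , c<qs) =
  ℚₚ.<-asym (ℚₚ.<-trans qr<c c<qs) (monoʳ 0<q (L<U x Ls Ur))
  where
  0<q : 0ℚ ℚ.< q
  0<q = cancelʳ₀ 0<s (ℚₚ.≤-<-trans 0≤c c<qs)
ratio c 0≤c x 0<x .located {s} {t} s<t with s ℚₚ.<? 0ℚ
... | yes s<0 with r , Ur ← inhabU x =
  inj₁ (r , Ur , ℚₚ.<-≤-trans (neg* (pos-U x 0<x Ur) s<0) 0≤c)
... | no  s≮0 with 0<t ← ℚₚ.≤-<-trans (ℚₚ.≮⇒≥ s≮0) s<t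
                 | 0ℚ ℚₚ.<? c
...   | no  0≮c with r , 0<r , Lr ← pos-L x 0<x =
  inj₂ (r , 0<r , Lr , ℚₚ.≤-<-trans (ℚₚ.≮⇒≥ 0≮c)
    (subst (ℚ._< t ℚ.* r) (ℚₚ.*-zeroˡ r) (mono 0<r 0<t)))
...   | yes 0<c
  -- with s < u < t:  c / t < r < c / u
  with u , s<u , u<t ← ℚₚ.<-dense s<t
  with 0<u ← ℚₚ.≤-<-trans (ℚₚ.≮⇒≥ s≮0) s<u
  with v , vt≡c ← quot c t 0<t
  with w , wu≡c ← quot c u 0<u
  with 0<v ← cancelʳ₀ {v} 0<t (subst (0ℚ ℚ.<_) (sym vt≡c) 0<c)
  with 0<w ← cancelʳ₀ {w} 0<u (subst (0ℚ ℚ.<_) (sym wu≡c) 0<c)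
  with r , v<r , r<w ← ℚₚ.<-dense
         (cancel {v} {w} 0<u (subst (v ℚ.* u ℚ.<_) (trans vt≡c (sym wu≡c)) (monoʳ 0<v u<t)))
  with located x r<w
...     | inj₁ Lr = inj₂ (r , ℚₚ.<-trans 0<v v<r , Lr ,
                          subst₂ ℚ._<_ vt≡c (ℚₚ.*-comm r t) (mono 0<t v<r))
...     | inj₂ Uw = inj₁ (w , Uw ,
                          subst (s ℚ.* w ℚ.<_) (trans (ℚₚ.*-comm u w) wu≡c) (mono 0<w s<u))

_/_[_] : ℕ → (x : ℝ) → 0ᵣ <ᵣ x → ℝ
n / x [ 0<x ] = ratio (+ n ℚ./ 1) (0≤ℕ n) x 0<x

-- m ≤ C n^α for a real exponent α ≥ 0 and n ≥ 1: since t ↦ n^t is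
-- continuous and nondecreasing, it means that m ≤ C n^(p/q), that is
-- m^q ≤ C^q n^p, for all rationals p/q > α.

infix 4 _≤_·_^ᵣ_

_≤_·_^ᵣ_ : ℕ → ℕ → ℕ → ℝ → Set
m ≤ C · n ^ᵣ α = ∀ (p q : ℕ) .{{_ : NonZero q}} → α <ᵣ fromℚ (+ p ℚ./ q) →
                 m ℕ.^ q ℕ.≤ C ℕ.^ q ℕ.* n ℕ.^ p

-- f(n) = O(n^α) as n → ∞, for α ≥ 0.  A natural number constant is no
-- restriction, as a real one can be rounded up.

infix 4 _=O[n^_]

_=O[n^_] : (ℕ → ℕ) → ℝ → Set
f =O[n^ α ] = ∃[ C ] ∃[ N ] ∀ n → N ℕ.≤ n → f n ≤ C · n ^ᵣ α

------------------------------------------------------------------------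
-- Finite simple graphs

record Graph (V : Set) : Set₁ where
  field
    _~_    : V → V → Set
    ~-sym  : ∀ {u v} → u ~ v → v ~ u
    ~-irr  : ∀ {v} → ¬ v ~ v
    _~?_   : ∀ u v → Dec (u ~ v)

open Graph

record FiniteGraph : Set₁ where
  field
    Vertex : Set
    order  : ℕ
    enum   : Fin order ↔ Vertex
    graph  : Graph Vertex

open FiniteGraph

pairs : ∀ n → List (Fin n × Fin n)
pairs n = cartesianProduct (allFin n) (allFin n)

∣E_∣ : ∀ {n} → Graph (Fin n) → ℕ
∣E_∣ {n} G = length (filter (λ (i , j) → i Finₚ.<? j ×-dec _~?_ G i j) (pairs n))

-- G has a subgraph isomorphic to H.  Such a subgraph is the image of an
-- adjacency-preserving injection; the subgraph need not be induced.
Contains : ∀ {n} → Graph (Fin n) → FiniteGraph → Set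
Contains {n} G H = Σ (Vertex H → Fin n) λ f →
  Injective _≡_ _≡_ f × (∀ {u v} → _~_ (graph H) u v → _~_ G (f u) (f v))

-- There is an n-vertex graph with m edges and no subgraph isomorphic to H.
FreeWith : ℕ → FiniteGraph → ℕ → Set₁
FreeWith n H m = Σ (Graph (Fin n)) λ G → ¬ Contains G H × ∣E G ∣ ≡ m

-- Containment is decidable, by searching through all maps.
private
  contains? : ∀ {n} (G : Graph (Fin n)) H → Dec (Contains G H)
  contains? {n} G H = map′ back forth (Finₚ.any? λ c → Good? (finToFun c))
    where
    open Inverse (enum H) renaming (to to dec; from to enc)
    h = order H
    dec∘enc : ∀ v → dec (enc v) ≡ v
    dec∘enc v = strictlyInverseˡ v
    enc∘dec : ∀ i → enc (dec i) ≡ i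
    enc∘dec i = strictlyInverseʳ i

    Good : (Fin h → Fin n) → Set
    Good g = ∀ i j → (g i ≡ g j → i ≡ j) ×
                     (_~_ (graph H) (dec i) (dec j) → _~_ G (g i) (g j))
    Good? : ∀ g → Dec (Good g)
    Good? g = Finₚ.all? λ i → Finₚ.all? λ j →
      ((g i Finₚ.≟ g j) →-dec (i Finₚ.≟ j)) ×-dec
      (_~?_ (graph H) (dec i) (dec j) →-dec _~?_ G (g i) (g j))

    back : (∃ λ c → Good (finToFun c)) → Contains G H
    back (c , good) = finToFun c ∘ enc ,
      (λ {u} {v} eq → trans (sym (dec∘enc u))
        (trans (cong dec (proj₁ (good (enc u) (enc v)) eq)) (dec∘enc v))) ,
      (λ {u} {v} u~v → proj₂ (good (enc u) (enc v))
        (subst₂ (_~_ (graph H)) (sym (dec∘enc u)) (sym (dec∘enc v)) u~v))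

    forth : Contains G H → ∃ λ c → Good (finToFun c)
    forth (f , inj , hom) = funToFin (f ∘ dec) , λ i j →
      (λ eq → trans (sym (enc∘dec i)) (trans
        (cong enc (inj (trans (sym (pt i)) (trans eq (pt j))))) (enc∘dec j))) ,
      (λ u~v → subst₂ (_~_ G) (sym (pt i)) (sym (pt j)) (hom u~v))
      where
      pt : ∀ i → finToFun (funToFin (f ∘ dec)) i ≡ f (dec i)
      pt = Finₚ.finToFun-funToFin (f ∘ dec)

  -- Graphs on Fin n are coded, up to pointwise equivalence, by subsets of Fin (n * n).
  decode : ∀ {n} → Subset (n ℕ.* n) → Graph (Fin n)
  decode S ._~_ i j = i ≢ j × (lookup S (combine i j) ≡ true ⊎ lookup S (combine j i) ≡ true)
  decode S .~-sym (i≢j , e) = i≢j ∘ sym , Sum.swap e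
  decode S .~-irr (i≢i , _) = i≢i refl
  decode S ._~?_ i j = ¬? (i Finₚ.≟ j) ×-dec
    ((lookup S (combine i j) Boolₚ.≟ true) ⊎-dec (lookup S (combine j i) Boolₚ.≟ true))

  encode : ∀ {n} → Graph (Fin n) → Subset (n ℕ.* n)
  encode {n} G = tabulate λ c → let (i , j) = remQuot {n} n c in does (_~?_ G i j)

  infix 4 _≈_
  _≈_ : ∀ {n} → Graph (Fin n) → Graph (Fin n) → Set
  G ≈ G′ = ∀ i j → (_~_ G i j → _~_ G′ i j) × (_~_ G′ i j → _~_ G i j)

  module _ {n} (G : Graph (Fin n)) where
    bit : ∀ i j → lookup (encode G) (combine i j) ≡ does (_~?_ G i j)
    bit i j = trans (lookup∘tabulate _ (combine i j))
      (cong (λ (i , j) → does (_~?_ G i j)) (Finₚ.remQuot-combine i j))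

    bit⇒~ : ∀ i j → lookup (encode G) (combine i j) ≡ true → _~_ G i j
    bit⇒~ i j eq with _~?_ G i j | trans (sym (bit i j)) eq
    ... | yes e | _ = e
    ... | no  _ | ()

    encode-≈ : G ≈ decode (encode G)
    encode-≈ i j =
      (λ e → (λ { refl → ~-irr G e }) , inj₁ (trans (bit i j) (dec-true (_~?_ G i j) e))) ,
      (λ { (_ , inj₁ e) → bit⇒~ i j e ; (_ , inj₂ e) → ~-sym G (bit⇒~ j i e) })

  ≈-edges : ∀ {n} {G G′ : Graph (Fin n)} → G ≈ G′ → ∣E G ∣ ≡ ∣E G′ ∣
  ≈-edges {n} {G} {G′} eq = cong length (filter-≐ _ _
    ((λ {(i , j)} (lt , e) → lt , proj₁ (eq i j) e) ,
     (λ {(i , j)} (lt , e) → lt , proj₂ (eq i j) e)) (pairs n))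

  ≈-free : ∀ {n} {G G′ : Graph (Fin n)} {H} → G ≈ G′ → ¬ Contains G H → ¬ Contains G′ H
  ≈-free eq free (f , inj , hom) = free (f , inj , λ {u} {v} e → proj₂ (eq (f u) (f v)) (hom e))

  freeWith? : ∀ n H m → Dec (FreeWith n H m)
  freeWith? n H m = map′
    (λ (S , free , eq) → decode {n} S , free , eq)
    (λ (G , free , eq) → encode G , ≈-free {G = G} {G′ = decode (encode G)} {H = H} (encode-≈ G) free
                       , trans (sym (≈-edges {G = G} {G′ = decode (encode G)} (encode-≈ G))) eq)
    (anySubset? λ S → ¬? (contains? (decode {n} S) H) ×-dec (∣E decode {n} S ∣ ℕₚ.≟ m))

IsMaximum : ∀ {a} → (ℕ → Set a) → ℕ → Set a
IsMaximum P m = P m × (∀ m′ → P m′ → m′ ℕ.≤ m)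

private
  maximum? : ∀ {a} {P : ℕ → Set a} → (∀ m → Dec (P m)) → ∀ b → (∀ m → P m → m ℕ.≤ b) →
             ∃ (IsMaximum P) ⊎ (∀ m → ¬ P m)
  maximum? P? b bnd with P? b
  ... | yes Pb = inj₁ (b , Pb , bnd)
  maximum? {P = P} P? zero bnd | no ¬Pb = inj₂ λ m Pm → ¬Pb (subst P (ℕₚ.n≤0⇒n≡0 (bnd m Pm)) Pm)
  maximum? P? (suc b) bnd | no ¬Pb = maximum? P? b λ m Pm →
    ℕₚ.≤-pred (ℕₚ.≤∧≢⇒< (bnd m Pm) λ { refl → ¬Pb Pm })

  search : ∀ n H → ∃ (IsMaximum (FreeWith n H)) ⊎ (∀ m → ¬ FreeWith n H m)
  search n H = maximum? (freeWith? n H) (length (pairs n))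
    λ { _ (G , _ , refl) → length-filter _ (pairs n) }

-- The value 0 in the absence of H-free graphs on n vertices is a
-- convention; it is irrelevant if H has an edge, as ex-isMaximum shows.
ex : ℕ → FiniteGraph → ℕ
ex n H = [ proj₁ , const 0 ]′ (search n H)

ex-isMaximum : ∀ n H {u v} → _~_ (graph H) u v → IsMaximum (FreeWith n H) (ex n H)
ex-isMaximum n H u~v with search n H
... | inj₁ (_ , max) = max
... | inj₂ none      = ⊥-elim (none _ (empty , (λ (_ , _ , hom) → hom u~v) , refl))
  where
  empty : Graph (Fin n)
  empty ._~_ _ _ = ⊥
  empty .~-sym ()
  empty .~-irr ()
  empty ._~?_ _ _ = no λ ()

------------------------------------------------------------------------
-- The graph H_{k,ℓ}

module _ (k ℓ : ℕ) where

  V : Set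
  V = Fin (4 ℕ.* k) × Fin (2 ℕ.* ℓ)

  -- The vertex x_{i,j} has row i and column j, counted from 1.
  row col : V → ℕ
  row (i , _) = suc (toℕ i)
  col (_ , j) = suc (toℕ j)

  -- The column of v is the successor of that of u, where 2ℓ + 1 is read as 1.
  NextCol : V → V → Set
  NextCol u v = col v ≡ suc (col u) ⊎ (col u ≡ 2 ℕ.* ℓ × col v ≡ 1)

  Exists[1≤i≤_] : ℕ → (ℕ → Set) → Set
  Exists[1≤i≤ b ] P = ∃[ i ] 1 ℕ.≤ i × i ℕ.≤ b × P i

  data ListedEdge (u v : V) : Set where
    -- x_{2i-1,j} x_{2i,j}
    rung   : Exists[1≤i≤ 2 ℕ.* k ] (λ i → row u ≡ 2 ℕ.* i ℕ.∸ 1 × row v ≡ 2 ℕ.* i) →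
             col u ≡ col v → ListedEdge u v
    -- x_{1,j} x_{1,j+1}
    first  : row u ≡ 1 → row v ≡ 1 → NextCol u v → ListedEdge u v
    -- x_{4k,j} x_{4k,j+1}
    last   : row u ≡ 4 ℕ.* k → row v ≡ 4 ℕ.* k → NextCol u v → ListedEdge u v
    -- x_{2i,j} x_{2i+1,j+1}
    cross  : Exists[1≤i≤ 2 ℕ.* k ℕ.∸ 1 ] (λ i → row u ≡ 2 ℕ.* i × row v ≡ 2 ℕ.* i ℕ.+ 1) →
             NextCol u v → ListedEdge u v
    -- x_{2i+1,j} x_{2i,j+1}
    cross′ : Exists[1≤i≤ 2 ℕ.* k ℕ.∸ 1 ] (λ i → row u ≡ 2 ℕ.* i ℕ.+ 1 × row v ≡ 2 ℕ.* i) →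
             NextCol u v → ListedEdge u v

  private
    exists? : ∀ b {P} → (∀ i → Dec (P i)) → Dec (Exists[1≤i≤ b ] P)
    exists? b P? = map′
      (λ (i , i<1+b , 1≤i , Pi) → i , 1≤i , ℕₚ.≤-pred i<1+b , Pi)
      (λ (i , 1≤i , i≤b , Pi) → i , ℕ.s≤s i≤b , 1≤i , Pi)
      (ℕₚ.anyUpTo? (λ i → (1 ℕₚ.≤? i) ×-dec P? i) (suc b))

    nextCol? : ∀ u v → Dec (NextCol u v)
    nextCol? u v = (col v ℕₚ.≟ suc (col u)) ⊎-dec ((col u ℕₚ.≟ 2 ℕ.* ℓ) ×-dec (col v ℕₚ.≟ 1))

    listed? : ∀ u v → Dec (ListedEdge u v)
    listed? u v = map′
      (λ { (inj₁ (e , c)) → rung e c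
         ; (inj₂ (inj₁ (a , b , c))) → first a b c
         ; (inj₂ (inj₂ (inj₁ (a , b , c)))) → last a b c
         ; (inj₂ (inj₂ (inj₂ (inj₁ (e , c))))) → cross e c
         ; (inj₂ (inj₂ (inj₂ (inj₂ (e , c))))) → cross′ e c })
      (λ { (rung e c)    → inj₁ (e , c)
         ; (first a b c) → inj₂ (inj₁ (a , b , c))
         ; (last a b c)  → inj₂ (inj₂ (inj₁ (a , b , c)))
         ; (cross e c)   → inj₂ (inj₂ (inj₂ (inj₁ (e , c))))
         ; (cross′ e c)  → inj₂ (inj₂ (inj₂ (inj₂ (e , c)))) })
      (  (exists? _ (λ i → (row u ℕₚ.≟ _) ×-dec (row v ℕₚ.≟ _)) ×-dec (col u ℕₚ.≟ col v))
      ⊎-dec ((row u ℕₚ.≟ _) ×-dec (row v ℕₚ.≟ _) ×-dec nextCol? u v)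
      ⊎-dec ((row u ℕₚ.≟ _) ×-dec (row v ℕₚ.≟ _) ×-dec nextCol? u v)
      ⊎-dec (exists? _ (λ i → (row u ℕₚ.≟ _) ×-dec (row v ℕₚ.≟ _)) ×-dec nextCol? u v)
      ⊎-dec (exists? _ (λ i → (row u ℕₚ.≟ _) ×-dec (row v ℕₚ.≟ _)) ×-dec nextCol? u v))

    2ℓ≢1 : ∀ m → 2 ℕ.* m ≢ 1
    2ℓ≢1 (suc m) eq with () ← trans (sym (ℕₚ.+-suc m _)) (ℕₚ.suc-injective eq)

    nextCol-irr : ∀ v → ¬ NextCol v v
    nextCol-irr v (inj₁ c≡1+c)      = ℕₚ.1+n≢n (sym c≡1+c)
    nextCol-irr v (inj₂ (c≡ , c≡1)) = 2ℓ≢1 ℓ (trans (sym c≡) c≡1)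

    listed-irr : ∀ v → ¬ ListedEdge v v
    listed-irr v (rung (suc i , _ , _ , r≡ , r≡′) _) = ℕₚ.1+n≢n (trans (sym r≡′) r≡)
    listed-irr v (first _ _ c)  = nextCol-irr v c
    listed-irr v (last _ _ c)   = nextCol-irr v c
    listed-irr v (cross _ c)    = nextCol-irr v c
    listed-irr v (cross′ _ c)   = nextCol-irr v c

  H : FiniteGraph
  H .Vertex = V
  H .order  = 4 ℕ.* k ℕ.* (2 ℕ.* ℓ)
  H .enum   = Finₚ.*↔×
  H .graph ._~_ u v = ListedEdge u v ⊎ ListedEdge v u
  H .graph .~-sym   = Sum.swap
  H .graph .~-irr   = [ listed-irr _ , listed-irr _ ]′
  H .graph ._~?_ u v = listed? u v ⊎-dec listed? v u

module Submission where

open import Defs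
open import Data.Nat using (ℕ; _*_; _≤_)
open import Data.Integer using (+_)
open import Data.Rational using (_/_)

import Data.Bool as Bool
open import Data.Nat.Properties
open import Algebra.Properties.CommutativeSemigroup *-commutativeSemigroup using (x∙yz≈y∙xz; x∙yz≈yx∙z; xy∙z≈xz∙y; xy∙z≈y∙xz)
open import Data.Bool using (Bool; _∧_; _∨_; false; if_then_else_; not; true)
open import Data.Bool.ListAction using (any)
import Data.Bool.Properties as Boolₚ
open import Data.Bool.Properties using (not-involutive; ∧-comm)
open import Data.Empty using (⊥; ⊥-elim)
import Data.Fin as Fin
open import Data.Fin using (Fin; toℕ)
import Data.Fin.Properties as Finₚ
open import Data.Fin.Properties using (toℕ-injective; toℕ<n)
import Data.Integer as ℤ
import Data.Integer.Properties as ℤₚ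
open import Data.Integer.Tactic.RingSolver using () renaming (solve-∀ to ℤ-solve-∀)
open import Data.List using (List; []; _++_; _∷_; allFin; cartesianProduct; cartesianProductWith; filter; filterᵇ; length; map; take)
open import Data.List.Membership.Propositional using (_∈_)
open import Data.List.Membership.Propositional.Properties using (∈-++⁺ʳ; ∈-++⁺ˡ; ∈-map⁺)
open import Data.List.Properties using (length-++; length-map; length-tabulate; length-take)
import Data.List.Relation.Unary.All as All
import Data.List.Relation.Unary.AllPairs as AllPairs
open import Data.List.Relation.Unary.Any using (here; there)
open import Data.List.Relation.Unary.Unique.Propositional using (Unique)
open import Data.List.Relation.Unary.Unique.Propositional.Properties using (allFin⁺)
import Data.Nat as ℕ
open import Data.Nat using (>-nonZero; NonZero; _!; _%_; _+_; _<?_; _<_; _^_; _∸_; _≤?_; suc; s≤s; zero; z≤n) renaming (_/_ to _div_)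
open import Data.Nat.DivMod using (/-monoˡ-≤; m%n<n; m*n/n≡m; m/n*n≡m; m/n*n≤m; m/n≤m; m≡m%n+[m/n]*n; m≥n⇒m/n>0)
open import Data.Nat.Divisibility using (_∣_; m∣m*n; m≤n⇒m!∣n!; ∣-trans)
open import Data.Nat.Induction using (<-wellFounded)
open import Data.Nat.Tactic.RingSolver using (solve-∀)
open import Data.Product using (_,_; _×_; proj₁; proj₂; ∃; ∃₂)
import Data.Rational as ℚ
import Data.Rational.Properties as ℚₚ
import Data.Rational.Unnormalised as ℚᵘ
open import Data.Rational.Unnormalised using (mkℚᵘ)
import Data.Rational.Unnormalised.Properties as ℚᵘₚ
open import Data.Sum using (_⊎_; inj₁; inj₂)
import Data.Vec as Vec
open import Data.Vec using (Vec; []; _∷_; head; tail; toList)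
import Data.Vec.Properties as Vecₚ
open import Data.Vec.Properties using (length-toList)
open import Induction.WellFounded using (Acc; acc)
open import Relation.Binary using (Tri; tri<; tri>; tri≈)
open import Relation.Binary.PropositionalEquality using (_≡_; _≢_; cong; cong₂; module ≡-Reasoning; refl; subst; subst₂; sym; trans)
open import Relation.Nullary using (Dec; does; no; yes; ¬_)
open import Relation.Nullary.Decidable using (_×-dec_; dec-true)

-- Write e for the number of edges of an H-free graph on n vertices, m = 2 k,
-- K = k ℓ and p = 4 K + ℓ + 16 k².  As p / 3K = 4/3 + (1/k + 16k/ℓ) / 3 < 4/3 + ε,
-- it suffices to show e^(3K) < C^(3K) n^p.  If vertices of degree above 64
-- times the average carry an eighth of the edges, they span, with equally
-- many vertices of the other side, a graph that is denser relative to its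
-- order; so the degrees may be assumed to be bounded by Δ = O(e / n).
--
-- A column of H is a tuple of m edges of G; two columns E, F are consecutive
-- if E₀ F₀ E₁ F₁ … is a closed walk of length 4 m in G, and H is a cyclic
-- sequence of 2 ℓ pairwise disjoint columns.  Thus closed walks are counted
-- twice: in G, and in the graph of columns, weighted by the walks of G.
-- Degenerate closed walks are rare: the numbers of closed walks form a
-- log-convex sequence, and by Cauchy–Schwarz across a reflection an event at
-- the start of the walk only has to be rare for half of the steps.  In the
-- graph of columns this needs that few of the ways through a column hit a
-- given vertex.  That holds if few pairs of vertices with many common
-- neighbours occur in G; otherwise there are many such pairs inside some
-- neighbourhood, and the columns are built from walks along these pairs.

-- The exponent is the price of passing from all closed walks to a single step. On N vertices the
-- even moments start at N, so log-convexity bounds their growth per two steps only up to the root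
-- N^(1/r), r the half-length. In G, with walks of length 4 m, degenerate steps must therefore be
-- rarer than 1/S, with S taken of order b = n^(1/m). In the graph of about n^(2 m) columns, with
-- cycles of length 2 ℓ, they must be rarer than 1/Z, with Z of order z = n^(4 m / ℓ). An entry of a
-- new column is an edge in the middle of a walk of length 3 between two given vertices. Typically
-- there are Δ³ / n such walks, and at most 2 t of them hit a given vertex if the pairs at distance
-- 2 have fewer than t common neighbours: hence Δ³ ≥ C n Z t. In the other case a proportion of
-- order 1/S of the pairs in some neighbourhood is heavy, and the walks along them need t of order Z
-- S². Together Δ³ ≥ C n b² z², where b² = n^(1/k) and z² = n^(16 k / ℓ). All of this is done in ℕ:
-- roots are least integers with a large power, and reciprocals of degrees are quotients of a common
-- factorial.

sq-cancel-≤ : ∀ x y → x * x ≤ y * y → x ≤ y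
sq-cancel-≤ x y h with x ≤? y
... | yes p = p
... | no  q = ⊥-elim (<⇒≱ (*-mono-< (≰⇒> q) (≰⇒> q)) h)

4xy≤[x+y]² : ∀ x y → 4 * (x * y) ≤ (x + y) * (x + y)
4xy≤[x+y]² x y with ≤-total x y
... | inj₁ x≤y with k , refl ← m≤n⇒∃[o]m+o≡n x≤y = subst (4 * (x * (x + k)) ≤_) (sym (lem x k)) (m≤m+n _ _)
  where
  lem : ∀ x k → (x + (x + k)) * (x + (x + k)) ≡ 4 * (x * (x + k)) + k * k
  lem = solve-∀
... | inj₂ y≤x with k , refl ← m≤n⇒∃[o]m+o≡n y≤x = subst (4 * ((y + k) * y) ≤_) (sym (lem y k)) (m≤m+n _ _)
  where
  lem : ∀ y k → ((y + k) + y) * ((y + k) + y) ≡ 4 * ((y + k) * y) + k * k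
  lem = solve-∀

-- Finite sums and the Cauchy-Schwarz inequality

infix 5 ∑
∑ : ∀ {X : Set} → List X → (X → ℕ) → ℕ
∑ []       f = 0
∑ (x ∷ xs) f = f x + ∑ xs f

syntax ∑ xs (λ x → e) = ∑[ x ∈ xs ] e

∑-cong : ∀ {X : Set} (xs : List X) {f g} → (∀ x → f x ≡ g x) → ∑ xs f ≡ ∑ xs g
∑-cong []       h = refl
∑-cong (x ∷ xs) h = cong₂ _+_ (h x) (∑-cong xs h)

∑-mono : ∀ {X : Set} (xs : List X) {f g} → (∀ x → f x ≤ g x) → ∑ xs f ≤ ∑ xs g
∑-mono []       h = z≤n
∑-mono (x ∷ xs) h = +-mono-≤ (h x) (∑-mono xs h)

∑-0 : ∀ {X : Set} (xs : List X) → ∑ xs (λ _ → 0) ≡ 0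
∑-0 []       = refl
∑-0 (x ∷ xs) = ∑-0 xs

∑-const : ∀ {X : Set} (xs : List X) a → ∑ xs (λ _ → a) ≡ length xs * a
∑-const []       a = refl
∑-const (x ∷ xs) a = cong (_+_ a) (∑-const xs a)

∑-+ : ∀ {X : Set} (xs : List X) f g → ∑ xs (λ x → f x + g x) ≡ ∑ xs f + ∑ xs g
∑-+ []       f g = refl
∑-+ (x ∷ xs) f g = trans (cong (_+_ (f x + g x)) (∑-+ xs f g)) (lem (f x) (g x) (∑ xs f) (∑ xs g))
  where
  lem : ∀ a b c d → a + b + (c + d) ≡ a + c + (b + d)
  lem = solve-∀

∑-*ˡ : ∀ {X : Set} (xs : List X) a f → ∑ xs (λ x → a * f x) ≡ a * ∑ xs f
∑-*ˡ []       a f = sym (*-zeroʳ a)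
∑-*ˡ (x ∷ xs) a f = trans (cong (_+_ (a * f x)) (∑-*ˡ xs a f)) (sym (*-distribˡ-+ a (f x) _))

∑-*ʳ : ∀ {X : Set} (xs : List X) a f → ∑ xs (λ x → f x * a) ≡ ∑ xs f * a
∑-*ʳ xs a f = trans (∑-cong xs (λ x → *-comm (f x) a)) (trans (∑-*ˡ xs a f) (*-comm a _))

∑-swap : ∀ {X Y : Set} (xs : List X) (ys : List Y) (f : X → Y → ℕ) →
         (∑[ x ∈ xs ] ∑[ y ∈ ys ] f x y) ≡ (∑[ y ∈ ys ] ∑[ x ∈ xs ] f x y)
∑-swap []       ys f = sym (∑-0 ys)
∑-swap (x ∷ xs) ys f = trans (cong (_+_ (∑ ys (f x))) (∑-swap xs ys f)) (sym (∑-+ ys (f x) _))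

∑-++ : ∀ {X : Set} (xs ys : List X) f → ∑ (xs ++ ys) f ≡ ∑ xs f + ∑ ys f
∑-++ []       ys f = refl
∑-++ (x ∷ xs) ys f = trans (cong (_+_ (f x)) (∑-++ xs ys f)) (sym (+-assoc (f x) _ _))

∑-map : ∀ {X Y : Set} (h : Y → X) (ys : List Y) f → ∑ (map h ys) f ≡ ∑ ys (λ y → f (h y))
∑-map h []       f = refl
∑-map h (y ∷ ys) f = cong (_+_ (f (h y))) (∑-map h ys f)

∑-cartesianProductWith : ∀ {X Y : Set} {Z : Set} (h : X → Y → Z) xs ys f →
  ∑ (cartesianProductWith h xs ys) f ≡ (∑[ x ∈ xs ] ∑[ y ∈ ys ] f (h x y))
∑-cartesianProductWith h []       ys f = refl
∑-cartesianProductWith h (x ∷ xs) ys f =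
  trans (∑-++ (map (h x) ys) _ f) (cong₂ _+_ (∑-map (h x) ys f) (∑-cartesianProductWith h xs ys f))

length-∑ : ∀ {X : Set} (xs : List X) → length xs ≡ ∑ xs (λ _ → 1)
length-∑ []       = refl
length-∑ (x ∷ xs) = cong suc (length-∑ xs)

∑-diag : ∀ {X : Set} (xs : List X) (f : X → X → ℕ) → (∑[ x ∈ xs ] f x x) ≤ (∑[ x ∈ xs ] ∑[ y ∈ xs ] f x y)
∑-diag []       f = z≤n
∑-diag (x ∷ xs) f = +-mono-≤ (m≤m+n (f x x) _)
  (≤-trans (∑-diag xs f) (∑-mono xs λ y → m≤n+m _ (f y x)))

∑-exists : ∀ {X : Set} (xs : List X) f g → ∑ xs f < ∑ xs g → ∃ λ x → f x < g x
∑-exists []       f g ()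
∑-exists (x ∷ xs) f g h with f x <? g x
... | yes p = x , p
... | no ¬p = ∑-exists xs f g (+-cancelˡ-< (f x) _ _ (<-≤-trans h (+-monoˡ-≤ _ (≮⇒≥ ¬p))))

-- Induction on the list. The cross term is compared through its square: after the induction
-- hypothesis it becomes an instance of 4 x y ≤ (x + y)², so that neither subtraction nor a square
-- root occurs.
cauchySchwarz : ∀ {X : Set} (xs : List X) (w f g : X → ℕ) →
  ∑ xs (λ x → w x * (f x * g x)) * ∑ xs (λ x → w x * (f x * g x)) ≤
  ∑ xs (λ x → w x * (f x * f x)) * ∑ xs (λ x → w x * (g x * g x))
cauchySchwarz []       w f g = z≤n
cauchySchwarz (x ∷ xs) w f g = begin
  (a * (b * c) + S) * (a * (b * c) + S)
    ≡⟨ lem₁ a b c S ⟩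
  a * (b * b) * (a * (c * c)) + 2 * (a * (b * c) * S) + S * S
    ≤⟨ +-mono-≤ (+-monoʳ-≤ (a * (b * b) * (a * (c * c))) crossed) ih ⟩
  a * (b * b) * (a * (c * c)) + (a * (b * b) * Q + a * (c * c) * P) + P * Q
    ≡⟨ lem₂ (a * (b * b)) (a * (c * c)) P Q ⟩
  (a * (b * b) + P) * (a * (c * c) + Q) ∎
  where
  open ≤-Reasoning
  a = w x
  b = f x
  c = g x
  S = ∑ xs (λ x → w x * (f x * g x))
  P = ∑ xs (λ x → w x * (f x * f x))
  Q = ∑ xs (λ x → w x * (g x * g x))
  ih : S * S ≤ P * Q
  ih = cauchySchwarz xs w f g
  lem₁ : ∀ a b c S → (a * (b * c) + S) * (a * (b * c) + S) ≡
         a * (b * b) * (a * (c * c)) + 2 * (a * (b * c) * S) + S * S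
  lem₁ = solve-∀
  lem₂ : ∀ A C P Q → A * C + (A * Q + C * P) + P * Q ≡ (A + P) * (C + Q)
  lem₂ = solve-∀
  lem₃ : ∀ a b c S → 2 * (a * (b * c) * S) * (2 * (a * (b * c) * S)) ≡
         4 * (a * (b * b) * (a * (c * c)) * (S * S))
  lem₃ = solve-∀
  lem₄ : ∀ A C P Q → 4 * (A * C * (P * Q)) ≡ 4 * (A * Q * (C * P))
  lem₄ = solve-∀
  crossed : 2 * (a * (b * c) * S) ≤ a * (b * b) * Q + a * (c * c) * P
  crossed = sq-cancel-≤ (2 * (a * (b * c) * S)) (a * (b * b) * Q + a * (c * c) * P) (begin
    2 * (a * (b * c) * S) * (2 * (a * (b * c) * S)) ≡⟨ lem₃ a b c S ⟩
    4 * (a * (b * b) * (a * (c * c)) * (S * S))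
      ≤⟨ *-monoʳ-≤ 4 (*-monoʳ-≤ (a * (b * b) * (a * (c * c))) ih) ⟩
    4 * (a * (b * b) * (a * (c * c)) * (P * Q)) ≡⟨ lem₄ (a * (b * b)) (a * (c * c)) P Q ⟩
    4 * (a * (b * b) * Q * (a * (c * c) * P)) ≤⟨ 4xy≤[x+y]² (a * (b * b) * Q) (a * (c * c) * P) ⟩
    (a * (b * b) * Q + a * (c * c) * P) * (a * (b * b) * Q + a * (c * c) * P) ∎)

∑∑-product : ∀ {X Y : Set} (xs : List X) (ys : List Y) (f : X × Y → ℕ) →
  ∑ (cartesianProduct xs ys) f ≡ (∑[ x ∈ xs ] ∑[ y ∈ ys ] f (x , y))
∑∑-product = ∑-cartesianProductWith _,_

cauchySchwarz₂ : ∀ {X Y : Set} (xs : List X) (ys : List Y) (w f g : X → Y → ℕ) →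
  (∑[ x ∈ xs ] ∑[ y ∈ ys ] w x y * (f x y * g x y)) * (∑[ x ∈ xs ] ∑[ y ∈ ys ] w x y * (f x y * g x y)) ≤
  (∑[ x ∈ xs ] ∑[ y ∈ ys ] w x y * (f x y * f x y)) * (∑[ x ∈ xs ] ∑[ y ∈ ys ] w x y * (g x y * g x y))
cauchySchwarz₂ xs ys w f g = subst₂ _≤_
  (cong₂ _*_ (∑∑-product xs ys _) (∑∑-product xs ys _))
  (cong₂ _*_ (∑∑-product xs ys _) (∑∑-product xs ys _))
  (cauchySchwarz (cartesianProduct xs ys) (λ p → w (proj₁ p) (proj₂ p))
    (λ p → f (proj₁ p) (proj₂ p)) (λ p → g (proj₁ p) (proj₂ p)))

-- Vectors

vecs : ∀ {X : Set} → List X → ∀ m → List (Vec X m)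
vecs xs zero    = [] ∷ []
vecs xs (suc m) = cartesianProductWith _∷_ xs (vecs xs m)

∑-vecs : ∀ {X : Set} (xs : List X) m (f : Vec X (suc m) → ℕ) →
  ∑ (vecs xs (suc m)) f ≡ (∑[ x ∈ xs ] ∑[ v ∈ vecs xs m ] f (x ∷ v))
∑-vecs xs m = ∑-cartesianProductWith _∷_ xs (vecs xs m)

length-vecs : ∀ {X : Set} (xs : List X) m → length (vecs xs m) ≡ length xs ^ m
length-vecs xs zero    = refl
length-vecs xs (suc m) = begin
  length (vecs xs (suc m))                   ≡⟨ length-∑ (vecs xs (suc m)) ⟩
  (∑[ v ∈ vecs xs (suc m) ] 1)               ≡⟨ ∑-vecs xs m _ ⟩
  (∑[ x ∈ xs ] ∑[ v ∈ vecs xs m ] 1)         ≡⟨ ∑-const xs _ ⟩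
  length xs * (∑[ v ∈ vecs xs m ] 1)         ≡⟨ cong (length xs *_) (trans (sym (length-∑ (vecs xs m))) (length-vecs xs m)) ⟩
  length xs * length xs ^ m                  ∎
  where open ≡-Reasoning

∑-vecs-∷ʳ : ∀ {X : Set} (xs : List X) m (f : Vec X (suc m) → ℕ) →
  ∑ (vecs xs (suc m)) f ≡ (∑[ v ∈ vecs xs m ] ∑[ x ∈ xs ] f (v Vec.∷ʳ x))
∑-vecs-∷ʳ xs zero    f = trans (∑-vecs xs 0 f)
  (trans (∑-cong xs (λ x → +-identityʳ _)) (sym (+-identityʳ _)))
∑-vecs-∷ʳ xs (suc m) f = trans (∑-vecs xs (suc m) f)
  (trans (∑-cong xs (λ x → ∑-vecs-∷ʳ xs m (λ v → f (x ∷ v)))) (sym (∑-vecs xs m _)))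

∑-vecs-++ : ∀ {X : Set} (xs : List X) m n (f : Vec X (m + n) → ℕ) →
  ∑ (vecs xs (m + n)) f ≡ (∑[ v ∈ vecs xs m ] ∑[ w ∈ vecs xs n ] f (v Vec.++ w))
∑-vecs-++ xs zero    n f = sym (+-identityʳ _)
∑-vecs-++ xs (suc m) n f = trans (∑-vecs xs (m + n) f)
  (trans (∑-cong xs (λ x → ∑-vecs-++ xs m n (λ v → f (x ∷ v)))) (sym (∑-vecs xs m _)))

∑-cong-∈ : ∀ {X : Set} (xs : List X) {f g} → (∀ {x} → x ∈ xs → f x ≡ g x) → ∑ xs f ≡ ∑ xs g
∑-cong-∈ []       h = refl
∑-cong-∈ (x ∷ xs) h = cong₂ _+_ (h (here refl)) (∑-cong-∈ xs (λ m → h (there m)))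

∈⇒≤∑ : ∀ {X : Set} {xs : List X} {x} f → x ∈ xs → f x ≤ ∑ xs f
∈⇒≤∑ f (here refl)               = m≤m+n _ _
∈⇒≤∑ {xs = y ∷ _} f (there x∈xs) = ≤-trans (∈⇒≤∑ f x∈xs) (m≤n+m _ (f y))

*-pull : ∀ a b c d → a * b * (c * d) ≡ a * c * (b * d)
*-pull = solve-∀

*-^ : ∀ m n o → (m * n) ^ o ≡ m ^ o * n ^ o
*-^ m n zero    = refl
*-^ m n (suc o) = trans (cong (m * n *_) (*-^ m n o)) (*-pull m n (m ^ o) (n ^ o))

-- Log-convex sequences

module LogConvex (a : ℕ → ℕ) (convex : ∀ j → a (1 + j) * a (1 + j) ≤ a j * a (2 + j)) where

  -- Log-convexity makes the quotients of consecutive terms nondecreasing, so the first one bounds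
  -- all of them from below. A vanishing `a (1 + j)` cannot be cancelled and is treated apart.
  ratio-ascends : ∀ A B → B * a 0 ≤ A * a 1 → ∀ j → B * a j ≤ A * a (1 + j)
  ratio-ascends A B h zero    = h
  ratio-ascends A B h (suc j) with a (1 + j) in eq
  ... | zero  = subst (_≤ A * a (2 + j)) (sym (*-zeroʳ B)) z≤n
  ... | suc n = *-cancelʳ-≤ _ _ (suc n) (begin
    B * suc n * suc n         ≡⟨ *-assoc B (suc n) (suc n) ⟩
    B * (suc n * suc n)       ≤⟨ *-monoʳ-≤ B (subst (λ t → t * t ≤ a j * a (2 + j)) eq (convex j)) ⟩
    B * (a j * a (2 + j))     ≡⟨ *-assoc B (a j) _ ⟨
    B * a j * a (2 + j)       ≤⟨ *-monoˡ-≤ _ (subst (λ t → B * a j ≤ A * t) eq (ratio-ascends A B h j)) ⟩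
    A * suc n * a (2 + j)     ≡⟨ xy∙z≈xz∙y A (suc n) (a (2 + j)) ⟩
    A * a (2 + j) * suc n     ∎)
    where
    open ≤-Reasoning

  growth : ∀ A B → B * a 0 ≤ A * a 1 → ∀ j → B ^ j * a 0 ≤ A ^ j * a j
  growth A B h zero    = ≤-refl
  growth A B h (suc j) = begin
    B * B ^ j * a 0     ≡⟨ *-assoc B _ _ ⟩
    B * (B ^ j * a 0)   ≤⟨ *-monoʳ-≤ B (growth A B h j) ⟩
    B * (A ^ j * a j)   ≡⟨ x∙yz≈y∙xz B (A ^ j) (a j) ⟩
    A ^ j * (B * a j)   ≤⟨ *-monoʳ-≤ (A ^ j) (ratio-ascends A B h j) ⟩
    A ^ j * (A * a (1 + j)) ≡⟨ x∙yz≈yx∙z (A ^ j) A (a (1 + j)) ⟩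
    A * A ^ j * a (1 + j) ∎
    where
    open ≤-Reasoning

  -- The same monotonicity read backwards: a quotient below `B / A` forces all earlier ones below
  -- it. If `a q` vanished, convexity would make `a (1 + q)` vanish too, against the strict
  -- inequality.
  ratio-descends : ∀ A B q → A * a (1 + q) < B * a q → ∀ j → j ≤ q → A * a (1 + j) < B * a j
  ratio-descends A B zero    h zero z≤n = h
  ratio-descends A B (suc q) h j j≤1+q with m≤n⇒m<n∨m≡n j≤1+q
  ... | inj₂ refl = h
  ... | inj₁ (s≤s j≤q) = ratio-descends A B q step j j≤q
    where
    open ≤-Reasoning
    lem₁ : ∀ A x → A * x * x ≡ A * (x * x)
    lem₁ = solve-∀
    lem₃ : ∀ A x y → x * (A * y) ≡ A * x * y
    lem₃ = solve-∀
    step : A * a (1 + q) < B * a q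
    step with a q in eq
    ... | zero  = ⊥-elim (n≮0 (subst (A * a (2 + q) <_) (trans (cong (B *_) a≡0) (*-zeroʳ B)) h))
      where
      a≡0 : a (1 + q) ≡ 0
      a≡0 with a (1 + q) | subst (λ t → a (1 + q) * a (1 + q) ≤ t * a (2 + q)) eq (convex q)
      ... | zero | _ = refl
    ... | suc n = *-cancelʳ-< (a (1 + q)) _ _ (begin-strict
      A * a (1 + q) * a (1 + q)   ≡⟨ lem₁ A (a (1 + q)) ⟩
      A * (a (1 + q) * a (1 + q)) ≤⟨ *-monoʳ-≤ A (subst (λ t → a (1 + q) * a (1 + q) ≤ t * a (2 + q)) eq (convex q)) ⟩
      A * (suc n * a (2 + q))     ≡⟨ x∙yz≈y∙xz A (suc n) (a (2 + q)) ⟩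
      suc n * (A * a (2 + q))     <⟨ *-monoʳ-< (suc n) h ⟩
      suc n * (B * a (1 + q))     ≡⟨ lem₃ B (suc n) (a (1 + q)) ⟩
      B * suc n * a (1 + q)       ∎)

  -- A lower bound for one term thus controls every later quotient: were the quotient at `q` below
  -- `B / A`, so would be those at 0, ..., `r`, and their product would contradict the last
  -- hypothesis.
  ratio-bound : ∀ A B r q → r ≤ q → B ^ suc r * a 0 ≤ A ^ suc r * a (suc r) → B * a q ≤ A * a (1 + q)
  ratio-bound A B r q r≤q h with A * a (1 + q) <? B * a q
  ... | no  q≮ = ≮⇒≥ q≮
  ... | yes q< = ⊥-elim (<⇒≱ (decay r r≤q) h)
    where
    open ≤-Reasoning
    decay : ∀ j → j ≤ q → A ^ suc j * a (suc j) < B ^ suc j * a 0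
    decay zero j≤q = subst₂ _<_ (cong (_* a 1) (sym (*-identityʳ A))) (cong (_* a 0) (sym (*-identityʳ B)))
                       (ratio-descends A B q q< zero z≤n)
    decay (suc j) j<q = begin-strict
      A * A ^ suc j * a (2 + j)   ≡⟨ xy∙z≈y∙xz A (A ^ suc j) (a (2 + j)) ⟩
      A ^ suc j * (A * a (2 + j)) ≤⟨ *-monoʳ-≤ (A ^ suc j) (<⇒≤ (ratio-descends A B q q< (suc j) j<q)) ⟩
      A ^ suc j * (B * a (1 + j)) ≡⟨ xy∙z≈y∙xz B (A ^ suc j) (a (1 + j)) ⟨
      B * A ^ suc j * a (1 + j)   ≡⟨ *-assoc B (A ^ suc j) _ ⟩
      B * (A ^ suc j * a (1 + j)) <⟨ *-monoʳ-< B {{>-nonZero B>0}} (decay j (<⇒≤ j<q)) ⟩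
      B * (B ^ suc j * a 0)       ≡⟨ *-assoc B (B ^ suc j) (a 0) ⟨
      B * B ^ suc j * a 0         ∎
      where
      B>0 : 0 < B
      B>0 = n≢0⇒n>0 λ B≡0 → n≮0 (subst (λ t → A * a (1 + q) < t * a q) B≡0 q<)

-- Beyond its length, a vector continues with its last entry.
at : ∀ {X : Set} {m} → Vec X (suc m) → ℕ → X
at (x ∷ _)     zero    = x
at (x ∷ [])    (suc _) = x
at (_ ∷ y ∷ v) (suc j) = at (y ∷ v) j

-- Weighted closed walks

module Walk {X : Set} (xs : List X) (c : X → X → ℕ) (c-sym : ∀ x y → c x y ≡ c y x)
  (ρ π : X → ℕ) (L : ℕ) (row≤ : ∀ x → ∑ xs (c x) ≤ π x)
  (norm : ∀ x → π x ≡ 0 ⊎ ρ x * π x ≡ L) where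

  -- `ρ` stands for `L / π`, the reciprocal of a bound for the degree, scaled to an integer. So
  -- `ρ x * c x y` is `L` times the weight of a step of a substochastic walk.
  ρ*row≤L : ∀ x → ρ x * ∑ xs (c x) ≤ L
  ρ*row≤L x with norm x
  ... | inj₂ eq = subst (ρ x * ∑ xs (c x) ≤_) eq (*-monoʳ-≤ (ρ x) (row≤ x))
  ... | inj₁ eq = subst (_≤ L) (sym (trans (cong (ρ x *_) (n≤0⇒n≡0 (subst (_ ≤_) eq (row≤ x)))) (*-zeroʳ (ρ x)))) z≤n

  chain : ∀ {m} → X → Vec X m → X → ℕ
  chain x []      z = c x z
  chain x (y ∷ v) z = c x y * ρ y * chain y v z

  cw : ∀ {m} → Vec X (suc m) → ℕ
  cw (x ∷ v) = ρ x * chain x v x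

  chain-++ : ∀ {m n} x (v : Vec X m) y (w : Vec X n) z →
    chain x (v Vec.++ y ∷ w) z ≡ chain x v y * ρ y * chain y w z
  chain-++ x []      y w z = refl
  chain-++ x (u ∷ v) y w z = trans (cong (c x u * ρ u *_) (chain-++ u v y w z))
    (lem (c x u * ρ u) (chain u v y) (ρ y) (chain y w z))
    where
    lem : ∀ a b c d → a * (b * c * d) ≡ a * b * c * d
    lem = solve-∀

  -- The index counts interior vertices: `K m` belongs to walks with m + 1 steps, whence the `suc`
  -- in `K-+`.
  K : ℕ → X → X → ℕ
  K m x z = ∑[ v ∈ vecs xs m ] chain x v z

  K-zero : ∀ x z → K 0 x z ≡ c x z
  K-zero x z = +-identityʳ _

  K-suc : ∀ m x z → K (suc m) x z ≡ (∑[ y ∈ xs ] c x y * ρ y * K m y z)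
  K-suc m x z = trans (∑-vecs xs m _) (∑-cong xs λ y → ∑-*ˡ (vecs xs m) (c x y * ρ y) _)

  K-+ : ∀ m n x z → K (m + suc n) x z ≡ (∑[ y ∈ xs ] K m x y * ρ y * K n y z)
  K-+ m n x z = begin
    K (m + suc n) x z
      ≡⟨ ∑-vecs-++ xs m (suc n) _ ⟩
    (∑[ v ∈ vecs xs m ] ∑[ w ∈ vecs xs (suc n) ] chain x (v Vec.++ w) z)
      ≡⟨ ∑-cong (vecs xs m) (λ v → ∑-vecs xs n _) ⟩
    (∑[ v ∈ vecs xs m ] ∑[ y ∈ xs ] ∑[ w ∈ vecs xs n ] chain x (v Vec.++ y ∷ w) z)
      ≡⟨ ∑-swap (vecs xs m) xs _ ⟩
    (∑[ y ∈ xs ] ∑[ v ∈ vecs xs m ] ∑[ w ∈ vecs xs n ] chain x (v Vec.++ y ∷ w) z)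
      ≡⟨ ∑-cong xs (λ y → ∑-cong (vecs xs m) λ v → trans (∑-cong (vecs xs n) λ w → chain-++ x v y w z)
           (∑-*ˡ (vecs xs n) (chain x v y * ρ y) _)) ⟩
    (∑[ y ∈ xs ] ∑[ v ∈ vecs xs m ] chain x v y * ρ y * K n y z)
      ≡⟨ ∑-cong xs (λ y → trans (∑-*ʳ (vecs xs m) (K n y z) _) (cong (_* K n y z) (∑-*ʳ (vecs xs m) (ρ y) _))) ⟩
    (∑[ y ∈ xs ] K m x y * ρ y * K n y z) ∎
    where open ≡-Reasoning

  K-sym : ∀ m x z → K m x z ≡ K m z x
  K-sym zero    x z = cong (_+ 0) (c-sym x z)
  K-sym (suc m) x z = begin
    K (suc m) x z                          ≡⟨ K-suc m x z ⟩
    (∑[ y ∈ xs ] c x y * ρ y * K m y z)    ≡⟨ ∑-cong xs (λ y → lem y) ⟩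
    (∑[ y ∈ xs ] K m z y * ρ y * K 0 y x)  ≡⟨ K-+ m 0 z x ⟨
    K (m + 1) z x                          ≡⟨ cong (λ n → K n z x) (+-comm m 1) ⟩
    K (suc m) z x                          ∎
    where
    open ≡-Reasoning
    lem′ : ∀ a b c → a * b * c ≡ c * b * a
    lem′ = solve-∀
    lem : ∀ y → c x y * ρ y * K m y z ≡ K m z y * ρ y * K 0 y x
    lem y = trans (lem′ (c x y) (ρ y) (K m y z))
      (cong₂ (λ a b → a * ρ y * b) (K-sym m y z) (trans (c-sym x y) (sym (K-zero y x))))

  M : ℕ → ℕ
  M p = ∑[ x ∈ xs ] ∑[ z ∈ xs ] ρ x * ρ z * (K p x z * K p x z)

  private
    trace : ∀ p q → (∑[ x ∈ xs ] ∑[ z ∈ xs ] ρ x * ρ z * (K p x z * K q x z)) ≡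
                    (∑[ x ∈ xs ] ρ x * K (p + suc q) x x)
    trace p q = ∑-cong xs λ x → begin
      (∑[ z ∈ xs ] ρ x * ρ z * (K p x z * K q x z))  ≡⟨ ∑-cong xs (λ z → cong (λ t → ρ x * ρ z * (K p x z * t)) (K-sym q x z)) ⟩
      (∑[ z ∈ xs ] ρ x * ρ z * (K p x z * K q z x))  ≡⟨ ∑-cong xs (λ z → lem (ρ x) (ρ z) (K p x z) (K q z x)) ⟩
      (∑[ z ∈ xs ] ρ x * (K p x z * ρ z * K q z x))  ≡⟨ ∑-*ˡ xs (ρ x) _ ⟩
      ρ x * (∑[ z ∈ xs ] K p x z * ρ z * K q z x)    ≡⟨ cong (ρ x *_) (K-+ p q x x) ⟨
      ρ x * K (p + suc q) x x ∎
      where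
      open ≡-Reasoning
      lem : ∀ a b c d → a * b * (c * d) ≡ a * (c * b * d)
      lem = solve-∀

  -- The even moments, with M p the moment of order 2 (p + 1).
  moment : ℕ → ℕ
  moment zero    = length xs
  moment (suc p) = M p

  -- A closed walk of length 2 (p + 2) can be cut into arcs with p + 1 and p + 3 steps;
  -- Cauchy-Schwarz separates them. The sequence starts with the order, the trace of the identity;
  -- there Cauchy-Schwarz is applied to the diagonal of `K 1`, whose squares are part of `M 1`.
  moment-convex : ∀ j → moment (1 + j) * moment (1 + j) ≤ moment j * moment (2 + j)
  moment-convex zero = begin
    M 0 * M 0
      ≡⟨ cong (λ t → t * t) (trans (trace 0 0) (∑-cong xs λ x → sym (trans (*-identityˡ (1 * f x)) (*-identityˡ (f x))))) ⟩
    (∑[ x ∈ xs ] 1 * (1 * f x)) * (∑[ x ∈ xs ] 1 * (1 * f x))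
      ≤⟨ cauchySchwarz xs (λ _ → 1) (λ _ → 1) f ⟩
    (∑[ x ∈ xs ] 1) * (∑[ x ∈ xs ] 1 * (f x * f x))
      ≡⟨ cong₂ _*_ (sym (length-∑ xs)) (∑-cong xs λ x → lem (ρ x) (K 1 x x)) ⟩
    length xs * (∑[ x ∈ xs ] ρ x * ρ x * (K 1 x x * K 1 x x))
      ≤⟨ *-monoʳ-≤ (length xs) (∑-diag xs (λ x z → ρ x * ρ z * (K 1 x z * K 1 x z))) ⟩
    length xs * M 1 ∎
    where
    open ≤-Reasoning
    f : X → ℕ
    f x = ρ x * K 1 x x
    lem : ∀ a b → 1 * (a * b * (a * b)) ≡ a * a * (b * b)
    lem = solve-∀
  moment-convex (suc p) = begin
    M (suc p) * M (suc p) ≡⟨ cong (λ t → t * t) shift ⟩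
    S * S                 ≤⟨ cauchySchwarz₂ xs xs (λ x z → ρ x * ρ z) (K p) (K (2 + p)) ⟩
    M p * M (2 + p)       ∎
    where
    open ≤-Reasoning
    S = ∑[ x ∈ xs ] ∑[ z ∈ xs ] ρ x * ρ z * (K p x z * K (2 + p) x z)
    shift : M (suc p) ≡ S
    shift = trans (trace (suc p) (suc p)) (trans (∑-cong xs λ x → cong (λ m → ρ x * K m x x) (sym (+-suc p (2 + p))))
              (sym (trace p (2 + p))))

  open LogConvex moment moment-convex using (ratio-bound) public

  -- The operator f ↦ P f is self-adjoint for the weights ρ; iterating it on
  -- π gives a lower bound for the number of closed walks.
  P : (X → ℕ) → X → ℕ
  P f x = ∑[ y ∈ xs ] c x y * ρ y * f y

  u : ℕ → X → ℕ
  u zero    = π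
  u (suc j) = P (u j)

  ⟪_,_⟫ : (X → ℕ) → (X → ℕ) → ℕ
  ⟪ f , g ⟫ = ∑[ x ∈ xs ] ρ x * (f x * g x)

  P-selfadjoint : ∀ f g → ⟪ P f , g ⟫ ≡ ⟪ f , P g ⟫
  P-selfadjoint f g = begin
    (∑[ x ∈ xs ] ρ x * (P f x * g x))
      ≡⟨ ∑-cong xs (λ x → trans (x∙yz≈y∙xz (ρ x) (P f x) (g x)) (sym (∑-*ʳ xs (ρ x * g x) _))) ⟩
    (∑[ x ∈ xs ] ∑[ y ∈ xs ] c x y * ρ y * f y * (ρ x * g x))
      ≡⟨ ∑-swap xs xs _ ⟩
    (∑[ y ∈ xs ] ∑[ x ∈ xs ] c x y * ρ y * f y * (ρ x * g x))
      ≡⟨ ∑-cong xs (λ y → trans (∑-cong xs λ x → trans (cong (λ t → t * ρ y * f y * (ρ x * g x)) (c-sym x y))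
           (lem₂ (c y x) (ρ y) (f y) (ρ x) (g x))) (∑-*ˡ xs (ρ y * f y) _)) ⟩
    (∑[ y ∈ xs ] ρ y * f y * P g y)
      ≡⟨ ∑-cong xs (λ y → *-assoc (ρ y) (f y) (P g y)) ⟩
    (∑[ y ∈ xs ] ρ y * (f y * P g y)) ∎
    where
    open ≡-Reasoning
    lem₂ : ∀ a b c d e → a * b * c * (d * e) ≡ b * c * (a * d * e)
    lem₂ = solve-∀

  T : ℕ → ℕ
  T i = ⟪ u i , u i ⟫

  T-convex : ∀ j → T (1 + j) * T (1 + j) ≤ T j * T (2 + j)
  T-convex j = subst (λ t → t * t ≤ T j * T (2 + j)) (sym (P-selfadjoint (u j) (u (1 + j))))
                 (cauchySchwarz xs ρ (u j) (u (2 + j)))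

  ⟪u,u⟫ : ∀ i j → ⟪ u i , u j ⟫ ≡ ⟪ π , u (i + j) ⟫
  ⟪u,u⟫ zero    j = refl
  ⟪u,u⟫ (suc i) j = trans (P-selfadjoint (u i) (u j))
    (trans (⟪u,u⟫ i (suc j)) (cong (λ m → ⟪ π , u m ⟫) (+-suc i j)))

  private
    null : ∀ {x} → π x ≡ 0 → ∀ {y} → y ∈ xs → c x y ≡ 0
    null {x} eq y∈ = n≤0⇒n≡0 (≤-trans (∈⇒≤∑ (c x) y∈) (subst (_ ≤_) eq (row≤ x)))

  -- Where `π` vanishes, so does the row of `c`, and with it every image under `P`. Hence `ρ` and
  -- `π` cancel on such images even at vertices without a reciprocal.
  ρπ-cancel : ∀ {x} → x ∈ xs → ∀ j → ρ x * (π x * u (suc j) x) ≡ L * u (suc j) x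
  ρπ-cancel {x} x∈ j with norm x
  ... | inj₂ eq = trans (sym (*-assoc (ρ x) (π x) _)) (cong (_* u (suc j) x) eq)
  ... | inj₁ eq = trans (trans (cong (λ t → ρ x * (π x * t)) u≡0) (lem (ρ x) (π x) L)) (cong (L *_) (sym u≡0))
    where
    u≡0 : u (suc j) x ≡ 0
    u≡0 = trans (∑-cong-∈ xs (λ {y} y∈ → cong (λ t → t * ρ y * u j y) (null eq y∈))) (∑-0 xs)
    lem : ∀ a b c → a * (b * 0) ≡ c * 0
    lem = solve-∀

  ρππ : ∀ x → ρ x * (π x * π x) ≡ L * π x
  ρππ x with norm x
  ... | inj₂ eq = trans (sym (*-assoc (ρ x) (π x) _)) (cong (_* π x) eq)
  ... | inj₁ eq rewrite eq = trans (*-zeroʳ (ρ x)) (sym (*-zeroʳ L))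

  u₁≡ : ∀ {x} → x ∈ xs → u 1 x ≡ L * ∑ xs (c x)
  u₁≡ {x} x∈ = trans (∑-cong xs step) (∑-*ˡ xs L _)
    where
    step : ∀ y → c x y * ρ y * π y ≡ L * c x y
    step y with norm y
    ... | inj₂ eq = trans (*-assoc (c x y) (ρ y) (π y)) (trans (cong (c x y *_) eq) (*-comm (c x y) L))
    ... | inj₁ eq = trans (cong (λ t → t * ρ y * π y) c≡0) (sym (trans (cong (L *_) c≡0) (*-zeroʳ L)))
      where
      c≡0 : c x y ≡ 0
      c≡0 = trans (c-sym x y) (null eq x∈)

  T₀ : T 0 ≡ L * ∑ xs π
  T₀ = trans (∑-cong xs ρππ) (∑-*ˡ xs L π)

  module LowerBound (κ : ℕ) (dense : ∑ xs π ≤ κ * (∑[ x ∈ xs ] ∑ xs (c x))) (T>0 : 0 < L * ∑ xs π) where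

    private
      Π = ∑ xs π
      C = ∑[ x ∈ xs ] ∑ xs (c x)

      ⟪π,u₁⟫ : ⟪ π , u 1 ⟫ ≡ L * (L * C)
      ⟪π,u₁⟫ = trans (∑-cong-∈ xs (λ x∈ → ρπ-cancel x∈ 0)) (trans (∑-*ˡ xs L _)
        (cong (L *_) (trans (∑-cong-∈ xs u₁≡) (∑-*ˡ xs L _))))

      base : L * L * T 0 ≤ κ * κ * T 1
      base = *-cancelˡ-≤ (T 0) {{>-nonZero (subst (0 <_) (sym T₀) T>0)}} (begin
        T 0 * (L * L * T 0)             ≡⟨ cong₂ (λ a b → a * (L * L * b)) T₀ T₀ ⟩
        L * Π * (L * L * (L * Π))       ≡⟨ lem₁ L Π ⟩
        L * (L * Π) * (L * (L * Π))     ≤⟨ *-mono-≤ LLΠ≤ LLΠ≤ ⟩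
        L * (L * (κ * C)) * (L * (L * (κ * C))) ≡⟨ lem₂ L κ C ⟩
        κ * κ * (L * (L * C) * (L * (L * C)))   ≡⟨ cong (λ t → κ * κ * (t * t)) ⟪π,u₁⟫ ⟨
        κ * κ * (⟪ π , u 1 ⟫ * ⟪ π , u 1 ⟫)     ≤⟨ *-monoʳ-≤ (κ * κ) (cauchySchwarz xs ρ π (u 1)) ⟩
        κ * κ * (T 0 * T 1)             ≡⟨ x∙yz≈y∙xz (κ * κ) (T 0) (T 1) ⟩
        T 0 * (κ * κ * T 1)             ∎)
        where
        open ≤-Reasoning
        LLΠ≤ : L * (L * Π) ≤ L * (L * (κ * C))
        LLΠ≤ = *-monoʳ-≤ L (*-monoʳ-≤ L dense)
        lem₁ : ∀ L Π → L * Π * (L * L * (L * Π)) ≡ L * (L * Π) * (L * (L * Π))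
        lem₁ = solve-∀
        lem₂ : ∀ L κ C → L * (L * (κ * C)) * (L * (L * (κ * C))) ≡ κ * κ * (L * (L * C) * (L * (L * C)))
        lem₂ = solve-∀

    -- With i = j + 1, `T i` pairs `K p` with π(x) π(z), so Cauchy-Schwarz gives T(i)² ≤ M(p) T(0)²,
    -- while log-convexity gives T(i) ≥ (L/κ)^(2 i) T(0). The resulting bound (L/κ)^(4 i) for closed
    -- walks of length 4 i loses no factor that depends on the order.
    closed-lower : ∀ j → (L * L) ^ suc j * (L * L) ^ suc j ≤ (κ * κ) ^ suc j * (κ * κ) ^ suc j * M (j + suc j)
    closed-lower j = *-cancelʳ-≤ _ _ (T 0 * T 0) {{>-nonZero (*-mono-≤ T₀>0 T₀>0)}} (begin
      A * A * (T 0 * T 0)         ≡⟨ *-pull A A (T 0) (T 0) ⟩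
      A * T 0 * (A * T 0)         ≤⟨ *-mono-≤ grow grow ⟩
      B * T i * (B * T i)         ≡⟨ *-pull B (T i) B (T i) ⟩
      B * B * (T i * T i)         ≤⟨ *-monoʳ-≤ (B * B) T²≤ ⟩
      B * B * (M p * (T 0 * T 0)) ≡⟨ *-assoc (B * B) (M p) _ ⟨
      B * B * M p * (T 0 * T 0)   ∎)
      where
      open ≤-Reasoning
      i = suc j
      p = j + suc j
      A = (L * L) ^ i
      B = (κ * κ) ^ i
      T₀>0 : 0 < T 0
      T₀>0 = subst (0 <_) (sym T₀) T>0
      grow : A * T 0 ≤ B * T i
      grow = LogConvex.growth T T-convex (κ * κ) (L * L) base i
      π-moment : ∀ m x → (∑[ z ∈ xs ] K m x z * ρ z * π z) ≡ u (suc m) x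
      π-moment zero    x = ∑-cong xs λ z → cong (λ t → t * ρ z * π z) (K-zero x z)
      π-moment (suc m) x = trans (∑-cong xs λ z → trans (cong (λ t → t * ρ z * π z) (K-suc m x z))
          (trans (*-assoc (∑[ y ∈ xs ] c x y * ρ y * K m y z) (ρ z) (π z)) (sym (∑-*ʳ xs (ρ z * π z) λ y → c x y * ρ y * K m y z))))
        (trans (∑-swap xs xs _) (∑-cong xs λ y → trans (∑-cong xs λ z → lem (c x y * ρ y) (K m y z) (ρ z) (π z))
          (trans (∑-*ˡ xs (c x y * ρ y) _) (cong (c x y * ρ y *_) (π-moment m y)))))
        where
        lem : ∀ a b c d → a * b * (c * d) ≡ a * (b * c * d)
        lem = solve-∀
      Tᵢ : (∑[ x ∈ xs ] ∑[ z ∈ xs ] ρ x * ρ z * (K p x z * (π x * π z))) ≡ T i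
      Tᵢ = trans (∑-cong xs λ x → trans (∑-cong xs λ z → lem (ρ x) (ρ z) (K p x z) (π x) (π z))
          (trans (∑-*ˡ xs (ρ x * π x) _) (trans (*-assoc (ρ x) (π x) _) (cong (λ t → ρ x * (π x * t)) (π-moment p x)))))
        (sym (⟪u,u⟫ i i))
        where
        lem : ∀ a b c d e → a * b * (c * (d * e)) ≡ a * d * (c * b * e)
        lem = solve-∀
      T₀² : (∑[ x ∈ xs ] ∑[ z ∈ xs ] ρ x * ρ z * (π x * π z * (π x * π z))) ≡ T 0 * T 0
      T₀² = trans (∑-cong xs λ x → trans (∑-cong xs λ z → lem (ρ x) (ρ z) (π x) (π z)) (∑-*ˡ xs (ρ x * (π x * π x)) _))
              (∑-*ʳ xs (T 0) _)
        where
        lem : ∀ a b d e → a * b * (d * e * (d * e)) ≡ a * (d * d) * (b * (e * e))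
        lem = solve-∀
      T²≤ : T i * T i ≤ M p * (T 0 * T 0)
      T²≤ = subst₂ _≤_ (cong₂ _*_ Tᵢ Tᵢ) (cong (M p *_) T₀²)
              (cauchySchwarz₂ xs xs (λ x z → ρ x * ρ z) (K p) (λ x z → π x * π z))

  -- The closed walk is cut at the opposite points `x` and `z`. A function of the head and the next
  -- p + 1 entries sees only one arc; the other one contributes `K p`.
  closed : ∀ p (φ : X → List X → ℕ) → 
    ∑ (vecs xs (suc p + suc p)) (λ z → cw z * φ (Vec.head z) (take (suc p) (toList (Vec.tail z)))) ≡
    (∑[ x ∈ xs ] ∑[ z ∈ xs ] ρ x * ρ z * ((∑[ v ∈ vecs xs p ] chain x v z * φ x (toList v ++ z ∷ [])) * K p x z))
  closed p φ = trans (∑-vecs xs (p + suc p) _) (∑-cong xs λ x → begin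
    (∑[ t ∈ vecs xs (p + suc p) ] ρ x * chain x t x * φ x (take (suc p) (toList t)))
      ≡⟨ ∑-vecs-++ xs p (suc p) _ ⟩
    (∑[ v ∈ vecs xs p ] ∑[ w ∈ vecs xs (suc p) ] ρ x * chain x (v Vec.++ w) x * φ x (take (suc p) (toList (v Vec.++ w))))
      ≡⟨ ∑-cong (vecs xs p) (λ v → ∑-vecs xs p _) ⟩
    (∑[ v ∈ vecs xs p ] ∑[ z ∈ xs ] ∑[ w ∈ vecs xs p ]
      ρ x * chain x (v Vec.++ z ∷ w) x * φ x (take (suc p) (toList (v Vec.++ z ∷ w))))
      ≡⟨ ∑-swap (vecs xs p) xs _ ⟩
    (∑[ z ∈ xs ] ∑[ v ∈ vecs xs p ] ∑[ w ∈ vecs xs p ]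
      ρ x * chain x (v Vec.++ z ∷ w) x * φ x (take (suc p) (toList (v Vec.++ z ∷ w))))
      ≡⟨ ∑-cong xs (λ z → trans (∑-cong (vecs xs p) λ v → split x v z) (gather x z)) ⟩
    (∑[ z ∈ xs ] ρ x * ρ z * ((∑[ v ∈ vecs xs p ] chain x v z * φ x (toList v ++ z ∷ [])) * K p x z)) ∎)
    where
    open ≡-Reasoning
    half : ∀ {m n} (v : Vec X m) z (w : Vec X n) → take (suc m) (toList (v Vec.++ z ∷ w)) ≡ toList v ++ z ∷ []
    half []      z w = refl
    half (y ∷ v) z w = cong (y ∷_) (half v z w)
    lem₁ : ∀ r a s b f → r * (a * s * b) * f ≡ r * s * (a * f) * b
    lem₁ = solve-∀
    split : ∀ x (v : Vec X p) z → (∑[ w ∈ vecs xs p ]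
      ρ x * chain x (v Vec.++ z ∷ w) x * φ x (take (suc p) (toList (v Vec.++ z ∷ w)))) ≡
      ρ x * ρ z * (chain x v z * φ x (toList v ++ z ∷ [])) * K p x z
    split x v z = trans (∑-cong (vecs xs p) λ w →
        trans (cong₂ (λ a b → ρ x * a * φ x b) (chain-++ x v z w x) (half v z w))
          (lem₁ (ρ x) (chain x v z) (ρ z) (chain z w x) (φ x (toList v ++ z ∷ []))))
      (trans (∑-*ˡ (vecs xs p) (ρ x * ρ z * (chain x v z * φ x (toList v ++ z ∷ []))) _)
        (cong (ρ x * ρ z * (chain x v z * φ x (toList v ++ z ∷ [])) *_) (K-sym p z x)))
    gather : ∀ x z → (∑[ v ∈ vecs xs p ] ρ x * ρ z * (chain x v z * φ x (toList v ++ z ∷ [])) * K p x z) ≡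
      ρ x * ρ z * ((∑[ v ∈ vecs xs p ] chain x v z * φ x (toList v ++ z ∷ [])) * K p x z)
    gather x z = trans (∑-*ʳ (vecs xs p) (K p x z) _)
      (trans (cong (_* K p x z) (∑-*ˡ (vecs xs p) (ρ x * ρ z) _)) (*-assoc (ρ x * ρ z) _ (K p x z)))

  ∑-cw : ∀ p → ∑ (vecs xs (suc p + suc p)) cw ≡ M p
  ∑-cw p = trans (∑-cong (vecs xs (suc p + suc p)) λ z → sym (*-identityʳ (cw z)))
    (trans (closed p (λ _ _ → 1)) (∑-cong xs λ x → ∑-cong xs λ z → cong (λ t → ρ x * ρ z * (t * K p x z))
      (∑-cong (vecs xs p) λ v → *-identityʳ (chain x v z))))

  chain-∷ʳ : ∀ {m} x (v : Vec X m) y z → chain x (v Vec.∷ʳ y) z ≡ chain x v y * ρ y * c y z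
  chain-∷ʳ x []      y z = refl
  chain-∷ʳ x (w ∷ v) y z = trans (cong (c x w * ρ w *_) (chain-∷ʳ w v y z)) (lem (c x w * ρ w) (chain w v y) (ρ y) (c y z))
    where
    lem : ∀ a b c d → a * (b * c * d) ≡ a * b * c * d
    lem = solve-∀

  c>0 : ∀ {m} x (v : Vec X m) z → 0 < chain x v z →
    (∀ {j} → j < m → 0 < c (at (x ∷ v) j) (at (x ∷ v) (suc j))) × 0 < c (at (x ∷ v) m) z
  c>0 x []      z h = (λ ()) , h
  c>0 x (y ∷ v) z h = (λ { {zero} _ → 0<cxy ; {suc j} (s≤s j<m) → proj₁ ih j<m }) , proj₂ ih
    where
    0<cxy : 0 < c x y
    0<cxy = n≢0⇒n>0 λ eq → <-irrefl refl (subst (λ t → 0 < t * ρ y * chain y v z) eq h)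
    ih = c>0 y v z (n≢0⇒n>0 λ eq → <-irrefl refl (subst (0 <_) (trans (cong (c x y * ρ y *_) eq) (*-zeroʳ (c x y * ρ y))) h))

  cw-∷ʳ : ∀ {m} x (v : Vec X m) → cw (x ∷ v) ≡ cw (v Vec.∷ʳ x)
  cw-∷ʳ x []      = refl
  cw-∷ʳ x (y ∷ v) = trans (lem (ρ x) (c x y) (ρ y) (chain y v x)) (cong (ρ y *_) (sym (chain-∷ʳ y v x y)))
    where
    lem : ∀ a b c d → a * (b * c * d) ≡ c * (d * a * b)
    lem = solve-∀

  -- Cauchy–Schwarz across the reflection that fixes the start of the walk
  -- puts the event R on both halves; one copy then suffices.
  module Rare (p : ℕ) (R : X → List X → ℕ) (R≤1 : ∀ x l → R x l ≤ 1) (S : ℕ)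
    (rare : ∀ x l → S * (ρ x * (∑[ y ∈ xs ] c x y * R y (x ∷ l))) ≤ L) where

    Q : ℕ
    Q = ∑ (vecs xs (suc (suc p) + suc (suc p))) (λ z → cw z * R (Vec.head z) (take (suc (suc p)) (toList (Vec.tail z))))

    private
      F : X → X → X → ℕ
      F y x z = ∑[ v ∈ vecs xs p ] chain x v z * R y (x ∷ toList v ++ z ∷ [])

      F≤K : ∀ y x z → F y x z ≤ K p x z
      F≤K y x z = ∑-mono (vecs xs p) λ v → ≤-trans (*-monoʳ-≤ (chain x v z) (R≤1 _ _)) (≤-reflexive (*-identityʳ _))

      KR : X → X → ℕ
      KR y z = ∑[ v ∈ vecs xs (suc p) ] chain y v z * R y (toList v ++ z ∷ [])

      KR≡ : ∀ y z → KR y z ≡ (∑[ x ∈ xs ] c y x * (1 * (ρ x * F y x z)))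
      KR≡ y z = trans (∑-vecs xs p _) (∑-cong xs λ x →
        trans (∑-cong (vecs xs p) λ v → *-assoc (c y x * ρ x) (chain x v z) _)
          (trans (∑-*ˡ (vecs xs p) (c y x * ρ x) _) (lem (c y x) (ρ x) (F y x z))))
        where
        lem : ∀ a b c → a * b * c ≡ a * (1 * (b * c))
        lem = solve-∀

      D = ∑[ y ∈ xs ] ∑[ z ∈ xs ] ρ y * ρ z * (KR y z * KR y z)

      -- A second Cauchy-Schwarz, over the first step from `y`: one factor is a row sum, bounded
      -- through `L`, and in the other one copy of `F` is relaxed to `K`. The event is left once and
      -- linearly, so that `rare` applies when `y` is summed over.
      KR² : ∀ y z → ρ y * ρ z * (KR y z * KR y z) ≤
            L * (ρ z * (∑[ x ∈ xs ] ρ x * K p x z * (c y x * (ρ x * F y x z))))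
      KR² y z = begin
        ρ y * ρ z * (KR y z * KR y z)
          ≡⟨ cong (λ t → ρ y * ρ z * (t * t)) (KR≡ y z) ⟩
        ρ y * ρ z * (∑ xs f * ∑ xs f)
          ≤⟨ *-monoʳ-≤ (ρ y * ρ z) (cauchySchwarz xs (c y) (λ _ → 1) (λ x → ρ x * F y x z)) ⟩
        ρ y * ρ z * ((∑[ x ∈ xs ] c y x * (1 * 1)) * (∑[ x ∈ xs ] c y x * (ρ x * F y x z * (ρ x * F y x z))))
          ≡⟨ lem₁ (ρ y) (ρ z) _ _ ⟩
        ρ y * (∑[ x ∈ xs ] c y x * (1 * 1)) * (ρ z * (∑[ x ∈ xs ] c y x * (ρ x * F y x z * (ρ x * F y x z))))
          ≤⟨ *-mono-≤ (subst (λ t → ρ y * t ≤ L) (∑-cong xs λ x → sym (*-identityʳ (c y x))) (ρ*row≤L y))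
              (*-monoʳ-≤ (ρ z) (∑-mono xs λ x → ≤-trans
                (*-monoʳ-≤ (c y x) (*-monoˡ-≤ (ρ x * F y x z) (*-monoʳ-≤ (ρ x) (F≤K y x z))))
                (≤-reflexive (x∙yz≈y∙xz (c y x) (ρ x * K p x z) (ρ x * F y x z))))) ⟩
        L * (ρ z * (∑[ x ∈ xs ] ρ x * K p x z * (c y x * (ρ x * F y x z)))) ∎
        where
        open ≤-Reasoning
        f = λ x → c y x * (1 * (ρ x * F y x z))
        lem₁ : ∀ a b c d → a * b * (c * d) ≡ a * c * (b * d)
        lem₁ = solve-∀

      SF : ∀ x z → S * (∑[ y ∈ xs ] c y x * (ρ x * F y x z)) ≤ L * K p x z
      SF x z = begin
        S * (∑[ y ∈ xs ] c y x * (ρ x * F y x z))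
          ≡⟨ cong (S *_) (trans (∑-cong xs λ y → trans (cong (λ t → c y x * t) (sym (∑-*ˡ (vecs xs p) (ρ x) _)))
               (sym (∑-*ˡ (vecs xs p) (c y x) _))) (∑-swap xs (vecs xs p) _)) ⟩
        S * (∑[ v ∈ vecs xs p ] ∑[ y ∈ xs ] c y x * (ρ x * (chain x v z * R y (x ∷ toList v ++ z ∷ []))))
          ≡⟨ trans (sym (∑-*ˡ (vecs xs p) S _)) (∑-cong (vecs xs p) λ v → trans (cong (S *_)
               (trans (∑-cong xs λ y → trans (lem₁ (c y x) (ρ x) (chain x v z) _)
                 (cong (λ t → chain x v z * ρ x * (t * R y (x ∷ toList v ++ z ∷ []))) (c-sym y x)))
                 (∑-*ˡ xs (chain x v z * ρ x) _)))
               (lem₂ S (chain x v z) (ρ x) _)) ⟩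
        (∑[ v ∈ vecs xs p ] chain x v z * (S * (ρ x * (∑[ y ∈ xs ] c x y * R y (x ∷ toList v ++ z ∷ [])))))
          ≤⟨ ∑-mono (vecs xs p) (λ v → *-monoʳ-≤ (chain x v z) (rare x _)) ⟩
        (∑[ v ∈ vecs xs p ] chain x v z * L)
          ≡⟨ trans (∑-*ʳ (vecs xs p) L _) (*-comm _ L) ⟩
        L * K p x z ∎
        where
        open ≤-Reasoning
        lem₁ : ∀ a b c d → a * (b * (c * d)) ≡ c * b * (a * d)
        lem₁ = solve-∀
        lem₂ : ∀ a b c d → a * (b * c * d) ≡ b * (a * (c * d))
        lem₂ = solve-∀

      SD≤ : S * D ≤ L * L * M p
      SD≤ = begin
        S * D
          ≤⟨ *-monoʳ-≤ S (∑-mono xs λ y → ∑-mono xs λ z → KR² y z) ⟩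
        S * (∑[ y ∈ xs ] ∑[ z ∈ xs ] L * (ρ z * (∑[ x ∈ xs ] ρ x * K p x z * (c y x * (ρ x * F y x z)))))
          ≡⟨ cong (S *_) (trans (∑-swap xs xs _) (trans (∑-cong xs λ z → trans (∑-*ˡ xs L _) (cong (L *_) (trans (∑-*ˡ xs (ρ z) _)
               (cong (ρ z *_) (trans (∑-swap xs xs _) (∑-cong xs λ x → ∑-*ˡ xs (ρ x * K p x z) _)))))) (∑-*ˡ xs L _))) ⟩
        S * (L * (∑[ z ∈ xs ] ρ z * (∑[ x ∈ xs ] ρ x * K p x z * (∑[ y ∈ xs ] c y x * (ρ x * F y x z)))))
          ≡⟨ trans (x∙yz≈y∙xz S L _) (cong (L *_) (trans (sym (∑-*ˡ xs S _)) (∑-cong xs λ z → trans (x∙yz≈y∙xz S (ρ z) _)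
               (cong (ρ z *_) (trans (sym (∑-*ˡ xs S _)) (∑-cong xs λ x → x∙yz≈y∙xz S (ρ x * K p x z) _)))))) ⟩
        L * (∑[ z ∈ xs ] ρ z * (∑[ x ∈ xs ] ρ x * K p x z * (S * (∑[ y ∈ xs ] c y x * (ρ x * F y x z)))))
          ≤⟨ *-monoʳ-≤ L (∑-mono xs λ z → *-monoʳ-≤ (ρ z) (∑-mono xs λ x → *-monoʳ-≤ (ρ x * K p x z) (SF x z))) ⟩
        L * (∑[ z ∈ xs ] ρ z * (∑[ x ∈ xs ] ρ x * K p x z * (L * K p x z)))
          ≡⟨ cong (L *_) (trans (∑-cong xs λ z → trans (sym (∑-*ˡ xs (ρ z) _)) (trans (∑-cong xs λ x → lem₂ (ρ z) (ρ x) (K p x z) L)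
               (∑-*ˡ xs L _))) (trans (∑-*ˡ xs L _) (cong (L *_) (∑-swap xs xs _)))) ⟩
        L * (L * M p)
          ≡⟨ *-assoc L L (M p) ⟨
        L * L * M p ∎
        where
        open ≤-Reasoning
        lem₂ : ∀ z x k l → z * (x * k * (l * k)) ≡ l * (x * z * (k * k))
        lem₂ = solve-∀

    SQ²≤ : S * (Q * Q) ≤ M (suc p) * (L * L * M p)
    SQ²≤ = begin
      S * (Q * Q)             ≡⟨ cong (λ t → S * (t * t)) (closed (suc p) R) ⟩
      S * (q * q)             ≤⟨ *-monoʳ-≤ S (cauchySchwarz₂ xs xs (λ x z → ρ x * ρ z) KR (K (suc p))) ⟩
      S * (D * M (suc p))     ≡⟨ lem S D (M (suc p)) ⟩
      M (suc p) * (S * D)     ≤⟨ *-monoʳ-≤ (M (suc p)) SD≤ ⟩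
      M (suc p) * (L * L * M p) ∎
      where
      open ≤-Reasoning
      q = ∑[ y ∈ xs ] ∑[ z ∈ xs ] ρ y * ρ z * (KR y z * K (suc p) y z)
      lem : ∀ a b c → a * (b * c) ≡ c * (a * b)
      lem = solve-∀

    -- r is a half-length at which the number of closed walks is bounded below
    bound : ∀ A B r → A * (B * B) ≤ S → r ≤ suc p → 0 < S →
      (L * L) ^ suc r * length xs ≤ A ^ suc r * M r → Q * B ≤ M (suc p)
    bound A B r AB²≤S r≤ S>0 h = sq-cancel-≤ _ _ (*-cancelˡ-≤ S {{>-nonZero S>0}} (begin
      S * (Q * B * (Q * B))               ≡⟨ lem₁ S Q B ⟩
      B * B * (S * (Q * Q))               ≤⟨ *-monoʳ-≤ (B * B) SQ²≤ ⟩
      B * B * (M (suc p) * (L * L * M p)) ≤⟨ *-monoʳ-≤ (B * B) (*-monoʳ-≤ (M (suc p)) (ratio-bound A (L * L) r (suc p) r≤ h)) ⟩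
      B * B * (M (suc p) * (A * M (suc p))) ≡⟨ lem₂ B (M (suc p)) A ⟩
      A * (B * B) * (M (suc p) * M (suc p)) ≤⟨ *-monoˡ-≤ _ AB²≤S ⟩
      S * (M (suc p) * M (suc p))         ∎))
      where
      open ≤-Reasoning
      lem₁ : ∀ s q b → s * (q * b * (q * b)) ≡ b * b * (s * (q * q))
      lem₁ = solve-∀
      lem₂ : ∀ b m a → b * b * (m * (a * m)) ≡ a * (b * b) * (m * m)
      lem₂ = solve-∀

  -- The order is the only loss in `ratio-bound`. As it is at most the (r + 1)-st power of `A`, with
  -- r + 1 = 2 (j + 1), it is absorbed by replacing κ² with κ² A, and from half-length r on every
  -- quotient of moments is controlled.
  module Dense (κ : ℕ) (dense : ∑ xs π ≤ κ * (∑[ x ∈ xs ] ∑ xs (c x))) (0<L : 0 < L) (0<Π : 0 < ∑ xs π)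
    (A j : ℕ) (size : length xs ≤ A ^ (suc j + suc j)) where

    private
      r = j + suc j
      open LowerBound κ dense (*-mono-≤ 0<L 0<Π)

      κ-lower : (L * L) ^ suc r ≤ (κ * κ) ^ suc r * M r
      κ-lower = subst₂ _≤_ (sym (^-distribˡ-+-* (L * L) (suc j) (suc j)))
        (cong (_* M r) (sym (^-distribˡ-+-* (κ * κ) (suc j) (suc j)))) (closed-lower j)

      lower : (L * L) ^ suc r * length xs ≤ (κ * κ * A) ^ suc r * M r
      lower = begin
        (L * L) ^ suc r * length xs                     ≤⟨ *-mono-≤ κ-lower size ⟩
        (κ * κ) ^ suc r * M r * A ^ suc r               ≡⟨ xy∙z≈xz∙y ((κ * κ) ^ suc r) (M r) (A ^ suc r) ⟩
        (κ * κ) ^ suc r * A ^ suc r * M r               ≡⟨ cong (_* M r) (sym (*-^ (κ * κ) A (suc r))) ⟩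
        (κ * κ * A) ^ suc r * M r                       ∎
        where
        open ≤-Reasoning

      0<L² : 0 < L * L
      0<L² = *-mono-≤ 0<L 0<L

      0<LHS : 0 < (L * L) ^ suc r
      0<LHS = m^n>0 (L * L) {{>-nonZero 0<L²}} (suc r)

      0<Mr : 0 < M r
      0<Mr = n≢0⇒n>0 λ M≡0 → <⇒≱ 0<LHS (≤-trans κ-lower (≤-reflexive (trans (cong ((κ * κ) ^ suc r *_) M≡0) (*-zeroʳ ((κ * κ) ^ suc r)))))

    M>0 : ∀ q → r ≤ q → 0 < M q
    M>0 q r≤q = subst (λ q → 0 < M q) (m+[n∸m]≡n r≤q) (go (q ∸ r))
      where
      go : ∀ d → 0 < M (r + d)
      go zero    = subst (λ q → 0 < M q) (sym (+-identityʳ r)) 0<Mr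
      go (suc d) = subst (λ q → 0 < M q) (sym (+-suc r d)) (n≢0⇒n>0 λ M≡0 →
        <⇒≱ (*-mono-≤ 0<L² (go d)) (≤-trans (ratio-bound (κ * κ * A) (L * L) r (suc (r + d)) (m≤n⇒m≤1+n (m≤m+n r d)) lower)
          (≤-reflexive (trans (cong (κ * κ * A *_) M≡0) (*-zeroʳ (κ * κ * A))))))

    rare-bound : ∀ p R R≤1 S rare B → r ≤ suc p → κ * κ * A * (B * B) ≤ S → 0 < S →
      Rare.Q p R R≤1 S rare * B ≤ M (suc p)
    rare-bound p R R≤1 S rare B r≤ AB²≤S 0<S = Rare.bound p R R≤1 S rare (κ * κ * A) B r AB²≤S r≤ 0<S lower

-- Indicators

𝟙 : Bool → ℕ
𝟙 true  = 1
𝟙 false = 0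

𝟙≤1 : ∀ b → 𝟙 b ≤ 1
𝟙≤1 true  = ≤-refl
𝟙≤1 false = z≤n

𝟙-∧ : ∀ a b → 𝟙 (a ∧ b) ≡ 𝟙 a * 𝟙 b
𝟙-∧ true  b = sym (+-identityʳ (𝟙 b))
𝟙-∧ false b = refl

𝟙-∨ : ∀ a b → 𝟙 (a ∨ b) ≤ 𝟙 a + 𝟙 b
𝟙-∨ true  b = s≤s z≤n
𝟙-∨ false b = ≤-refl

𝟙-split : ∀ b → 𝟙 b + 𝟙 (not b) ≡ 1
𝟙-split true  = refl
𝟙-split false = refl

-- Rotation of vectors

rot : ∀ {X : Set} {m} → Vec X m → Vec X m
rot []      = []
rot (x ∷ v) = v Vec.∷ʳ x

rotⁿ : ∀ {X : Set} {m} → ℕ → Vec X m → Vec X m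
rotⁿ zero    v = v
rotⁿ (suc i) v = rotⁿ i (rot v)

∑-rot : ∀ {X : Set} (xs : List X) m (φ : Vec X m → ℕ) → ∑ (vecs xs m) (λ v → φ (rot v)) ≡ ∑ (vecs xs m) φ
∑-rot xs zero    φ = refl
∑-rot xs (suc m) φ = trans (∑-vecs xs m _) (trans (∑-swap xs (vecs xs m) _) (sym (∑-vecs-∷ʳ xs m φ)))

∑-rotⁿ : ∀ {X : Set} (xs : List X) m i (φ : Vec X m → ℕ) → ∑ (vecs xs m) (λ v → φ (rotⁿ i v)) ≡ ∑ (vecs xs m) φ
∑-rotⁿ xs m zero    φ = refl
∑-rotⁿ xs m (suc i) φ = trans (∑-rot xs m (λ v → φ (rotⁿ i v))) (∑-rotⁿ xs m i φ)

-- `u` is an arbitrary entry in front: `at` wants a nonempty vector, and position `suc j` of `u ∷ v`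
-- is position `j` of `v`.
at-∷ʳ : ∀ {X : Set} {m} (u : X) (v : Vec X m) (x : X) {j} → j < m → at (v Vec.∷ʳ x) j ≡ at (u ∷ v) (suc j)
at-∷ʳ u (y ∷ v)     x {zero}  _               = refl
at-∷ʳ u (y ∷ w ∷ v) x {suc j} (s≤s j<m)       = at-∷ʳ y (w ∷ v) x j<m
at-∷ʳ u (y ∷ [])    x {suc j} (s≤s ())

at-∷ʳ-last : ∀ {X : Set} {m} (v : Vec X m) (x : X) → at (v Vec.∷ʳ x) m ≡ x
at-∷ʳ-last []          x = refl
at-∷ʳ-last (y ∷ [])    x = refl
at-∷ʳ-last (y ∷ w ∷ v) x = at-∷ʳ-last (w ∷ v) x

at-rot : ∀ {X : Set} {m} (v : Vec X (suc m)) {j} → j < m → at (rot v) j ≡ at v (suc j)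
at-rot (x ∷ v) j<m = at-∷ʳ x v x j<m

at-rot-last : ∀ {X : Set} {m} (v : Vec X (suc m)) → at (rot v) m ≡ at v 0
at-rot-last (x ∷ v) = at-∷ʳ-last v x

at-rotⁿ : ∀ {X : Set} {m} (v : Vec X (suc m)) i {j} → i + j ≤ m → at (rotⁿ i v) j ≡ at v (i + j)
at-rotⁿ v zero    _ = refl
at-rotⁿ v (suc i) {j} (s≤s i+j≤m) = trans (at-rotⁿ (rot v) i (m≤n⇒m≤1+n i+j≤m)) (at-rot v (s≤s i+j≤m))

at-rotⁿ-wrap : ∀ {X : Set} {m} (v : Vec X (suc m)) i {j r} → i + j ≡ suc m + r → r < i → i ≤ suc m → at (rotⁿ i v) j ≡ at v r
at-rotⁿ-wrap {m = m} v (suc i) {j} {zero} eq r<i i≤m = begin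
  at (rotⁿ i (rot v)) j ≡⟨ at-rotⁿ (rot v) i (≤-reflexive i+j≡m) ⟩
  at (rot v) (i + j)    ≡⟨ cong (at (rot v)) i+j≡m ⟩
  at (rot v) m          ≡⟨ at-rot-last v ⟩
  at v 0                ∎
  where
  open ≡-Reasoning
  i+j≡m : i + j ≡ m
  i+j≡m = trans (suc-injective eq) (+-identityʳ m)
at-rotⁿ-wrap {m = m} v (suc i) {j} {suc r} eq (s≤s r<i) (s≤s i≤m) = trans
  (at-rotⁿ-wrap (rot v) i (trans (suc-injective eq) (+-suc m r)) r<i (m≤n⇒m≤1+n i≤m))
  (at-rot v (<-≤-trans r<i i≤m))

at-ext : ∀ {X : Set} {m} (v w : Vec X (suc m)) → (∀ {j} → j ≤ m → at v j ≡ at w j) → v ≡ w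
at-ext (x ∷ [])    (y ∷ [])     h = cong (_∷ []) (h z≤n)
at-ext (x ∷ x′ ∷ v) (y ∷ y′ ∷ w) h = cong₂ _∷_ (h z≤n) (at-ext (x′ ∷ v) (y′ ∷ w) (λ j≤m → h (s≤s j≤m)))

rotⁿ-length : ∀ {X : Set} {m} (v : Vec X m) → rotⁿ m v ≡ v
rotⁿ-length []      = refl
rotⁿ-length {m = suc m} v@(_ ∷ _) = at-ext _ _ (λ {j} j≤m → at-rotⁿ-wrap v (suc m) {j} {j} refl (s≤s j≤m) ≤-refl)

head≡at : ∀ {X : Set} {m} (v : Vec X (suc m)) → head v ≡ at v 0
head≡at (x ∷ v) = refl

head-rotⁿ : ∀ {X : Set} {m} (v : Vec X (suc m)) i → i ≤ m → head (rotⁿ i v) ≡ at v i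
head-rotⁿ v i i≤m = trans (head≡at (rotⁿ i v)) (trans (at-rotⁿ v i (subst (_≤ _) (sym (+-identityʳ i)) i≤m)) (cong (at v) (+-identityʳ i)))

-- On a cycle of length 2 ℓ, one of the two arcs between two positions has
-- length at most ℓ.
cyclic-pairs : ∀ {X : Set} {r ℓ} → suc r ≡ ℓ + ℓ → (z : Vec X (suc r)) (P : X → X → Set) → (∀ {x y} → P x y → P y x) →
  (∀ i d → i < suc r → d < ℓ → P (head (rotⁿ i z)) (at (rotⁿ i z) (suc d))) →
  ∀ {j j′} → j < j′ → j′ < suc r → P (at z j) (at z j′)
cyclic-pairs {r = r} {ℓ} len z P P-sym near-P {j} {j′} j<j′ j′<2ℓ = go (≤-total j′ (j + ℓ))
  where
  d = j′ ∸ suc j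
  j+d : j + suc d ≡ j′
  j+d = trans (+-suc j d) (m+[n∸m]≡n j<j′)
  e = (suc r + j) ∸ suc j′
  j′+e : j′ + suc e ≡ suc r + j
  j′+e = trans (+-suc j′ e) (m+[n∸m]≡n (≤-trans j′<2ℓ (m≤m+n (suc r) j)))
  lem : ∀ ℓ j → ℓ + ℓ + j ≡ j + ℓ + ℓ
  lem = solve-∀
  go : j′ ≤ j + ℓ ⊎ j + ℓ ≤ j′ → P (at z j) (at z j′)
  go (inj₁ near) = subst₂ P
    (head-rotⁿ z j (≤-pred (<-trans j<j′ j′<2ℓ)))
    (trans (at-rotⁿ z j (subst (_≤ r) (sym j+d) (≤-pred j′<2ℓ))) (cong (at z) j+d))
    (near-P j d (<-trans j<j′ j′<2ℓ) (+-cancelˡ-≤ j (suc d) ℓ (subst (_≤ j + ℓ) (sym j+d) near)))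
  go (inj₂ far) = P-sym (subst₂ P
    (head-rotⁿ z j′ (≤-pred j′<2ℓ))
    (at-rotⁿ-wrap z j′ j′+e j<j′ (<⇒≤ j′<2ℓ))
    (near-P j′ e j′<2ℓ (+-cancelˡ-≤ j′ (suc e) ℓ (begin
      j′ + suc e ≡⟨ trans j′+e (cong (_+ j) len) ⟩
      ℓ + ℓ + j  ≡⟨ lem ℓ j ⟩
      j + ℓ + ℓ  ≤⟨ +-monoˡ-≤ ℓ far ⟩
      j′ + ℓ     ∎))))
    where open ≤-Reasoning

-- Sums over an initial segment of ℕ

∑< : ℕ → (ℕ → ℕ) → ℕ
∑< zero    f = 0
∑< (suc m) f = f 0 + ∑< m (λ i → f (suc i))

∑<-≤ : ∀ m f B → (∀ i → i < m → f i ≤ B) → ∑< m f ≤ m * B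
∑<-≤ zero    f B h = z≤n
∑<-≤ (suc m) f B h = +-mono-≤ (h 0 (s≤s z≤n)) (∑<-≤ m _ B (λ i i<m → h (suc i) (s≤s i<m)))

∑-∑< : ∀ {X : Set} (xs : List X) m (f : X → ℕ → ℕ) → (∑[ x ∈ xs ] ∑< m (f x)) ≡ ∑< m (λ i → ∑[ x ∈ xs ] f x i)
∑-∑< xs zero    f = ∑-0 xs
∑-∑< xs (suc m) f = trans (∑-+ xs _ _) (cong (_+_ (∑[ x ∈ xs ] f x 0)) (∑-∑< xs m _))

∑<-*ˡ : ∀ m a f → ∑< m (λ i → a * f i) ≡ a * ∑< m f
∑<-*ˡ zero    a f = sym (*-zeroʳ a)
∑<-*ˡ (suc m) a f = trans (cong (_+_ (a * f 0)) (∑<-*ˡ m a _)) (sym (*-distribˡ-+ a (f 0) _))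

∑<-cong : ∀ m {f g} → (∀ i → i < m → f i ≡ g i) → ∑< m f ≡ ∑< m g
∑<-cong zero    h = refl
∑<-cong (suc m) h = cong₂ _+_ (h 0 (s≤s z≤n)) (∑<-cong m (λ i i<m → h (suc i) (s≤s i<m)))

∑-toList : ∀ {X : Set} {m} (f : X → ℕ) (v : Vec X (suc m)) → ∑ (toList v) f ≡ ∑< (suc m) (λ i → f (at v i))
∑-toList f (x ∷ [])    = refl
∑-toList f (x ∷ y ∷ v) = cong (_+_ (f x)) (∑-toList f (y ∷ v))

∑-toList-∷ʳ : ∀ {X : Set} {m} (f : X → ℕ) (v : Vec X m) x → ∑ (toList (v Vec.∷ʳ x)) f ≡ ∑ (toList v) f + f x
∑-toList-∷ʳ f []      x = +-identityʳ (f x)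
∑-toList-∷ʳ f (y ∷ v) x = trans (cong (_+_ (f y)) (∑-toList-∷ʳ f v x)) (sym (+-assoc (f y) _ (f x)))

∑-toList-rot : ∀ {X : Set} {m} (f : X → ℕ) (v : Vec X m) → ∑ (toList (rot v)) f ≡ ∑ (toList v) f
∑-toList-rot f []      = refl
∑-toList-rot f (x ∷ v) = trans (∑-toList-∷ʳ f v x) (+-comm _ (f x))

-- Union bound over the rotations of a cyclic structure

module Union {Z : Set} (zs : List Z) (W : Z → ℕ) (σ : Z → Z)
  (∑-σ : ∀ φ → (∑[ z ∈ zs ] φ (σ z)) ≡ ∑ zs φ) (W-σ : ∀ z → W (σ z) ≡ W z) (bad : Z → Bool) where

  σⁿ : ℕ → Z → Z
  σⁿ zero    z = z
  σⁿ (suc i) z = σⁿ i (σ z)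

  clean : ℕ → Z → Bool
  clean zero    z = true
  clean (suc i) z = not (bad z) ∧ clean i (σ z)

  clean⇒¬bad : ∀ M z → clean M z ≡ true → ∀ i → i < M → bad (σⁿ i z) ≡ false
  clean⇒¬bad (suc M) z h zero    _         with bad z
  ... | false = refl
  clean⇒¬bad (suc M) z h (suc i) (s≤s i<M) with bad z
  ... | false = clean⇒¬bad M (σ z) h i i<M

  ¬bad⇒clean : ∀ M z → (∀ i → i < M → bad (σⁿ i z) ≡ false) → clean M z ≡ true
  ¬bad⇒clean zero    z h = refl
  ¬bad⇒clean (suc M) z h rewrite h 0 (s≤s z≤n) = ¬bad⇒clean M (σ z) (λ i i<M → h (suc i) (s≤s i<M))

  -- If σ has period M, the M shifts run through a whole orbit, so the starting point is irrelevant.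
  -- This yields the invariance of the good sequences under rotation, and from it `g-shift`.
  clean-σ : ∀ M → (∀ z → σⁿ M z ≡ z) → ∀ z → clean M (σ z) ≡ clean M z
  clean-σ zero    period z = refl
  clean-σ M@(suc M′) period z with clean M z in eq | clean M (σ z) in eq′
  ... | true  | true  = refl
  ... | false | false = refl
  ... | false | true  = trans (sym (¬bad⇒clean M z λ where
      zero    _         → trans (cong bad (sym (period z))) (clean⇒¬bad M (σ z) eq′ M′ ≤-refl)
      (suc i) (s≤s i<M) → clean⇒¬bad M (σ z) eq′ i (m≤n⇒m≤1+n i<M))) eq
  ... | true  | false = trans (sym eq′) (¬bad⇒clean M (σ z) λ i i<M → pr i i<M)
    where
    pr : ∀ i → i < M → bad (σⁿ (suc i) z) ≡ false
    pr i (s≤s i≤M′) with m≤n⇒m<n∨m≡n i≤M′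
    ... | inj₁ i<M′ = clean⇒¬bad M z eq (suc i) (s≤s i<M′)
    ... | inj₂ refl = trans (cong bad (period z)) (clean⇒¬bad M z eq 0 (s≤s z≤n))

  union : ∀ M → (∑[ z ∈ zs ] W z * 𝟙 (not (clean M z))) ≤ M * (∑[ z ∈ zs ] W z * 𝟙 (bad z))
  union zero    = ≤-reflexive (trans (∑-cong zs λ z → *-zeroʳ (W z)) (∑-0 zs))
  union (suc M) = begin
    (∑[ z ∈ zs ] W z * 𝟙 (not (not (bad z) ∧ clean M (σ z))))
      ≤⟨ ∑-mono zs (λ z → ≤-trans (*-monoʳ-≤ (W z) (step (bad z) (clean M (σ z))))
           (≤-reflexive (*-distribˡ-+ (W z) _ _))) ⟩
    (∑[ z ∈ zs ] W z * 𝟙 (bad z) + W z * 𝟙 (not (clean M (σ z))))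
      ≡⟨ ∑-+ zs _ _ ⟩
    (∑[ z ∈ zs ] W z * 𝟙 (bad z)) + (∑[ z ∈ zs ] W z * 𝟙 (not (clean M (σ z))))
      ≡⟨ cong (_+_ ((∑[ z ∈ zs ] W z * 𝟙 (bad z)))) (trans (∑-cong zs λ z → cong (_* 𝟙 (not (clean M (σ z)))) (sym (W-σ z)))
           (∑-σ (λ z → W z * 𝟙 (not (clean M z))))) ⟩
    (∑[ z ∈ zs ] W z * 𝟙 (bad z)) + (∑[ z ∈ zs ] W z * 𝟙 (not (clean M z)))
      ≤⟨ +-monoʳ-≤ _ (union M) ⟩
    suc M * (∑[ z ∈ zs ] W z * 𝟙 (bad z)) ∎
    where
    open ≤-Reasoning
    step : ∀ b c → 𝟙 (not (not b ∧ c)) ≤ 𝟙 b + 𝟙 (not c)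
    step true  c     = s≤s z≤n
    step false c     = ≤-refl

  half-clean : ∀ M → 2 * (M * (∑[ z ∈ zs ] W z * 𝟙 (bad z))) ≤ ∑ zs W →
    ∑ zs W ≤ 2 * (∑[ z ∈ zs ] W z * 𝟙 (clean M z))
  half-clean M h = +-cancelʳ-≤ (2 * B) _ _ (begin
    ∑ zs W + 2 * B             ≤⟨ +-monoʳ-≤ (∑ zs W) (≤-trans (*-monoʳ-≤ 2 (union M)) h) ⟩
    ∑ zs W + ∑ zs W            ≡⟨ cong (λ t → t + t) total ⟩
    (G + B) + (G + B)          ≡⟨ lem G B ⟩
    2 * G + 2 * B              ∎)
    where
    open ≤-Reasoning
    G = ∑[ z ∈ zs ] W z * 𝟙 (clean M z)
    B = ∑[ z ∈ zs ] W z * 𝟙 (not (clean M z))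
    total : ∑ zs W ≡ G + B
    total = trans (∑-cong zs λ z → trans (sym (*-identityʳ (W z))) (trans (cong (W z *_) (sym (𝟙-split (clean M z))))
              (*-distribˡ-+ (W z) _ _))) (∑-+ zs _ _)
    lem : ∀ G B → (G + B) + (G + B) ≡ 2 * G + 2 * B
    lem = solve-∀

  exists-clean : ∀ M → 2 * (M * (∑[ z ∈ zs ] W z * 𝟙 (bad z))) ≤ ∑ zs W → 0 < ∑ zs W →
    ∃ λ z → 0 < W z × clean M z ≡ true
  exists-clean M h 0<W with z , lt ← ∑-exists zs (λ _ → 0) (λ z → W z * 𝟙 (clean M z))
      (subst (_< (∑[ z ∈ zs ] W z * 𝟙 (clean M z))) (sym (∑-0 zs))
        (*-cancelˡ-< 2 0 _ (<-≤-trans 0<W (half-clean M h))))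
    with W z in eqW | clean M z in eqC
  ... | suc w | true  = z , subst (0 <_) (sym eqW) (s≤s z≤n) , eqC
  ... | suc w | false = ⊥-elim (<-irrefl refl (subst (0 <_) (*-zeroʳ w) lt))

-- L div p for the common multiple L = B ! of 1, …, B
share : ℕ → ℕ → ℕ
share B zero    = 0
share B (suc p) = B ! div suc p

share-* : ∀ B {p} → 0 < p → p ≤ B → share B p * p ≡ B !
share-* B {suc p} _ p≤B = m/n*n≡m (∣-trans (m∣m*n (p !)) (m≤n⇒m!∣n! p≤B))

!>0 : ∀ B → 0 < B !
!>0 B = n≢0⇒n>0 (m!≢0 B)
  where
  m!≢0 : ∀ B → B ! ≢ 0
  m!≢0 (suc B) eq with m*n≡0⇒m≡0∨n≡0 (suc B) eq
  ... | inj₂ eq′ = m!≢0 B eq′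

∑-any : ∀ {X : Set} (p : X → Bool) l → 𝟙 (any p l) ≤ ∑ l (λ x → 𝟙 (p x))
∑-any p []      = z≤n
∑-any p (x ∷ l) = ≤-trans (𝟙-∨ (p x) (any p l)) (+-monoʳ-≤ (𝟙 (p x)) (∑-any p l))

∑-≤ : ∀ {X : Set} (l : List X) f B → (∀ x → f x ≤ B) → ∑ l f ≤ length l * B
∑-≤ l f B h = ≤-trans (∑-mono l h) (≤-reflexive (∑-const l B))

-- Cyclic sequences E₀ F₀ E₁ F₁ … of length 2 m with weights τ

module Cyclic {D : Set} (ds : List D) (τ : D → D → ℕ) where

  along : ∀ {m} → Vec D m → Vec D m → ℕ
  along []      []      = 1
  along (e ∷ E) (f ∷ F) = τ e f * along E F

  along-∷ʳ : ∀ {m} (E F : Vec D m) e f → along (E Vec.∷ʳ e) (F Vec.∷ʳ f) ≡ along E F * τ e f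
  along-∷ʳ []       []       e f = *-comm (τ e f) 1
  along-∷ʳ (e′ ∷ E) (f′ ∷ F) e f = trans (cong (τ e′ f′ *_) (along-∷ʳ E F e f)) (sym (*-assoc (τ e′ f′) _ _))

  along-rot : ∀ {m} (E F : Vec D m) → along (rot E) (rot F) ≡ along E F
  along-rot []      []      = refl
  along-rot (e ∷ E) (f ∷ F) = trans (along-∷ʳ E F e f) (*-comm _ (τ e f))

  along-≤ : ∀ B → (∀ e f → τ e f ≤ B) → ∀ {m} (E F : Vec D m) → along E F ≤ B ^ m
  along-≤ B h []      []      = ≤-refl
  along-≤ B h (e ∷ E) (f ∷ F) = *-mono-≤ (h e f) (along-≤ B h E F)

  along>0 : ∀ {m} (E F : Vec D (suc m)) → 0 < along E F → ∀ {j} → j ≤ m → 0 < τ (at E j) (at F j)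
  along>0 (e ∷ E) (f ∷ F) h {zero}  j≤m = n≢0⇒n>0 λ τ≡0 → <-irrefl refl (subst (λ t → 0 < t * along E F) τ≡0 h)
  along>0 (e ∷ e′ ∷ E) (f ∷ f′ ∷ F) h {suc j} (s≤s j≤m) = along>0 (e′ ∷ E) (f′ ∷ F)
    (n≢0⇒n>0 λ a≡0 → <-irrefl refl (subst (0 <_) (trans (cong (τ e f *_) a≡0) (*-zeroʳ (τ e f))) h)) j≤m

  cyc : ∀ {m} → Vec D m → Vec D m → ℕ
  cyc E F = along E F * along F (rot E)

  -- Starting the cyclic sequence one place later turns the pair E, F into F, `rot E`; two such
  -- moves rotate both columns.
  cyc-shift : ∀ {m} (E F : Vec D m) → cyc F (rot E) ≡ cyc E F
  cyc-shift E F = trans (*-comm (along F (rot E)) _) (cong (_* along F (rot E)) (along-rot E F))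

  cyc-rot : ∀ {m} (E F : Vec D m) → cyc (rot E) (rot F) ≡ cyc E F
  cyc-rot E F = trans (cyc-shift F (rot E)) (cyc-shift E F)

  total : ℕ → ℕ
  total m = ∑[ E ∈ vecs ds m ] ∑[ F ∈ vecs ds m ] cyc E F

-- Columns are m-tuples of edges of a graph; consecutive columns E, F
-- interlace to a closed walk E₀ F₀ E₁ F₁ ….  The spread condition makes a
-- step to a column through a prescribed vertex v rare.

module ColumnGraph {n : ℕ} {D : Set} (ds : List D) (a b : D → Fin n) (τ : D → D → ℕ) (T : ℕ) (τ≤T : ∀ e f → τ e f ≤ T)
  (N : D → D → D → Bool) where

  open Cyclic ds τ public

  hits : Fin n → D → Bool
  hits v f = does (a f Finₚ.≟ v) ∨ does (b f Finₚ.≟ v)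

  module _ {m : ℕ} where

    column : Vec D m ⊎ Vec D m → Vec D m
    column (inj₁ E) = E
    column (inj₂ F) = F

    verts : Vec D m → List (Fin n)
    verts E = map a (toList E) ++ map b (toList E)

    length-verts : ∀ E → length (verts E) ≡ m + m
    length-verts E = trans (length-++ (map a (toList E))) (cong₂ _+_
      (trans (length-map a (toList E)) (Vecₚ.length-toList E)) (trans (length-map b (toList E)) (Vecₚ.length-toList E)))

    meets : Vec D m ⊎ Vec D m → Vec D m ⊎ Vec D m → Bool
    meets x y = any (λ v → any (hits v) (toList (column x))) (verts (column y))

    Consecutive : (Vec D m → Vec D m → Bool) → Vec D m ⊎ Vec D m → Vec D m ⊎ Vec D m → Set
    Consecutive g (inj₁ E) (inj₂ F) = 0 < along E F × 0 < along F (rot E) × g E F ≡ true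
    Consecutive g (inj₂ F) (inj₁ E) = 0 < along E F × 0 < along F (rot E) × g E F ≡ true
    Consecutive g (inj₁ _) (inj₁ _) = ⊥
    Consecutive g (inj₂ _) (inj₂ _) = ⊥

  module Spread (Z : ℕ)
    (spread : ∀ e e′ v → Z * (∑[ f ∈ ds ] τ e f * τ f e′ * 𝟙 (N e f e′ ∧ hits v f)) ≤ (∑[ f ∈ ds ] τ e f * τ f e′))
    (k′ : ℕ)
    (g : Vec D (suc (k′ + suc k′)) → Vec D (suc (k′ + suc k′)) → Bool)
    (g-shift : ∀ E F → g F (rot E) ≡ g E F)
    (g-N : ∀ E F → g E F ≡ true → N (head E) (head F) (head (rot E)) ≡ true)
    (dense : total (suc (k′ + suc k′)) ≤ 2 * (∑[ E ∈ vecs ds (suc (k′ + suc k′)) ] ∑[ F ∈ vecs ds (suc (k′ + suc k′)) ] cyc E F * 𝟙 (g E F)))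
    (positive : 0 < total (suc (k′ + suc k′)))
    where

    private
      m′ = k′ + suc k′
      m = suc m′
      X = Vec D m
      xs = vecs ds m

    c : X → X → ℕ
    c E F = cyc E F * 𝟙 (g E F)

    c≤cyc : ∀ E F → c E F ≤ cyc E F
    c≤cyc E F = ≤-trans (*-monoʳ-≤ (cyc E F) (𝟙≤1 _)) (≤-reflexive (*-identityʳ _))

    c-shift : ∀ E F → c F (rot E) ≡ c E F
    c-shift E F = cong₂ (λ s t → s * 𝟙 t) (cyc-shift E F) (g-shift E F)

    c-rotⁿ : ∀ i E F → c (rotⁿ i E) (rotⁿ i F) ≡ c E F
    c-rotⁿ zero    E F = refl
    c-rotⁿ (suc i) E F = trans (c-rotⁿ i (rot E) (rot F)) (trans (c-shift F (rot E)) (c-shift E F))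

    cyc-rotⁿ : ∀ i (E F : X) → cyc (rotⁿ i E) (rotⁿ i F) ≡ cyc E F
    cyc-rotⁿ zero    E F = refl
    cyc-rotⁿ (suc i) E F = trans (cyc-rotⁿ i (rot E) (rot F)) (cyc-rot E F)

    π₁ : X → ℕ
    π₁ E = ∑[ F ∈ xs ] cyc E F

    π₁-rotⁿ : ∀ i E → π₁ (rotⁿ i E) ≡ π₁ E
    π₁-rotⁿ i E = trans (sym (∑-rotⁿ ds m i (cyc (rotⁿ i E)))) (∑-cong xs λ F → cyc-rotⁿ i E F)

    π₁-left : ∀ F → (∑[ E ∈ xs ] cyc E F) ≡ π₁ F
    π₁-left F = trans (∑-cong xs λ E → sym (cyc-shift E F)) (∑-rot ds m (cyc F))

    -- All of `F` but its head is frozen. The head then ranges over the entries between the first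
    -- two entries of `E`, which is the situation of `spread`; `g` only has to supply `N`.
    head-spread : ∀ E v → Z * (∑[ F ∈ xs ] c E F * 𝟙 (hits v (head F))) ≤ π₁ E
    head-spread E@(e ∷ E′) v = begin
      Z * (∑[ F ∈ xs ] c E F * 𝟙 (hits v (head F)))
        ≤⟨ *-monoʳ-≤ Z (∑-mono xs λ F → ≤-trans (≤-reflexive (*-assoc (cyc E F) _ _)) (*-monoʳ-≤ (cyc E F) (guard F))) ⟩
      Z * (∑[ F ∈ xs ] cyc E F * 𝟙 (N e (head F) e⁺ ∧ hits v (head F)))
        ≡⟨ cong (Z *_) (trans (∑-vecs ds m′ _) (∑-swap ds (vecs ds m′) _)) ⟩
      Z * (∑[ F ∈ vecs ds m′ ] ∑[ f ∈ ds ] cyc E (f ∷ F) * 𝟙 (N e f e⁺ ∧ hits v f))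
        ≡⟨ trans (sym (∑-*ˡ (vecs ds m′) Z _)) (∑-cong (vecs ds m′) λ F → trans (cong (Z *_)
             (trans (∑-cong ds λ f → trans (cong (_* 𝟙 (N e f e⁺ ∧ hits v f)) (factor f F)) (*-assoc (rest F) _ _))
               (∑-*ˡ ds (rest F) _))) (x∙yz≈y∙xz Z (rest F) _)) ⟩
      (∑[ F ∈ vecs ds m′ ] rest F * (Z * (∑[ f ∈ ds ] τ e f * τ f e⁺ * 𝟙 (N e f e⁺ ∧ hits v f))))
        ≤⟨ ∑-mono (vecs ds m′) (λ F → *-monoʳ-≤ (rest F) (spread e e⁺ v)) ⟩
      (∑[ F ∈ vecs ds m′ ] rest F * (∑[ f ∈ ds ] τ e f * τ f e⁺))
        ≡⟨ ∑-cong (vecs ds m′) (λ F → trans (sym (∑-*ˡ ds (rest F) _)) (∑-cong ds λ f → sym (factor f F))) ⟩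
      (∑[ F ∈ vecs ds m′ ] ∑[ f ∈ ds ] cyc E (f ∷ F))
        ≡⟨ trans (∑-swap (vecs ds m′) ds _) (sym (∑-vecs ds m′ _)) ⟩
      π₁ E ∎
      where
      open ≤-Reasoning
      e⁺ = head (rot E)
      rest : Vec D m′ → ℕ
      rest F = along E′ F * along F (tail (rot E))
      along-head : ∀ (w : Vec D m) f F → along (f ∷ F) w ≡ τ f (head w) * along F (tail w)
      along-head (x ∷ w) f F = refl
      lem₂ : ∀ s t u v → s * t * (u * v) ≡ t * v * (s * u)
      lem₂ = solve-∀
      factor : ∀ f F → cyc E (f ∷ F) ≡ rest F * (τ e f * τ f e⁺)
      factor f F = trans (cong (τ e f * along E′ F *_) (along-head (rot E) f F))
                     (lem₂ (τ e f) (along E′ F) (τ f e⁺) (along F (tail (rot E))))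
      guard : ∀ F → 𝟙 (g E F) * 𝟙 (hits v (head F)) ≤ 𝟙 (N e (head F) e⁺ ∧ hits v (head F))
      guard F with g E F in eq
      ... | false = z≤n
      ... | true rewrite g-N E F eq = ≤-reflexive (+-identityʳ _)

    through : Fin n → X → ℕ
    through v F = ∑ (toList F) (λ f → 𝟙 (hits v f))

    -- A rotation brings any entry of `F` to the head, and `c` and `π₁` are invariant under rotating
    -- both columns.
    column-spread : ∀ E v → Z * (∑[ F ∈ xs ] c E F * through v F) ≤ m * π₁ E
    column-spread E v = begin
      Z * (∑[ F ∈ xs ] c E F * through v F)
        ≡⟨ cong (Z *_) (trans (∑-cong xs λ F → trans (cong (c E F *_) (trans (∑-toList (λ f → 𝟙 (hits v f)) F)
             (∑<-cong m {g = h F} λ i i<m → cong (λ f → 𝟙 (hits v f)) (sym (head-rotⁿ F i (≤-pred i<m))))))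
             (sym (∑<-*ˡ m (c E F) (h F)))) (∑-∑< xs m λ F i → c E F * h F i)) ⟩
      Z * ∑< m (λ i → ∑[ F ∈ xs ] c E F * 𝟙 (hits v (head (rotⁿ i F))))
        ≡⟨ ∑<-*ˡ m Z (λ i → ∑[ F ∈ xs ] c E F * h F i) ⟨
      ∑< m (λ i → Z * (∑[ F ∈ xs ] c E F * 𝟙 (hits v (head (rotⁿ i F)))))
        ≤⟨ ∑<-≤ m _ (π₁ E) (λ i _ → each i) ⟩
      m * π₁ E ∎
      where
      open ≤-Reasoning
      h : X → ℕ → ℕ
      h F i = 𝟙 (hits v (head (rotⁿ i F)))
      each : ∀ i → Z * (∑[ F ∈ xs ] c E F * 𝟙 (hits v (head (rotⁿ i F)))) ≤ π₁ E
      each i = subst₂ _≤_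
        (cong (Z *_) (trans (sym (∑-rotⁿ ds m i λ F → c (rotⁿ i E) F * 𝟙 (hits v (head F)))) (∑-cong xs λ F → cong (_* h F i) (c-rotⁿ i E F))))
        (π₁-rotⁿ i E) (head-spread (rotⁿ i E) v)

    -- `c` need not be symmetric: exchanging the roles of two columns turns `c E F` into
    -- `c F (rot E)`. Doubling the columns into two sides provides the symmetric weights that `Walk`
    -- requires and records how a column is interlaced with its neighbours.
    Y : Set
    Y = X ⊎ X

    ys : List Y
    ys = map inj₁ xs ++ map inj₂ xs

    ∑-ys : ∀ φ → ∑ ys φ ≡ ∑ xs (λ E → φ (inj₁ E)) + ∑ xs (λ F → φ (inj₂ F))
    ∑-ys φ = trans (∑-++ (map inj₁ xs) _ φ) (cong₂ _+_ (∑-map inj₁ xs φ) (∑-map inj₂ xs φ))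

    c′ : Y → Y → ℕ
    c′ (inj₁ E) (inj₂ F) = c E F
    c′ (inj₂ F) (inj₁ E) = c E F
    c′ (inj₁ _) (inj₁ _) = 0
    c′ (inj₂ _) (inj₂ _) = 0

    c′-sym : ∀ x y → c′ x y ≡ c′ y x
    c′-sym (inj₁ _) (inj₁ _) = refl
    c′-sym (inj₁ _) (inj₂ _) = refl
    c′-sym (inj₂ _) (inj₁ _) = refl
    c′-sym (inj₂ _) (inj₂ _) = refl

    -- A bound for all degrees `π y`, so that its factorial is a common multiple of the nonzero
    -- ones.
    cmax : ℕ
    cmax = length xs * (T ^ m * T ^ m)

    π : Y → ℕ
    π y = π₁ (column y)

    ρ : Y → ℕ
    ρ y = share cmax (π y)

    L : ℕ
    L = cmax !

    norm : ∀ y → π y ≡ 0 ⊎ ρ y * π y ≡ L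
    norm y with π y in eq
    ... | zero  = inj₁ refl
    ... | suc p = inj₂ (share-* cmax (s≤s z≤n) (subst (_≤ cmax) eq
      (∑-≤ xs _ _ λ F → *-mono-≤ (along-≤ T τ≤T (column y) F) (along-≤ T τ≤T F (rot (column y))))))

    row≤ : ∀ y → ∑ ys (c′ y) ≤ π y
    row≤ (inj₁ E) = begin
      ∑ ys (c′ (inj₁ E))              ≡⟨ trans (∑-ys _) (cong (_+ ∑ xs (c E)) (∑-0 xs)) ⟩
      ∑ xs (c E)                      ≤⟨ ∑-mono xs (c≤cyc E) ⟩
      π₁ E                            ∎
      where open ≤-Reasoning
    row≤ (inj₂ F) = begin
      ∑ ys (c′ (inj₂ F))              ≡⟨ trans (∑-ys _) (trans (cong (_+_ (∑ xs (λ E → c E F))) (∑-0 xs)) (+-identityʳ _)) ⟩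
      (∑[ E ∈ xs ] c E F)             ≤⟨ ∑-mono xs (λ E → c≤cyc E F) ⟩
      (∑[ E ∈ xs ] cyc E F)           ≡⟨ π₁-left F ⟩
      π₁ F                            ∎
      where open ≤-Reasoning

    open Walk ys c′ c′-sym ρ π L row≤ norm

    ∑π : ∑ ys π ≡ 2 * total m
    ∑π = trans (∑-ys π) (cong (_+_ (total m)) (sym (+-identityʳ (total m))))

    dense′ : ∑ ys π ≤ 2 * (∑[ y ∈ ys ] ∑ ys (c′ y))
    dense′ = begin
      ∑ ys π                           ≡⟨ ∑π ⟩
      2 * total m                      ≤⟨ *-monoʳ-≤ 2 dense ⟩
      2 * (2 * C)                      ≡⟨ cong (2 *_) (cong (_+_ C) (trans (+-identityʳ C) (∑-swap xs xs c))) ⟩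
      2 * (C + (∑[ F ∈ xs ] ∑[ E ∈ xs ] c E F))
        ≡⟨ cong (2 *_) (trans (∑-ys _) (cong₂ _+_
             (∑-cong xs λ E → trans (∑-ys _) (cong (_+ ∑ xs (c E)) (∑-0 xs)))
             (∑-cong xs λ F → trans (∑-ys _) (trans (cong (_+_ (∑ xs (λ E → c E F))) (∑-0 xs)) (+-identityʳ _))))) ⟨
      2 * (∑[ y ∈ ys ] ∑ ys (c′ y))    ∎
      where
      open ≤-Reasoning
      C = ∑[ E ∈ xs ] ∑ xs (c E)

    c′-spread : ∀ x v → Z * (∑[ y ∈ ys ] c′ x y * through v (column y)) ≤ m * π x
    c′-spread (inj₁ E) v = ≤-trans (≤-reflexive (cong (Z *_)
      (trans (∑-ys _) (cong (_+ (∑[ F ∈ xs ] c E F * through v F)) (∑-0 xs))))) (column-spread E v)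
    c′-spread (inj₂ F) v = subst (λ t → Z * t ≤ m * π₁ F)
      (sym (trans (∑-ys _) (trans (cong (_+_ (∑[ E ∈ xs ] c E F * through v E)) (∑-0 xs)) (trans (+-identityʳ _)
        (trans (∑-cong xs λ E → cong₂ _*_ (sym (c-shift E F)) (sym (∑-toList-rot _ E))) (∑-rot ds m _)))))) (column-spread F v)

    R : ℕ → Y → List Y → ℕ
    R q x l = 𝟙 (any (meets x) (take q l))

    R≤ : ∀ q x l → R q x l ≤ ∑[ y ∈ take q l ] ∑[ v ∈ verts (column y) ] through v (column x)
    R≤ q x l = ≤-trans (∑-any (meets x) (take q l)) (∑-mono (take q l) λ y →
      ≤-trans (∑-any _ (verts (column y))) (∑-mono (verts (column y)) λ v → ∑-any (hits v) (toList (column x))))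

    -- A column that meets one of q others passes through one of their q (m + m) vertices. By
    -- `c′-spread` each of these accounts for at most a proportion m / Z of the degree.
    rare : ∀ q S → S * (q * ((m + m) * m)) ≤ Z → 0 < q → ∀ x l → S * (ρ x * (∑[ y ∈ ys ] c′ x y * R q y l)) ≤ L
    rare q S small 0<q x l = *-cancelʳ-≤ _ _ w {{>-nonZero 0<w}} (begin
      S * (ρ x * s) * w       ≡⟨ lem S (ρ x) s w ⟩
      ρ x * (S * w * s)       ≤⟨ *-monoʳ-≤ (ρ x) (≤-trans (*-monoˡ-≤ s small) Zs≤) ⟩
      ρ x * (w * π x)         ≡⟨ lem′ (ρ x) w (π x) ⟩
      ρ x * π x * w           ≤⟨ *-monoˡ-≤ w ρπ≤L ⟩
      L * w                   ∎)
      where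
      open ≤-Reasoning
      w = q * ((m + m) * m)
      0<w : 0 < w
      0<w = *-mono-≤ 0<q (*-mono-≤ {1} {m + m} {1} {m} (s≤s z≤n) (s≤s z≤n))
      s = ∑[ y ∈ ys ] c′ x y * R q y l
      lem : ∀ S r s w → S * (r * s) * w ≡ r * (S * w * s)
      lem = solve-∀
      lem′ : ∀ r w p → r * (w * p) ≡ r * p * w
      lem′ = solve-∀
      ρπ≤L : ρ x * π x ≤ L
      ρπ≤L with norm x
      ... | inj₂ eq = ≤-reflexive eq
      ... | inj₁ eq = subst (_≤ L) (sym (trans (cong (ρ x *_) eq) (*-zeroʳ (ρ x)))) z≤n
      Zs≤ : Z * s ≤ w * π x
      Zs≤ = begin
        Z * s
          ≤⟨ *-monoʳ-≤ Z (∑-mono ys λ y → *-monoʳ-≤ (c′ x y) (R≤ q y l)) ⟩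
        Z * (∑[ y ∈ ys ] c′ x y * (∑[ z ∈ take q l ] ∑[ v ∈ verts (column z) ] through v (column y)))
          ≡⟨ cong (Z *_) (trans (∑-cong ys λ y → trans (sym (∑-*ˡ (take q l) (c′ x y) _)) (∑-cong (take q l) λ z →
               sym (∑-*ˡ (verts (column z)) (c′ x y) _))) (trans (∑-swap ys (take q l) _) (∑-cong (take q l) λ z →
               ∑-swap ys (verts (column z)) _))) ⟩
        Z * (∑[ z ∈ take q l ] ∑[ v ∈ verts (column z) ] ∑[ y ∈ ys ] c′ x y * through v (column y))
          ≡⟨ trans (sym (∑-*ˡ (take q l) Z _)) (∑-cong (take q l) λ z → sym (∑-*ˡ (verts (column z)) Z _)) ⟩
        (∑[ z ∈ take q l ] ∑[ v ∈ verts (column z) ] Z * (∑[ y ∈ ys ] c′ x y * through v (column y)))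
          ≤⟨ ∑-≤ (take q l) _ ((m + m) * (m * π x)) (λ z → ≤-trans (∑-≤ (verts (column z)) _ (m * π x) (c′-spread x))
               (≤-reflexive (cong (_* (m * π x)) (length-verts (column z))))) ⟩
        length (take q l) * ((m + m) * (m * π x))
          ≤⟨ *-monoˡ-≤ _ (≤-trans (≤-reflexive (length-take q l)) (m⊓n≤m q (length l))) ⟩
        q * ((m + m) * (m * π x))
          ≡⟨ lem₂ q (m + m) m (π x) ⟩
        w * π x ∎
        where
        lem₂ : ∀ q k m p → q * (k * (m * p)) ≡ q * (k * m) * p
        lem₂ = solve-∀

    private
      closed-columns′ : ∀ p j A → j + suc j ≤ suc p → length ys ≤ A ^ (suc j + suc j) → 0 < A →
        (let ℓ = suc (suc p)) →
        2 * 2 * A * (2 * (ℓ + ℓ) * (2 * (ℓ + ℓ))) * (ℓ * ((m + m) * m)) ≤ Z →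
        ∃ λ (z : Vec Y (ℓ + ℓ)) → 0 < cw z ×
          (∀ i → i < ℓ + ℓ → any (meets (head (rotⁿ i z))) (take ℓ (take ℓ (toList (tail (rotⁿ i z))))) ≡ false)
      closed-columns′ p j A r≤ size 0<A small =
        let z , 0<cwz , clean-z = exists-clean (ℓ + ℓ) rare-sum (subst (0 <_) (sym (∑-cw (suc p))) (M>0 (suc p) r≤))
        in z , 0<cwz , λ i i< → subst (λ w → any (meets (head w)) (take ℓ (take ℓ (toList (tail w)))) ≡ false)
             (σⁿ≡rotⁿ i z) (clean⇒¬bad (ℓ + ℓ) z clean-z i i<)
        where
        ℓ = suc (suc p)
        -- 2 * 2 * A is κ² A for κ = 2. The square of 2 (ℓ + ℓ) makes a bad start so rare that the
        -- union over all ℓ + ℓ rotations still leaves half of the weight.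
        S = 2 * 2 * A * (2 * (ℓ + ℓ) * (2 * (ℓ + ℓ)))
        0<S : 0 < S
        0<S = *-mono-≤ {1} {2 * 2 * A} (*-mono-≤ {1} {2 * 2} (s≤s z≤n) 0<A) (s≤s z≤n)
        0<∑π : 0 < ∑ ys π
        0<∑π = subst (0 <_) (sym ∑π) (*-mono-≤ {1} {2} (s≤s z≤n) positive)
        open Dense 2 dense′ (!>0 cmax) 0<∑π A j size
        -- The inner `take` is the arc seen by `Rare`, the outer one the window of `R ℓ`; both have
        -- length ℓ.
        bad : Vec Y (ℓ + ℓ) → Bool
        bad w = any (meets (head w)) (take ℓ (take ℓ (toList (tail w))))
        cw-rot : ∀ z → cw (rot z) ≡ cw z
        cw-rot (x ∷ v) = sym (cw-∷ʳ x v)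
        open Union (vecs ys (ℓ + ℓ)) cw rot (∑-rot ys (ℓ + ℓ)) cw-rot bad
        σⁿ≡rotⁿ : ∀ i z → σⁿ i z ≡ rotⁿ i z
        σⁿ≡rotⁿ zero    z = refl
        σⁿ≡rotⁿ (suc i) z = σⁿ≡rotⁿ i (rot z)
        q = Rare.Q p (R ℓ) (λ x l → 𝟙≤1 _) S (λ x l → rare ℓ S small (s≤s z≤n) x (x ∷ l))
        rare-sum : 2 * ((ℓ + ℓ) * (∑[ z ∈ vecs ys (ℓ + ℓ) ] cw z * 𝟙 (bad z))) ≤ ∑ (vecs ys (ℓ + ℓ)) cw
        rare-sum = begin
          2 * ((ℓ + ℓ) * q)       ≡⟨ trans (sym (*-assoc 2 (ℓ + ℓ) q)) (*-comm (2 * (ℓ + ℓ)) q) ⟩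
          q * (2 * (ℓ + ℓ))       ≤⟨ rare-bound p (R ℓ) (λ x l → 𝟙≤1 _) S (λ x l → rare ℓ S small (s≤s z≤n) x (x ∷ l)) (2 * (ℓ + ℓ)) r≤ ≤-refl 0<S ⟩
          M (suc p)               ≡⟨ ∑-cw (suc p) ⟨
          ∑ (vecs ys (ℓ + ℓ)) cw  ∎
          where open ≤-Reasoning

    abstract
      closed-columns : ∀ p j A → j + suc j ≤ suc p → length ys ≤ A ^ (suc j + suc j) → 0 < A →
        (let ℓ = suc (suc p)) →
        2 * 2 * A * (2 * (ℓ + ℓ) * (2 * (ℓ + ℓ))) * (ℓ * ((m + m) * m)) ≤ Z →
        ∃ λ (z : Vec Y (ℓ + ℓ)) → 0 < cw z ×
          (∀ i → i < ℓ + ℓ → any (meets (head (rotⁿ i z))) (take ℓ (take ℓ (toList (tail (rotⁿ i z))))) ≡ false)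
      closed-columns = closed-columns′

    c-positive : ∀ {E F} → 0 < c E F → 0 < along E F × 0 < along F (rot E) × g E F ≡ true
    c-positive {E} {F} h with along E F | along F (rot E) | g E F
    ... | suc _ | suc _ | true  = s≤s z≤n , s≤s z≤n , refl
    ... | suc x | suc y | false = ⊥-elim (<-irrefl refl (subst (0 <_) (*-zeroʳ (suc x * suc y)) h))
    ... | suc x | zero  | t     = ⊥-elim (<-irrefl refl (subst (λ s → 0 < s * 𝟙 t) (*-zeroʳ x) h))
    ... | zero  | _     | _     = ⊥-elim (<-irrefl refl h)

    c′-positive : ∀ y y′ → 0 < c′ y y′ → Consecutive g y y′
    c′-positive (inj₁ E) (inj₂ F) = c-positive
    c′-positive (inj₂ F) (inj₁ E) = c-positive

    closed-steps : ∀ {r} (z : Vec Y (suc r)) → 0 < cw z →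
      (∀ {j} → j < r → Consecutive g (at z j) (at z (suc j))) × Consecutive g (at z r) (at z 0)
    closed-steps (x ∷ v) 0<cw = (λ j<r → c′-positive _ _ (proj₁ cs j<r)) , c′-positive _ _ (proj₂ cs)
      where
      cs = c>0 x v x (n≢0⇒n>0 λ eq → <-irrefl refl (subst (0 <_) (trans (cong (ρ x *_) eq) (*-zeroʳ (ρ x))) 0<cw))

-- The copy of H in a cyclic sequence of columns

pick : ∀ {A : Set} (f₀ f₁ f₂ f₃ : ℕ → A) → ℕ → A
pick f₀ f₁ f₂ f₃ 0 = f₀ 0
pick f₀ f₁ f₂ f₃ 1 = f₁ 0
pick f₀ f₁ f₂ f₃ 2 = f₂ 0
pick f₀ f₁ f₂ f₃ 3 = f₃ 0
pick f₀ f₁ f₂ f₃ (suc (suc (suc (suc r)))) =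
  pick (λ h → f₀ (suc h)) (λ h → f₁ (suc h)) (λ h → f₂ (suc h)) (λ h → f₃ (suc h)) r

module _ {A : Set} where
  pick₀ : ∀ (f₀ f₁ f₂ f₃ : ℕ → A) h → pick f₀ f₁ f₂ f₃ (h * 4) ≡ f₀ h
  pick₀ f₀ f₁ f₂ f₃ zero    = refl
  pick₀ f₀ f₁ f₂ f₃ (suc h) = pick₀ _ _ _ _ h
  pick₁ : ∀ (f₀ f₁ f₂ f₃ : ℕ → A) h → pick f₀ f₁ f₂ f₃ (1 + h * 4) ≡ f₁ h
  pick₁ f₀ f₁ f₂ f₃ zero    = refl
  pick₁ f₀ f₁ f₂ f₃ (suc h) = pick₁ _ _ _ _ h
  pick₂ : ∀ (f₀ f₁ f₂ f₃ : ℕ → A) h → pick f₀ f₁ f₂ f₃ (2 + h * 4) ≡ f₂ h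
  pick₂ f₀ f₁ f₂ f₃ zero    = refl
  pick₂ f₀ f₁ f₂ f₃ (suc h) = pick₂ _ _ _ _ h
  pick₃ : ∀ (f₀ f₁ f₂ f₃ : ℕ → A) h → pick f₀ f₁ f₂ f₃ (3 + h * 4) ≡ f₃ h
  pick₃ f₀ f₁ f₂ f₃ zero    = refl
  pick₃ f₀ f₁ f₂ f₃ (suc h) = pick₃ _ _ _ _ h

data Mod4 : ℕ → Set where
  mod0 : ∀ h → Mod4 (h * 4)
  mod1 : ∀ h → Mod4 (1 + h * 4)
  mod2 : ∀ h → Mod4 (2 + h * 4)
  mod3 : ∀ h → Mod4 (3 + h * 4)

mod4 : ∀ r → Mod4 r
mod4 0 = mod0 0
mod4 1 = mod1 0
mod4 2 = mod2 0
mod4 3 = mod3 0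
mod4 (suc (suc (suc (suc r)))) with mod4 r
... | mod0 h = mod0 (suc h)
... | mod1 h = mod1 (suc h)
... | mod2 h = mod2 (suc h)
... | mod3 h = mod3 (suc h)

h<k : ∀ e h k → e + h * 4 < k * 4 → h < k
h<k e h k lt = *-cancelʳ-< 4 h k (≤-<-trans (m≤n+m (h * 4) e) lt)

-- The rows 2i - 1, 2i of H (i ≥ 1) form the pair i - 1 = 2 h + β.  A column
-- E (interlaced as E₀ F₀ E₁ F₁ …) occupies the pairs with β = 0 in the order
-- E₀, E₁, … and those with β = 1 backwards from its end; a column F does so
-- with the roles of β exchanged.

module Embedding {n : ℕ} (G : Graph (Fin n)) {D : Set} (a b : D → Fin n) (k′ p : ℕ) where

  open Graph G

  k = suc k′
  m′ = k′ + suc k′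
  ℓ = suc (suc p)

  X : Set
  X = Vec D (suc m′)

  op : ℕ → ℕ
  op h = m′ ∸ h

  vertex : X → Bool × ℕ → Fin n
  vertex E (true  , i) = a (at E i)
  vertex E (false , i) = b (at E i)

  code₁ code₂ : ℕ → Bool × ℕ
  code₁ = pick (λ h → true , h) (λ h → false , h) (λ h → false , op h) (λ h → true , op h)
  code₂ = pick (λ h → false , op h) (λ h → true , op h) (λ h → true , h) (λ h → false , h)

  code₁-0 : ∀ h → code₁ (h * 4) ≡ (true , h)
  code₁-0 = pick₀ (λ h → true , h) (λ h → false , h) (λ h → false , op h) (λ h → true , op h)

  code₁-1 : ∀ h → code₁ (1 + h * 4) ≡ (false , h)
  code₁-1 = pick₁ (λ h → true , h) (λ h → false , h) (λ h → false , op h) (λ h → true , op h)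

  code₁-2 : ∀ h → code₁ (2 + h * 4) ≡ (false , op h)
  code₁-2 = pick₂ (λ h → true , h) (λ h → false , h) (λ h → false , op h) (λ h → true , op h)

  code₁-3 : ∀ h → code₁ (3 + h * 4) ≡ (true , op h)
  code₁-3 = pick₃ (λ h → true , h) (λ h → false , h) (λ h → false , op h) (λ h → true , op h)

  code₂-0 : ∀ h → code₂ (h * 4) ≡ (false , op h)
  code₂-0 = pick₀ (λ h → false , op h) (λ h → true , op h) (λ h → true , h) (λ h → false , h)

  code₂-1 : ∀ h → code₂ (1 + h * 4) ≡ (true , op h)
  code₂-1 = pick₁ (λ h → false , op h) (λ h → true , op h) (λ h → true , h) (λ h → false , h)

  code₂-2 : ∀ h → code₂ (2 + h * 4) ≡ (true , h)
  code₂-2 = pick₂ (λ h → false , op h) (λ h → true , op h) (λ h → true , h) (λ h → false , h)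

  code₂-3 : ∀ h → code₂ (3 + h * 4) ≡ (false , h)
  code₂-3 = pick₃ (λ h → false , op h) (λ h → true , op h) (λ h → true , h) (λ h → false , h)

  code : X ⊎ X → ℕ → Bool × ℕ
  code (inj₁ _) = code₁
  code (inj₂ _) = code₂

  strip : X ⊎ X → X
  strip (inj₁ E) = E
  strip (inj₂ F) = F

  entry : X ⊎ X → ℕ → Fin n
  entry y r = vertex (strip y) (code y r)

  -- The pairs of rows filled forwards use the indices below `k`, those filled from the end the
  -- indices from `k` on; comparing with `k` therefore inverts `code`.
  decode₁ decode₂ : Bool × ℕ → ℕ
  decode₁ (s , i) with i <? k
  ... | yes _ = if s then i * 4 else 1 + i * 4
  ... | no  _ = if s then 3 + op i * 4 else 2 + op i * 4
  decode₂ (s , i) with i <? k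
  ... | yes _ = if s then 2 + i * 4 else 3 + i * 4
  ... | no  _ = if s then 1 + op i * 4 else op i * 4

  m′<2k : ∀ {h} → h < k → h ≤ m′
  m′<2k (s≤s h≤k′) = ≤-trans h≤k′ (m≤m+n k′ _)

  op≥k : ∀ {h} → h < k → ¬ op h < k
  op≥k {h} (s≤s h≤k′) op<k = <⇒≱ op<k (subst (_≤ op h) (m+n∸m≡n k′ (suc k′)) (∸-monoʳ-≤ m′ h≤k′))

  op≤m′ : ∀ h → op h ≤ m′
  op≤m′ h = m∸n≤m m′ h

  op-op : ∀ {h} → h < k → op (op h) ≡ h
  op-op h<k = m∸[m∸n]≡n (m′<2k h<k)

  decode₁-low : ∀ s i → i < k → decode₁ (s , i) ≡ (if s then i * 4 else 1 + i * 4)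
  decode₁-low s i i<k with i <? k
  ... | yes _ = refl
  ... | no ¬p = ⊥-elim (¬p i<k)

  decode₁-high : ∀ s h → h < k → decode₁ (s , op h) ≡ (if s then 3 + h * 4 else 2 + h * 4)
  decode₁-high s h h<k with op h <? k
  ... | yes q = ⊥-elim (op≥k h<k q)
  ... | no _  = cong (λ t → if s then 3 + t * 4 else 2 + t * 4) (op-op h<k)

  decode₂-low : ∀ s i → i < k → decode₂ (s , i) ≡ (if s then 2 + i * 4 else 3 + i * 4)
  decode₂-low s i i<k with i <? k
  ... | yes _ = refl
  ... | no ¬p = ⊥-elim (¬p i<k)

  decode₂-high : ∀ s h → h < k → decode₂ (s , op h) ≡ (if s then 1 + h * 4 else h * 4)
  decode₂-high s h h<k with op h <? k
  ... | yes q = ⊥-elim (op≥k h<k q)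
  ... | no _  = cong (λ t → if s then 1 + t * 4 else t * 4) (op-op h<k)

  decode-code₁ : ∀ {r} → r < k * 4 → decode₁ (code₁ r) ≡ r
  decode-code₁ {r} r<4k with mod4 r
  ... | mod0 h = trans (cong decode₁ (code₁-0 h)) (decode₁-low true h (h<k 0 h k r<4k))
  ... | mod1 h = trans (cong decode₁ (code₁-1 h)) (decode₁-low false h (h<k 1 h k r<4k))
  ... | mod2 h = trans (cong decode₁ (code₁-2 h)) (decode₁-high false h (h<k 2 h k r<4k))
  ... | mod3 h = trans (cong decode₁ (code₁-3 h)) (decode₁-high true h (h<k 3 h k r<4k))

  decode-code₂ : ∀ {r} → r < k * 4 → decode₂ (code₂ r) ≡ r
  decode-code₂ {r} r<4k with mod4 r
  ... | mod0 h = trans (cong decode₂ (code₂-0 h)) (decode₂-high false h (h<k 0 h k r<4k))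
  ... | mod1 h = trans (cong decode₂ (code₂-1 h)) (decode₂-high true h (h<k 1 h k r<4k))
  ... | mod2 h = trans (cong decode₂ (code₂-2 h)) (decode₂-low true h (h<k 2 h k r<4k))
  ... | mod3 h = trans (cong decode₂ (code₂-3 h)) (decode₂-low false h (h<k 3 h k r<4k))

  code-injective : ∀ y {r r′} → r < k * 4 → r′ < k * 4 → code y r ≡ code y r′ → r ≡ r′
  code-injective (inj₁ _) r< r′< eq = trans (sym (decode-code₁ r<)) (trans (cong decode₁ eq) (decode-code₁ r′<))
  code-injective (inj₂ _) r< r′< eq = trans (sym (decode-code₂ r<)) (trans (cong decode₂ eq) (decode-code₂ r′<))

  code-≤ : ∀ y {r} → r < k * 4 → proj₂ (code y r) ≤ m′
  code-≤ (inj₁ _) {r} r<4k with mod4 r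
  ... | mod0 h = subst (λ c → proj₂ c ≤ m′) (sym (code₁-0 h)) (m′<2k {h} (h<k 0 h k r<4k))
  ... | mod1 h = subst (λ c → proj₂ c ≤ m′) (sym (code₁-1 h)) (m′<2k {h} (h<k 1 h k r<4k))
  ... | mod2 h = subst (λ c → proj₂ c ≤ m′) (sym (code₁-2 h)) (op≤m′ h)
  ... | mod3 h = subst (λ c → proj₂ c ≤ m′) (sym (code₁-3 h)) (op≤m′ h)
  code-≤ (inj₂ _) {r} r<4k with mod4 r
  ... | mod0 h = subst (λ c → proj₂ c ≤ m′) (sym (code₂-0 h)) (op≤m′ h)
  ... | mod1 h = subst (λ c → proj₂ c ≤ m′) (sym (code₂-1 h)) (op≤m′ h)
  ... | mod2 h = subst (λ c → proj₂ c ≤ m′) (sym (code₂-2 h)) (m′<2k {h} (h<k 2 h k r<4k))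
  ... | mod3 h = subst (λ c → proj₂ c ≤ m′) (sym (code₂-3 h)) (m′<2k {h} (h<k 3 h k r<4k))

  Distinct : X → Set
  Distinct E = ∀ c c′ → proj₂ c ≤ m′ → proj₂ c′ ≤ m′ → vertex E c ≡ vertex E c′ → c ≡ c′

  Disjoint : X → X → Set
  Disjoint E F = ∀ c c′ → proj₂ c ≤ m′ → proj₂ c′ ≤ m′ → vertex E c ≢ vertex F c′

  -- In H, two adjacent columns with their rungs and the edges between them form a single cycle of
  -- length 8 k: it zigzags from row 1 down to row 4 k, crosses over, and returns along the other
  -- zigzag. The fields are the edges of this cycle.
  record Interlaced (E F : X) : Set where
    field
      aE~bE : ∀ {j} → j ≤ m′ → a (at E j) ~ b (at E j)
      bE~aF : ∀ {j} → j ≤ m′ → b (at E j) ~ a (at F j)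
      aF~bF : ∀ {j} → j ≤ m′ → a (at F j) ~ b (at F j)
      bF~aE : ∀ {j} → suc j ≤ m′ → b (at F j) ~ a (at E (suc j))
      wrap  : b (at F m′) ~ a (at E 0)

  Linked : X ⊎ X → X ⊎ X → Set
  Linked (inj₁ E) (inj₂ F) = Interlaced E F
  Linked (inj₂ F) (inj₁ E) = Interlaced E F
  Linked (inj₁ _) (inj₁ _) = ⊥
  Linked (inj₂ _) (inj₂ _) = ⊥

  Linked-sym : ∀ y y′ → Linked y y′ → Linked y′ y
  Linked-sym (inj₁ _) (inj₂ _) h = h
  Linked-sym (inj₂ _) (inj₁ _) h = h

  open Interlaced

  private
    op-suc : ∀ {h} → suc h < k → op h ≡ suc (op (suc h))
    op-suc {h} 1+h<k = sym (trans (sym (+-∸-assoc 1 (m′<2k 1+h<k))) refl)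

    via : ∀ {c c′ d d′ : Bool × ℕ} E F → c ≡ d → c′ ≡ d′ → vertex E d ~ vertex F d′ → vertex E c ~ vertex F c′
    via E F refl refl e = e

  rung₀ : ∀ y y′ → Linked y y′ → ∀ h → h < k → entry y (h * 4) ~ entry y (1 + h * 4)
  rung₀ (inj₁ E) (inj₂ F) e h h<k = via E E (code₁-0 h) (code₁-1 h) (aE~bE e (m′<2k h<k))
  rung₀ (inj₂ F) (inj₁ E) e h h<k = via F F (code₂-0 h) (code₂-1 h) (~-sym (aF~bF e (op≤m′ h)))

  rung₂ : ∀ y y′ → Linked y y′ → ∀ h → h < k → entry y (2 + h * 4) ~ entry y (3 + h * 4)
  rung₂ (inj₁ E) (inj₂ F) e h h<k = via E E (code₁-2 h) (code₁-3 h) (~-sym (aE~bE e (op≤m′ h)))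
  rung₂ (inj₂ F) (inj₁ E) e h h<k = via F F (code₂-2 h) (code₂-3 h) (aF~bF e (m′<2k h<k))

  cross₁ : ∀ y y′ → Linked y y′ → ∀ h → h < k → entry y (1 + h * 4) ~ entry y′ (2 + h * 4)
  cross₁ (inj₁ E) (inj₂ F) e h h<k = via E F (code₁-1 h) (code₂-2 h) (bE~aF e (m′<2k h<k))
  cross₁ (inj₂ F) (inj₁ E) e h h<k = via F E (code₂-1 h) (code₁-2 h) (~-sym (bE~aF e (op≤m′ h)))

  cross₃ : ∀ y y′ → Linked y y′ → ∀ h → suc h < k → entry y (3 + h * 4) ~ entry y′ (suc h * 4)
  cross₃ (inj₁ E) (inj₂ F) e h 1+h<k = via E F (trans (code₁-3 h) (cong (true ,_) (op-suc 1+h<k))) (code₂-0 (suc h))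
    (~-sym (bF~aE e (subst (_≤ m′) (op-suc 1+h<k) (op≤m′ h))))
  cross₃ (inj₂ F) (inj₁ E) e h 1+h<k = via F E (code₂-3 h) (code₁-0 (suc h)) (bF~aE e (m′<2k 1+h<k))

  first~ : ∀ y y′ → Linked y y′ → entry y 0 ~ entry y′ 0
  first~ (inj₁ E) (inj₂ F) e = ~-sym (wrap e)
  first~ (inj₂ F) (inj₁ E) e = wrap e

  -- The lower turning point of the zigzag: the last row carries the index `op k′` = k′ + 1 in E and
  -- k′ in F, and the closed walk goes from entry k′ of F to entry k′ + 1 of E. The upper turning
  -- point is `wrap`.
  last~ : ∀ y y′ → Linked y y′ → entry y (3 + k′ * 4) ~ entry y′ (3 + k′ * 4)
  last~ (inj₁ E) (inj₂ F) e = via E F (trans (code₁-3 k′) (cong (true ,_) (m+n∸m≡n k′ (suc k′)))) (code₂-3 k′)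
    (~-sym (bF~aE e (m≤n+m (suc k′) k′)))
  last~ (inj₂ F) (inj₁ E) e = via F E (code₂-3 k′) (trans (code₁-3 k′) (cong (true ,_) (m+n∸m≡n k′ (suc k′))))
    (bF~aE e (m≤n+m (suc k′) k′))

  data Half : ℕ → Set where
    even : ∀ h → Half (h * 2)
    odd  : ∀ h → Half (1 + h * 2)

  half : ∀ t → Half t
  half 0 = even 0
  half 1 = odd 0
  half (suc (suc t)) with half t
  ... | even h = even (suc h)
  ... | odd h  = odd (suc h)

  module _ (y : ℕ → X ⊎ X)
    (linked : ∀ {j j′} → (suc j ≡ j′ × j′ < 2 * ℓ) ⊎ (suc j ≡ 2 * ℓ × j′ ≡ 0) → Linked (y j) (y j′))
    (distinct : ∀ {j} → j < 2 * ℓ → Distinct (strip (y j)))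
    (disjoint : ∀ {j j′} → j < j′ → j′ < 2 * ℓ → Disjoint (strip (y j)) (strip (y j′))) where

    φ : V k ℓ → Fin n
    φ (i , j) = entry (y (toℕ j)) (toℕ i)

    private
      i< : ∀ (v : V k ℓ) → toℕ (proj₁ v) < k * 4
      i< (i , j) = subst (toℕ i <_) (*-comm 4 k) (toℕ<n i)

    φ-injective : ∀ {u v} → φ u ≡ φ v → u ≡ v
    φ-injective {u@(i , j)} {v@(i′ , j′)} eq with <-cmp (toℕ j) (toℕ j′)
    ... | tri< j<j′ _ _ = ⊥-elim (disjoint j<j′ (toℕ<n j′) (code (y (toℕ j)) (toℕ i)) (code (y (toℕ j′)) (toℕ i′)) (code-≤ (y (toℕ j)) (i< u)) (code-≤ (y (toℕ j′)) (i< v)) eq)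
    ... | tri> _ _ j>j′ = ⊥-elim (disjoint j>j′ (toℕ<n j) (code (y (toℕ j′)) (toℕ i′)) (code (y (toℕ j)) (toℕ i)) (code-≤ (y (toℕ j′)) (i< v)) (code-≤ (y (toℕ j)) (i< u)) (sym eq))
    ... | tri≈ _ j≡j′ _ with refl ← toℕ-injective j≡j′ =
      cong (_, j) (toℕ-injective (code-injective (y (toℕ j)) (i< u) (i< v)
        (distinct (toℕ<n j) _ _ (code-≤ (y (toℕ j)) (i< u)) (code-≤ (y (toℕ j)) (i< v)) eq)))

    next : ∀ u v → NextCol k ℓ u v → Linked (y (toℕ (proj₂ u))) (y (toℕ (proj₂ v)))
    next u v (inj₁ eq)       = linked (inj₁ (sym (suc-injective eq) , toℕ<n (proj₂ v)))
    next u v (inj₂ (eq , e)) = linked (inj₂ (eq , suc-injective e))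

    -- every column has a successor, which supplies its rungs
    linked-next : ∀ {j} → j < 2 * ℓ → ∃ λ j′ → Linked (y j) (y j′)
    linked-next {j} j<2ℓ with m≤n⇒m<n∨m≡n j<2ℓ
    ... | inj₁ lt = suc j , linked (inj₁ (refl , lt))
    ... | inj₂ eq = 0 , linked (inj₂ (eq , refl))

    private
      2*-even : ∀ h → 2 * (h * 2) ≡ h * 4
      2*-even = solve-∀
      2*-odd : ∀ h → 2 * (1 + h * 2) ≡ 2 + h * 4
      2*-odd = solve-∀
      h<k₀ : ∀ h → h * 2 < 2 * k → h < k
      h<k₀ h lt = *-cancelʳ-< 2 _ _ (subst (h * 2 <_) (*-comm 2 k) lt)

    rung-edge : ∀ t → t < 2 * k → ∀ {j r r′} → j < 2 * ℓ → r ≡ 2 * t → r′ ≡ 1 + 2 * t → entry (y j) r ~ entry (y j) r′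
    rung-edge t t<2k {j} j<2ℓ refl refl with half t | linked-next j<2ℓ
    ... | even h | j′ , e rewrite 2*-even h = rung₀ (y j) (y j′) e h (h<k₀ h t<2k)
    ... | odd h  | j′ , e rewrite 2*-odd h  = rung₂ (y j) (y j′) e h (h<k₀ h (<-trans (n<1+n _) t<2k))

    cross-edge : ∀ y y′ → Linked y y′ → ∀ t → suc t < 2 * k → ∀ {r r′} → r ≡ 1 + 2 * t → r′ ≡ 2 + 2 * t → entry y r ~ entry y′ r′
    cross-edge y y′ e t 1+t<2k refl refl with half t
    ... | even h rewrite 2*-even h = cross₁ y y′ e h (h<k₀ h (<-trans (n<1+n _) 1+t<2k))
    ... | odd h  rewrite 2*-odd h  = cross₃ y y′ e h (h<k₀ (suc h) 1+t<2k)

    private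
      2*suc : ∀ t → 2 * suc t ≡ 2 + 2 * t
      2*suc = solve-∀
      last-row : ∀ {r} → suc r ≡ 4 * k → r ≡ 3 + k′ * 4
      last-row eq = suc-injective (trans eq (*-comm 4 k))
      i≤2k∸1 : ∀ {t} → suc t ≤ 2 * k ∸ 1 → suc t < 2 * k
      i≤2k∸1 le = s≤s le

    listed : ∀ u v → ListedEdge k ℓ u v → φ u ~ φ v
    listed u@(i , j) v@(i′ , j′) (rung (suc t , _ , t<2k , r≡ , r≡′) c≡) =
      subst (λ c → entry (y (toℕ j)) (toℕ i) ~ entry (y c) (toℕ i′)) (suc-injective c≡)
        (rung-edge t t<2k (toℕ<n j)
          (suc-injective (trans r≡ (cong (_∸ 1) (2*suc t))))
          (suc-injective (trans r≡′ (2*suc t))))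
    listed u@(i , j) v@(i′ , j′) (first r≡ r≡′ c) =
      subst₂ (λ r r′ → entry (y (toℕ j)) r ~ entry (y (toℕ j′)) r′) (sym (suc-injective r≡)) (sym (suc-injective r≡′))
        (first~ _ _ (next u v c))
    listed u@(i , j) v@(i′ , j′) (last r≡ r≡′ c) =
      subst₂ (λ r r′ → entry (y (toℕ j)) r ~ entry (y (toℕ j′)) r′) (sym (last-row r≡)) (sym (last-row r≡′))
        (last~ _ _ (next u v c))
    listed u v (cross (suc t , _ , t< , r≡ , r≡′) c) =
      cross-edge _ _ (next u v c) t (i≤2k∸1 t<)
        (suc-injective (trans r≡ (2*suc t)))
        (suc-injective (trans r≡′ (trans (+-comm _ 1) (cong suc (2*suc t)))))
    listed u v (cross′ (suc t , _ , t< , r≡ , r≡′) c) =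
      ~-sym (cross-edge _ _ (Linked-sym _ _ (next u v c)) t (i≤2k∸1 t<)
        (suc-injective (trans r≡′ (2*suc t)))
        (suc-injective (trans r≡ (trans (+-comm _ 1) (cong suc (2*suc t))))))

    contains : Contains G (H k ℓ)
    contains = φ , φ-injective , λ { {u} {v} (inj₁ e) → listed u v e ; {u} {v} (inj₂ e) → ~-sym (listed v u e) }

  module _ (z : Vec (X ⊎ X) (ℓ + ℓ)) (_⇢_ : X ⊎ X → X ⊎ X → Set)
    (⇢-linked : ∀ y y′ → y ⇢ y′ → Linked y y′)
    (⇢-distinct : ∀ y y′ → y ⇢ y′ → Distinct (strip y))
    (steps : ∀ {j} → j < suc p + ℓ → at z j ⇢ at z (suc j))
    (closing : at z (suc p + ℓ) ⇢ at z 0)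
    (apart : ∀ i d → i < ℓ + ℓ → d < ℓ → Disjoint (strip (head (rotⁿ i z))) (strip (at (rotⁿ i z) (suc d)))) where

    private
      2ℓ = ℓ + ℓ

      2*ℓ : 2 * ℓ ≡ 2ℓ
      2*ℓ = cong (_+_ ℓ) (+-identityʳ ℓ)

      step : ∀ {j j′} → (suc j ≡ j′ × j′ < 2 * ℓ) ⊎ (suc j ≡ 2 * ℓ × j′ ≡ 0) → at z j ⇢ at z j′
      step {j} (inj₁ (refl , lt)) = steps {j} (≤-pred (subst (suc j <_) 2*ℓ lt))
      step {j} (inj₂ (eq , refl)) = subst (λ i → at z i ⇢ at z 0) (sym (suc-injective (trans eq 2*ℓ))) closing

      distinct : ∀ {j} → j < 2 * ℓ → Distinct (strip (at z j))
      distinct {j} j<2ℓ with m≤n⇒m<n∨m≡n j<2ℓ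
      ... | inj₁ lt = ⇢-distinct (at z j) (at z (suc j)) (step (inj₁ (refl , lt)))
      ... | inj₂ eq = ⇢-distinct (at z j) (at z 0) (step (inj₂ (eq , refl)))

      disjoint : ∀ {j j′} → j < j′ → j′ < 2 * ℓ → Disjoint (strip (at z j)) (strip (at z j′))
      disjoint {j′ = j′} j<j′ j′<2*ℓ = cyclic-pairs refl z (λ y y′ → Disjoint (strip y) (strip y′))
        (λ D c c′ i≤ i′≤ eq → D c′ c i′≤ i≤ (sym eq)) apart j<j′ (subst (j′ <_) 2*ℓ j′<2*ℓ)

    contains-closed : Contains G (H k ℓ)
    contains-closed = contains (at z) (λ h → ⇢-linked _ _ (step h)) distinct disjoint

-- From spread columns to a copy of H

any-∈ : ∀ {A : Set} (q : A → Bool) {l x} → x ∈ l → q x ≡ true → any q l ≡ true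
any-∈ q (here refl) qx rewrite qx = refl
any-∈ q {l = y ∷ l} (there x∈) qx with q y
... | true  = refl
... | false = any-∈ q x∈ qx

at-∈ : ∀ {A : Set} {r} (v : Vec A (suc r)) {j} → j ≤ r → at v j ∈ toList v
at-∈ (x ∷ v)     {zero}  _         = here refl
at-∈ (x ∷ y ∷ v) {suc j} (s≤s j≤r) = there (at-∈ (y ∷ v) j≤r)

any-take : ∀ {A : Set} (q : A → Bool) ℓ {r} (x : A) (v : Vec A r) d → d < ℓ → d < r →
  any q (take ℓ (take ℓ (toList v))) ≡ false → q (at (x ∷ v) (suc d)) ≡ false
any-take q (suc ℓ) x (y ∷ v) zero    _         _         h with q y
... | false = refl
any-take q (suc ℓ) x (y ∷ v) (suc d) (s≤s d<ℓ) (s≤s d<r) h with q y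
... | false = any-take q ℓ y v d d<ℓ d<r h

false≢true : false ≢ true
false≢true ()

module Columns⇒H {n : ℕ} (G : Graph (Fin n)) {D : Set} (a b : D → Fin n)
  (τ : D → D → ℕ) (ds : List D) (T : ℕ) (τ≤T : ∀ e f → τ e f ≤ T) (N : D → D → D → Bool)
  (adjacent : ∀ e f → 0 < τ e f → Graph._~_ G (a e) (b e) × Graph._~_ G (b e) (a f)) (k′ p : ℕ) where

  open Graph G

  open ColumnGraph ds a b τ T τ≤T N
  module Emb = Embedding G a b k′ p
  open Emb hiding (k)

  interlaced : ∀ {E F : Vec D (suc m′)} → 0 < along E F → 0 < along F (rot E) → Interlaced E F
  interlaced {E} {F} h h′ = record
    { aE~bE = λ j≤m′ → proj₁ (EF j≤m′)
    ; bE~aF = λ j≤m′ → proj₂ (EF j≤m′)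
    ; aF~bF = λ j≤m′ → proj₁ (FE j≤m′)
    ; bF~aE = λ {j} j<m′ → subst (λ e → b (at F j) ~ a e) (at-rot E j<m′) (proj₂ (FE (<⇒≤ j<m′)))
    ; wrap  = subst (λ e → b (at F m′) ~ a e) (at-rot-last E) (proj₂ (FE ≤-refl))
    }
    where
    EF : ∀ {j} → j ≤ m′ → a (at E j) ~ b (at E j) × b (at E j) ~ a (at F j)
    EF {j} j≤m′ = adjacent (at E j) (at F j) (along>0 E F h j≤m′)
    FE : ∀ {j} → j ≤ m′ → a (at F j) ~ b (at F j) × b (at F j) ~ a (at (rot E) j)
    FE {j} j≤m′ = adjacent (at F j) (at (rot E) j) (along>0 F (rot E) h′ j≤m′)

  ¬meets⇒disjoint : ∀ x y → meets x y ≡ false → Disjoint (strip x) (strip y)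
  ¬meets⇒disjoint x y ¬meet c@(s , i) c′@(s′ , i′) i≤ i′≤ eq =
    false≢true (trans (sym ¬meet) (any-∈ _ (subst (λ E → vertex E c′ ∈ verts (column y)) (col≡strip y) (∈verts s′))
      (any-∈ (hits (vertex (strip y) c′)) (at-∈ (column x) i≤) (hit s (trans (cong (λ E → vertex E c) (col≡strip x)) eq)))))
    where
    col≡strip : ∀ y → column y ≡ strip y
    col≡strip (inj₁ _) = refl
    col≡strip (inj₂ _) = refl
    ∈verts : ∀ s′ → vertex (column y) (s′ , i′) ∈ verts (column y)
    ∈verts true  = ∈-++⁺ˡ (∈-map⁺ a (at-∈ (column y) i′≤))
    ∈verts false = ∈-++⁺ʳ (map a (toList (column y))) (∈-map⁺ b (at-∈ (column y) i′≤))
    hit : ∀ s {v} → vertex (column x) (s , i) ≡ v → hits v (at (column x) i) ≡ true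
    hit true  {v} eq = cong (_∨ does (b (at (column x) i) Finₚ.≟ v)) (dec-true (_ Finₚ.≟ v) eq)
    hit false {v} eq = trans (cong (does (a (at (column x) i) Finₚ.≟ v) ∨_) (dec-true (_ Finₚ.≟ v) eq)) (Boolₚ.∨-zeroʳ _)

  module _ (Z : ℕ)
    (spread : ∀ e e′ v → Z * (∑[ f ∈ ds ] τ e f * τ f e′ * 𝟙 (N e f e′ ∧ hits v f)) ≤ (∑[ f ∈ ds ] τ e f * τ f e′))
    (g : Vec D (suc m′) → Vec D (suc m′) → Bool)
    (g-shift : ∀ E F → g F (rot E) ≡ g E F)
    (g-N : ∀ E F → g E F ≡ true → N (head E) (head F) (head (rot E)) ≡ true)
    (dense : total (suc m′) ≤ 2 * (∑[ E ∈ vecs ds (suc m′) ] ∑[ F ∈ vecs ds (suc m′) ] cyc E F * 𝟙 (g E F)))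
    (positive : 0 < total (suc m′))
    (g-distinct : ∀ E F → g E F ≡ true → Distinct E) where

    private
      module S = Spread Z spread k′ g g-shift g-N dense positive

    contains-H : ∀ j A → j + suc j ≤ suc p → length S.ys ≤ A ^ (suc j + suc j) → 0 < A →
      2 * 2 * A * (2 * (ℓ + ℓ) * (2 * (ℓ + ℓ))) * (ℓ * ((suc m′ + suc m′) * suc m′)) ≤ Z →
      Contains G (H (suc k′) ℓ)
    contains-H j A r≤ size 0<A small = contains-closed (proj₁ found) (Consecutive g) linked distinct
        (proj₁ steps) (proj₂ steps)
        (λ i d i<2ℓ d<ℓ → apart (rotⁿ i (proj₁ found)) d d<ℓ (proj₂ (proj₂ found) i i<2ℓ))
      where
      found = S.closed-columns p j A r≤ size 0<A small
      steps = S.closed-steps (proj₁ found) (proj₁ (proj₂ found))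
      linked : ∀ y y′ → Consecutive g y y′ → Linked y y′
      linked (inj₁ E) (inj₂ F) (h , h′ , _) = interlaced h h′
      linked (inj₂ F) (inj₁ E) (h , h′ , _) = interlaced h h′
      distinct : ∀ y y′ → Consecutive g y y′ → Distinct (strip y)
      distinct (inj₁ E) (inj₂ F) (_ , _ , h) = g-distinct E F h
      distinct (inj₂ F) (inj₁ E) (_ , _ , h) = g-distinct F (rot E) (trans (g-shift E F) h)
      apart : ∀ (w : Vec (X ⊎ X) (ℓ + ℓ)) d → d < ℓ → any (meets (head w)) (take ℓ (take ℓ (toList (tail w)))) ≡ false →
        Disjoint (strip (head w)) (strip (at w (suc d)))
      apart (w ∷ ws) d d<ℓ h = ¬meets⇒disjoint w (at (w ∷ ws) (suc d)) (any-take (meets w) ℓ w ws d d<ℓ (≤-trans d<ℓ (m≤n+m ℓ (suc p))) h)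

-- The closed walk E₀ F₀ E₁ F₁ … of edges, spelled out as a sequence of vertices

module Flat {O : Set} (os : List O) where

  D : Set
  D = O × O

  ds : List D
  ds = cartesianProduct os os

  flat : ∀ {m} → Vec D m → Vec D m → Vec O (m * 4)
  flat []            []            = []
  flat ((a , b) ∷ E) ((c , d) ∷ F) = a ∷ b ∷ c ∷ d ∷ flat E F

  ∑-flat : ∀ m (φ : Vec O (m * 4) → ℕ) →
    (∑[ E ∈ vecs ds m ] ∑[ F ∈ vecs ds m ] φ (flat E F)) ≡ ∑ (vecs os (m * 4)) φ
  ∑-flat zero    φ = +-identityʳ _
  ∑-flat (suc m) φ = begin
    (∑[ E ∈ vecs ds (suc m) ] ∑[ F ∈ vecs ds (suc m) ] φ (flat E F))
      ≡⟨ trans (∑-vecs ds m _) (∑-cong ds λ e → ∑-cong (vecs ds m) λ E → ∑-vecs ds m _) ⟩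
    (∑[ e ∈ ds ] ∑[ E ∈ vecs ds m ] ∑[ f ∈ ds ] ∑[ F ∈ vecs ds m ] φ (flat (e ∷ E) (f ∷ F)))
      ≡⟨ ∑-cong ds (λ e → ∑-swap (vecs ds m) ds _) ⟩
    (∑[ e ∈ ds ] ∑[ f ∈ ds ] ∑[ E ∈ vecs ds m ] ∑[ F ∈ vecs ds m ] φ (flat (e ∷ E) (f ∷ F)))
      ≡⟨ ∑-cong ds (λ e → ∑-cong ds λ f → ∑-flat m (λ v → φ (proj₁ e ∷ proj₂ e ∷ proj₁ f ∷ proj₂ f ∷ v))) ⟩
    (∑[ e ∈ ds ] ∑[ f ∈ ds ] ∑[ v ∈ vecs os (m * 4) ] φ (proj₁ e ∷ proj₂ e ∷ proj₁ f ∷ proj₂ f ∷ v))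
      ≡⟨ trans (∑∑-product os os _) (∑-cong os λ a → ∑-cong os λ b → ∑∑-product os os _) ⟩
    (∑[ a ∈ os ] ∑[ b ∈ os ] ∑[ c ∈ os ] ∑[ d ∈ os ] ∑[ v ∈ vecs os (m * 4) ] φ (a ∷ b ∷ c ∷ d ∷ v))
      ≡⟨ trans (∑-vecs os (3 + m * 4) _) (∑-cong os λ a → trans (∑-vecs os (2 + m * 4) _) (∑-cong os λ b →
           trans (∑-vecs os (1 + m * 4) _) (∑-cong os λ c → ∑-vecs os (m * 4) _))) ⟨
    ∑ (vecs os (suc m * 4)) φ ∎
    where open ≡-Reasoning

  private
    flat-shift-∷ : ∀ {m} (E F : Vec D m) e c d → flat ((c , d) ∷ F) (E Vec.∷ʳ e) ≡ (c ∷ d ∷ flat E F) Vec.∷ʳ proj₁ e Vec.∷ʳ proj₂ e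
    flat-shift-∷ []            []              e c d = refl
    flat-shift-∷ ((a′ , b′) ∷ E) ((c′ , d′) ∷ F) e c d = cong (λ v → c ∷ d ∷ a′ ∷ b′ ∷ v) (flat-shift-∷ E F e c′ d′)

  flat-shift : ∀ {m} (E F : Vec D m) → flat F (rot E) ≡ rot (rot (flat E F))
  flat-shift []      []            = refl
  flat-shift (e ∷ E) ((c , d) ∷ F) = flat-shift-∷ E F e c d

  at-flat₀ : ∀ {m} (E F : Vec D (suc m)) {j} → j ≤ m → at (flat E F) (j * 4) ≡ proj₁ (at E j)
  at-flat₀ (_ ∷ _)      (_ ∷ _)      {zero}  _         = refl
  at-flat₀ (_ ∷ e ∷ E) (_ ∷ f ∷ F) {suc j} (s≤s j≤m) = at-flat₀ (e ∷ E) (f ∷ F) j≤m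

  at-flat₁ : ∀ {m} (E F : Vec D (suc m)) {j} → j ≤ m → at (flat E F) (1 + j * 4) ≡ proj₂ (at E j)
  at-flat₁ (_ ∷ _)      (_ ∷ _)      {zero}  _         = refl
  at-flat₁ (_ ∷ e ∷ E) (_ ∷ f ∷ F) {suc j} (s≤s j≤m) = at-flat₁ (e ∷ E) (f ∷ F) j≤m

-- A finite graph whose vertices O lie over those of G; distinct elements of O
-- may lie over the same vertex, but no two neighbours of an element do.

record Cover {n : ℕ} (G : Graph (Fin n)) : Set₁ where
  open Graph G
  field
    O      : Set
    os     : List O
    und    : O → Fin n
    adj    : O → O → Bool
    adj-sym : ∀ x y → adj x y ≡ adj y x
    adj⇒~  : ∀ {x y} → adj x y ≡ true → und x ~ und y
    simple : ∀ x v → (∑[ y ∈ os ] 𝟙 (adj x y) * 𝟙 (does (und y Finₚ.≟ v))) ≤ 1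
    Δ      : ℕ
    degree≤Δ : ∀ x → (∑[ y ∈ os ] 𝟙 (adj x y)) ≤ Δ

  codegree : O → O → ℕ
  codegree u w = ∑[ x ∈ os ] 𝟙 (adj u x) * 𝟙 (adj x w)

𝟙>0 : ∀ {b} → 0 < 𝟙 b → b ≡ true
𝟙>0 {true} _ = refl

*>0ˡ : ∀ a b → 0 < a * b → 0 < a
*>0ˡ (suc a) b _ = s≤s z≤n

*>0ʳ : ∀ a b → 0 < a * b → 0 < b
*>0ʳ a b h = *>0ˡ b a (subst (0 <_) (*-comm a b) h)

∧-true : ∀ {a b} → a ∧ b ≡ true → a ≡ true × b ≡ true
∧-true {true} {true} _ = refl , refl

∨-false : ∀ {a b} → a ∨ b ≡ false → a ≡ false × b ≡ false
∨-false {false} {false} _ = refl , refl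

𝟙-<? : ∀ a b → a * 𝟙 (does (a <? b)) ≤ b
𝟙-<? a b with does (a <? b) in eq
... | true  = ≤-trans (≤-reflexive (*-identityʳ a)) (<⇒≤ (<ᵇ⇒< a b (subst Bool.T (sym eq) _)))
... | false = ≤-trans (≤-reflexive (*-zeroʳ a)) z≤n

<?-false : ∀ a b → does (a <? b) ≡ false → b ≤ a
<?-false a b eq = ≮⇒≥ λ lt → subst Bool.T eq (<⇒<ᵇ lt)

≤?-false : ∀ a b → does (a ≤? b) ≡ false → b < a
≤?-false a b eq = ≰⇒> λ le → subst Bool.T eq (≤⇒≤ᵇ le)

≤?-true : ∀ a b → does (a ≤? b) ≡ true → a ≤ b
≤?-true a b eq = ≤ᵇ⇒≤ a b (subst Bool.T (sym eq) _)

-- Few heavy pairs: columns from closed walks in G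

module RegularCase {n : ℕ} (G : Graph (Fin n)) (C : Cover G) (k′ : ℕ) (t S Z : ℕ) where

  open Cover C
  open Graph G using (_~_)
  open Flat os

  private
    m′ = k′ + suc k′
    m  = suc m′
    p₁ = m′ + m′
    ℓ₁ = suc (suc p₁)

  heavy : O → O → Bool
  heavy u w = does (t ≤? codegree u w)

  #heavy : O → O → ℕ
  #heavy x w = ∑[ u ∈ os ] 𝟙 (adj x u) * 𝟙 (heavy u w)

  -- Once the bad edges are gone, for every remaining edge x w only few neighbours u of x form a
  -- heavy pair with w. This is the form of rareness that `Rare` asks for: one step back from x,
  -- with the rest of the walk fixed.
  bad-edge : O → O → Bool
  bad-edge x w = does (Δ <? 2 * S * #heavy x w)

  adj′ : O → O → Bool
  adj′ x w = adj x w ∧ not (bad-edge x w ∨ bad-edge w x)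

  adj′-sym : ∀ x w → adj′ x w ≡ adj′ w x
  adj′-sym x w = cong₂ (λ s t → s ∧ not t) (adj-sym x w) (∨-comm (bad-edge x w) (bad-edge w x))
    where
    ∨-comm : ∀ a b → a ∨ b ≡ b ∨ a
    ∨-comm true  true  = refl
    ∨-comm true  false = refl
    ∨-comm false true  = refl
    ∨-comm false false = refl

  adj′≤adj : ∀ x w → 𝟙 (adj′ x w) ≤ 𝟙 (adj x w)
  adj′≤adj x w = subst (_≤ 𝟙 (adj x w)) (sym (𝟙-∧ (adj x w) _)) (≤-trans (*-monoʳ-≤ (𝟙 (adj x w)) (𝟙≤1 _)) (≤-reflexive (*-identityʳ _)))

  c : O → O → ℕ
  c x y = 𝟙 (adj′ x y)

  edges : ℕ
  edges = ∑[ x ∈ os ] ∑[ w ∈ os ] 𝟙 (adj x w)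

  #heavy₂ : ℕ
  #heavy₂ = ∑[ x ∈ os ] ∑[ w ∈ os ] 𝟙 (adj x w) * #heavy x w

  module _ (few : 8 * S * #heavy₂ ≤ Δ * edges) (0<Δ : 0 < Δ) where

    private
      bads : ℕ
      bads = ∑[ x ∈ os ] ∑[ w ∈ os ] 𝟙 (adj x w) * 𝟙 (bad-edge x w)

      4bads≤ : 4 * bads ≤ edges
      4bads≤ = *-cancelˡ-≤ Δ {{>-nonZero 0<Δ}} (begin
        Δ * (4 * bads)
          ≡⟨ lem Δ bads ⟩
        4 * (Δ * bads)
          ≡⟨ cong (4 *_) (trans (sym (∑-*ˡ os Δ _)) (∑-cong os λ x → sym (∑-*ˡ os Δ _))) ⟩
        4 * (∑[ x ∈ os ] ∑[ w ∈ os ] Δ * (𝟙 (adj x w) * 𝟙 (bad-edge x w)))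
          ≤⟨ *-monoʳ-≤ 4 (∑-mono os λ x → ∑-mono os λ w → each x w) ⟩
        4 * (∑[ x ∈ os ] ∑[ w ∈ os ] 2 * S * (𝟙 (adj x w) * #heavy x w))
          ≡⟨ cong (4 *_) (trans (∑-cong os λ x → ∑-*ˡ os (2 * S) _) (∑-*ˡ os (2 * S) _)) ⟩
        4 * (2 * S * #heavy₂)
          ≡⟨ lem′ S #heavy₂ ⟩
        8 * S * #heavy₂
          ≤⟨ few ⟩
        Δ * edges ∎)
        where
        open ≤-Reasoning
        lem : ∀ a b → a * (4 * b) ≡ 4 * (a * b)
        lem = solve-∀
        lem′ : ∀ a b → 4 * (2 * a * b) ≡ 8 * a * b
        lem′ = solve-∀
        each : ∀ x w → Δ * (𝟙 (adj x w) * 𝟙 (bad-edge x w)) ≤ 2 * S * (𝟙 (adj x w) * #heavy x w)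
        each x w = begin
          Δ * (𝟙 (adj x w) * 𝟙 (bad-edge x w))  ≡⟨ x∙yz≈y∙xz Δ (𝟙 (adj x w)) _ ⟩
          𝟙 (adj x w) * (Δ * 𝟙 (bad-edge x w))  ≤⟨ *-monoʳ-≤ (𝟙 (adj x w)) (𝟙-<? Δ _) ⟩
          𝟙 (adj x w) * (2 * S * #heavy x w)    ≡⟨ x∙yz≈y∙xz (𝟙 (adj x w)) (2 * S) _ ⟩
          2 * S * (𝟙 (adj x w) * #heavy x w)    ∎

    -- Markov's inequality: in either orientation at most a quarter of the edges is bad, so at least
    -- half of them survive.
    edges≤ : edges ≤ 2 * (∑[ x ∈ os ] ∑ os (c x))
    edges≤ = +-cancelʳ-≤ edges edges (2 * C′) (begin
      edges + edges                       ≤⟨ +-mono-≤ split split ⟩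
      (C′ + (bads + bads)) + (C′ + (bads + bads)) ≡⟨ lem C′ bads ⟩
      2 * C′ + 4 * bads                   ≤⟨ +-monoʳ-≤ (2 * C′) 4bads≤ ⟩
      2 * C′ + edges                      ∎)
      where
      open ≤-Reasoning
      C′ = ∑[ x ∈ os ] ∑ os (c x)
      lem : ∀ a b → (a + (b + b)) + (a + (b + b)) ≡ 2 * a + 4 * b
      lem = solve-∀
      pt : ∀ a b b′ → 𝟙 a ≤ 𝟙 (a ∧ not (b ∨ b′)) + (𝟙 a * 𝟙 b + 𝟙 a * 𝟙 b′)
      pt false _     _     = z≤n
      pt true  true  _     = s≤s z≤n
      pt true  false true  = s≤s z≤n
      pt true  false false = s≤s z≤n
      split : edges ≤ C′ + (bads + bads)
      split = begin
        edges
          ≤⟨ ∑-mono os (λ x → ∑-mono os λ w → pt (adj x w) (bad-edge x w) (bad-edge w x)) ⟩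
        (∑[ x ∈ os ] ∑[ w ∈ os ] c x w + (𝟙 (adj x w) * 𝟙 (bad-edge x w) + 𝟙 (adj x w) * 𝟙 (bad-edge w x)))
          ≡⟨ trans (∑-cong os λ x → trans (∑-+ os _ _) (cong (_+_ (∑ os (c x))) (∑-+ os _ _)))
               (trans (∑-+ os _ _) (cong (_+_ C′) (∑-+ os _ _))) ⟩
        C′ + (bads + (∑[ x ∈ os ] ∑[ w ∈ os ] 𝟙 (adj x w) * 𝟙 (bad-edge w x)))
          ≡⟨ cong (λ t → C′ + (bads + t)) (trans (∑-swap os os _) (∑-cong os λ w → ∑-cong os λ x →
               cong (λ t → 𝟙 t * 𝟙 (bad-edge w x)) (adj-sym x w))) ⟩
        C′ + (bads + bads) ∎

  row≤ : ∀ x → ∑ os (c x) ≤ Δ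
  row≤ x = ≤-trans (∑-mono os (adj′≤adj x)) (degree≤Δ x)

  open Walk os c (λ x y → cong 𝟙 (adj′-sym x y)) (λ _ → 1) (λ _ → Δ) Δ row≤ (λ _ → inj₂ (*-identityˡ Δ)) public

  -- `K 2` counts walks with three steps, that is, the possible middle edges. θ is Z times t + t,
  -- the bound in `spread` for the middle edges through a given vertex.
  θ : ℕ
  θ = Z * (t + t)

  thin : O → O → Bool
  thin x y = does (K 2 x y <? θ)

  same : O → O → Bool
  same u y = does (und u Finₚ.≟ und y)

  clash : O → List O → Bool
  clash u l = any (same u) (take ℓ₁ l)

  -- The test `adj′ x w` makes the event empty on lists that are not walks, since `Rare` demands its
  -- estimate for every list.
  close : O → List O → Bool
  close u (x ∷ w ∷ l) = adj′ x w ∧ heavy u w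
  close u _           = false

  R : O → List O → ℕ
  R u l = 𝟙 (close u l ∨ clash u l)

  module _ (0<S : 0 < S) (degree-large : 2 * S * ℓ₁ ≤ Δ) where

    -- Each kind of event takes half of the allowance: `close` because the edge from x to the next
    -- vertex is not bad, `clash` because by `simple` each of the ℓ₁ following vertices lies under
    -- at most one neighbour of x.
    rare : ∀ x l → S * (1 * (∑[ u ∈ os ] c x u * R u (x ∷ l))) ≤ Δ
    rare x l = *-cancelˡ-≤ 2 (begin
      2 * (S * (1 * (∑[ u ∈ os ] c x u * R u (x ∷ l))))
        ≡⟨ lem S _ ⟩
      2 * S * (∑[ u ∈ os ] c x u * R u (x ∷ l))
        ≤⟨ *-monoʳ-≤ (2 * S) (∑-mono os λ u → ≤-trans (*-monoʳ-≤ (c x u) (𝟙-∨ (close u (x ∷ l)) (clash u (x ∷ l)))) (≤-reflexive (*-distribˡ-+ (c x u) _ _))) ⟩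
      2 * S * (∑[ u ∈ os ] c x u * 𝟙 (close u (x ∷ l)) + c x u * 𝟙 (clash u (x ∷ l)))
        ≡⟨ trans (cong (2 * S *_) (∑-+ os _ _)) (*-distribˡ-+ (2 * S) _ _) ⟩
      2 * S * (∑[ u ∈ os ] c x u * 𝟙 (close u (x ∷ l))) + 2 * S * (∑[ u ∈ os ] c x u * 𝟙 (clash u (x ∷ l)))
        ≤⟨ +-mono-≤ (rare-close l) (≤-trans (*-monoʳ-≤ (2 * S) rare-clash) degree-large) ⟩
      Δ + Δ
        ≡⟨ cong (_+_ Δ) (sym (+-identityʳ Δ)) ⟩
      2 * Δ ∎)
      where
      open ≤-Reasoning
      lem : ∀ s q → 2 * (s * (1 * q)) ≡ 2 * s * q
      lem = solve-∀
      nothing : 2 * S * (∑[ u ∈ os ] c x u * 0) ≤ Δ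
      nothing = ≤-trans (≤-reflexive (trans (cong (2 * S *_) (trans (∑-cong os λ u → *-zeroʳ (c x u)) (∑-0 os))) (*-zeroʳ (2 * S)))) z≤n
      rare-close : ∀ l → 2 * S * (∑[ u ∈ os ] c x u * 𝟙 (close u (x ∷ l))) ≤ Δ
      rare-close []      = nothing
      rare-close (w ∷ l) = go (adj x w) (bad-edge x w) (bad-edge w x) (<?-false Δ _)
        where
        go : ∀ a b b′ → (b ≡ false → 2 * S * #heavy x w ≤ Δ) →
          2 * S * (∑[ u ∈ os ] c x u * 𝟙 ((a ∧ not (b ∨ b′)) ∧ heavy u w)) ≤ Δ
        go true  false false h = ≤-trans (*-monoʳ-≤ (2 * S) (∑-mono os λ u → *-monoˡ-≤ _ (adj′≤adj x u))) (h refl)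
        go true  false true  h = nothing
        go true  true  _     h = nothing
        go false _     _     h = nothing
      rare-clash : (∑[ u ∈ os ] c x u * 𝟙 (clash u (x ∷ l))) ≤ ℓ₁
      rare-clash = begin
        (∑[ u ∈ os ] c x u * 𝟙 (clash u (x ∷ l)))
          ≤⟨ ∑-mono os (λ u → *-mono-≤ (adj′≤adj x u) (∑-any (same u) (take ℓ₁ (x ∷ l)))) ⟩
        (∑[ u ∈ os ] 𝟙 (adj x u) * (∑[ y ∈ take ℓ₁ (x ∷ l) ] 𝟙 (same u y)))
          ≡⟨ trans (∑-cong os λ u → sym (∑-*ˡ (take ℓ₁ (x ∷ l)) (𝟙 (adj x u)) _)) (∑-swap os (take ℓ₁ (x ∷ l)) _) ⟩
        (∑[ y ∈ take ℓ₁ (x ∷ l) ] ∑[ u ∈ os ] 𝟙 (adj x u) * 𝟙 (same u y))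
          ≤⟨ ∑-≤ (take ℓ₁ (x ∷ l)) _ 1 (λ y → simple x (und y)) ⟩
        length (take ℓ₁ (x ∷ l)) * 1
          ≤⟨ *-monoˡ-≤ 1 (≤-trans (≤-reflexive (length-take ℓ₁ (x ∷ l))) (m⊓n≤m ℓ₁ _)) ⟩
        ℓ₁ * 1 ≡⟨ *-identityʳ ℓ₁ ⟩
        ℓ₁ ∎

  K≤ : ∀ r z → (∑[ x ∈ os ] K r z x) ≤ Δ ^ suc r
  K≤ zero    z = ≤-trans (≤-reflexive (∑-cong os λ x → K-zero z x)) (≤-trans (row≤ z) (≤-reflexive (sym (*-identityʳ Δ))))
  K≤ (suc r) z = begin
    (∑[ x ∈ os ] K (suc r) z x)                          ≡⟨ trans (∑-cong os λ x → K-suc r z x) (∑-swap os os _) ⟩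
    (∑[ y ∈ os ] ∑[ x ∈ os ] c z y * 1 * K r y x)        ≡⟨ ∑-cong os (λ y → trans (∑-*ˡ os (c z y * 1) _) (cong (_* ∑ os (K r y)) (*-identityʳ (c z y)))) ⟩
    (∑[ y ∈ os ] c z y * ∑ os (K r y))                   ≤⟨ ∑-mono os (λ y → *-monoʳ-≤ (c z y) (K≤ r y)) ⟩
    (∑[ y ∈ os ] c z y * Δ ^ suc r)                      ≡⟨ ∑-*ʳ os (Δ ^ suc r) (c z) ⟩
    ∑ os (c z) * Δ ^ suc r                               ≤⟨ *-monoˡ-≤ (Δ ^ suc r) (row≤ z) ⟩
    Δ ^ suc (suc r)                                      ∎
    where open ≤-Reasoning

  W : ∀ {r} → Vec O r → ℕ
  W []        = 0
  W z@(_ ∷ _) = cw z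

  returns : ∀ {r} → Vec O r → Bool
  returns []      = false
  returns (u ∷ v) = close u (take ℓ₁ (toList v)) ∨ clash u (take ℓ₁ (toList v))

  thins : ∀ {r} → Vec O r → Bool
  thins (x ∷ _ ∷ _ ∷ y ∷ _) = thin x y
  thins _                   = false

  bad : ∀ {r} → Vec O r → Bool
  bad z = returns z ∨ thins z

  ¬bad-close : ∀ {r} u (v : Vec O r) → bad (u ∷ v) ≡ false → close u (take ℓ₁ (toList v)) ≡ false
  ¬bad-close u v h = proj₁ (∨-false {close u l} {clash u l} (proj₁ (∨-false {returns (u ∷ v)} {thins (u ∷ v)} h)))
    where l = take ℓ₁ (toList v)

  ¬bad-clash : ∀ {r} u (v : Vec O r) → bad (u ∷ v) ≡ false → clash u (take ℓ₁ (toList v)) ≡ false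
  ¬bad-clash u v h = proj₂ (∨-false {close u l} {clash u l} (proj₁ (∨-false {returns (u ∷ v)} {thins (u ∷ v)} h)))
    where l = take ℓ₁ (toList v)

  ¬bad-thins : ∀ {r} u (v : Vec O r) → bad (u ∷ v) ≡ false → thins (u ∷ v) ≡ false
  ¬bad-thins u v h = proj₂ (∨-false {returns (u ∷ v)} {thins (u ∷ v)} h)

  -- Cut at positions 0 and 3: θ bounds the weight of the three thin steps, and what remains is one
  -- of at most Δ^(4 m - 3) walks from each of the starting points.
  thin-sum : (∑[ z ∈ vecs os (m * 4) ] W z * 𝟙 (thins z)) ≤ θ * (length os * Δ ^ suc (m′ * 4))
  thin-sum = begin
    (∑[ z ∈ vecs os (m * 4) ] W z * 𝟙 (thins z))
      ≡⟨ trans (∑-vecs os (3 + m′ * 4) _) (∑-cong os λ x → trans (∑-vecs os (2 + m′ * 4) _) (∑-cong os λ a →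
           trans (∑-vecs os (1 + m′ * 4) _) (∑-cong os λ b → trans (∑-vecs os (m′ * 4) _) (∑-cong os λ y →
             trans (∑-cong (vecs os (m′ * 4)) λ v → lem (c x a) (c a b) (c b y) (chain y v x) (𝟙 (thin x y))) (∑-*ˡ (vecs os (m′ * 4)) (c x a * 1 * (c a b * 1 * c b y) * 𝟙 (thin x y)) (λ v → chain y v x)))))) ⟩
    (∑[ x ∈ os ] ∑[ a ∈ os ] ∑[ b ∈ os ] ∑[ y ∈ os ] c x a * 1 * (c a b * 1 * c b y) * 𝟙 (thin x y) * K (m′ * 4) y x)
      ≡⟨ ∑-cong os (λ x → trans (∑-cong os λ a → ∑-swap os os _) (∑-swap os os _)) ⟩
    (∑[ x ∈ os ] ∑[ y ∈ os ] ∑[ a ∈ os ] ∑[ b ∈ os ] c x a * 1 * (c a b * 1 * c b y) * 𝟙 (thin x y) * K (m′ * 4) y x)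
      ≡⟨ ∑-cong os (λ x → ∑-cong os λ y → trans (∑-cong os λ a → trans (∑-*ʳ os (K (m′ * 4) y x) _) (cong (_* K (m′ * 4) y x) (∑-*ʳ os (𝟙 (thin x y)) _)))
           (trans (∑-*ʳ os (K (m′ * 4) y x) _) (cong (_* K (m′ * 4) y x) (trans (∑-*ʳ os (𝟙 (thin x y)) _) (cong (_* 𝟙 (thin x y)) (K₂ x y)))))) ⟩
    (∑[ x ∈ os ] ∑[ y ∈ os ] K 2 x y * 𝟙 (thin x y) * K (m′ * 4) y x)
      ≤⟨ ∑-mono os (λ x → ∑-mono os λ y → *-monoˡ-≤ (K (m′ * 4) y x) (𝟙-<?′ (K 2 x y) θ)) ⟩
    (∑[ x ∈ os ] ∑[ y ∈ os ] θ * K (m′ * 4) y x)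
      ≡⟨ trans (∑-swap os os _) (trans (∑-cong os λ y → ∑-*ˡ os θ _) (∑-*ˡ os θ _)) ⟩
    θ * (∑[ y ∈ os ] ∑ os (K (m′ * 4) y))
      ≤⟨ *-monoʳ-≤ θ (∑-≤ os _ _ (K≤ (m′ * 4))) ⟩
    θ * (length os * Δ ^ suc (m′ * 4)) ∎
    where
    open ≤-Reasoning
    lem : ∀ xa ab by k i → 1 * (xa * 1 * (ab * 1 * (by * 1 * k))) * i ≡ xa * 1 * (ab * 1 * by) * i * k
    lem = solve-∀
    K₂ : ∀ x y → (∑[ a ∈ os ] ∑[ b ∈ os ] c x a * 1 * (c a b * 1 * c b y)) ≡ K 2 x y
    K₂ x y = sym (trans (∑-vecs os 1 _) (∑-cong os λ a → trans (∑-vecs os 0 _) (∑-cong os λ b → +-identityʳ _)))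
    𝟙-<?′ : ∀ a b → a * 𝟙 (does (a <? b)) ≤ b
    𝟙-<?′ = 𝟙-<?

  length≡ : m * 4 ≡ ℓ₁ + ℓ₁
  length≡ = lem m′
    where
    lem : ∀ m → suc m * 4 ≡ suc (suc (m + m)) + suc (suc (m + m))
    lem = solve-∀

  -- 200 is twice the 100 of the density hypothesis, as half of the edges may be lost. The factor 4
  -- (m * 4) serves two kinds of bad events at m * 4 rotations, which together may take half of the
  -- weight.
  module Good (few : 8 * S * #heavy₂ ≤ Δ * edges) (0<Δ : 0 < Δ) (0<S : 0 < S) (degree-large : 2 * S * ℓ₁ ≤ Δ)
    (dense : length os * Δ ≤ 100 * edges) (0<os : 0 < length os)
    (A : ℕ) (size : length os ≤ A ^ (m + m)) (S-large : 200 * 200 * A * (4 * (m * 4) * (4 * (m * 4))) ≤ S)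
    (κ : ℕ) (κ≡ : (200 * 200) ^ m * (200 * 200) ^ m ≡ κ)
    (Δ-large : 4 * (m * 4) * (θ * length os) * κ ≤ Δ * Δ * Δ) where

    private
      N = m * 4

      total : ℕ
      total = ∑ (vecs os N) W

      W-cw : ∀ r → ∑ (vecs os (suc r)) W ≡ ∑ (vecs os (suc r)) cw
      W-cw r = ∑-cong (vecs os (suc r)) λ { (x ∷ v) → refl }

      ∑Δ : ∑ os (λ _ → Δ) ≡ length os * Δ
      ∑Δ = ∑-const os Δ

      dense′ : ∑ os (λ _ → Δ) ≤ 200 * (∑[ x ∈ os ] ∑ os (c x))
      dense′ = begin
        ∑ os (λ _ → Δ)                          ≡⟨ ∑Δ ⟩
        length os * Δ                           ≤⟨ dense ⟩
        100 * edges                             ≤⟨ *-monoʳ-≤ 100 (edges≤ few 0<Δ) ⟩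
        100 * (2 * C′)                          ≡⟨ *-assoc 100 2 C′ ⟨
        200 * C′                                ∎
        where
        open ≤-Reasoning
        C′ = ∑[ x ∈ os ] ∑ os (c x)

      0<∑Δ : 0 < ∑ os (λ _ → Δ)
      0<∑Δ = subst (0 <_) (sym ∑Δ) (*-mono-≤ 0<os 0<Δ)

      module DD = Dense 200 dense′ 0<Δ 0<∑Δ A m′ size

      r≡ : m′ + suc m′ ≡ suc p₁
      r≡ = +-suc m′ m′

      total≡ : total ≡ M (suc p₁)
      total≡ = go N length≡
        where
        go : ∀ N → N ≡ ℓ₁ + ℓ₁ → ∑ (vecs os N) W ≡ M (suc p₁)
        go _ refl = trans (W-cw _) (∑-cw (suc p₁))

      return-sum : (∑[ z ∈ vecs os N ] W z * 𝟙 (returns z)) * (4 * N) ≤ total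
      return-sum = subst ((∑[ z ∈ vecs os N ] W z * 𝟙 (returns z)) * (4 * N) ≤_) (sym total≡) (go N length≡ (4 * N) S-large)
        where
        go : ∀ N → N ≡ ℓ₁ + ℓ₁ → ∀ B → 200 * 200 * A * (B * B) ≤ S → (∑[ z ∈ vecs os N ] W z * 𝟙 (returns z)) * B ≤ M (suc p₁)
        go _ refl B S≥ = subst (λ q → q * B ≤ M (suc p₁)) (sym (∑-cong (vecs os (ℓ₁ + ℓ₁)) λ { (x ∷ v) → refl }))
          (DD.rare-bound p₁ R (λ _ _ → 𝟙≤1 _) S (rare 0<S degree-large) B (≤-reflexive r≡) S≥ 0<S)

      0<κ : 0 < κ
      0<κ = subst (0 <_) κ≡ (*-mono-≤ (m^n>0 (200 * 200) m) (m^n>0 (200 * 200) m))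

      -- The number of closed walks is at least (Δ/200)^(4 m). The power is split as Δ^(4 m - 3) Δ³
      -- to match `thin-sum`, which leaves only a condition on Δ³.
      lower : Δ ^ suc (m′ * 4) * (Δ * Δ * Δ) ≤ κ * total
      lower = begin
        Δ ^ suc (m′ * 4) * (Δ * Δ * Δ)
          ≡⟨ lem Δ (Δ ^ (m′ * 4)) ⟩
        Δ ^ 4 * Δ ^ (m′ * 4)
          ≡⟨ trans (sym (^-distribˡ-+-* Δ 4 (m′ * 4))) (trans (cong (Δ ^_) (lem′ m)) (trans (^-distribˡ-+-* Δ (2 * m) (2 * m))
               (cong (λ t → t * t) (trans (sym (^-*-assoc Δ 2 m)) (cong (_^ m) (cong (Δ *_) (*-identityʳ Δ))))))) ⟩
        (Δ * Δ) ^ m * (Δ * Δ) ^ m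
          ≤⟨ LowerBound.closed-lower 200 dense′ (*-mono-≤ 0<Δ 0<∑Δ) m′ ⟩
        (200 * 200) ^ m * (200 * 200) ^ m * M (m′ + suc m′)
          ≡⟨ cong (_* M (m′ + suc m′)) κ≡ ⟩
        κ * M (m′ + suc m′)
          ≡⟨ cong (κ *_) (trans (cong M r≡) (sym total≡)) ⟩
        κ * total ∎
        where
        open ≤-Reasoning
        lem : ∀ d e → d * e * (d * d * d) ≡ d * (d * (d * (d * 1))) * e
        lem = solve-∀
        lem′ : ∀ m → m * 4 ≡ 2 * m + 2 * m
        lem′ = solve-∀

      thin-small : 4 * N * (∑[ z ∈ vecs os N ] W z * 𝟙 (thins z)) ≤ total
      thin-small = *-cancelˡ-≤ κ {{>-nonZero 0<κ}} (begin
        κ * (4 * N * (∑[ z ∈ vecs os N ] W z * 𝟙 (thins z)))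
          ≤⟨ *-monoʳ-≤ κ (*-monoʳ-≤ (4 * N) thin-sum) ⟩
        κ * (4 * N * (θ * (length os * Δ ^ suc (m′ * 4))))
          ≡⟨ lem κ (4 * N) θ (length os) (Δ ^ suc (m′ * 4)) ⟩
        Δ ^ suc (m′ * 4) * (4 * N * (θ * length os) * κ)
          ≤⟨ *-monoʳ-≤ (Δ ^ suc (m′ * 4)) Δ-large ⟩
        Δ ^ suc (m′ * 4) * (Δ * Δ * Δ)
          ≤⟨ lower ⟩
        κ * total ∎)
        where
        open ≤-Reasoning
        lem : ∀ k n t l d → k * (n * (t * (l * d))) ≡ d * (n * (t * l) * k)
        lem = solve-∀

      bad-sum : 2 * (N * (∑[ z ∈ vecs os N ] W z * 𝟙 (bad z))) ≤ total
      bad-sum = *-cancelˡ-≤ 2 (begin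
        2 * (2 * (N * (∑[ z ∈ vecs os N ] W z * 𝟙 (bad z))))
          ≤⟨ *-monoʳ-≤ 2 (*-monoʳ-≤ 2 (*-monoʳ-≤ N (≤-trans (∑-mono (vecs os N) λ z → ≤-trans (*-monoʳ-≤ (W z) (𝟙-∨ (returns z) (thins z)))
               (≤-reflexive (*-distribˡ-+ (W z) _ _))) (≤-reflexive (∑-+ (vecs os N) _ _))))) ⟩
        2 * (2 * (N * (q + h)))       ≡⟨ lem N q h ⟩
        q * (4 * N) + 4 * N * h       ≤⟨ +-mono-≤ return-sum thin-small ⟩
        total + total                 ≡⟨ cong (_+_ total) (sym (+-identityʳ total)) ⟩
        2 * total                     ∎)
        where
        open ≤-Reasoning
        q = ∑[ z ∈ vecs os N ] W z * 𝟙 (returns z)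
        h = ∑[ z ∈ vecs os N ] W z * 𝟙 (thins z)
        lem : ∀ n q h → 2 * (2 * (n * (q + h))) ≡ q * (4 * n) + 4 * n * h
        lem = solve-∀

      W-rot : ∀ {r} (z : Vec O r) → W (rot z) ≡ W z
      W-rot []            = refl
      W-rot (x ∷ [])      = refl
      W-rot (x ∷ y ∷ v)   = sym (cw-∷ʳ x (y ∷ v))

      module Un = Union (vecs os N) W rot (∑-rot os N) W-rot bad

    good : Vec O N → Bool
    good = Un.clean N

    good-rot : ∀ z → good (rot z) ≡ good z
    good-rot = Un.clean-σ N (λ z → trans (σⁿ≡rotⁿ N z) (rotⁿ-length z))
      where
      σⁿ≡rotⁿ : ∀ i z → Un.σⁿ i z ≡ rotⁿ i z
      σⁿ≡rotⁿ zero    z = refl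
      σⁿ≡rotⁿ (suc i) z = σⁿ≡rotⁿ i (rot z)

    good⇒¬bad : ∀ z → good z ≡ true → ∀ i → i < N → bad (rotⁿ i z) ≡ false
    good⇒¬bad z gz i i<N = trans (cong bad (sym (σⁿ≡rotⁿ i z))) (Un.clean⇒¬bad N z gz i i<N)
      where
      σⁿ≡rotⁿ : ∀ i z → Un.σⁿ i z ≡ rotⁿ i z
      σⁿ≡rotⁿ zero    z = refl
      σⁿ≡rotⁿ (suc i) z = σⁿ≡rotⁿ i (rot z)

    good-dense : ∑ (vecs os N) W ≤ 2 * (∑[ z ∈ vecs os N ] W z * 𝟙 (good z))
    good-dense = Un.half-clean N bad-sum

    total>0 : 0 < ∑ (vecs os N) W
    total>0 = subst (0 <_) (sym total≡) (DD.M>0 (suc p₁) (≤-reflexive r≡))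

length-columns : ∀ {D : Set} (ds : List D) m → length (map {B = Vec D m ⊎ Vec D m} inj₁ (vecs ds m) ++ map inj₂ (vecs ds m)) ≡ 2 * length ds ^ m
length-columns ds m = trans (length-++ (map inj₁ (vecs ds m))) (trans (cong₂ _+_ (length-map inj₁ (vecs ds m)) (length-map inj₂ (vecs ds m)))
  (trans (cong (λ t → t + t) (length-vecs ds m)) (cong (_+_ (length ds ^ m)) (sym (+-identityʳ _)))))

module Positions {O : Set} {n : ℕ} (os : List O) (und : O → Fin n) where

  open Flat os

  position : Bool × ℕ → ℕ
  position (true  , i) = i * 4
  position (false , i) = 1 + i * 4

  position-injective : ∀ c c′ → position c ≡ position c′ → c ≡ c′
  position-injective (true  , i) (true  , i′) eq = cong (true ,_) (*-cancelʳ-≡ i i′ 4 eq)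
  position-injective (false , i) (false , i′) eq = cong (false ,_) (*-cancelʳ-≡ i i′ 4 (suc-injective eq))
  position-injective (true  , i) (false , i′) eq = ⊥-elim (clash i i′ eq)
    where
    clash : ∀ i i′ → i * 4 ≢ 1 + i′ * 4
    clash (suc i) (suc i′) eq = clash i i′ (+-cancelˡ-≡ 4 _ _ eq)
  position-injective (false , i) (true  , i′) eq = ⊥-elim (clash i i′ eq)
    where
    clash : ∀ i i′ → 1 + i * 4 ≢ i′ * 4
    clash (suc i) (suc i′) eq = clash i i′ (+-cancelˡ-≡ 4 _ _ eq)

  position< : ∀ c {r} → proj₂ c ≤ r → position c < suc r * 4
  position< (true  , i) {r} i≤r = s≤s (≤-trans (*-monoˡ-≤ 4 i≤r) (m≤n+m (r * 4) 3))
  position< (false , i) {r} i≤r = s≤s (s≤s (≤-trans (*-monoˡ-≤ 4 i≤r) (m≤n+m (r * 4) 2)))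

module RegularContains {n : ℕ} (G : Graph (Fin n)) (C : Cover G) (k′ p : ℕ) (t S Z : ℕ) where

  open Cover C
  open Graph G using (_~_)
  open Flat os
  open Positions os und
  open RegularCase G C k′ t S Z

  private
    m′ = k′ + suc k′
    m  = suc m′

  -- An entry pays for its own edge and for the link to the next entry, so that the cyclic product
  -- contains every edge of the closed walk exactly once.
  τ : D → D → ℕ
  τ (e₁ , e₂) (f₁ , f₂) = c e₁ e₂ * c e₂ f₁

  τ≤1 : ∀ e f → τ e f ≤ 1
  τ≤1 (e₁ , e₂) (f₁ , f₂) = *-mono-≤ (𝟙≤1 (adj′ e₁ e₂)) (𝟙≤1 (adj′ e₂ f₁))

  -- On the stretch e₂ f₁ f₂ e₃ of the walk, the two pairs at distance 2 are light and the ends are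
  -- joined by many walks of length 3. The guards with `adj′` mirror those in `close`.
  N : D → D → D → Bool
  N (_ , e₂) (f₁ , f₂) (e₃ , _) = not (adj′ f₁ f₂ ∧ heavy e₂ f₂) ∧ (not (adj′ f₂ e₃ ∧ heavy f₁ e₃) ∧ not (thin e₂ e₃))

  c>0⇒~ : ∀ x y → 0 < c x y → und x ~ und y
  c>0⇒~ x y h = adj⇒~ (proj₁ (∧-true (𝟙>0 h)))

  adjacent : ∀ e f → 0 < τ e f → und (proj₁ e) ~ und (proj₂ e) × und (proj₂ e) ~ und (proj₁ f)
  adjacent (e₁ , e₂) (f₁ , f₂) h = c>0⇒~ e₁ e₂ (*>0ˡ (c e₁ e₂) _ h) , c>0⇒~ e₂ f₁ (*>0ʳ (c e₁ e₂) _ h)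

  module CH = Columns⇒H G (λ e → und (proj₁ e)) (λ e → und (proj₂ e)) τ ds 1 τ≤1 N adjacent k′ p
  module CG = ColumnGraph ds (λ e → und (proj₁ e)) (λ e → und (proj₂ e)) τ 1 τ≤1 N

  -- For a light pair this is its codegree; for a heavy one the guard removes every x that is joined
  -- to w.
  common : ∀ u w → (∑[ x ∈ os ] c u x * (c x w * 𝟙 (not (adj′ x w ∧ heavy u w)))) ≤ t
  common u w with heavy u w in eq
  ... | false = ≤-trans (∑-mono os λ x → *-mono-≤ (adj′≤adj u x) (≤-trans (*-mono-≤ (adj′≤adj x w) (𝟙≤1 (not (adj′ x w ∧ false)))) (≤-reflexive (*-identityʳ _))))
                  (<⇒≤ (≤?-false t (codegree u w) eq))
  ... | true  = ≤-trans (≤-reflexive (trans (∑-cong os λ x → trans (cong (c u x *_) (zero-term (adj′ x w))) (*-zeroʳ (c u x))) (∑-0 os))) z≤n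
    where
    zero-term : ∀ b → 𝟙 b * 𝟙 (not (b ∧ true)) ≡ 0
    zero-term true  = refl
    zero-term false = refl

  private
    one : O → Fin n → Bool
    one x v = does (und x Finₚ.≟ v)

    hit-once : ∀ x v → (∑[ y ∈ os ] c x y * 𝟙 (one y v)) ≤ 1
    hit-once x v = ≤-trans (∑-mono os λ y → *-monoˡ-≤ _ (adj′≤adj x y)) (simple x v)

  -- If the entry (x , y) hits v with x, at most one x is possible, and y is one of at most t common
  -- neighbours of x and e₃; if with y, the same holds with x between e₂ and y. The total is
  -- `K 2 e₂ e₃`, which is at least Z (t + t) as the step is not thin.
  spread : ∀ e e′ v → Z * (∑[ f ∈ ds ] τ e f * τ f e′ * 𝟙 (N e f e′ ∧ CG.hits v f)) ≤ (∑[ f ∈ ds ] τ e f * τ f e′)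
  spread (e₁ , e₂) (e₃ , e₄) v = begin
    Z * (∑[ f ∈ ds ] τ (e₁ , e₂) f * τ f (e₃ , e₄) * 𝟙 (N (e₁ , e₂) f (e₃ , e₄) ∧ CG.hits v f))
      ≡⟨ cong (Z *_) (∑∑-product os os _) ⟩
    Z * (∑[ x ∈ os ] ∑[ y ∈ os ] c e₁ e₂ * c e₂ x * (c x y * c y e₃) * 𝟙 (N (e₁ , e₂) (x , y) (e₃ , e₄) ∧ CG.hits v (x , y)))
      ≤⟨ *-monoʳ-≤ Z (∑-mono os λ x → ∑-mono os λ y → term (c e₁ e₂) (c e₂ x) (c x y) (c y e₃)
           (not (adj′ x y ∧ heavy e₂ y)) (not (adj′ y e₃ ∧ heavy x e₃)) (not (thin e₂ e₃)) (one x v) (one y v)) ⟩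
    Z * (∑[ x ∈ os ] ∑[ y ∈ os ] (𝟙 (not (thin e₂ e₃)) * c e₁ e₂) *
      (P₁ x y + P₂ x y))
      ≡⟨ cong (Z *_) (trans (∑-cong os λ x → ∑-*ˡ os i₃ _) (∑-*ˡ os i₃ _)) ⟩
    Z * ((𝟙 (not (thin e₂ e₃)) * c e₁ e₂) * (∑[ x ∈ os ] ∑[ y ∈ os ] P₁ x y + P₂ x y))
      ≤⟨ *-monoʳ-≤ Z (*-monoʳ-≤ (𝟙 (not (thin e₂ e₃)) * c e₁ e₂) bound) ⟩
    Z * ((𝟙 (not (thin e₂ e₃)) * c e₁ e₂) * (t + t))
      ≡⟨ lem Z (𝟙 (not (thin e₂ e₃))) (c e₁ e₂) (t + t) ⟩
    c e₁ e₂ * (θ * 𝟙 (not (thin e₂ e₃)))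
      ≤⟨ *-monoʳ-≤ (c e₁ e₂) thick ⟩
    c e₁ e₂ * K 2 e₂ e₃
      ≡⟨ trans (∑∑-product os os _) (trans (∑-cong os λ x → trans (∑-cong os λ y → lem₂ (c e₁ e₂) (c e₂ x) (c x y) (c y e₃)) (∑-*ˡ os (c e₁ e₂) _))
           (trans (∑-*ˡ os (c e₁ e₂) _) (cong (c e₁ e₂ *_) K₂))) ⟨
    (∑[ f ∈ ds ] τ (e₁ , e₂) f * τ f (e₃ , e₄)) ∎
    where
    open ≤-Reasoning
    i₃ = 𝟙 (not (thin e₂ e₃)) * c e₁ e₂
    P₁ P₂ : O → O → ℕ
    P₁ x y = c e₂ x * 𝟙 (one x v) * (c x y * (c y e₃ * 𝟙 (not (adj′ y e₃ ∧ heavy x e₃))))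
    P₂ x y = c y e₃ * 𝟙 (one y v) * (c e₂ x * (c x y * 𝟙 (not (adj′ x y ∧ heavy e₂ y))))
    lem : ∀ z i a w → z * (i * a * w) ≡ a * (z * w * i)
    lem = solve-∀
    lem₂ : ∀ a b c d → a * b * (c * d) ≡ a * (b * 1 * (c * 1 * d))
    lem₂ = solve-∀
    K₂ : (∑[ x ∈ os ] ∑[ y ∈ os ] c e₂ x * 1 * (c x y * 1 * c y e₃)) ≡ K 2 e₂ e₃
    K₂ = sym (trans (∑-vecs os 1 _) (∑-cong os λ a → trans (∑-vecs os 0 _) (∑-cong os λ b → +-identityʳ _)))
    term : ∀ a b c d n₁ n₂ n₃ h₁ h₂ → a * b * (c * d) * 𝟙 ((n₁ ∧ (n₂ ∧ n₃)) ∧ (h₁ ∨ h₂)) ≤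
      𝟙 n₃ * a * (b * 𝟙 h₁ * (c * (d * 𝟙 n₂)) + d * 𝟙 h₂ * (b * (c * 𝟙 n₁)))
    term a b c d n₁ n₂ n₃ h₁ h₂ = begin
      a * b * (c * d) * 𝟙 ((n₁ ∧ (n₂ ∧ n₃)) ∧ (h₁ ∨ h₂))
        ≤⟨ *-monoʳ-≤ (a * b * (c * d)) (pt n₁ n₂ n₃ h₁ h₂) ⟩
      a * b * (c * d) * (𝟙 n₃ * (𝟙 h₁ * 𝟙 n₂ + 𝟙 h₂ * 𝟙 n₁))
        ≡⟨ lem₃ a b c d (𝟙 n₁) (𝟙 n₂) (𝟙 n₃) (𝟙 h₁) (𝟙 h₂) ⟩
      𝟙 n₃ * a * (b * 𝟙 h₁ * (c * (d * 𝟙 n₂)) + d * 𝟙 h₂ * (b * (c * 𝟙 n₁))) ∎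
      where
      lem₃ : ∀ a b c d n₁ n₂ n₃ h₁ h₂ → a * b * (c * d) * (n₃ * (h₁ * n₂ + h₂ * n₁)) ≡
        n₃ * a * (b * h₁ * (c * (d * n₂)) + d * h₂ * (b * (c * n₁)))
      lem₃ = solve-∀
      pt : ∀ n₁ n₂ n₃ h₁ h₂ → 𝟙 ((n₁ ∧ (n₂ ∧ n₃)) ∧ (h₁ ∨ h₂)) ≤ 𝟙 n₃ * (𝟙 h₁ * 𝟙 n₂ + 𝟙 h₂ * 𝟙 n₁)
      pt false _     _     _     _     = z≤n
      pt true  false _     _     _     = z≤n
      pt true  true  false _     _     = z≤n
      pt true  true  true  true  _     = s≤s z≤n
      pt true  true  true  false true  = s≤s z≤n
      pt true  true  true  false false = z≤n
    bound : (∑[ x ∈ os ] ∑[ y ∈ os ] P₁ x y + P₂ x y) ≤ t + t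
    bound = ≤-trans (≤-reflexive (trans (∑-cong os λ x → ∑-+ os _ _) (∑-+ os _ _))) (+-mono-≤ P₁≤ P₂≤)
      where
      P₁≤ : (∑[ x ∈ os ] ∑[ y ∈ os ] P₁ x y) ≤ t
      P₁≤ = begin
        (∑[ x ∈ os ] ∑[ y ∈ os ] P₁ x y)                  ≡⟨ ∑-cong os (λ x → ∑-*ˡ os (c e₂ x * 𝟙 (one x v)) _) ⟩
        (∑[ x ∈ os ] c e₂ x * 𝟙 (one x v) * (∑[ y ∈ os ] c x y * (c y e₃ * 𝟙 (not (adj′ y e₃ ∧ heavy x e₃)))))
                                                         ≤⟨ ∑-mono os (λ x → *-monoʳ-≤ (c e₂ x * 𝟙 (one x v)) (common x e₃)) ⟩
        (∑[ x ∈ os ] c e₂ x * 𝟙 (one x v) * t)           ≡⟨ ∑-*ʳ os t _ ⟩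
        (∑[ x ∈ os ] c e₂ x * 𝟙 (one x v)) * t           ≤⟨ *-monoˡ-≤ t (hit-once e₂ v) ⟩
        1 * t                                            ≡⟨ *-identityˡ t ⟩
        t                                                ∎
      P₂≤ : (∑[ x ∈ os ] ∑[ y ∈ os ] P₂ x y) ≤ t
      P₂≤ = begin
        (∑[ x ∈ os ] ∑[ y ∈ os ] P₂ x y)                  ≡⟨ trans (∑-swap os os _) (∑-cong os (λ y → ∑-*ˡ os (c y e₃ * 𝟙 (one y v)) _)) ⟩
        (∑[ y ∈ os ] c y e₃ * 𝟙 (one y v) * (∑[ x ∈ os ] c e₂ x * (c x y * 𝟙 (not (adj′ x y ∧ heavy e₂ y)))))
                                                         ≤⟨ ∑-mono os (λ y → *-monoʳ-≤ (c y e₃ * 𝟙 (one y v)) (common e₂ y)) ⟩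
        (∑[ y ∈ os ] c y e₃ * 𝟙 (one y v) * t)           ≡⟨ ∑-*ʳ os t _ ⟩
        (∑[ y ∈ os ] c y e₃ * 𝟙 (one y v)) * t           ≡⟨ cong (_* t) (∑-cong os λ y → cong (λ b → 𝟙 b * 𝟙 (one y v)) (adj′-sym y e₃)) ⟩
        (∑[ y ∈ os ] c e₃ y * 𝟙 (one y v)) * t           ≤⟨ *-monoˡ-≤ t (hit-once e₃ v) ⟩
        1 * t                                            ≡⟨ *-identityˡ t ⟩
        t                                                ∎
    thick : θ * 𝟙 (not (thin e₂ e₃)) ≤ K 2 e₂ e₃
    thick with thin e₂ e₃ in eq
    ... | true  = ≤-trans (≤-reflexive (*-zeroʳ θ)) z≤n
    ... | false = ≤-trans (≤-reflexive (*-identityʳ θ)) (<?-false (K 2 e₂ e₃) θ eq)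

  cyc-flat : ∀ {r} (E F : Vec D (suc r)) → W (flat E F) ≡ CG.cyc E F
  cyc-flat ((e₁ , e₂) ∷ E) ((f₁ , f₂) ∷ F) = trans (*-identityˡ _) (go E F e₁ e₂ f₁ f₂ (e₁ , e₂))
    where
    lem₀ : ∀ a b c d → a * 1 * (b * 1 * (c * 1 * d)) ≡ a * b * 1 * (c * d * 1)
    lem₀ = solve-∀
    lem₁ : ∀ a b c d x y → a * 1 * (b * 1 * (c * 1 * (d * 1 * (x * y)))) ≡ a * b * x * (c * d * y)
    lem₁ = solve-∀
    go : ∀ {r} (E F : Vec D r) e₁ e₂ f₁ f₂ (d : D) → chain e₁ (e₂ ∷ f₁ ∷ f₂ ∷ flat E F) (proj₁ d) ≡
      CG.along ((e₁ , e₂) ∷ E) ((f₁ , f₂) ∷ F) * CG.along ((f₁ , f₂) ∷ F) (E Vec.∷ʳ d)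
    go []            []            e₁ e₂ f₁ f₂ d = lem₀ (c e₁ e₂) (c e₂ f₁) (c f₁ f₂) (c f₂ (proj₁ d))
    go ((a , b) ∷ E) ((x , y) ∷ F) e₁ e₂ f₁ f₂ d = trans
      (cong (λ t → c e₁ e₂ * 1 * (c e₂ f₁ * 1 * (c f₁ f₂ * 1 * (c f₂ a * 1 * t)))) (go E F a b x y d))
      (lem₁ (c e₁ e₂) (c e₂ f₁) (c f₁ f₂) (c f₂ a) _ _)

  -- For the walk a b x y e ..., the rotation by 1 starts at b and gives the conditions on the pairs
  -- b y and b e; the rotation by 2 starts at x and gives the one on x e.
  ¬bad⇒N : ∀ {r} → 0 < r → (E F : Vec D (suc r)) → bad (rotⁿ 1 (flat E F)) ≡ false → bad (rotⁿ 2 (flat E F)) ≡ false →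
    N (head E) (head F) (head (rot E)) ≡ true
  ¬bad⇒N _ ((a , b) ∷ (e , _) ∷ E) ((x , y) ∷ (_ , _) ∷ F) h₁ h₂ =
    and (adj′ x y ∧ heavy b y) (adj′ y e ∧ heavy x e) (thin b e)
      (¬bad-close b _ h₁) (¬bad-close x _ h₂) (¬bad-thins b _ h₁)
    where
    and : ∀ p q r → p ≡ false → q ≡ false → r ≡ false → not p ∧ (not q ∧ not r) ≡ true
    and false false false _ _ _ = refl

  open CH.Emb using (vertex; Distinct)

  vertex-flat : ∀ (E F : Vec D m) c → proj₂ c ≤ m′ → vertex E c ≡ und (at (flat E F) (position c))
  vertex-flat E F (true  , i) i≤ = cong und (sym (at-flat₀ E F i≤))
  vertex-flat E F (false , i) i≤ = cong und (sym (at-flat₁ E F i≤))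

  ¬bad⇒distinct : ∀ E F → (∀ i → i < m * 4 → bad (rotⁿ i (flat E F)) ≡ false) → Distinct E
  ¬bad⇒distinct E F ¬bad c c′ i≤ i′≤ eq = go (<-cmp (position c) (position c′))
    where
    ℓ₁ = suc (suc (m′ + m′))
    near : ∀ {r} (z : Vec O (suc r)) d → d < ℓ₁ → d < r → bad z ≡ false → und (head z) ≢ und (at z (suc d))
    near (u ∷ v) d d<ℓ d<r h eq = false≢true (trans (sym (any-take (same u) ℓ₁ u v d d<ℓ d<r
      (¬bad-clash u v h))) (dec-true (und u Finₚ.≟ _) eq))
    apart : ∀ {j j′} → j < j′ → j′ < m * 4 → und (at (flat E F) j) ≢ und (at (flat E F) j′)
    apart = cyclic-pairs {ℓ = ℓ₁} length≡ (flat E F) (λ x y → und x ≢ und y) (λ ne eq → ne (sym eq))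
      (λ i d i< d<ℓ → near (rotⁿ i (flat E F)) d d<ℓ (≤-trans d<ℓ ℓ₁≤) (¬bad i i<))
      where
      ℓ₁≤ : ℓ₁ ≤ 3 + m′ * 4
      ℓ₁≤ = s≤s (s≤s (≤-trans (m≤m+n (m′ + m′) (m′ + m′ + 1)) (≤-reflexive (lem m′))))
        where
        lem : ∀ m → m + m + (m + m + 1) ≡ suc (m * 4)
        lem = solve-∀
    go : Tri (position c < position c′) (position c ≡ position c′) (position c′ < position c) → c ≡ c′
    go (tri≈ _ eq′ _) = position-injective c c′ eq′
    go (tri< lt _ _) = ⊥-elim (apart lt (position< c′ i′≤) (trans (sym (vertex-flat E F c i≤)) (trans eq (vertex-flat E F c′ i′≤))))
    go (tri> _ _ gt) = ⊥-elim (apart gt (position< c i≤) (trans (sym (vertex-flat E F c′ i′≤)) (trans (sym eq) (vertex-flat E F c i≤))))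

  regular-contains : (few : 8 * S * #heavy₂ ≤ Δ * edges) (0<Δ : 0 < Δ) (0<S : 0 < S) (degree-large : 2 * S * suc (suc (m′ + m′)) ≤ Δ)
    (dense : length os * Δ ≤ 100 * edges) (0<os : 0 < length os)
    (A : ℕ) (size : length os ≤ A ^ (m + m)) (S-large : 200 * 200 * A * (4 * (m * 4) * (4 * (m * 4))) ≤ S)
    (κ : ℕ) (κ≡ : (200 * 200) ^ m * (200 * 200) ^ m ≡ κ) (Δ-large : 4 * (m * 4) * (Z * (t + t) * length os) * κ ≤ Δ * Δ * Δ)
    (j A₂ : ℕ) → j + suc j ≤ suc p → 2 * (length os * length os) ^ m ≤ A₂ ^ (suc j + suc j) → 0 < A₂ →
    (let ℓ = suc (suc p)) →
    2 * 2 * A₂ * (2 * (ℓ + ℓ) * (2 * (ℓ + ℓ))) * (ℓ * ((m + m) * m)) ≤ Z →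
    Contains G (H (suc k′) ℓ)
  regular-contains few 0<Δ 0<S degree-large dense 0<os A size S-large κ κ≡ Δ-large j A₂ j≤ size₂ 0<A₂ small =
    CH.contains-H Z spread g g-shift g-N g-dense positive g-distinct j A₂ j≤ (≤-trans (≤-reflexive columns) size₂) 0<A₂ small
    where
    open Good few 0<Δ 0<S degree-large dense 0<os A size S-large κ κ≡ Δ-large
    g : Vec D m → Vec D m → Bool
    g E F = good (flat E F)
    g-shift : ∀ E F → g F (rot E) ≡ g E F
    g-shift E F = trans (cong good (flat-shift E F)) (trans (good-rot (rot (flat E F))) (good-rot (flat E F)))
    0<m′ : 0 < m′
    0<m′ = ≤-trans (s≤s z≤n) (m≤n+m (suc k′) k′)
    g-N : ∀ E F → g E F ≡ true → N (head E) (head F) (head (rot E)) ≡ true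
    g-N E F gEF = ¬bad⇒N 0<m′ E F (good⇒¬bad (flat E F) gEF 1 (s≤s (s≤s z≤n))) (good⇒¬bad (flat E F) gEF 2 (s≤s (s≤s (s≤s z≤n))))
    total≡ : CG.total m ≡ ∑ (vecs os (m * 4)) W
    total≡ = trans (∑-cong (vecs ds m) λ E → ∑-cong (vecs ds m) λ F → sym (cyc-flat E F)) (∑-flat m W)
    g-dense : CG.total m ≤ 2 * (∑[ E ∈ vecs ds m ] ∑[ F ∈ vecs ds m ] CG.cyc E F * 𝟙 (g E F))
    g-dense = subst₂ (λ s t → s ≤ 2 * t) (sym total≡) (trans (sym (∑-flat m (λ z → W z * 𝟙 (good z))))
      (∑-cong (vecs ds m) λ E → ∑-cong (vecs ds m) λ F → cong (_* 𝟙 (g E F)) (cyc-flat E F))) good-dense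
    positive : 0 < CG.total m
    positive = subst (0 <_) (sym total≡) total>0
    g-distinct : ∀ E F → g E F ≡ true → Distinct E
    g-distinct E F gEF = ¬bad⇒distinct E F (good⇒¬bad (flat E F) gEF)
    columns = trans (length-columns ds m) (cong (λ t → 2 * t ^ m) (trans (length-∑ ds) (trans (∑∑-product os os (λ _ → 1))
      (trans (∑-cong os λ _ → sym (length-∑ os)) (∑-const os (length os))))))

-- Many heavy pairs: columns from walks along heavy pairs in a neighbourhood

module Alternate {D : Set} (ds : List D) where

  alt : ∀ {m} → Vec D m → Vec D m → Vec D (m * 2)
  alt []      []      = []
  alt (e ∷ E) (f ∷ F) = e ∷ f ∷ alt E F

  ∑-alt : ∀ m (φ : Vec D (m * 2) → ℕ) →
    (∑[ E ∈ vecs ds m ] ∑[ F ∈ vecs ds m ] φ (alt E F)) ≡ ∑ (vecs ds (m * 2)) φ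
  ∑-alt zero    φ = +-identityʳ _
  ∑-alt (suc m) φ = begin
    (∑[ E ∈ vecs ds (suc m) ] ∑[ F ∈ vecs ds (suc m) ] φ (alt E F))
      ≡⟨ trans (∑-vecs ds m _) (∑-cong ds λ e → ∑-cong (vecs ds m) λ E → ∑-vecs ds m _) ⟩
    (∑[ e ∈ ds ] ∑[ E ∈ vecs ds m ] ∑[ f ∈ ds ] ∑[ F ∈ vecs ds m ] φ (alt (e ∷ E) (f ∷ F)))
      ≡⟨ ∑-cong ds (λ e → ∑-swap (vecs ds m) ds _) ⟩
    (∑[ e ∈ ds ] ∑[ f ∈ ds ] ∑[ E ∈ vecs ds m ] ∑[ F ∈ vecs ds m ] φ (alt (e ∷ E) (f ∷ F)))
      ≡⟨ ∑-cong ds (λ e → ∑-cong ds λ f → ∑-alt m (λ v → φ (e ∷ f ∷ v))) ⟩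
    (∑[ e ∈ ds ] ∑[ f ∈ ds ] ∑[ v ∈ vecs ds (m * 2) ] φ (e ∷ f ∷ v))
      ≡⟨ trans (∑-vecs ds (1 + m * 2) _) (∑-cong ds λ e → ∑-vecs ds (m * 2) _) ⟨
    ∑ (vecs ds (suc m * 2)) φ ∎
    where open ≡-Reasoning

  private
    alt-shift-∷ : ∀ {m} (E F : Vec D m) e f → alt (f ∷ F) (E Vec.∷ʳ e) ≡ (f ∷ alt E F) Vec.∷ʳ e
    alt-shift-∷ []       []       e f = refl
    alt-shift-∷ (e′ ∷ E) (f′ ∷ F) e f = cong (λ v → f ∷ e′ ∷ v) (alt-shift-∷ E F e f′)

  alt-shift : ∀ {m} (E F : Vec D m) → alt F (rot E) ≡ rot (alt E F)
  alt-shift []      []      = refl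
  alt-shift (e ∷ E) (f ∷ F) = alt-shift-∷ E F e f

  at-alt : ∀ {m} (E F : Vec D (suc m)) {j} → j ≤ m → at (alt E F) (j * 2) ≡ at E j
  at-alt (_ ∷ _)     (_ ∷ _)     {zero}  _         = refl
  at-alt (_ ∷ e ∷ E) (_ ∷ f ∷ F) {suc j} (s≤s j≤m) = at-alt (e ∷ E) (f ∷ F) j≤m

  module _ (τ : D → D → ℕ) where

    open Cyclic ds τ

    chainτ : ∀ {r} → D → Vec D r → D → ℕ
    chainτ x []      z = τ x z
    chainτ x (y ∷ v) z = τ x y * chainτ y v z

    Wτ : ∀ {r} → Vec D r → ℕ
    Wτ []      = 0
    Wτ (x ∷ v) = chainτ x v x

    chainτ-∷ʳ : ∀ {r} x (v : Vec D r) y z → chainτ x (v Vec.∷ʳ y) z ≡ chainτ x v y * τ y z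
    chainτ-∷ʳ x []      y z = refl
    chainτ-∷ʳ x (w ∷ v) y z = trans (cong (τ x w *_) (chainτ-∷ʳ w v y z)) (sym (*-assoc (τ x w) _ _))

    Wτ-rot : ∀ {r} (z : Vec D r) → Wτ (rot z) ≡ Wτ z
    Wτ-rot []          = refl
    Wτ-rot (x ∷ [])    = refl
    Wτ-rot (x ∷ y ∷ v) = trans (chainτ-∷ʳ y v x y) (*-comm _ (τ x y))

    cyc-alt : ∀ {r} (E F : Vec D (suc r)) → Wτ (alt E F) ≡ cyc E F
    cyc-alt (e ∷ E) (f ∷ F) = go E F e f e
      where
      lem₀ : ∀ a b → a * b ≡ a * 1 * (b * 1)
      lem₀ = solve-∀
      lem₁ : ∀ a b x y → a * (b * (x * y)) ≡ a * x * (b * y)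
      lem₁ = solve-∀
      go : ∀ {r} (E F : Vec D r) e f d → chainτ e (f ∷ alt E F) d ≡ along (e ∷ E) (f ∷ F) * along (f ∷ F) (E Vec.∷ʳ d)
      go []       []       e f d = lem₀ (τ e f) (τ f d)
      go (e′ ∷ E) (f′ ∷ F) e f d = trans (cong (λ t → τ e f * (τ f e′ * t)) (go E F e′ f′ d)) (lem₁ (τ e f) (τ f e′) _ _)

share-≤ : ∀ B p → share B p ≤ B !
share-≤ B zero    = z≤n
share-≤ B (suc p) = m/n≤m (B !) (suc p)

module HeavyCase {n : ℕ} (G : Graph (Fin n)) (C : Cover G) (k′ : ℕ) (t Z : ℕ) (ctr : Cover.O C) (δ : ℕ)
  (0<t : 0 < t) (0<δ : 0 < δ) where

  open Cover C

  private
    m′ = k′ + suc k′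
    m  = suc m′

  𝕒 : O → O → ℕ
  𝕒 x y = 𝟙 (adj x y)

  inP : O → Bool
  inP = adj ctr

  codegree-sym : ∀ u w → codegree u w ≡ codegree w u
  codegree-sym u w = ∑-cong os λ x → trans (*-comm (𝕒 u x) (𝕒 x w)) (cong₂ (λ a b → 𝟙 a * 𝟙 b) (adj-sym x w) (adj-sym u x))

  codegree≤Δ : ∀ u w → codegree u w ≤ Δ
  codegree≤Δ u w = ≤-trans (∑-mono os λ x → ≤-trans (*-monoʳ-≤ (𝕒 u x) (𝟙≤1 _)) (≤-reflexive (*-identityʳ _))) (degree≤Δ u)

  heavy : O → O → Bool
  heavy u w = does (t ≤? codegree u w)

  γ : O → O → Bool
  γ p p′ = (inP p ∧ inP p′) ∧ heavy p p′

  c : O → O → ℕ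
  c p p′ = 𝟙 (γ p p′)

  c-sym : ∀ p p′ → c p p′ ≡ c p′ p
  c-sym p p′ = cong₂ (λ a b → 𝟙 (a ∧ does (t ≤? b))) (∧-comm (inP p) (inP p′)) (codegree-sym p p′)

  γ≤ : ∀ p p′ → c p p′ ≤ 𝟙 (inP p′)
  γ≤ p p′ with inP p | inP p′
  ... | true  | true  = 𝟙≤1 (heavy p p′)
  ... | true  | false = z≤n
  ... | false | _     = z≤n

  -- Adding δ to the degrees inside the neighbourhood of `ctr` keeps ρ below L / δ there, so that no
  -- single vertex is a likely next step. The later choice of δ keeps the sum of `π` within a factor
  -- 2 of the sum of the degrees.
  π : O → ℕ
  π p = ∑ os (c p) + δ * 𝟙 (inP p)

  π≡0 : ∀ p → inP p ≡ false → π p ≡ 0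
  π≡0 p eq rewrite eq = trans (cong (_+_ (∑ os (λ _ → 0))) (*-zeroʳ δ)) (trans (+-identityʳ _) (∑-0 os))

  ∑inP≤Δ : (∑[ p ∈ os ] 𝟙 (inP p)) ≤ Δ
  ∑inP≤Δ = degree≤Δ ctr

  π≤ : ∀ p → π p ≤ Δ + δ
  π≤ p = +-mono-≤ (≤-trans (∑-mono os (γ≤ p)) ∑inP≤Δ) (≤-trans (*-monoʳ-≤ δ (𝟙≤1 (inP p))) (≤-reflexive (*-identityʳ δ)))

  L L₂ : ℕ
  L = (Δ + δ) !
  L₂ = Δ !

  ρ : O → ℕ
  ρ p = share (Δ + δ) (π p)

  norm : ∀ p → π p ≡ 0 ⊎ ρ p * π p ≡ L
  norm p with π p in eq
  ... | zero  = inj₁ refl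
  ... | suc q = inj₂ (share-* (Δ + δ) (s≤s z≤n) (subst (_≤ Δ + δ) eq (π≤ p)))

  open Walk os c c-sym ρ π L (λ p → m≤m+n (∑ os (c p)) _) norm public

  ρδ≤ : ∀ p → ρ p * δ ≤ L * 𝟙 (inP p)
  ρδ≤ p = go (inP p) refl
    where
    open ≤-Reasoning
    go : ∀ b → inP p ≡ b → ρ p * δ ≤ L * 𝟙 b
    go false eq = ≤-reflexive (trans (cong (λ q → share (Δ + δ) q * δ) (π≡0 p eq)) (sym (*-zeroʳ L)))
    go true  eq = begin
      ρ p * δ     ≤⟨ *-monoʳ-≤ (ρ p) δ≤π ⟩
      ρ p * π p   ≡⟨ share-* (Δ + δ) (<-≤-trans 0<δ δ≤π) (π≤ p) ⟩
      L           ≡⟨ *-identityʳ L ⟨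
      L * 1       ∎
      where
      δ≤π : δ ≤ π p
      δ≤π = subst (λ b → δ ≤ ∑ os (c p) + δ * 𝟙 b) (sym eq) (≤-trans (≤-reflexive (sym (*-identityʳ δ))) (m≤n+m (δ * 1) _))

  -- the weight of each of the common neighbours of a heavy pair p p′
  ω : O → O → ℕ
  ω p p′ = c p p′ * share Δ (codegree p p′)

  ω-codegree : ∀ p p′ → ω p p′ * codegree p p′ ≡ L₂ * c p p′
  ω-codegree p p′ with γ p p′ in eq
  ... | false = sym (*-zeroʳ L₂)
  ... | true  = trans (cong (_* codegree p p′) (*-identityˡ (share Δ (codegree p p′)))) (trans (share-* Δ (<-≤-trans 0<t (≤?-true t _ (proj₂ (∧-true eq)))) (codegree≤Δ p p′))
                  (sym (*-identityʳ L₂)))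

  ωt≤ : ∀ p p′ → ω p p′ * t ≤ L₂ * c p p′
  ωt≤ p p′ with γ p p′ in eq
  ... | false = z≤n
  ... | true  = begin
    1 * share Δ (codegree p p′) * t              ≡⟨ cong (_* t) (*-identityˡ (share Δ (codegree p p′))) ⟩
    share Δ (codegree p p′) * t                  ≤⟨ *-monoʳ-≤ (share Δ (codegree p p′)) t≤ ⟩
    share Δ (codegree p p′) * codegree p p′      ≡⟨ share-* Δ (<-≤-trans 0<t t≤) (codegree≤Δ p p′) ⟩
    L₂                                           ≡⟨ *-identityʳ L₂ ⟨
    L₂ * 1                                       ∎
    where
    open ≤-Reasoning
    t≤ = ≤?-true t _ (proj₂ (∧-true eq))

  D : Set
  D = O × O

  ds : List D
  ds = cartesianProduct os os

  -- A step of the walk on heavy pairs from p to p′, together with a uniformly chosen common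
  -- neighbour q through which it is realised in the cover.
  τ₁ : D → O → ℕ
  τ₁ (p , q) p′ = ρ p * ω p p′ * (𝕒 p q * 𝕒 q p′)

  τ : D → D → ℕ
  τ e (p′ , _) = τ₁ e p′

  open Alternate ds public
  open Cyclic ds τ public

  ∑-τ₁ : ∀ p p′ → (∑[ q ∈ os ] τ₁ (p , q) p′) ≡ L₂ * (ρ p * c p p′)
  ∑-τ₁ p p′ = trans (∑-*ˡ os (ρ p * ω p p′) _) (trans (*-assoc (ρ p) (ω p p′) _) (trans (cong (ρ p *_) (ω-codegree p p′)) (x∙yz≈y∙xz (ρ p) L₂ (c p p′))))

  ∑-chainτ : ∀ r p d (φ : Vec O r → ℕ) →
    (∑[ q ∈ os ] ∑[ s ∈ vecs ds r ] chainτ τ (p , q) s d * φ (Vec.map proj₁ s)) ≡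
    L₂ ^ suc r * (ρ p * (∑[ v ∈ vecs os r ] chain p v (proj₁ d) * φ v))
  ∑-chainτ zero p d φ = begin
    (∑[ q ∈ os ] (τ₁ (p , q) z * φ [] + 0))  ≡⟨ trans (∑-cong os λ q → +-identityʳ _) (trans (∑-*ʳ os (φ []) _) (cong (_* φ []) (∑-τ₁ p z))) ⟩
    L₂ * (ρ p * c p z) * φ []              ≡⟨ lem L₂ (ρ p) (c p z) (φ []) ⟩
    L₂ * 1 * (ρ p * (c p z * φ [] + 0))    ∎
    where
    open ≡-Reasoning
    z = proj₁ d
    lem : ∀ l r c f → l * (r * c) * f ≡ l * 1 * (r * (c * f + 0))
    lem = solve-∀
  ∑-chainτ (suc r) p d φ = begin
    (∑[ q ∈ os ] ∑[ s ∈ vecs ds (suc r) ] chainτ τ (p , q) s d * φ (Vec.map proj₁ s))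
      ≡⟨ ∑-cong os (λ q → trans (∑-vecs ds r _) (∑∑-product os os _)) ⟩
    (∑[ q ∈ os ] ∑[ p′ ∈ os ] ∑[ q′ ∈ os ] ∑[ s ∈ vecs ds r ] τ₁ (p , q) p′ * chainτ τ (p′ , q′) s d * φ (p′ ∷ Vec.map proj₁ s))
      ≡⟨ ∑-swap os os _ ⟩
    (∑[ p′ ∈ os ] ∑[ q ∈ os ] ∑[ q′ ∈ os ] ∑[ s ∈ vecs ds r ] τ₁ (p , q) p′ * chainτ τ (p′ , q′) s d * φ (p′ ∷ Vec.map proj₁ s))
      ≡⟨ ∑-cong os (λ p′ → trans (∑-cong os λ q → trans (∑-cong os λ q′ → trans (∑-cong (vecs ds r) λ s → *-assoc (τ₁ (p , q) p′) _ _)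
           (∑-*ˡ (vecs ds r) (τ₁ (p , q) p′) _)) (∑-*ˡ os (τ₁ (p , q) p′) _)) (∑-*ʳ os (S p′) λ q → τ₁ (p , q) p′)) ⟩
    (∑[ p′ ∈ os ] (∑[ q ∈ os ] τ₁ (p , q) p′) * S p′)
      ≡⟨ ∑-cong os (λ p′ → trans (cong₂ _*_ (∑-τ₁ p p′) (∑-chainτ r p′ d (λ v → φ (p′ ∷ v)))) (lem L₂ (ρ p) (c p p′) (L₂ ^ suc r) (ρ p′) _)) ⟩
    (∑[ p′ ∈ os ] L₂ ^ suc (suc r) * ρ p * (c p p′ * ρ p′ * (∑[ v ∈ vecs os r ] chain p′ v z * φ (p′ ∷ v))))
      ≡⟨ trans (∑-*ˡ os (L₂ ^ suc (suc r) * ρ p) _) (*-assoc (L₂ ^ suc (suc r)) (ρ p) _) ⟩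
    L₂ ^ suc (suc r) * (ρ p * (∑[ p′ ∈ os ] c p p′ * ρ p′ * (∑[ v ∈ vecs os r ] chain p′ v z * φ (p′ ∷ v))))
      ≡⟨ cong (λ t → L₂ ^ suc (suc r) * (ρ p * t)) (trans (∑-vecs os r _) (∑-cong os λ p′ → trans (∑-cong (vecs os r) λ v →
           *-assoc (c p p′ * ρ p′) _ _) (∑-*ˡ (vecs os r) (c p p′ * ρ p′) _))) ⟨
    L₂ ^ suc (suc r) * (ρ p * (∑[ v ∈ vecs os (suc r) ] chain p v z * φ v)) ∎
    where
    open ≡-Reasoning
    z = proj₁ d
    S : O → ℕ
    S p′ = ∑[ q′ ∈ os ] ∑[ s ∈ vecs ds r ] chainτ τ (p′ , q′) s d * φ (p′ ∷ Vec.map proj₁ s)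
    lem : ∀ l a b m c d → l * (a * b) * (m * (c * d)) ≡ l * m * a * (b * c * d)
    lem = solve-∀

  -- Summing over the common neighbours gives back the walk on heavy pairs, as each sum over q
  -- contributes exactly `L₂`. Its lower bound for closed walks is thereby transferred to `τ`.
  ∑-Wτ : ∀ r (φ : Vec O (suc r) → ℕ) →
    (∑[ s ∈ vecs ds (suc r) ] Wτ τ s * φ (Vec.map proj₁ s)) ≡ L₂ ^ suc r * (∑[ z ∈ vecs os (suc r) ] cw z * φ z)
  ∑-Wτ r φ = begin
    (∑[ s ∈ vecs ds (suc r) ] Wτ τ s * φ (Vec.map proj₁ s))
      ≡⟨ trans (∑-vecs ds r _) (∑∑-product os os _) ⟩
    (∑[ p ∈ os ] ∑[ q ∈ os ] ∑[ s ∈ vecs ds r ] chainτ τ (p , q) s (p , q) * φ (p ∷ Vec.map proj₁ s))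
      ≡⟨ ∑-cong os (λ p → trans (∑-cong os λ q → ∑-cong (vecs ds r) λ s → cong (_* φ (p ∷ Vec.map proj₁ s)) (end p q (p , q) s))
           (trans (∑-chainτ r p (p , p) (λ v → φ (p ∷ v))) (cong (L₂ ^ suc r *_) (trans (sym (∑-*ˡ (vecs os r) (ρ p) _))
           (∑-cong (vecs os r) λ v → sym (*-assoc (ρ p) _ _)))))) ⟩
    (∑[ p ∈ os ] L₂ ^ suc r * (∑[ v ∈ vecs os r ] cw (p ∷ v) * φ (p ∷ v)))
      ≡⟨ trans (∑-*ˡ os (L₂ ^ suc r) _) (cong (L₂ ^ suc r *_) (sym (∑-vecs os r _))) ⟩
    L₂ ^ suc r * (∑[ z ∈ vecs os (suc r) ] cw z * φ z) ∎
    where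
    open ≡-Reasoning
    end : ∀ {r} p q d (s : Vec D r) → chainτ τ d s (p , q) ≡ chainτ τ d s (p , p)
    end p q d []      = refl
    end p q d (e ∷ s) = cong (τ d e *_) (end p q e s)

  ρ-inP : ∀ p → ρ p ≤ ρ p * 𝟙 (inP p)
  ρ-inP p = go (inP p) refl
    where
    go : ∀ b → inP p ≡ b → ρ p ≤ ρ p * 𝟙 b
    go true  eq = ≤-reflexive (sym (*-identityʳ (ρ p)))
    go false eq = subst (λ q → share (Δ + δ) q ≤ ρ p * 0) (sym (π≡0 p eq)) z≤n

  ρ∑K≤ : ∀ r p → ρ p * ∑ os (K r p) ≤ L ^ suc r
  ρ∑K≤ zero    p = begin
    ρ p * ∑ os (K 0 p) ≡⟨ cong (ρ p *_) (∑-cong os (K-zero p)) ⟩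
    ρ p * ∑ os (c p)   ≤⟨ ρ*row≤L p ⟩
    L                  ≡⟨ *-identityʳ L ⟨
    L * 1              ∎
    where open ≤-Reasoning
  ρ∑K≤ (suc r) p = begin
    ρ p * ∑ os (K (suc r) p)
      ≡⟨ cong (ρ p *_) (trans (∑-cong os (K-suc r p)) (trans (∑-swap os os _) (∑-cong os λ y →
           trans (∑-*ˡ os (c p y * ρ y) _) (*-assoc (c p y) (ρ y) _)))) ⟩
    ρ p * (∑[ y ∈ os ] c p y * (ρ y * ∑ os (K r y)))
      ≤⟨ *-monoʳ-≤ (ρ p) (∑-mono os λ y → *-monoʳ-≤ (c p y) (ρ∑K≤ r y)) ⟩
    ρ p * (∑[ y ∈ os ] c p y * L ^ suc r)
      ≡⟨ trans (cong (ρ p *_) (∑-*ʳ os (L ^ suc r) (c p))) (sym (*-assoc (ρ p) _ _)) ⟩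
    ρ p * ∑ os (c p) * L ^ suc r
      ≤⟨ *-monoˡ-≤ (L ^ suc r) (ρ*row≤L p) ⟩
    L ^ suc (suc r) ∎
    where open ≤-Reasoning

  ρ∑K≤′ : ∀ r p → ρ p * ∑ os (K r p) ≤ 𝟙 (inP p) * L ^ suc r
  ρ∑K≤′ r p = begin
    ρ p * ∑ os (K r p)                 ≤⟨ *-monoˡ-≤ (∑ os (K r p)) (ρ-inP p) ⟩
    ρ p * 𝟙 (inP p) * ∑ os (K r p)     ≡⟨ xy∙z≈y∙xz (ρ p) (𝟙 (inP p)) _ ⟩
    𝟙 (inP p) * (ρ p * ∑ os (K r p))   ≤⟨ *-monoʳ-≤ (𝟙 (inP p)) (ρ∑K≤ r p) ⟩
    𝟙 (inP p) * L ^ suc r              ∎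
    where
    open ≤-Reasoning

  -- Up to the factor `L₂`, the weight of all entries (x , y) between `e` and an entry that starts
  -- at `p`; the sum over y has been carried out.
  ways : D → O → ℕ
  ways e p = ∑[ x ∈ os ] τ₁ e x * (ρ x * c x p)

  ∑-ways : ∀ e e′ → (∑[ f ∈ ds ] τ e f * τ f e′) ≡ L₂ * ways e (proj₁ e′)
  ∑-ways e (p , q) = trans (∑∑-product os os _) (trans (∑-cong os λ x → trans (∑-*ˡ os (τ₁ e x) _) (trans (cong (τ₁ e x *_) (∑-τ₁ x p))
      (x∙yz≈y∙xz (τ₁ e x) L₂ (ρ x * c x p)))) (∑-*ˡ os L₂ _))

  -- Since ω is at most L₂ / t and ρ at most L / δ, a single x contributes at most ρ(p) 𝕒(p, q) L₂ L
  -- / (δ t) to `ways`. The threshold is 2 Z times this, cleared of denominators.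
  floor : D → ℕ
  floor (p , q) = 2 * Z * (ρ p * 𝕒 p q * (L₂ * L))

  thin : D → O → Bool
  thin e p = does (ways e p * (δ * t) <? floor e)

  thins : ∀ {r} → Vec D r → Bool
  thins (e ∷ _ ∷ e′ ∷ _) = thin e (proj₁ e′)
  thins _                = false

  same : O → O → Bool
  same u y = does (und u Finₚ.≟ und y)

  first-clash : ∀ {r} → Vec O r → Bool
  first-clash []      = false
  first-clash (x ∷ v) = any (same x) (toList v)

  others : ∀ {r} → O → Vec D r → List O
  others p s = p ∷ toList (Vec.map proj₁ s) ++ toList (Vec.map proj₂ s)

  second-clash : ∀ {r} → Vec D r → Bool
  second-clash []            = false
  second-clash ((p , q) ∷ s) = any (same q) (others p s)

  bad : ∀ {r} → Vec D r → Bool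
  bad s = thins s ∨ (first-clash (Vec.map proj₁ s) ∨ second-clash s)

  -- On thin steps `floor` replaces the weight, and ρ δ ≤ L uses up the factor ρ(p) in it. The next
  -- common neighbour q and the vertex p₂ are then free, at the cost of Δ each. Relative to the
  -- product of powers of `L₂` and `L`, what remains is 2 Z Δ² / (δ² t).
  thin-sum : ∀ r → δ * (δ * t * (∑[ s ∈ vecs ds (3 + r) ] Wτ τ s * 𝟙 (thins s))) ≤ 2 * Z * (Δ * Δ) * (L₂ ^ (3 + r) * L ^ (3 + r))
  thin-sum r = begin
    δ * (δ * t * (∑[ s ∈ vecs ds (3 + r) ] Wτ τ s * 𝟙 (thins s)))
      ≡⟨ cong (λ x → δ * (δ * t * x)) expand ⟩
    δ * (δ * t * (∑[ p ∈ os ] ∑[ q ∈ os ] ∑[ p₂ ∈ os ] 𝟙 (thin (p , q) p₂) * (L₂ * ways (p , q) p₂) * (L₂ ^ suc r * (ρ p₂ * K r p₂ p))))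
      ≡⟨ trans (cong (δ *_) (∑³-*ˡ (δ * t) _)) (∑³-*ˡ δ _) ⟩
    (∑[ p ∈ os ] ∑[ q ∈ os ] ∑[ p₂ ∈ os ] δ * (δ * t * (𝟙 (thin (p , q) p₂) * (L₂ * ways (p , q) p₂) * (L₂ ^ suc r * (ρ p₂ * K r p₂ p)))))
      ≤⟨ ∑-mono os (λ p → ∑-mono os λ q → ∑-mono os λ p₂ → each p q p₂) ⟩
    (∑[ p ∈ os ] ∑[ q ∈ os ] ∑[ p₂ ∈ os ] A₀ * 𝕒 p q * (ρ p₂ * K r p₂ p))
      ≡⟨ ∑-cong os (λ p → trans (∑-cong os λ q → trans (∑-cong os λ p₂ → *-assoc A₀ (𝕒 p q) _) (trans (∑-*ˡ os A₀ _) (cong (A₀ *_) (∑-*ˡ os (𝕒 p q) _))))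
           (trans (∑-*ˡ os A₀ _) (cong (A₀ *_) (∑-*ʳ os (∑[ p₂ ∈ os ] ρ p₂ * K r p₂ p) (𝕒 p))))) ⟩
    (∑[ p ∈ os ] A₀ * (∑ os (𝕒 p) * (∑[ p₂ ∈ os ] ρ p₂ * K r p₂ p)))
      ≤⟨ ∑-mono os (λ p → *-monoʳ-≤ A₀ (*-monoˡ-≤ _ (degree≤Δ p))) ⟩
    (∑[ p ∈ os ] A₀ * (Δ * (∑[ p₂ ∈ os ] ρ p₂ * K r p₂ p)))
      ≡⟨ trans (∑-*ˡ os A₀ _) (cong (A₀ *_) (trans (∑-*ˡ os Δ _) (cong (Δ *_) (trans (∑-swap os os _) (∑-cong os λ p₂ → ∑-*ˡ os (ρ p₂) _))))) ⟩
    A₀ * (Δ * (∑[ p₂ ∈ os ] ρ p₂ * ∑ os (K r p₂)))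
      ≤⟨ *-monoʳ-≤ A₀ (*-monoʳ-≤ Δ (≤-trans (∑-mono os (ρ∑K≤′ r)) (≤-trans (≤-reflexive (∑-*ʳ os (L ^ suc r) _)) (*-monoˡ-≤ (L ^ suc r) ∑inP≤Δ)))) ⟩
    A₀ * (Δ * (Δ * L ^ suc r))
      ≡⟨ lem₃ Z L L₂ (L₂ ^ suc r) Δ (L ^ suc r) ⟩
    2 * Z * (Δ * Δ) * (L₂ ^ (3 + r) * L ^ (3 + r)) ∎
    where
    open ≤-Reasoning
    A₀ = 2 * Z * (L * (L₂ * L) * (L₂ * L₂ ^ suc r))
    ∑³-*ˡ : ∀ a (f : O → O → O → ℕ) → a * (∑[ p ∈ os ] ∑[ q ∈ os ] ∑[ x ∈ os ] f p q x) ≡ (∑[ p ∈ os ] ∑[ q ∈ os ] ∑[ x ∈ os ] a * f p q x)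
    ∑³-*ˡ a f = sym (trans (∑-cong os λ p → trans (∑-cong os λ q → ∑-*ˡ os a _) (∑-*ˡ os a _)) (∑-*ˡ os a _))
    lem₃ : ∀ z l m n d e → 2 * z * (l * (m * l) * (m * n)) * (d * (d * e)) ≡ 2 * z * (d * d) * (m * (m * n) * (l * (l * e)))
    lem₃ = solve-∀
    lem₁ : ∀ a b c i → a * (b * c) * i ≡ i * (a * b) * c
    lem₁ = solve-∀
    expand : (∑[ s ∈ vecs ds (3 + r) ] Wτ τ s * 𝟙 (thins s)) ≡
      (∑[ p ∈ os ] ∑[ q ∈ os ] ∑[ p₂ ∈ os ] 𝟙 (thin (p , q) p₂) * (L₂ * ways (p , q) p₂) * (L₂ ^ suc r * (ρ p₂ * K r p₂ p)))
    expand = begin-equality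
      (∑[ s ∈ vecs ds (3 + r) ] Wτ τ s * 𝟙 (thins s))
        ≡⟨ trans (∑-vecs ds (2 + r) _) (∑-cong ds λ e → trans (∑-vecs ds (1 + r) _) (trans (∑-cong ds λ f → ∑-vecs ds r _) (∑-swap ds ds _))) ⟩
      (∑[ e ∈ ds ] ∑[ e′ ∈ ds ] ∑[ f ∈ ds ] ∑[ v ∈ vecs ds r ] τ e f * (τ f e′ * chainτ τ e′ v e) * 𝟙 (thin e (proj₁ e′)))
        ≡⟨ ∑-cong ds (λ e → ∑-cong ds λ e′ → trans (∑-cong ds λ f → trans (∑-cong (vecs ds r) λ v → lem₁ (τ e f) (τ f e′) (chainτ τ e′ v e) _)
             (∑-*ˡ (vecs ds r) (𝟙 (thin e (proj₁ e′)) * (τ e f * τ f e′)) _)) (trans (∑-*ʳ ds (∑[ v ∈ vecs ds r ] chainτ τ e′ v e) _)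
             (cong (_* (∑[ v ∈ vecs ds r ] chainτ τ e′ v e)) (trans (∑-*ˡ ds (𝟙 (thin e (proj₁ e′))) _) (cong (𝟙 (thin e (proj₁ e′)) *_) (∑-ways e e′)))))) ⟩
      (∑[ e ∈ ds ] ∑[ e′ ∈ ds ] 𝟙 (thin e (proj₁ e′)) * (L₂ * ways e (proj₁ e′)) * (∑[ v ∈ vecs ds r ] chainτ τ e′ v e))
        ≡⟨ ∑-cong ds (λ e → trans (∑∑-product os os _) (∑-cong os λ p₂ → trans (∑-*ˡ os (𝟙 (thin e p₂) * (L₂ * ways e p₂)) _)
             (cong (𝟙 (thin e p₂) * (L₂ * ways e p₂) *_) (trans (∑-cong os λ q₂ → ∑-cong (vecs ds r) λ v → sym (*-identityʳ _))
               (trans (∑-chainτ r p₂ e (λ _ → 1)) (cong (λ t → L₂ ^ suc r * (ρ p₂ * t)) (∑-cong (vecs os r) λ v → *-identityʳ _))))))) ⟩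
      (∑[ e ∈ ds ] ∑[ p₂ ∈ os ] 𝟙 (thin e p₂) * (L₂ * ways e p₂) * (L₂ ^ suc r * (ρ p₂ * K r p₂ (proj₁ e))))
        ≡⟨ ∑∑-product os os _ ⟩
      (∑[ p ∈ os ] ∑[ q ∈ os ] ∑[ p₂ ∈ os ] 𝟙 (thin (p , q) p₂) * (L₂ * ways (p , q) p₂) * (L₂ ^ suc r * (ρ p₂ * K r p₂ p))) ∎
    each : ∀ p q p₂ → δ * (δ * t * (𝟙 (thin (p , q) p₂) * (L₂ * ways (p , q) p₂) * (L₂ ^ suc r * (ρ p₂ * K r p₂ p)))) ≤ A₀ * 𝕒 p q * (ρ p₂ * K r p₂ p)
    each p q p₂ = begin
      δ * (δ * t * (𝟙 (thin (p , q) p₂) * (L₂ * y) * (L₂ ^ suc r * k)))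
        ≡⟨ lem₄ δ t (𝟙 (thin (p , q) p₂)) L₂ y (L₂ ^ suc r) k ⟩
      δ * (L₂ * L₂ ^ suc r * k) * (y * (δ * t) * 𝟙 (thin (p , q) p₂))
        ≤⟨ *-monoʳ-≤ (δ * (L₂ * L₂ ^ suc r * k)) (𝟙-<? (y * (δ * t)) (floor (p , q))) ⟩
      δ * (L₂ * L₂ ^ suc r * k) * (2 * Z * (ρ p * 𝕒 p q * (L₂ * L)))
        ≡⟨ lem₅ δ (L₂ * L₂ ^ suc r) k Z (ρ p) (𝕒 p q) (L₂ * L) ⟩
      ρ p * δ * (L₂ * L₂ ^ suc r * k * (2 * Z * (𝕒 p q * (L₂ * L))))
        ≤⟨ *-monoˡ-≤ _ (≤-trans (ρδ≤ p) (≤-trans (*-monoʳ-≤ L (𝟙≤1 (inP p))) (≤-reflexive (*-identityʳ L)))) ⟩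
      L * (L₂ * L₂ ^ suc r * k * (2 * Z * (𝕒 p q * (L₂ * L))))
        ≡⟨ lem₆ L (L₂ * L₂ ^ suc r) k Z (𝕒 p q) (L₂ * L) ⟩
      A₀ * 𝕒 p q * k ∎
      where
      y = ways (p , q) p₂
      k = ρ p₂ * K r p₂ p
      lem₄ : ∀ d t i l y m k → d * (d * t * (i * (l * y) * (m * k))) ≡ d * (l * m * k) * (y * (d * t) * i)
      lem₄ = solve-∀
      lem₅ : ∀ d x k z r a w → d * (x * k) * (2 * z * (r * a * w)) ≡ r * d * (x * k * (2 * z * (a * w)))
      lem₅ = solve-∀
      lem₆ : ∀ l x k z a w → l * (x * k * (2 * z * (a * w))) ≡ 2 * z * (l * w * x) * a * k
      lem₆ = solve-∀

  simple-list : ∀ x l → (∑[ q ∈ os ] 𝕒 x q * 𝟙 (any (same q) l)) ≤ length l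
  simple-list x l = begin
    (∑[ q ∈ os ] 𝕒 x q * 𝟙 (any (same q) l))
      ≤⟨ ∑-mono os (λ q → *-monoʳ-≤ (𝕒 x q) (∑-any (same q) l)) ⟩
    (∑[ q ∈ os ] 𝕒 x q * (∑[ y ∈ l ] 𝟙 (same q y)))
      ≡⟨ trans (∑-cong os λ q → sym (∑-*ˡ l (𝕒 x q) _)) (∑-swap os l _) ⟩
    (∑[ y ∈ l ] ∑[ q ∈ os ] 𝕒 x q * 𝟙 (same q y))
      ≤⟨ ∑-≤ l _ 1 (λ y → simple x (und y)) ⟩
    length l * 1
      ≡⟨ *-identityʳ _ ⟩
    length l ∎
    where open ≤-Reasoning

  -- q is uniform among at least t common neighbours, and by `simple` each element of l excludes at
  -- most one of them.
  second-clash-step : ∀ p p′ l → t * (∑[ q ∈ os ] τ₁ (p , q) p′ * 𝟙 (any (same q) l)) ≤ length l * (∑[ q ∈ os ] τ₁ (p , q) p′)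
  second-clash-step p p′ l = begin
    t * (∑[ q ∈ os ] τ₁ (p , q) p′ * 𝟙 (any (same q) l))
      ≤⟨ *-monoʳ-≤ t (∑-mono os λ q → ≤-trans (≤-reflexive (*-assoc (ρ p * ω p p′) _ _)) (*-monoʳ-≤ (ρ p * ω p p′) (*-monoˡ-≤ _
           (≤-trans (*-monoʳ-≤ (𝕒 p q) (𝟙≤1 (adj q p′))) (≤-reflexive (*-identityʳ (𝕒 p q))))))) ⟩
    t * (∑[ q ∈ os ] ρ p * ω p p′ * (𝕒 p q * 𝟙 (any (same q) l)))
      ≡⟨ trans (cong (t *_) (∑-*ˡ os (ρ p * ω p p′) _)) (lem t (ρ p) (ω p p′) _) ⟩
    (∑[ q ∈ os ] 𝕒 p q * 𝟙 (any (same q) l)) * (ρ p * (ω p p′ * t))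
      ≤⟨ *-mono-≤ (simple-list p l) (*-monoʳ-≤ (ρ p) (ωt≤ p p′)) ⟩
    length l * (ρ p * (L₂ * c p p′))
      ≡⟨ cong (length l *_) (trans (x∙yz≈y∙xz (ρ p) L₂ (c p p′)) (sym (∑-τ₁ p p′))) ⟩
    length l * (∑[ q ∈ os ] τ₁ (p , q) p′) ∎
    where
    open ≤-Reasoning
    lem : ∀ t r w s → t * (r * w * s) ≡ s * (r * (w * t))
    lem = solve-∀

  length-others : ∀ {r} p (s : Vec D r) → length (others p s) ≡ suc (r + r)
  length-others p s = cong suc (trans (length-++ (toList (Vec.map proj₁ s))) (cong₂ _+_ (length-toList (Vec.map proj₁ s)) (length-toList (Vec.map proj₂ s))))

  chainτ-end : ∀ {r} p q d (s : Vec D r) → chainτ τ d s (p , q) ≡ chainτ τ d s (p , p)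
  chainτ-end p q d []      = refl
  chainτ-end p q d (e ∷ s) = cong (τ d e *_) (chainτ-end p q e s)

  second-clash-sum : ∀ r → t * (∑[ s ∈ vecs ds (2 + r) ] Wτ τ s * 𝟙 (second-clash s)) ≤ suc (suc r + suc r) * ∑ (vecs ds (2 + r)) (Wτ τ)
  second-clash-sum r = begin
    t * (∑[ s ∈ vecs ds (2 + r) ] Wτ τ s * 𝟙 (second-clash s))
      ≡⟨ cong (t *_) (expand (λ s → 𝟙 (second-clash s))) ⟩
    t * (∑[ p ∈ os ] ∑[ f ∈ ds ] ∑[ v ∈ vecs ds r ] chainτ τ f v (p , p) * (∑[ q ∈ os ] τ₁ (p , q) (proj₁ f) * 𝟙 (any (same q) (others p (f ∷ v)))))
      ≡⟨ trans (∑³-*ˡ t _) (∑-cong os λ p → ∑-cong ds λ f → ∑-cong (vecs ds r) λ v → x∙yz≈y∙xz t (chainτ τ f v (p , p)) _) ⟩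
    (∑[ p ∈ os ] ∑[ f ∈ ds ] ∑[ v ∈ vecs ds r ] chainτ τ f v (p , p) * (t * (∑[ q ∈ os ] τ₁ (p , q) (proj₁ f) * 𝟙 (any (same q) (others p (f ∷ v))))))
      ≤⟨ ∑-mono os (λ p → ∑-mono ds λ f → ∑-mono (vecs ds r) λ v → *-monoʳ-≤ (chainτ τ f v (p , p))
           (≤-trans (second-clash-step p (proj₁ f) (others p (f ∷ v))) (≤-reflexive (cong₂ _*_ (length-others p (f ∷ v)) (∑-cong os λ q → sym (*-identityʳ _)))))) ⟩
    (∑[ p ∈ os ] ∑[ f ∈ ds ] ∑[ v ∈ vecs ds r ] chainτ τ f v (p , p) * (B * (∑[ q ∈ os ] τ₁ (p , q) (proj₁ f) * 1)))
      ≡⟨ trans (∑-cong os λ p → ∑-cong ds λ f → ∑-cong (vecs ds r) λ v → x∙yz≈y∙xz (chainτ τ f v (p , p)) B _) (sym (∑³-*ˡ B _)) ⟩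
    B * (∑[ p ∈ os ] ∑[ f ∈ ds ] ∑[ v ∈ vecs ds r ] chainτ τ f v (p , p) * (∑[ q ∈ os ] τ₁ (p , q) (proj₁ f) * 1))
      ≡⟨ cong (B *_) (trans (sym (expand (λ _ → 1))) (∑-cong (vecs ds (2 + r)) λ s → *-identityʳ _)) ⟩
    B * ∑ (vecs ds (2 + r)) (Wτ τ) ∎
    where
    open ≤-Reasoning
    B = suc (suc r + suc r)
    ∑³-*ˡ : ∀ a (f : O → D → Vec D r → ℕ) → a * (∑[ p ∈ os ] ∑[ q ∈ ds ] ∑[ x ∈ vecs ds r ] f p q x) ≡ (∑[ p ∈ os ] ∑[ q ∈ ds ] ∑[ x ∈ vecs ds r ] a * f p q x)
    ∑³-*ˡ a f = sym (trans (∑-cong os λ p → trans (∑-cong ds λ q → ∑-*ˡ (vecs ds r) a _) (∑-*ˡ ds a _)) (∑-*ˡ os a _))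
    expand : ∀ (φ : Vec D (2 + r) → ℕ) → (∑[ s ∈ vecs ds (2 + r) ] Wτ τ s * φ s) ≡
      (∑[ p ∈ os ] ∑[ f ∈ ds ] ∑[ v ∈ vecs ds r ] chainτ τ f v (p , p) * (∑[ q ∈ os ] τ₁ (p , q) (proj₁ f) * φ ((p , q) ∷ f ∷ v)))
    expand φ = trans (∑-vecs ds (1 + r) _) (trans (∑∑-product os os _) (∑-cong os λ p → trans (∑-cong os λ q → ∑-vecs ds r _)
      (trans (∑-swap os ds _) (∑-cong ds λ f → trans (∑-swap os (vecs ds r) _) (∑-cong (vecs ds r) λ v → trans (∑-cong os λ q →
        trans (cong (λ t → τ₁ (p , q) (proj₁ f) * t * φ ((p , q) ∷ f ∷ v)) (chainτ-end p q f v)) (xy∙z≈y∙xz (τ₁ (p , q) (proj₁ f)) (chainτ τ f v (p , p)) _))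
        (∑-*ˡ os (chainτ τ f v (p , p)) _))))))

  -- The walk without its closing step; once that is dropped, the rest does not depend on the first
  -- vertex.
  openW : ∀ {r} → O → Vec O r → ℕ
  openW y []      = ρ y
  openW y (w ∷ v) = ρ y * (c y w * openW w v)

  chain≤openW : ∀ {r} y (v : Vec O r) x → ρ y * chain y v x ≤ openW y v
  chain≤openW y []      x = ≤-trans (*-monoʳ-≤ (ρ y) (𝟙≤1 (γ y x))) (≤-reflexive (*-identityʳ (ρ y)))
  chain≤openW y (w ∷ v) x = *-monoʳ-≤ (ρ y) (≤-trans (≤-reflexive (*-assoc (c y w) (ρ w) _)) (*-monoʳ-≤ (c y w) (chain≤openW w v x)))

  ∑-openW : ∀ r y → δ * ∑ (vecs os r) (openW y) ≤ 𝟙 (inP y) * L ^ suc r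
  ∑-openW zero    y = begin
    δ * (ρ y + 0)        ≡⟨ lem δ (ρ y) ⟩
    ρ y * δ              ≤⟨ ρδ≤ y ⟩
    L * 𝟙 (inP y)        ≡⟨ lem′ L (𝟙 (inP y)) ⟩
    𝟙 (inP y) * (L * 1)  ∎
    where
    open ≤-Reasoning
    lem : ∀ a b → a * (b + 0) ≡ b * a
    lem = solve-∀
    lem′ : ∀ a b → a * b ≡ b * (a * 1)
    lem′ = solve-∀
  ∑-openW (suc r) y = begin
    δ * ∑ (vecs os (suc r)) (openW y)
      ≡⟨ cong (δ *_) (trans (∑-vecs os r _) (trans (∑-cong os λ w → trans (∑-*ˡ (vecs os r) (ρ y) _) (cong (ρ y *_) (∑-*ˡ (vecs os r) (c y w) _)))
           (∑-*ˡ os (ρ y) _))) ⟩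
    δ * (ρ y * (∑[ w ∈ os ] c y w * ∑ (vecs os r) (openW w)))
      ≡⟨ trans (x∙yz≈y∙xz δ (ρ y) _) (cong (ρ y *_) (trans (sym (∑-*ˡ os δ _)) (∑-cong os λ w → x∙yz≈y∙xz δ (c y w) _))) ⟩
    ρ y * (∑[ w ∈ os ] c y w * (δ * ∑ (vecs os r) (openW w)))
      ≤⟨ *-mono-≤ (ρ-inP y) (∑-mono os λ w → *-monoʳ-≤ (c y w) (≤-trans (∑-openW r w) (≤-trans (*-monoˡ-≤ (L ^ suc r) (𝟙≤1 (inP w))) (≤-reflexive (*-identityˡ _))))) ⟩
    ρ y * 𝟙 (inP y) * (∑[ w ∈ os ] c y w * L ^ suc r)
      ≡⟨ trans (cong (ρ y * 𝟙 (inP y) *_) (∑-*ʳ os (L ^ suc r) (c y))) (lem₂ (ρ y) (𝟙 (inP y)) _ _) ⟩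
    𝟙 (inP y) * (ρ y * ∑ os (c y) * L ^ suc r)
      ≤⟨ *-monoʳ-≤ (𝟙 (inP y)) (*-monoˡ-≤ (L ^ suc r) (ρ*row≤L y)) ⟩
    𝟙 (inP y) * L ^ suc (suc r) ∎
    where
    open ≤-Reasoning
    lem₂ : ∀ a b c d → a * b * (c * d) ≡ b * (a * c * d)
    lem₂ = solve-∀

  -- With the closing step dropped, the first vertex is one of at most r + 1 neighbours of `ctr`
  -- lying over the later vertices, each of weight at most L / δ. The second δ belongs to the open
  -- end of the walk, and Δ to its start in the neighbourhood.
  first-clash-sum : ∀ r → δ * (δ * (∑[ z ∈ vecs os (2 + r) ] cw z * 𝟙 (first-clash z))) ≤ suc r * Δ * L ^ (2 + r)
  first-clash-sum r = begin
    δ * (δ * (∑[ z ∈ vecs os (2 + r) ] cw z * 𝟙 (first-clash z)))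
      ≡⟨ cong (λ t → δ * (δ * t)) (trans (∑-vecs os (1 + r) _) (∑-swap os (vecs os (1 + r)) _)) ⟩
    δ * (δ * (∑[ v ∈ vecs os (1 + r) ] ∑[ x ∈ os ] ρ x * chain x v x * 𝟙 (any (same x) (toList v))))
      ≡⟨ cong (δ *_) (trans (sym (∑-*ˡ (vecs os (1 + r)) δ _)) (∑-vecs os r _)) ⟩
    δ * (∑[ y ∈ os ] ∑[ v ∈ vecs os r ] δ * (∑[ x ∈ os ] ρ x * chain x (y ∷ v) x * 𝟙 (any (same x) (y ∷ toList v))))
      ≤⟨ *-monoʳ-≤ δ (∑-mono os λ y → ∑-mono (vecs os r) λ v → each y v) ⟩
    δ * (∑[ y ∈ os ] ∑[ v ∈ vecs os r ] L * suc r * openW y v)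
      ≡⟨ cong (δ *_) (trans (∑-cong os λ y → ∑-*ˡ (vecs os r) (L * suc r) _) (∑-*ˡ os (L * suc r) _)) ⟩
    δ * (L * suc r * (∑[ y ∈ os ] ∑ (vecs os r) (openW y)))
      ≡⟨ trans (x∙yz≈y∙xz δ (L * suc r) _) (cong (L * suc r *_) (sym (∑-*ˡ os δ _))) ⟩
    L * suc r * (∑[ y ∈ os ] δ * ∑ (vecs os r) (openW y))
      ≤⟨ *-monoʳ-≤ (L * suc r) (≤-trans (∑-mono os (∑-openW r)) (≤-trans (≤-reflexive (∑-*ʳ os (L ^ suc r) _)) (*-monoˡ-≤ (L ^ suc r) ∑inP≤Δ))) ⟩
    L * suc r * (Δ * L ^ suc r)
      ≡⟨ lem₂ L (suc r) Δ (L ^ suc r) ⟩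
    suc r * Δ * L ^ (2 + r) ∎
    where
    open ≤-Reasoning
    lem₂ : ∀ a b c d → a * b * (c * d) ≡ b * c * (a * d)
    lem₂ = solve-∀
    each : ∀ y (v : Vec O r) → δ * (∑[ x ∈ os ] ρ x * chain x (y ∷ v) x * 𝟙 (any (same x) (y ∷ toList v))) ≤ L * suc r * openW y v
    each y v = begin
      δ * (∑[ x ∈ os ] ρ x * (c x y * ρ y * chain y v x) * 𝟙 (any (same x) (y ∷ toList v)))
        ≡⟨ sym (∑-*ˡ os δ _) ⟩
      (∑[ x ∈ os ] δ * (ρ x * (c x y * ρ y * chain y v x) * 𝟙 (any (same x) (y ∷ toList v))))
        ≤⟨ ∑-mono os (λ x → term x) ⟩
      (∑[ x ∈ os ] L * openW y v * (𝟙 (inP x) * 𝟙 (any (same x) (y ∷ toList v))))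
        ≡⟨ ∑-*ˡ os (L * openW y v) _ ⟩
      L * openW y v * (∑[ x ∈ os ] 𝟙 (inP x) * 𝟙 (any (same x) (y ∷ toList v)))
        ≤⟨ *-monoʳ-≤ (L * openW y v) (≤-trans (simple-list ctr (y ∷ toList v)) (≤-reflexive (cong suc (length-toList v)))) ⟩
      L * openW y v * suc r
        ≡⟨ xy∙z≈xz∙y L (openW y v) (suc r) ⟩
      L * suc r * openW y v ∎
      where
      lem₄ : ∀ d r c s k i → d * (r * (c * s * k) * i) ≡ r * d * (c * (s * k)) * i
      lem₄ = solve-∀
      lem₅ : ∀ l i w a → l * i * w * a ≡ l * w * (i * a)
      lem₅ = solve-∀
      term : ∀ x → δ * (ρ x * (c x y * ρ y * chain y v x) * 𝟙 (any (same x) (y ∷ toList v))) ≤ L * openW y v * (𝟙 (inP x) * 𝟙 (any (same x) (y ∷ toList v)))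
      term x = begin
        δ * (ρ x * (c x y * ρ y * chain y v x) * 𝟙 (any (same x) (y ∷ toList v)))
          ≡⟨ lem₄ δ (ρ x) (c x y) (ρ y) (chain y v x) _ ⟩
        ρ x * δ * (c x y * (ρ y * chain y v x)) * 𝟙 (any (same x) (y ∷ toList v))
          ≤⟨ *-monoˡ-≤ _ (*-mono-≤ (ρδ≤ x) (≤-trans (*-mono-≤ (𝟙≤1 (γ x y)) (chain≤openW y v x)) (≤-reflexive (*-identityˡ _)))) ⟩
        L * 𝟙 (inP x) * openW y v * 𝟙 (any (same x) (y ∷ toList v))
          ≡⟨ lem₅ L (𝟙 (inP x)) (openW y v) _ ⟩
        L * openW y v * (𝟙 (inP x) * 𝟙 (any (same x) (y ∷ toList v))) ∎

cyclic-others : ∀ {X : Set} {r} (z : Vec X (suc r)) {j j′} → j ≤ r → j′ ≤ r → j ≢ j′ →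
  ∃ λ d → d < r × at (rotⁿ j z) (suc d) ≡ at z j′
cyclic-others {r = r} z {j} {j′} j≤r j′≤r j≢j′ with <-cmp j j′
... | tri≈ _ eq _ = ⊥-elim (j≢j′ eq)
... | tri< lt _ _ = j′ ∸ suc j , ≤-trans (≤-trans (m≤n+m (suc d) j) (≤-reflexive j+d)) j′≤r ,
      trans (at-rotⁿ z j (subst (_≤ r) (sym j+d) j′≤r)) (cong (at z) j+d)
  where
  d = j′ ∸ suc j
  j+d : j + suc d ≡ j′
  j+d = trans (+-suc j d) (m+[n∸m]≡n lt)
... | tri> _ _ gt = d , +-cancelˡ-≤ j (suc d) r (begin
        j + suc d      ≡⟨ j+d ⟩
        suc r + j′     ≡⟨ +-suc r j′ ⟨
        r + suc j′     ≤⟨ +-monoʳ-≤ r gt ⟩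
        r + j          ≡⟨ +-comm r j ⟩
        j + r          ∎) ,
      at-rotⁿ-wrap z j j+d gt (m≤n⇒m≤1+n j≤r)
  where
  open ≤-Reasoning
  d = (suc r + j′) ∸ suc j
  j+d : j + suc d ≡ suc r + j′
  j+d = trans (+-suc j d) (m+[n∸m]≡n (≤-trans (s≤s j≤r) (m≤m+n (suc r) j′)))

at-map : ∀ {A B : Set} {r} (f : A → B) (v : Vec A (suc r)) j → at (Vec.map f v) j ≡ f (at v j)
at-map f (x ∷ v)     zero     = refl
at-map f (x ∷ [])    (suc j) = refl
at-map f (x ∷ y ∷ v) (suc j) = at-map f (y ∷ v) j

at-suc-∈ : ∀ {A B : Set} {r} (f : A → B) x (v : Vec A r) {d} → d < r → f (at (x ∷ v) (suc d)) ∈ toList (Vec.map f v)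
at-suc-∈ f x (y ∷ v) {d} (s≤s d≤r) = subst (_∈ toList (Vec.map f (y ∷ v))) (at-map f (y ∷ v) d) (at-∈ (Vec.map f (y ∷ v)) d≤r)

any-false : ∀ {A : Set} (q : A → Bool) {l x} → any q l ≡ false → x ∈ l → q x ≡ false
any-false q {x = x} h x∈ with q x in eq
... | false = refl
... | true  = trans (sym (any-∈ q x∈ eq)) h

module HeavyContains {n : ℕ} (G : Graph (Fin n)) (C : Cover G) (k′ p : ℕ) (t Z : ℕ) (ctr : Cover.O C) (δ : ℕ)
  (0<t : 0 < t) (0<δ : 0 < δ) where

  open Cover C
  open Graph G using (_~_)
  open HeavyCase G C k′ t Z ctr δ 0<t 0<δ

  private
    k  = suc k′
    m′ = k′ + suc k′
    m  = suc m′
    N₂ = m * 2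

  N : D → D → D → Bool
  N e _ e′ = not (thin e (proj₁ e′))

  τ≤ : ∀ e f → τ e f ≤ L * L₂
  τ≤ (p , q) (p′ , _) = ≤-trans (*-mono-≤ (*-mono-≤ (share-≤ (Δ + δ) (π p)) (≤-trans (*-mono-≤ (𝟙≤1 (γ p p′)) (share-≤ Δ (codegree p p′))) (≤-reflexive (*-identityˡ L₂))))
    (*-mono-≤ (𝟙≤1 (adj p q)) (𝟙≤1 (adj q p′)))) (≤-reflexive (*-identityʳ (L * L₂)))

  adjacent : ∀ e f → 0 < τ e f → und (proj₁ e) ~ und (proj₂ e) × und (proj₂ e) ~ und (proj₁ f)
  adjacent (p , q) (p′ , _) h = adj⇒~ (𝟙>0 (*>0ˡ (𝕒 p q) (𝕒 q p′) h′)) , adj⇒~ (𝟙>0 (*>0ʳ (𝕒 p q) (𝕒 q p′) h′))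
    where
    h′ = *>0ʳ (ρ p * ω p p′) (𝕒 p q * 𝕒 q p′) h

  module CH = Columns⇒H G (λ e → und (proj₁ e)) (λ e → und (proj₂ e)) τ ds (L * L₂) τ≤ N adjacent k′ p
  module CG = ColumnGraph ds (λ e → und (proj₁ e)) (λ e → und (proj₂ e)) τ (L * L₂) τ≤ N

  private
    one : O → Fin n → Bool
    one x v = does (und x Finₚ.≟ v)

  module _ (2Z≤t : 2 * Z ≤ t) where

    -- An entry (x , y) hits v with x or with y. By `simple` there is at most one x to consider, and
    -- thickness makes its weight a small part of `ways`; in the other case y is one of at least t
    -- equally weighted common neighbours, and 2 Z ≤ t.
    spread-thick : ∀ e p₂ v → floor e ≤ ways e p₂ * (δ * t) →
      Z * (∑[ x ∈ os ] ∑[ y ∈ os ] τ₁ e x * τ₁ (x , y) p₂ * (𝟙 (one x v) + 𝟙 (one y v))) ≤ L₂ * ways e p₂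
    spread-thick e@(p , q) p₂ v thick = *-cancelˡ-≤ 2 (begin
      2 * (Z * (∑[ x ∈ os ] ∑[ y ∈ os ] τ₁ e x * τ₁ (x , y) p₂ * (𝟙 (one x v) + 𝟙 (one y v))))
        ≡⟨ cong (λ s → 2 * (Z * s)) (trans (∑-cong os λ x → trans (∑-cong os λ y → *-distribˡ-+ (τ₁ e x * τ₁ (x , y) p₂) _ _) (∑-+ os _ _)) (∑-+ os _ _)) ⟩
      2 * (Z * (F₁ + F₂))
        ≡⟨ lem Z F₁ F₂ ⟩
      2 * Z * F₁ + 2 * Z * F₂
        ≤⟨ +-mono-≤ F₁≤ F₂≤ ⟩
      L₂ * ways e p₂ + L₂ * ways e p₂
        ≡⟨ cong (_+_ (L₂ * ways e p₂)) (sym (+-identityʳ _)) ⟩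
      2 * (L₂ * ways e p₂) ∎)
      where
      open ≤-Reasoning
      F₁ = ∑[ x ∈ os ] ∑[ y ∈ os ] τ₁ e x * τ₁ (x , y) p₂ * 𝟙 (one x v)
      F₂ = ∑[ x ∈ os ] ∑[ y ∈ os ] τ₁ e x * τ₁ (x , y) p₂ * 𝟙 (one y v)
      lem : ∀ z a b → 2 * (z * (a + b)) ≡ 2 * z * a + 2 * z * b
      lem = solve-∀
      F₁≡ : F₁ ≡ (∑[ x ∈ os ] τ₁ e x * 𝟙 (one x v) * (L₂ * (ρ x * c x p₂)))
      F₁≡ = ∑-cong os λ x → trans (∑-cong os λ y → xy∙z≈xz∙y (τ₁ e x) (τ₁ (x , y) p₂) (𝟙 (one x v)))
              (trans (∑-*ˡ os (τ₁ e x * 𝟙 (one x v)) _) (cong (τ₁ e x * 𝟙 (one x v) *_) (∑-τ₁ x p₂)))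
      F₁-step : ∀ x → δ * t * (τ₁ e x * 𝟙 (one x v) * (L₂ * (ρ x * c x p₂))) ≤ ρ p * 𝕒 p q * (L₂ * (L₂ * L)) * (𝕒 q x * 𝟙 (one x v))
      F₁-step x = begin
        δ * t * (ρ p * ω p x * (𝕒 p q * 𝕒 q x) * 𝟙 (one x v) * (L₂ * (ρ x * c x p₂)))
          ≡⟨ lem₂ δ t (ρ p) (ω p x) (𝕒 p q) (𝕒 q x) (𝟙 (one x v)) L₂ (ρ x) (c x p₂) ⟩
        ρ p * 𝕒 p q * (L₂ * (ω p x * t * (ρ x * δ * c x p₂))) * (𝕒 q x * 𝟙 (one x v))
          ≤⟨ *-monoˡ-≤ _ (*-monoʳ-≤ (ρ p * 𝕒 p q) (*-monoʳ-≤ L₂ (*-mono-≤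
               (≤-trans (ωt≤ p x) (≤-trans (*-monoʳ-≤ L₂ (𝟙≤1 (γ p x))) (≤-reflexive (*-identityʳ L₂))))
               (≤-trans (*-mono-≤ (≤-trans (ρδ≤ x) (≤-trans (*-monoʳ-≤ L (𝟙≤1 (inP x))) (≤-reflexive (*-identityʳ L)))) (𝟙≤1 (γ x p₂))) (≤-reflexive (*-identityʳ L)))))) ⟩
        ρ p * 𝕒 p q * (L₂ * (L₂ * L)) * (𝕒 q x * 𝟙 (one x v)) ∎
        where
        lem₂ : ∀ d t r w a b i l s c → d * t * (r * w * (a * b) * i * (l * (s * c))) ≡ r * a * (l * (w * t * (s * d * c))) * (b * i)
        lem₂ = solve-∀
      F₁≤ : 2 * Z * F₁ ≤ L₂ * ways e p₂
      F₁≤ = *-cancelˡ-≤ (δ * t) {{>-nonZero (*-mono-≤ 0<δ 0<t)}} (begin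
        δ * t * (2 * Z * F₁)
          ≡⟨ x∙yz≈y∙xz (δ * t) (2 * Z) F₁ ⟩
        2 * Z * (δ * t * F₁)
          ≡⟨ cong (2 * Z *_) (trans (cong (δ * t *_) F₁≡) (sym (∑-*ˡ os (δ * t) _))) ⟩
        2 * Z * (∑[ x ∈ os ] δ * t * (τ₁ e x * 𝟙 (one x v) * (L₂ * (ρ x * c x p₂))))
          ≤⟨ *-monoʳ-≤ (2 * Z) (∑-mono os F₁-step) ⟩
        2 * Z * (∑[ x ∈ os ] ρ p * 𝕒 p q * (L₂ * (L₂ * L)) * (𝕒 q x * 𝟙 (one x v)))
          ≡⟨ cong (2 * Z *_) (∑-*ˡ os (ρ p * 𝕒 p q * (L₂ * (L₂ * L))) _) ⟩
        2 * Z * (ρ p * 𝕒 p q * (L₂ * (L₂ * L)) * (∑[ x ∈ os ] 𝕒 q x * 𝟙 (one x v)))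
          ≤⟨ *-monoʳ-≤ (2 * Z) (*-monoʳ-≤ (ρ p * 𝕒 p q * (L₂ * (L₂ * L))) (simple q v)) ⟩
        2 * Z * (ρ p * 𝕒 p q * (L₂ * (L₂ * L)) * 1)
          ≡⟨ lem₄ Z (ρ p * 𝕒 p q) L₂ (L₂ * L) ⟩
        L₂ * floor e
          ≤⟨ *-monoʳ-≤ L₂ thick ⟩
        L₂ * (ways e p₂ * (δ * t))
          ≡⟨ lem₅ L₂ (ways e p₂) (δ * t) ⟩
        δ * t * (L₂ * ways e p₂) ∎)
        where
        lem₄ : ∀ z r l w → 2 * z * (r * (l * w) * 1) ≡ l * (2 * z * (r * w))
        lem₄ = solve-∀
        lem₅ : ∀ a b c → a * (b * c) ≡ c * (a * b)
        lem₅ = solve-∀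
      F₂-step : ∀ x → t * (∑[ y ∈ os ] τ₁ (x , y) p₂ * 𝟙 (one y v)) ≤ L₂ * (ρ x * c x p₂)
      F₂-step x = begin
        t * (∑[ y ∈ os ] ρ x * ω x p₂ * (𝕒 x y * 𝕒 y p₂) * 𝟙 (one y v))
          ≤⟨ *-monoʳ-≤ t (∑-mono os λ y → ≤-trans (≤-reflexive (*-assoc (ρ x * ω x p₂) _ _)) (*-monoʳ-≤ (ρ x * ω x p₂) (*-monoˡ-≤ _
               (≤-trans (*-monoʳ-≤ (𝕒 x y) (𝟙≤1 (adj y p₂))) (≤-reflexive (*-identityʳ (𝕒 x y))))))) ⟩
        t * (∑[ y ∈ os ] ρ x * ω x p₂ * (𝕒 x y * 𝟙 (one y v)))
          ≡⟨ trans (cong (t *_) (∑-*ˡ os (ρ x * ω x p₂) _)) (lem₆ t (ρ x) (ω x p₂) _) ⟩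
        ρ x * (ω x p₂ * t) * (∑[ y ∈ os ] 𝕒 x y * 𝟙 (one y v))
          ≤⟨ *-mono-≤ (*-monoʳ-≤ (ρ x) (ωt≤ x p₂)) (simple x v) ⟩
        ρ x * (L₂ * c x p₂) * 1
          ≡⟨ lem₇ (ρ x) L₂ (c x p₂) ⟩
        L₂ * (ρ x * c x p₂) ∎
        where
        lem₆ : ∀ t r w s → t * (r * w * s) ≡ r * (w * t) * s
        lem₆ = solve-∀
        lem₇ : ∀ a b c → a * (b * c) * 1 ≡ b * (a * c)
        lem₇ = solve-∀
      F₂≤ : 2 * Z * F₂ ≤ L₂ * ways e p₂
      F₂≤ = begin
        2 * Z * F₂
          ≤⟨ *-monoˡ-≤ F₂ 2Z≤t ⟩
        t * F₂
          ≡⟨ trans (cong (t *_) (∑-cong os λ x → trans (∑-cong os λ y → *-assoc (τ₁ e x) _ _) (∑-*ˡ os (τ₁ e x) _)))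
               (trans (sym (∑-*ˡ os t _)) (∑-cong os λ x → x∙yz≈y∙xz t (τ₁ e x) _)) ⟩
        (∑[ x ∈ os ] τ₁ e x * (t * (∑[ y ∈ os ] τ₁ (x , y) p₂ * 𝟙 (one y v))))
          ≤⟨ ∑-mono os (λ x → *-monoʳ-≤ (τ₁ e x) (F₂-step x)) ⟩
        (∑[ x ∈ os ] τ₁ e x * (L₂ * (ρ x * c x p₂)))
          ≡⟨ trans (∑-cong os λ x → x∙yz≈y∙xz (τ₁ e x) L₂ _) (∑-*ˡ os L₂ _) ⟩
        L₂ * ways e p₂ ∎

    spread : ∀ e e′ v → Z * (∑[ f ∈ ds ] τ e f * τ f e′ * 𝟙 (N e f e′ ∧ CG.hits v f)) ≤ (∑[ f ∈ ds ] τ e f * τ f e′)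
    spread e e′@(p₂ , _) v = go (thin e p₂) refl
      where
      open ≤-Reasoning
      go : ∀ b → thin e p₂ ≡ b → Z * (∑[ f ∈ ds ] τ e f * τ f e′ * 𝟙 (not b ∧ CG.hits v f)) ≤ (∑[ f ∈ ds ] τ e f * τ f e′)
      go true  _  = ≤-trans (≤-reflexive (trans (cong (Z *_) (trans (∑-cong ds λ f → *-zeroʳ (τ e f * τ f e′)) (∑-0 ds))) (*-zeroʳ Z))) z≤n
      go false eq = begin
        Z * (∑[ f ∈ ds ] τ e f * τ f e′ * 𝟙 (CG.hits v f))
          ≤⟨ *-monoʳ-≤ Z (∑-mono ds λ f → *-monoʳ-≤ (τ e f * τ f e′) (𝟙-∨ (one (proj₁ f) v) (one (proj₂ f) v))) ⟩
        Z * (∑[ f ∈ ds ] τ e f * τ f e′ * (𝟙 (one (proj₁ f) v) + 𝟙 (one (proj₂ f) v)))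
          ≡⟨ cong (Z *_) (∑∑-product os os _) ⟩
        Z * (∑[ x ∈ os ] ∑[ y ∈ os ] τ₁ e x * τ₁ (x , y) p₂ * (𝟙 (one x v) + 𝟙 (one y v)))
          ≤⟨ spread-thick e p₂ v (<?-false _ (floor e) eq) ⟩
        L₂ * ways e p₂
          ≡⟨ ∑-ways e e′ ⟨
        (∑[ f ∈ ds ] τ e f * τ f e′) ∎

  ¬bad-thins : ∀ {r} (s : Vec D r) → bad s ≡ false → thins s ≡ false
  ¬bad-thins s h = proj₁ (∨-false {thins s} h)

  ¬bad-first : ∀ {r} (s : Vec D r) → bad s ≡ false → first-clash (Vec.map proj₁ s) ≡ false
  ¬bad-first s h = proj₁ (∨-false {first-clash (Vec.map proj₁ s)} {second-clash s} (proj₂ (∨-false {thins s} h)))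

  ¬bad-second : ∀ {r} (s : Vec D r) → bad s ≡ false → second-clash s ≡ false
  ¬bad-second s h = proj₂ (∨-false {first-clash (Vec.map proj₁ s)} {second-clash s} (proj₂ (∨-false {thins s} h)))

  private
    different : ∀ {u y} → same u y ≡ false → und u ≢ und y
    different {u} {y} h eq = false≢true (trans (sym h) (dec-true (und u Finₚ.≟ und y) eq))

  head-distinct : ∀ {r} e (s : Vec D r) → bad (e ∷ s) ≡ false → und (proj₂ e) ≢ und (proj₁ e) ×
    (∀ {d} → d < r → (und (proj₁ e) ≢ und (proj₁ (at (e ∷ s) (suc d)))) × (und (proj₂ e) ≢ und (proj₁ (at (e ∷ s) (suc d)))) ×
      (und (proj₂ e) ≢ und (proj₂ (at (e ∷ s) (suc d)))))
  head-distinct e@(p , q) s h = different (any-false (same q) {l = others p s} second (here refl)) , λ d<r →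
    different (any-false (same p) (¬bad-first (e ∷ s) h) (at-suc-∈ proj₁ e s d<r)) ,
    different (any-false (same q) {l = others p s} second (there (∈-++⁺ˡ (at-suc-∈ proj₁ e s d<r)))) ,
    different (any-false (same q) {l = others p s} second (there (∈-++⁺ʳ (toList (Vec.map proj₁ s)) (at-suc-∈ proj₂ e s d<r))))
    where
    second = ¬bad-second (e ∷ s) h

  entry-distinct : ∀ {r} (z : Vec D (suc r)) → (∀ i → i ≤ r → bad (rotⁿ i z) ≡ false) → ∀ {j} → j ≤ r →
    und (proj₂ (at z j)) ≢ und (proj₁ (at z j)) ×
    (∀ {j′} → j′ ≤ r → j ≢ j′ → (und (proj₁ (at z j)) ≢ und (proj₁ (at z j′))) × (und (proj₂ (at z j)) ≢ und (proj₁ (at z j′))) ×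
      (und (proj₂ (at z j)) ≢ und (proj₂ (at z j′))))
  entry-distinct {r} z h {j} j≤r = go (rotⁿ j z) (h j j≤r) (head-rotⁿ z j j≤r) (λ j′≤r j≢j′ → cyclic-others z j≤r j′≤r j≢j′)
    where
    go : (w : Vec D (suc r)) → bad w ≡ false → head w ≡ at z j → (∀ {j′} → j′ ≤ r → j ≢ j′ → ∃ λ d → d < r × at w (suc d) ≡ at z j′) →
      und (proj₂ (at z j)) ≢ und (proj₁ (at z j)) ×
      (∀ {j′} → j′ ≤ r → j ≢ j′ → (und (proj₁ (at z j)) ≢ und (proj₁ (at z j′))) × (und (proj₂ (at z j)) ≢ und (proj₁ (at z j′))) ×
        (und (proj₂ (at z j)) ≢ und (proj₂ (at z j′))))
    go (e ∷ s) ¬bad refl other = proj₁ (head-distinct e s ¬bad) , λ j′≤r j≢j′ → let d , d<r , eq = other j′≤r j≢j′ in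
      subst (λ f → (und (proj₁ e) ≢ und (proj₁ f)) × (und (proj₂ e) ≢ und (proj₁ f)) × (und (proj₂ e) ≢ und (proj₂ f))) eq
        (proj₂ (head-distinct e s ¬bad) d<r)

  open CH.Emb using (vertex; Distinct)

  ¬bad⇒distinct : ∀ E F → (∀ i → i < N₂ → bad (rotⁿ i (alt E F)) ≡ false) → Distinct E
  ¬bad⇒distinct E F ¬bad = go
    where
    pos< : ∀ {i} → i ≤ m′ → i * 2 ≤ suc (m′ * 2)
    pos< {i} i≤ = ≤-trans (*-monoˡ-≤ 2 i≤) (n≤1+n _)
    ED : ∀ {i} → i ≤ m′ → _
    ED {i} i≤ = entry-distinct (alt E F) (λ i i≤ → ¬bad i (s≤s i≤)) (pos< i≤)
    2*-inj : ∀ {i i′} → i ≢ i′ → i * 2 ≢ i′ * 2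
    2*-inj {i} {i′} i≢i′ eq = i≢i′ (*-cancelʳ-≡ i i′ 2 eq)
    fst≡ : ∀ {i} → i ≤ m′ → und (proj₁ (at E i)) ≡ und (proj₁ (at (alt E F) (i * 2)))
    fst≡ i≤ = cong (λ e → und (proj₁ e)) (sym (at-alt E F i≤))
    snd≡ : ∀ {i} → i ≤ m′ → und (proj₂ (at E i)) ≡ und (proj₂ (at (alt E F) (i * 2)))
    snd≡ i≤ = cong (λ e → und (proj₂ e)) (sym (at-alt E F i≤))
    crossed : ∀ {i i′} → i ≤ m′ → i′ ≤ m′ → und (proj₁ (at E i)) ≢ und (proj₂ (at E i′))
    crossed {i} {i′} i≤ i′≤ eq with i ≟ i′
    ... | yes refl = proj₁ (ED i≤) (trans (sym (snd≡ i≤)) (trans (sym eq) (fst≡ i≤)))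
    ... | no  i≢i′ = proj₁ (proj₂ (proj₂ (ED i′≤) (pos< i≤) (2*-inj (λ e → i≢i′ (sym e))))) (trans (sym (snd≡ i′≤)) (trans (sym eq) (fst≡ i≤)))
    go : Distinct E
    go (true , i) (true , i′) i≤ i′≤ eq with i ≟ i′
    ... | yes refl = refl
    ... | no  i≢i′ = ⊥-elim (proj₁ (proj₂ (ED i≤) (pos< i′≤) (2*-inj i≢i′)) (trans (sym (fst≡ i≤)) (trans eq (fst≡ i′≤))))
    go (false , i) (false , i′) i≤ i′≤ eq with i ≟ i′
    ... | yes refl = refl
    ... | no  i≢i′ = ⊥-elim (proj₂ (proj₂ (proj₂ (ED i≤) (pos< i′≤) (2*-inj i≢i′))) (trans (sym (snd≡ i≤)) (trans eq (snd≡ i′≤))))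
    go (true , i) (false , i′) i≤ i′≤ eq = ⊥-elim (crossed i≤ i′≤ eq)
    go (false , i) (true , i′) i≤ i′≤ eq = ⊥-elim (crossed i′≤ i≤ (sym eq))

  -- More than Δ² / T₁ of the ordered pairs in the neighbourhood are heavy, and δ is Δ / T₁ up to a
  -- factor 2. Three kinds of bad events at N₂ rotations must each stay below 1 / (6 N₂) of the
  -- weight; 48 = 6 · 2 · 4 collects this 6, the 2 of `floor` and the 4 of `Δ²≤`.
  module _ (T₁ : ℕ) (0<T₁ : 0 < T₁) (0<Z : 0 < Z)
    (big : Δ * Δ < T₁ * (∑[ x ∈ os ] ∑ os (c x)))
    (δT₁≤Δ : δ * T₁ ≤ Δ) (Δ≤2T₁δ : Δ ≤ 2 * T₁ * δ)
    (t-large : 48 * Z * (T₁ * T₁) * (N₂ * N₂) * ((2 * 2) ^ k * (2 * 2) ^ k) ≤ t) where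

    private
      κ = (2 * 2) ^ k * (2 * 2) ^ k

      hv = ∑[ x ∈ os ] ∑ os (c x)

      0<hv : 0 < hv
      0<hv = n≢0⇒n>0 λ eq → n≮0 (subst (Δ * Δ <_) (trans (cong (T₁ *_) eq) (*-zeroʳ T₁)) big)

      0<κ : 0 < κ
      0<κ = *-mono-≤ (m^n>0 (2 * 2) k) (m^n>0 (2 * 2) k)

      δΔ≤hv : δ * Δ ≤ hv
      δΔ≤hv = *-cancelˡ-≤ T₁ {{>-nonZero 0<T₁}} (begin
        T₁ * (δ * Δ) ≡⟨ x∙yz≈yx∙z T₁ δ Δ ⟩
        δ * T₁ * Δ   ≤⟨ *-monoˡ-≤ Δ δT₁≤Δ ⟩
        Δ * Δ        ≤⟨ <⇒≤ big ⟩
        T₁ * hv      ∎)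
        where
        open ≤-Reasoning

      dense : ∑ os π ≤ 2 * hv
      dense = begin
        ∑ os π                                      ≡⟨ trans (∑-+ os _ _) (cong (_+_ hv) (∑-*ˡ os δ _)) ⟩
        hv + δ * (∑[ p ∈ os ] 𝟙 (inP p))            ≤⟨ +-monoʳ-≤ hv (≤-trans (*-monoʳ-≤ δ ∑inP≤Δ) δΔ≤hv) ⟩
        hv + hv                                     ≡⟨ cong (_+_ hv) (+-identityʳ hv) ⟨
        2 * hv                                      ∎
        where open ≤-Reasoning

      0<∑π : 0 < ∑ os π
      0<∑π = <-≤-trans 0<hv (∑-mono os λ p → m≤m+n (∑ os (c p)) _)

      -- There is a heavy pair, because `hv` is positive, and its codegree lies between t and Δ.
      t≤Δ : t ≤ Δ
      t≤Δ with x , lt ← ∑-exists os (λ _ → 0) (λ x → ∑ os (c x)) (subst (_< hv) (sym (∑-0 os)) 0<hv)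
          with y , lt′ ← ∑-exists os (λ _ → 0) (c x) (subst (_< ∑ os (c x)) (sym (∑-0 os)) lt) =
          ≤-trans (≤?-true t _ (proj₂ (∧-true {inP x ∧ inP y} (𝟙>0 lt′)))) (codegree≤Δ x y)

      wt : ℕ
      wt = ∑ (vecs ds N₂) (Wτ τ)

      Λ : ℕ
      Λ = L₂ ^ N₂ * L ^ N₂

      lower : Λ ≤ κ * wt
      lower = begin
        L₂ ^ N₂ * L ^ N₂
          ≡⟨ cong (L₂ ^ N₂ *_) (trans (cong (L ^_) (lem k′)) (trans (^-distribˡ-+-* L (2 * k) (2 * k))
               (cong (λ t → t * t) (trans (sym (^-*-assoc L 2 k)) (cong (_^ k) (cong (L *_) (*-identityʳ L))))))) ⟩
        L₂ ^ N₂ * ((L * L) ^ k * (L * L) ^ k)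
          ≤⟨ *-monoʳ-≤ (L₂ ^ N₂) (LowerBound.closed-lower 2 dense (*-mono-≤ (!>0 (Δ + δ)) 0<∑π) k′) ⟩
        L₂ ^ N₂ * (κ * M m′)
          ≡⟨ x∙yz≈y∙xz (L₂ ^ N₂) κ (M m′) ⟩
        κ * (L₂ ^ N₂ * M m′)
          ≡⟨ cong (κ *_) (trans (cong (L₂ ^ N₂ *_) (trans (sym (∑-cw m′)) (go (length-eq m′)))) (sym (trans (∑-cong (vecs ds N₂) λ s → sym (*-identityʳ _)) (∑-Wτ (suc (m′ * 2)) (λ _ → 1))))) ⟩
        κ * wt ∎
        where
        open ≤-Reasoning
        lem : ∀ k′ → suc (k′ + suc k′) * 2 ≡ 2 * suc k′ + 2 * suc k′
        lem = solve-∀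
        length-eq : ∀ m → m + suc m ≡ suc (m * 2)
        length-eq = solve-∀
        go : ∀ {r r′} → r ≡ r′ → ∑ (vecs os (suc r)) cw ≡ (∑[ z ∈ vecs os (suc r′) ] cw z * 1)
        go {r} refl = ∑-cong (vecs os (suc r)) λ z → sym (*-identityʳ (cw z))

      thinΣ firstΣ secondΣ : ℕ
      thinΣ = ∑[ s ∈ vecs ds N₂ ] Wτ τ s * 𝟙 (thins s)
      firstΣ = ∑[ s ∈ vecs ds N₂ ] Wτ τ s * 𝟙 (first-clash (Vec.map proj₁ s))
      secondΣ = ∑[ s ∈ vecs ds N₂ ] Wτ τ s * 𝟙 (second-clash s)

      Δ²≤ : Δ * Δ ≤ 4 * (T₁ * T₁) * (δ * δ)
      Δ²≤ = ≤-trans (*-mono-≤ Δ≤2T₁δ Δ≤2T₁δ) (≤-reflexive (lem T₁ δ))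
        where
        lem : ∀ a b → 2 * a * b * (2 * a * b) ≡ 4 * (a * a) * (b * b)
        lem = solve-∀

      1≤N₂ : 1 ≤ N₂
      1≤N₂ = s≤s z≤n

      thin-small : 6 * N₂ * thinΣ ≤ wt
      thin-small = *-cancelˡ-≤ (δ * δ * t) {{>-nonZero (*-mono-≤ (*-mono-≤ 0<δ 0<δ) 0<t)}} (begin
        δ * δ * t * (6 * N₂ * thinΣ)
          ≡⟨ lem₁ δ t N₂ thinΣ ⟩
        6 * N₂ * (δ * (δ * t * thinΣ))
          ≤⟨ *-monoʳ-≤ (6 * N₂) (≤-trans thin-sum′ (≤-trans (*-monoʳ-≤ (2 * Z * (Δ * Δ)) lower) (*-monoˡ-≤ (κ * wt) (*-monoʳ-≤ (2 * Z) Δ²≤)))) ⟩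
        6 * N₂ * (2 * Z * (4 * (T₁ * T₁) * (δ * δ)) * (κ * wt))
          ≡⟨ lem₂ N₂ Z (T₁ * T₁) (δ * δ) κ wt ⟩
        48 * Z * (T₁ * T₁) * (N₂ * 1) * κ * (δ * δ * wt)
          ≤⟨ *-monoˡ-≤ (δ * δ * wt) (≤-trans (*-monoˡ-≤ κ (*-monoʳ-≤ (48 * Z * (T₁ * T₁)) (*-monoʳ-≤ N₂ 1≤N₂))) t-large) ⟩
        t * (δ * δ * wt)
          ≡⟨ x∙yz≈yx∙z t (δ * δ) wt ⟩
        δ * δ * t * wt ∎)
        where
        open ≤-Reasoning
        lem₁ : ∀ d t n s → d * d * t * (6 * n * s) ≡ 6 * n * (d * (d * t * s))
        lem₁ = solve-∀
        lem₂ : ∀ n z t d k w → 6 * n * (2 * z * (4 * t * d) * (k * w)) ≡ 48 * z * t * (n * 1) * k * (d * w)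
        lem₂ = solve-∀
        lem₄ : ∀ k′ → suc (k′ + suc k′) * 2 ≡ 3 + (1 + k′ * 4)
        lem₄ = solve-∀
        thin-sum′ : δ * (δ * t * thinΣ) ≤ 2 * Z * (Δ * Δ) * Λ
        thin-sum′ = subst (λ N → δ * (δ * t * (∑[ s ∈ vecs ds N ] Wτ τ s * 𝟙 (thins s))) ≤ 2 * Z * (Δ * Δ) * (L₂ ^ N * L ^ N))
          (sym (lem₄ k′)) (thin-sum (1 + k′ * 4))

      first-small : 6 * N₂ * firstΣ ≤ wt
      first-small = *-cancelˡ-≤ (4 * (T₁ * T₁) * (δ * δ)) {{>-nonZero (*-mono-≤ (*-mono-≤ {1} {4} (s≤s z≤n) (*-mono-≤ 0<T₁ 0<T₁)) (*-mono-≤ 0<δ 0<δ))}} (begin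
        4 * (T₁ * T₁) * (δ * δ) * (6 * N₂ * firstΣ)
          ≡⟨ lem₁ (T₁ * T₁) δ N₂ firstΣ ⟩
        24 * (T₁ * T₁) * N₂ * (δ * (δ * firstΣ))
          ≤⟨ *-monoʳ-≤ (24 * (T₁ * T₁) * N₂) (≤-trans first-sum′ (≤-trans (*-monoʳ-≤ (N₂ * Δ) lower) (≤-reflexive (*-assoc N₂ Δ _)))) ⟩
        24 * (T₁ * T₁) * N₂ * (N₂ * (Δ * (κ * wt)))
          ≡⟨ lem₂ (T₁ * T₁) N₂ Δ κ wt ⟩
        24 * 1 * (T₁ * T₁) * (N₂ * N₂) * κ * (Δ * wt)
          ≤⟨ *-monoˡ-≤ (Δ * wt) (≤-trans (*-monoˡ-≤ κ (*-monoˡ-≤ (N₂ * N₂) (*-monoˡ-≤ (T₁ * T₁) (*-mono-≤ 24≤48 0<Z)))) (≤-trans t-large t≤Δ)) ⟩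
        Δ * (Δ * wt)
          ≡⟨ *-assoc Δ Δ wt ⟨
        Δ * Δ * wt
          ≤⟨ *-monoˡ-≤ wt Δ²≤ ⟩
        4 * (T₁ * T₁) * (δ * δ) * wt ∎)
        where
        open ≤-Reasoning
        24≤48 : 24 ≤ 48
        24≤48 = m≤m+n 24 24
        lem₁ : ∀ t d n s → 4 * t * (d * d) * (6 * n * s) ≡ 24 * t * n * (d * (d * s))
        lem₁ = solve-∀
        lem₂ : ∀ t n d k w → 24 * t * n * (n * (d * (k * w))) ≡ 24 * 1 * t * (n * n) * k * (d * w)
        lem₂ = solve-∀
        lem₃ : ∀ d l s → d * (d * (l * s)) ≡ l * (d * (d * s))
        lem₃ = solve-∀
        lem₄ : ∀ l n d w → l * (n * d * w) ≡ n * d * (l * w)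
        lem₄ = solve-∀
        first-sum′ : δ * (δ * firstΣ) ≤ N₂ * Δ * Λ
        first-sum′ = begin
          δ * (δ * firstΣ)
            ≡⟨ trans (cong (λ s → δ * (δ * s)) (∑-Wτ (suc (m′ * 2)) (λ z → 𝟙 (first-clash z)))) (lem₃ δ (L₂ ^ N₂) _) ⟩
          L₂ ^ N₂ * (δ * (δ * (∑[ z ∈ vecs os N₂ ] cw z * 𝟙 (first-clash z))))
            ≤⟨ *-monoʳ-≤ (L₂ ^ N₂) (≤-trans (first-clash-sum (m′ * 2)) (*-monoˡ-≤ (L ^ N₂) (*-monoˡ-≤ Δ (n≤1+n (suc (m′ * 2)))))) ⟩
          L₂ ^ N₂ * (N₂ * Δ * L ^ N₂)
            ≡⟨ lem₄ (L₂ ^ N₂) N₂ Δ (L ^ N₂) ⟩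
          N₂ * Δ * Λ ∎

      second-small : 6 * N₂ * secondΣ ≤ wt
      second-small = *-cancelˡ-≤ t {{>-nonZero 0<t}} (begin
        t * (6 * N₂ * secondΣ)           ≡⟨ x∙yz≈y∙xz t (6 * N₂) secondΣ ⟩
        6 * N₂ * (t * secondΣ)           ≤⟨ *-monoʳ-≤ (6 * N₂) (≤-trans (second-clash-sum (m′ * 2)) (*-monoˡ-≤ wt len≤)) ⟩
        6 * N₂ * ((N₂ + N₂) * wt)     ≡⟨ lem₂ N₂ wt ⟩
        12 * 1 * (1 * 1) * (N₂ * N₂) * 1 * wt
          ≤⟨ *-monoˡ-≤ wt (≤-trans (*-mono-≤ (*-monoˡ-≤ (N₂ * N₂) (*-mono-≤ (*-mono-≤ 12≤48 0<Z) (*-mono-≤ 0<T₁ 0<T₁))) 0<κ) t-large) ⟩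
        t * wt                        ∎)
        where
        open ≤-Reasoning
        12≤48 : 12 ≤ 48
        12≤48 = m≤m+n 12 36
        lem₂ : ∀ n w → 6 * n * ((n + n) * w) ≡ 12 * 1 * (1 * 1) * (n * n) * 1 * w
        lem₂ = solve-∀
        len≤ : suc (suc (m′ * 2) + suc (m′ * 2)) ≤ N₂ + N₂
        len≤ = ≤-trans (n≤1+n _) (≤-reflexive (lem₃ (m′ * 2)))
          where
          lem₃ : ∀ a → suc (suc (suc a + suc a)) ≡ suc (suc a) + suc (suc a)
          lem₃ = solve-∀

      bad-sum : 2 * (N₂ * (∑[ s ∈ vecs ds N₂ ] Wτ τ s * 𝟙 (bad s))) ≤ wt
      bad-sum = *-cancelˡ-≤ 3 (begin
        3 * (2 * (N₂ * (∑[ s ∈ vecs ds N₂ ] Wτ τ s * 𝟙 (bad s))))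
          ≤⟨ *-monoʳ-≤ 3 (*-monoʳ-≤ 2 (*-monoʳ-≤ N₂ (≤-trans (∑-mono (vecs ds N₂) λ s → ≤-trans
               (*-monoʳ-≤ (Wτ τ s) (≤-trans (𝟙-∨ (thins s) _) (+-monoʳ-≤ (𝟙 (thins s)) (𝟙-∨ (first-clash (Vec.map proj₁ s)) (second-clash s)))))
               (≤-reflexive (lem₀ (Wτ τ s) (𝟙 (thins s)) (𝟙 (first-clash (Vec.map proj₁ s))) (𝟙 (second-clash s)))))
               (≤-reflexive (trans (∑-+ (vecs ds N₂) _ _) (cong (_+ secondΣ) (∑-+ (vecs ds N₂) _ _))))))) ⟩
        3 * (2 * (N₂ * (thinΣ + firstΣ + secondΣ)))
          ≡⟨ lem N₂ thinΣ firstΣ secondΣ ⟩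
        6 * N₂ * thinΣ + 6 * N₂ * firstΣ + 6 * N₂ * secondΣ
          ≤⟨ +-mono-≤ (+-mono-≤ thin-small first-small) second-small ⟩
        wt + wt + wt
          ≡⟨ lem₁ wt ⟩
        3 * wt ∎)
        where
        open ≤-Reasoning
        lem₀ : ∀ w a b c → w * (a + (b + c)) ≡ w * a + w * b + w * c
        lem₀ = solve-∀
        lem : ∀ n a b c → 3 * (2 * (n * (a + b + c))) ≡ 6 * n * a + 6 * n * b + 6 * n * c
        lem = solve-∀
        lem₁ : ∀ a → a + a + a ≡ 3 * a
        lem₁ = solve-∀

      module Un = Union (vecs ds N₂) (Wτ τ) rot (∑-rot ds N₂) (Wτ-rot τ) bad

      σⁿ≡rotⁿ : ∀ i z → Un.σⁿ i z ≡ rotⁿ i z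
      σⁿ≡rotⁿ zero    z = refl
      σⁿ≡rotⁿ (suc i) z = σⁿ≡rotⁿ i (rot z)

      g : Vec D m → Vec D m → Bool
      g E F = Un.clean N₂ (alt E F)

      g-shift : ∀ E F → g F (rot E) ≡ g E F
      g-shift E F = trans (cong (Un.clean N₂) (alt-shift E F)) (Un.clean-σ N₂ (λ z → trans (σⁿ≡rotⁿ N₂ z) (rotⁿ-length z)) (alt E F))

      g⇒¬bad : ∀ E F → g E F ≡ true → ∀ i → i < N₂ → bad (rotⁿ i (alt E F)) ≡ false
      g⇒¬bad E F gEF i i< = trans (cong bad (sym (σⁿ≡rotⁿ i (alt E F)))) (Un.clean⇒¬bad N₂ (alt E F) gEF i i<)

      ¬thin⇒N : ∀ {r} → 0 < r → (E F : Vec D (suc r)) → thins (alt E F) ≡ false → N (head E) (head F) (head (rot E)) ≡ true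
      ¬thin⇒N _ (e ∷ e′ ∷ E) (f ∷ f′ ∷ F) h = cong not h

      g-N : ∀ E F → g E F ≡ true → N (head E) (head F) (head (rot E)) ≡ true
      g-N E F gEF = ¬thin⇒N (≤-trans (s≤s z≤n) (m≤n+m (suc k′) k′)) E F (¬bad-thins (alt E F) (g⇒¬bad E F gEF 0 (s≤s z≤n)))

      total≡ : CG.total m ≡ wt
      total≡ = trans (∑-cong (vecs ds m) λ E → ∑-cong (vecs ds m) λ F → sym (cyc-alt τ E F)) (∑-alt m (Wτ τ))

      g-dense : CG.total m ≤ 2 * (∑[ E ∈ vecs ds m ] ∑[ F ∈ vecs ds m ] CG.cyc E F * 𝟙 (g E F))
      g-dense = subst₂ (λ s t → s ≤ 2 * t) (sym total≡) (trans (sym (∑-alt m (λ z → Wτ τ z * 𝟙 (Un.clean N₂ z))))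
        (∑-cong (vecs ds m) λ E → ∑-cong (vecs ds m) λ F → cong (_* 𝟙 (g E F)) (cyc-alt τ E F))) (Un.half-clean N₂ bad-sum)

      positive : 0 < CG.total m
      positive = subst (0 <_) (sym total≡) (n≢0⇒n>0 λ eq → <⇒≱ (*-mono-≤ (m^n>0 L₂ {{>-nonZero (!>0 Δ)}} N₂) (m^n>0 L {{>-nonZero (!>0 (Δ + δ))}} N₂))
        (≤-trans lower (≤-reflexive (trans (cong (κ *_) eq) (*-zeroʳ κ)))))

      2Z≤t : 2 * Z ≤ t
      2Z≤t = begin
        2 * Z                          ≡⟨ lem Z ⟩
        2 * Z * (1 * 1) * (1 * 1) * 1  ≤⟨ *-mono-≤ (*-mono-≤ (*-mono-≤ (*-monoˡ-≤ Z (m≤m+n 2 46)) (*-mono-≤ 0<T₁ 0<T₁)) (*-mono-≤ 1≤N₂ 1≤N₂)) 0<κ ⟩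
        48 * Z * (T₁ * T₁) * (N₂ * N₂) * κ ≤⟨ t-large ⟩
        t ∎
        where
        open ≤-Reasoning
        lem : ∀ z → 2 * z ≡ 2 * z * (1 * 1) * (1 * 1) * 1
        lem = solve-∀

    heavy-contains : (j A₂ : ℕ) → j + suc j ≤ suc p → 2 * (length os * length os) ^ m ≤ A₂ ^ (suc j + suc j) → 0 < A₂ →
      (let ℓ = suc (suc p)) →
      2 * 2 * A₂ * (2 * (ℓ + ℓ) * (2 * (ℓ + ℓ))) * (ℓ * ((m + m) * m)) ≤ Z →
      Contains G (H (suc k′) ℓ)
    heavy-contains j A₂ j≤ size₂ 0<A₂ small =
      CH.contains-H Z (spread 2Z≤t) g g-shift g-N g-dense positive (λ E F gEF → ¬bad⇒distinct E F (g⇒¬bad E F gEF))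
        j A₂ j≤ (≤-trans (≤-reflexive columns) size₂) 0<A₂ small
      where
      columns = trans (length-columns ds m) (cong (λ t → 2 * t ^ m) (trans (length-∑ ds) (trans (∑∑-product os os (λ _ → 1))
        (trans (∑-cong os λ _ → sym (length-∑ os)) (∑-const os (length os))))))

-- The dichotomy between few and many heavy pairs

m<[1+m/n]*n : ∀ m n .{{_ : NonZero n}} → m < suc (m div n) * n
m<[1+m/n]*n m n = begin-strict
  m                    ≡⟨ m≡m%n+[m/n]*n m n ⟩
  m % n + m div n * n    <⟨ +-monoˡ-< (m div n * n) (m%n<n m n) ⟩
  suc (m div n) * n      ∎
  where open ≤-Reasoning

module _ {n : ℕ} (G : Graph (Fin n)) (C : Cover G) (k′ p t S Z : ℕ) where

  open Cover C
  open RegularCase G C k′ t S Z using (edges; #heavy; #heavy₂; heavy)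

  private
    k = suc k′
    m′ = k′ + suc k′
    m = suc m′
    N₂ = m * 2
    ℓ = suc (suc p)

    heavy-pairs : O → ℕ
    heavy-pairs x = ∑[ w ∈ os ] 𝟙 (adj x w) * #heavy x w

    heavy-pairs≡ : ∀ x δ 0<t 0<δ → (∑[ q ∈ os ] ∑ os (HeavyCase.c G C k′ t Z x δ 0<t 0<δ q)) ≡ heavy-pairs x
    heavy-pairs≡ x δ 0<t 0<δ = trans (∑-swap os os _) (∑-cong os λ w → trans (∑-cong os λ u →
        trans (𝟙-∧ (adj x u ∧ adj x w) (heavy u w)) (trans (cong (_* 𝟙 (heavy u w)) (𝟙-∧ (adj x u) (adj x w))) (xy∙z≈y∙xz (𝟙 (adj x u)) (𝟙 (adj x w)) _)))
      (∑-*ˡ os (𝟙 (adj x w)) _))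

  -- If the heavy pairs are not few, averaging over the middle vertex finds a neighbourhood with
  -- more than Δ² / T₁ of them, where T₁ = 800 S: 8 from the definition of few, 100 from the
  -- density. Numerals enter as variables with an equation, so that products with them do not
  -- unfold.
  local-contains : ∀ q → 100 * 8 ≡ q → 2 ≤ q → 0 < t → 0 < S → 0 < Z → 0 < length os → length os * Δ ≤ 100 * edges →
    q * S * suc (suc (m′ + m′)) ≤ Δ →
    ∀ A → length os ≤ A ^ (m + m) → 200 * 200 * A * (4 * (m * 4) * (4 * (m * 4))) ≤ S →
    ∀ κ → (200 * 200) ^ m * (200 * 200) ^ m ≡ κ → 4 * (m * 4) * (Z * (t + t) * length os) * κ ≤ Δ * Δ * Δ →
    48 * Z * (q * S * (q * S)) * (N₂ * N₂) * ((2 * 2) ^ k * (2 * 2) ^ k) ≤ t →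
    ∀ j A₂ → j + suc j ≤ suc p → 2 * (length os * length os) ^ m ≤ A₂ ^ (suc j + suc j) → 0 < A₂ →
    2 * 2 * A₂ * (2 * (ℓ + ℓ) * (2 * (ℓ + ℓ))) * (ℓ * ((m + m) * m)) ≤ Z →
    Contains G (H k ℓ)
  local-contains q q≡ 2≤q 0<t 0<S 0<Z 0<os dense a A b₁ b₂ κ κ≡ c d j A₂ e₁ e₂ e₃ e₄ = cases (8 * S * #heavy₂ ≤? Δ * edges)
    where
    open ≤-Reasoning
    2Sℓ≤Δ : 2 * S * suc (suc (m′ + m′)) ≤ Δ
    2Sℓ≤Δ = ≤-trans (*-monoˡ-≤ (suc (suc (m′ + m′))) (*-monoˡ-≤ S 2≤q)) a
    0<Δ : 0 < Δ
    0<Δ = <-≤-trans (*-mono-≤ (*-mono-≤ {1} {2} (s≤s z≤n) 0<S) (s≤s z≤n)) 2Sℓ≤Δ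
    T₁ = q * S
    lem₁ : ∀ e d → 100 * e * d ≡ 100 * (d * e)
    lem₁ e d = trans (*-assoc 100 e d) (cong (100 *_) (*-comm e d))
    lem₂ : ∀ s h → 100 * (8 * s * h) ≡ q * s * h
    lem₂ s h = trans (sym (*-assoc 100 (8 * s) h)) (cong (_* h) (trans (sym (*-assoc 100 8 s)) (cong (_* s) q≡)))
    0<T₁ : 0 < T₁
    0<T₁ = *-mono-≤ {1} {q} (≤-trans (s≤s z≤n) 2≤q) 0<S
    T₁≤Δ : T₁ ≤ Δ
    T₁≤Δ = ≤-trans (≤-trans (≤-reflexive (sym (*-identityʳ T₁))) (*-monoʳ-≤ T₁ {1} {suc (suc (m′ + m′))} (s≤s z≤n))) a
    heavy-case : (∃ λ x → Δ * Δ < T₁ * heavy-pairs x) → Contains G (H k ℓ)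
    heavy-case (x , big) = HeavyContains.heavy-contains G C k′ p t Z x δ 0<t 0<δ T₁ 0<T₁ 0<Z
      (subst (λ h → Δ * Δ < T₁ * h) (sym (heavy-pairs≡ x δ 0<t 0<δ)) big) (m/n*n≤m Δ T₁) Δ≤ d j A₂ e₁ e₂ e₃ e₄
      where
      instance
        nz = >-nonZero 0<T₁
      δ = Δ div T₁
      0<δ : 0 < δ
      0<δ = m≥n⇒m/n>0 T₁≤Δ
      Δ≤ : Δ ≤ 2 * T₁ * δ
      Δ≤ = begin
        Δ              ≤⟨ <⇒≤ (m<[1+m/n]*n Δ T₁) ⟩
        suc δ * T₁     ≤⟨ *-monoˡ-≤ T₁ (+-monoˡ-≤ δ 0<δ) ⟩
        (δ + δ) * T₁   ≡⟨ lem δ T₁ ⟩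
        2 * T₁ * δ     ∎
        where
        lem : ∀ d t → (d + d) * t ≡ 2 * t * d
        lem = solve-∀
    cases : Dec (8 * S * #heavy₂ ≤ Δ * edges) → Contains G (H k ℓ)
    cases (yes few) = RegularContains.regular-contains G C k′ p t S Z few 0<Δ 0<S 2Sℓ≤Δ dense 0<os A b₁ b₂ κ κ≡ c j A₂ e₁ e₂ e₃ e₄
    cases (no many) = heavy-case (∑-exists os (λ _ → Δ * Δ) (λ x → T₁ * heavy-pairs x) (begin-strict
      (∑[ x ∈ os ] Δ * Δ)              ≡⟨ ∑-const os (Δ * Δ) ⟩
      length os * (Δ * Δ)              ≡⟨ *-assoc (length os) Δ Δ ⟨
      length os * Δ * Δ                ≤⟨ *-monoˡ-≤ Δ dense ⟩
      100 * edges * Δ                  ≡⟨ lem₁ edges Δ ⟩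
      100 * (Δ * edges)                <⟨ *-monoʳ-< 100 (≰⇒> many) ⟩
      100 * (8 * S * #heavy₂)          ≡⟨ lem₂ S #heavy₂ ⟩
      T₁ * #heavy₂                     ≡⟨ ∑-*ˡ os T₁ heavy-pairs ⟨
      (∑[ x ∈ os ] T₁ * heavy-pairs x) ∎))

-- The choice of the parameters

cube-cancel-≤ : ∀ x y → x * x * x ≤ y * y * y → x ≤ y
cube-cancel-≤ x y h with x ≤? y
... | yes p = p
... | no  q = ⊥-elim (<⇒≱ (*-mono-< (*-mono-< (≰⇒> q) (≰⇒> q)) (≰⇒> q)) h)

halve : ∀ p → ∃ λ j → j + j ≤ p × p ≤ suc (j + j)
halve zero          = 0 , z≤n , z≤n
halve (suc zero)    = 0 , z≤n , ≤-refl
halve (suc (suc p)) with j , l , u ← halve p =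
  suc j , s≤s (subst (_≤ suc p) (sym (+-suc j j)) (s≤s l)) , s≤s (s≤s (subst (p ≤_) (sym (+-suc j j)) u))

module _ (k′ p : ℕ) where

  private
    k = suc k′
    m′ = k′ + suc k′
    m = suc m′
    N₂ = m * 2
    ℓ = suc (suc p)
    ℓ₁ = suc (suc (m′ + m′))
    B = 4 * (m * 4)
    q₂ = (2 * (ℓ + ℓ) * (2 * (ℓ + ℓ))) * (ℓ * ((m + m) * m))

  module _ (q d cS c₂ cZ cₜ κ κ₂ C₇ : ℕ) (q≡ : 100 * 8 ≡ q) (2≤q : 2 ≤ q)
    (d≡ : 200 * 200 ≡ d) (0<cS : 0 < cS) (0<cZ : 0 < cZ) (0<cₜ : 0 < cₜ)
    (hS : d * 2 * (B * B) ≤ cS) (h₂ : 2 * 4 ^ m ≤ c₂) (hZ : 2 * 2 * c₂ * q₂ ≤ cZ)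
    (κ≡ : (200 * 200) ^ m * (200 * 200) ^ m ≡ κ) (κ₂≡ : (2 * 2) ^ k * (2 * 2) ^ k ≡ κ₂)
    (hₜ : 48 * cZ * (q * cS * (q * cS)) * (N₂ * N₂) * κ₂ ≤ cₜ)
    (h₇ : B * (cZ * (cₜ + cₜ) * 2) * κ ≤ C₇) (h₇′ : q * cS * ℓ₁ * (q * cS * ℓ₁) * (q * cS * ℓ₁) ≤ C₇)
    {n : ℕ} (G : Graph (Fin n)) (C : Cover G) (s b z : ℕ) where

    open Cover C

    -- `b` and `z` play the roles of s^(1/m) and s^(4 m / ℓ). The order 2 s of the cover makes S a
    -- multiple of b, the number of columns makes Z a multiple of z, and the heavy case makes t a
    -- multiple of Z S², that is of z b². The thin steps then require Δ³ to exceed a multiple of s Z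
    -- t.
    params-contains′ : 1 ≤ b → b ≤ s → 1 ≤ z → s ≤ b ^ m → s ^ m * s ^ m * (s ^ m * s ^ m) ≤ z ^ ℓ →
      0 < length os → length os ≤ 2 * s → length os * Δ ≤ 100 * (∑[ x ∈ os ] ∑[ w ∈ os ] 𝟙 (adj x w)) →
      C₇ * (s * (b * b * (z * z))) ≤ Δ * Δ * Δ → Contains G (H k ℓ)
    params-contains′ 1≤b b≤s 1≤z s≤bᵐ s≤zˡ 0<os os≤2s dense large =
      local-contains G C k′ p t S Z q q≡ 2≤q (*-mono-≤ 0<cₜ (*-mono-≤ 1≤z (*-mono-≤ 1≤b 1≤b))) (*-mono-≤ 0<cS 1≤b) (*-mono-≤ 0<cZ 1≤z)
        0<os dense Δ≥ (2 * b) size S-large κ κ≡ Δ³≥ t-large j (c₂ * z) (≤-trans (≤-reflexive (+-suc j j)) (s≤s j+j≤p)) size₂ 0<A₂ small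
      where
      open ≤-Reasoning
      S = cS * b
      Z = cZ * z
      t = cₜ * (z * (b * b))
      -- `hh` becomes the largest even number up to ℓ, and the half-length `j + suc j` stays below
      -- that of the cyclic sequence of columns.
      j = proj₁ (halve p)
      j+j≤p = proj₁ (proj₂ (halve p))
      p≤ = proj₂ (proj₂ (halve p))
      hh = suc j + suc j
      w = q * cS * ℓ₁
      S-large : 200 * 200 * (2 * b) * (B * B) ≤ S
      S-large = begin
        200 * 200 * (2 * b) * (B * B) ≡⟨ cong (λ x → x * (2 * b) * (B * B)) d≡ ⟩
        d * (2 * b) * (B * B)         ≡⟨ lem d b (B * B) ⟩
        d * 2 * (B * B) * b           ≤⟨ *-monoˡ-≤ b hS ⟩
        cS * b                        ∎
        where
        lem : ∀ d b e → d * (2 * b) * e ≡ d * 2 * e * b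
        lem = solve-∀
      size : length os ≤ (2 * b) ^ (m + m)
      size = begin
        length os                         ≤⟨ os≤2s ⟩
        2 * s                             ≤⟨ *-monoʳ-≤ 2 s≤bᵐ ⟩
        2 * b ^ m                         ≤⟨ *-mono-≤ {2} {2 ^ m} (m≤m*n 2 (2 ^ m′) {{m^n≢0 2 m′}}) ≤-refl ⟩
        2 ^ m * b ^ m                     ≡⟨ *-^ 2 b m ⟨
        (2 * b) ^ m                       ≤⟨ m≤m*n ((2 * b) ^ m) ((2 * b) ^ m) {{>-nonZero (m^n>0 (2 * b) {{>-nonZero (*-mono-≤ {1} {2} (s≤s z≤n) 1≤b)}} m)}} ⟩
        (2 * b) ^ m * (2 * b) ^ m         ≡⟨ ^-distribˡ-+-* (2 * b) m m ⟨
        (2 * b) ^ (m + m)                 ∎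
      0<c₂ : 0 < c₂
      0<c₂ = <-≤-trans (*-mono-≤ {1} {2} (s≤s z≤n) (m^n>0 4 m)) h₂
      0<A₂ : 0 < c₂ * z
      0<A₂ = *-mono-≤ 0<c₂ 1≤z
      ℓ≤2hh : ℓ ≤ hh + hh
      ℓ≤2hh = begin
        suc (suc p)              ≤⟨ s≤s (s≤s p≤) ⟩
        suc (suc (suc (j + j)))  ≤⟨ m≤m+n _ (suc (j + j)) ⟩
        suc (suc (suc (j + j))) + suc (j + j) ≡⟨ lem j ⟩
        hh + hh                  ∎
        where
        lem : ∀ j → suc (suc (suc (j + j))) + suc (j + j) ≡ suc j + suc j + (suc j + suc j)
        lem = solve-∀
      sᵐ≤ : s ^ m * s ^ m ≤ z ^ hh
      sᵐ≤ = sq-cancel-≤ _ _ (begin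
        s ^ m * s ^ m * (s ^ m * s ^ m)  ≤⟨ s≤zˡ ⟩
        z ^ ℓ                            ≤⟨ ^-monoʳ-≤ z {{>-nonZero 1≤z}} ℓ≤2hh ⟩
        z ^ (hh + hh)                    ≡⟨ ^-distribˡ-+-* z hh hh ⟩
        z ^ hh * z ^ hh                  ∎)
      size₂ : 2 * (length os * length os) ^ m ≤ (c₂ * z) ^ hh
      size₂ = begin
        2 * (length os * length os) ^ m     ≤⟨ *-monoʳ-≤ 2 (^-monoˡ-≤ m (*-mono-≤ os≤2s os≤2s)) ⟩
        2 * (2 * s * (2 * s)) ^ m           ≡⟨ cong (λ x → 2 * x ^ m) (lem s) ⟩
        2 * (4 * (s * s)) ^ m               ≡⟨ cong (2 *_) (trans (*-^ 4 (s * s) m) (cong (4 ^ m *_) (*-^ s s m))) ⟩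
        2 * (4 ^ m * (s ^ m * s ^ m))       ≡⟨ *-assoc 2 (4 ^ m) _ ⟨
        2 * 4 ^ m * (s ^ m * s ^ m)         ≤⟨ *-mono-≤ (≤-trans h₂ (m≤m*n c₂ (c₂ ^ (j + suc j)) {{>-nonZero (m^n>0 c₂ {{>-nonZero 0<c₂}} (j + suc j))}})) sᵐ≤ ⟩
        c₂ ^ hh * z ^ hh                    ≡⟨ *-^ c₂ z hh ⟨
        (c₂ * z) ^ hh                       ∎
        where
        lem : ∀ s → 2 * s * (2 * s) ≡ 4 * (s * s)
        lem = solve-∀
      small : 2 * 2 * (c₂ * z) * (2 * (ℓ + ℓ) * (2 * (ℓ + ℓ))) * (ℓ * ((m + m) * m)) ≤ Z
      small = begin
        2 * 2 * (c₂ * z) * (2 * (ℓ + ℓ) * (2 * (ℓ + ℓ))) * (ℓ * ((m + m) * m)) ≡⟨ lem (2 * 2) c₂ z _ _ ⟩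
        2 * 2 * c₂ * q₂ * z  ≤⟨ *-monoˡ-≤ z hZ ⟩
        cZ * z               ∎
        where
        lem : ∀ a c z x y → a * (c * z) * x * y ≡ a * c * (x * y) * z
        lem = solve-∀
      t-large : 48 * Z * (q * S * (q * S)) * (N₂ * N₂) * ((2 * 2) ^ k * (2 * 2) ^ k) ≤ t
      t-large = begin
        48 * Z * (q * S * (q * S)) * (N₂ * N₂) * ((2 * 2) ^ k * (2 * 2) ^ k) ≡⟨ cong (48 * Z * (q * S * (q * S)) * (N₂ * N₂) *_) κ₂≡ ⟩
        48 * (cZ * z) * (q * (cS * b) * (q * (cS * b))) * (N₂ * N₂) * κ₂ ≡⟨ lem 48 cZ z q cS b (N₂ * N₂) κ₂ ⟩
        48 * cZ * (q * cS * (q * cS)) * (N₂ * N₂) * κ₂ * (z * (b * b)) ≤⟨ *-monoˡ-≤ (z * (b * b)) hₜ ⟩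
        t ∎
        where
        lem : ∀ a c z q s b n k → a * (c * z) * (q * (s * b) * (q * (s * b))) * n * k ≡ a * c * (q * s * (q * s)) * n * k * (z * (b * b))
        lem = solve-∀
      Δ³≥ : B * (Z * (t + t) * length os) * κ ≤ Δ * Δ * Δ
      Δ³≥ = begin
        B * (Z * (t + t) * length os) * κ      ≤⟨ *-monoˡ-≤ κ (*-monoʳ-≤ B (*-monoʳ-≤ (Z * (t + t)) os≤2s)) ⟩
        B * (Z * (t + t) * (2 * s)) * κ        ≡⟨ lem B cZ z cₜ (b * b) s κ ⟩
        B * (cZ * (cₜ + cₜ) * 2) * κ * (s * (b * b * (z * z))) ≤⟨ *-monoˡ-≤ _ h₇ ⟩
        C₇ * (s * (b * b * (z * z)))           ≤⟨ large ⟩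
        Δ * Δ * Δ                              ∎
        where
        lem : ∀ B c z t b s k → B * (c * z * (t * (z * b) + t * (z * b)) * (2 * s)) * k ≡ B * (c * (t + t) * 2) * k * (s * (b * (z * z)))
        lem = solve-∀
      -- A bound linear in b; its cube is covered by s b² z², because b ≤ s and 1 ≤ z.
      Δ≥ : q * S * ℓ₁ ≤ Δ
      Δ≥ = cube-cancel-≤ _ _ (begin
        q * S * ℓ₁ * (q * S * ℓ₁) * (q * S * ℓ₁) ≡⟨ lem q cS b ℓ₁ ⟩
        w * w * w * (b * (b * b * (1 * 1)))      ≤⟨ *-mono-≤ h₇′ (*-mono-≤ b≤s (*-monoʳ-≤ (b * b) (*-mono-≤ 1≤z 1≤z))) ⟩
        C₇ * (s * (b * b * (z * z)))             ≤⟨ large ⟩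
        Δ * Δ * Δ                                ∎)
        where
        lem : ∀ q c b l → q * (c * b) * l * (q * (c * b) * l) * (q * (c * b) * l) ≡ q * c * l * (q * c * l) * (q * c * l) * (b * (b * b * (1 * 1)))
        lem = solve-∀

  Sufficient : ℕ → Set₁
  Sufficient C₇ = ∀ {n : ℕ} (G : Graph (Fin n)) (C : Cover G) (let open Cover C) (s b z : ℕ) →
    1 ≤ b → b ≤ s → 1 ≤ z → s ≤ b ^ m → s ^ m * s ^ m * (s ^ m * s ^ m) ≤ z ^ ℓ →
    0 < length os → length os ≤ 2 * s → length os * Δ ≤ 100 * (∑[ x ∈ os ] ∑[ w ∈ os ] 𝟙 (adj x w)) →
    C₇ * (s * (b * b * (z * z))) ≤ Δ * Δ * Δ → Contains G (H k ℓ)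

  private
    constant′ : ∃ Sufficient
    constant′ = choose (100 * 8) (200 * 200) refl (s≤s (s≤s z≤n)) refl ((200 * 200) ^ m * (200 * 200) ^ m) refl ((2 * 2) ^ k * (2 * 2) ^ k) refl
      where
      choose : ∀ q d → 100 * 8 ≡ q → 2 ≤ q → 200 * 200 ≡ d → ∀ κ → (200 * 200) ^ m * (200 * 200) ^ m ≡ κ →
        ∀ κ₂ → (2 * 2) ^ k * (2 * 2) ^ k ≡ κ₂ → ∃ Sufficient
      -- C₆ serves the condition `Δ³≥`, the cube of w the condition `Δ≥`.
      choose q d q≡ 2≤q d≡ κ κ≡ κ₂ κ₂≡ = C₆ + w * w * w , λ G C s b z →
        params-contains′ q d cS c₂ cZ cₜ κ κ₂ (C₆ + w * w * w) q≡ 2≤q d≡ (s≤s z≤n) (s≤s z≤n) (s≤s z≤n)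
          (n≤1+n _) ≤-refl (n≤1+n _) κ≡ κ₂≡ (n≤1+n _) (m≤m+n C₆ _) (m≤n+m _ C₆) G C s b z
        where
        cS c₂ cZ cₜ C₆ w : ℕ
        cS = suc (d * 2 * (B * B))
        c₂ = 2 * 4 ^ m
        cZ = suc (2 * 2 * c₂ * q₂)
        cₜ = suc (48 * cZ * (q * cS * (q * cS)) * (N₂ * N₂) * κ₂)
        C₆ = B * (cZ * (cₜ + cₜ) * 2) * κ
        w = q * cS * ℓ₁

  abstract
    constant : ∃ Sufficient
    constant = constant′

-- Integer roots and sublists of large weight

^-cancelˡ-≤ : ∀ m {x y} → .{{NonZero m}} → x ^ m ≤ y ^ m → x ≤ y
^-cancelˡ-≤ m {x} {y} h with x ≤? y
... | yes p = p
... | no  q = ⊥-elim (<⇒≱ (^-monoˡ-< m (≰⇒> q)) h)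

root : ∀ m N c → N ≤ c ^ suc m → ∃ λ b → b ≤ c × N ≤ b ^ suc m × (b ≡ 0 ⊎ ∃ λ b′ → b ≡ suc b′ × b′ ^ suc m < N)
root m N zero    h = 0 , z≤n , h , inj₁ refl
root m N (suc c) h with N ≤? c ^ suc m
... | yes p with b , b≤c , rest ← root m N c p = b , m≤n⇒m≤1+n b≤c , rest
... | no  q = suc c , ≤-refl , h , inj₂ (c , refl , ≰⇒> q)

-- For the least b > 1, the failure of b - 1 together with b ≤ 2 (b - 1) yields the upper bound; for
-- b = 1 the latter is immediate.
least-root : ∀ m N → 1 ≤ N → ∃ λ b → 1 ≤ b × b ≤ N × N ≤ b ^ suc m × b ^ suc m ≤ 2 ^ suc m * N
least-root m N 1≤N with root m N N (m≤m*n N (N ^ m) {{>-nonZero (m^n>0 N {{>-nonZero 1≤N}} m)}})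
... | .0       , b≤N , lo , inj₁ refl = ⊥-elim (<⇒≱ 1≤N lo)
... | .1       , b≤N , lo , inj₂ (zero , refl , hi) = 1 , s≤s z≤n , b≤N , lo ,
        ≤-trans (≤-reflexive (^-zeroˡ (suc m))) (*-mono-≤ (m^n>0 2 (suc m)) 1≤N)
... | suc b    , b≤N , lo , inj₂ (suc b′ , refl , hi) = suc b , s≤s z≤n , b≤N , lo , (begin
        suc (suc b′) ^ suc m         ≤⟨ ^-monoˡ-≤ (suc m) (s≤s (s≤s (m≤m+n b′ b′))) ⟩
        (2 + (b′ + b′)) ^ suc m      ≡⟨ cong (_^ suc m) (lem b′) ⟩
        (2 * suc b′) ^ suc m         ≡⟨ *-^ 2 (suc b′) (suc m) ⟩
        2 ^ suc m * suc b′ ^ suc m   ≤⟨ *-monoʳ-≤ (2 ^ suc m) (<⇒≤ hi) ⟩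
        2 ^ suc m * N                ∎)
  where
  open ≤-Reasoning
  lem : ∀ b → 2 + (b + b) ≡ 2 * suc b
  lem = solve-∀

remove-light : ∀ {X : Set} (f : X → ℕ) x xs → ∃₂ λ b ys → (∀ h → ∑ (x ∷ xs) h ≡ h b + ∑ ys h) ×
  length ys ≡ length xs × f b * length (x ∷ xs) ≤ ∑ (x ∷ xs) f
remove-light f x []        = x , [] , (λ h → refl) , refl , ≤-reflexive (trans (*-identityʳ (f x)) (sym (+-identityʳ (f x))))
remove-light f x (x′ ∷ xs) with b , ys , eq , len , le ← remove-light f x′ xs | f x ≤? f b
... | yes fx≤fb = x , x′ ∷ xs , (λ h → refl) , refl ,
      ≤-trans (≤-reflexive (*-suc (f x) _)) (+-monoʳ-≤ (f x) (≤-trans (*-monoˡ-≤ (length (x′ ∷ xs)) fx≤fb) le))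
... | no  fx≰fb = b , x ∷ ys , (λ h → trans (cong (_+_ (h x)) (eq h)) (lem (h x) (h b) (∑ ys h))) , cong suc len ,
      ≤-trans (≤-reflexive (*-suc (f b) _)) (+-mono-≤ (<⇒≤ (≰⇒> fx≰fb)) le)
  where
  lem : ∀ a b c → a + (b + c) ≡ b + (a + c)
  lem = solve-∀

-- Removing an element of at most average weight never lowers the average, so this is repeated until
-- σ elements remain. Comparing the sums of all functions `h` expresses that the result is a
-- sub-multiset, which is what `Once` needs.
heavy-sublist : ∀ {X : Set} (f : X → ℕ) σ d xs → length xs ≡ d + σ → ∃ λ ys → length ys ≡ σ × (∀ h → ∑ ys h ≤ ∑ xs h) ×
  σ * ∑ xs f ≤ ∑ ys f * length xs
heavy-sublist f σ zero    xs len = xs , len , (λ h → ≤-refl) , ≤-reflexive (trans (cong (_* ∑ xs f) (sym len)) (*-comm (length xs) _))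
heavy-sublist f σ (suc d) (x ∷ xs) len with b , ys , eq , len′ , light ← remove-light f x xs
  with zs , lenz , sub , avg ← heavy-sublist f σ d ys (trans len′ (suc-injective len)) =
  zs , lenz , (λ h → ≤-trans (sub h) (≤-trans (m≤n+m _ (h b)) (≤-reflexive (sym (eq h))))) , scale (length ys) refl
  where
  open ≤-Reasoning
  Σx = ∑ (x ∷ xs) f
  scale : ∀ l → length ys ≡ l → σ * Σx ≤ ∑ zs f * suc (length xs)
  scale zero    eq₀ = subst (λ s → s * Σx ≤ ∑ zs f * suc (length xs)) (sym (m+n≡0⇒n≡0 d (trans (sym (suc-injective len)) (trans (sym len′) eq₀)))) z≤n
  scale (suc l) eq₀ = *-cancelˡ-≤ (length ys) {{>-nonZero (subst (0 <_) (sym eq₀) (s≤s z≤n))}} (begin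
    length ys * (σ * Σx)                       ≡⟨ x∙yz≈y∙xz (length ys) σ Σx ⟩
    σ * (length ys * Σx)                       ≤⟨ *-monoʳ-≤ σ shrink ⟩
    σ * (suc (length ys) * ∑ ys f)             ≡⟨ x∙yz≈y∙xz σ (suc (length ys)) (∑ ys f) ⟩
    suc (length ys) * (σ * ∑ ys f)             ≤⟨ *-monoʳ-≤ (suc (length ys)) avg ⟩
    suc (length ys) * (∑ zs f * length ys)     ≡⟨ lem₃ (suc (length ys)) (∑ zs f) (length ys) ⟩
    length ys * (∑ zs f * suc (length ys))     ≡⟨ cong (λ l → length ys * (∑ zs f * suc l)) len′ ⟩
    length ys * (∑ zs f * suc (length xs))     ∎)
    where
    lem₃ : ∀ a b c → a * (b * c) ≡ c * (b * a)
    lem₃ = solve-∀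
    shrink : length ys * Σx ≤ suc (length ys) * ∑ ys f
    shrink = +-cancelˡ-≤ Σx _ _ (begin
      Σx + length ys * Σx                          ≡⟨ cong (suc (length ys) *_) (eq f) ⟩
      suc (length ys) * (f b + ∑ ys f)             ≡⟨ *-distribˡ-+ (suc (length ys)) (f b) _ ⟩
      suc (length ys) * f b + suc (length ys) * ∑ ys f ≤⟨ +-monoˡ-≤ _ (≤-trans (≤-reflexive (trans (*-comm (suc (length ys)) (f b)) (cong (λ l → f b * suc l) len′))) light) ⟩
      Σx + suc (length ys) * ∑ ys f                ∎)

∑-split : ∀ {X : Set} (q : X → Bool) xs f → ∑ xs f ≡ ∑ (filterᵇ q xs) f + ∑ (filterᵇ (λ x → not (q x)) xs) f
∑-split q []       f = refl
∑-split q (x ∷ xs) f with q x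
... | true  = trans (cong (_+_ (f x)) (∑-split q xs f)) (sym (+-assoc (f x) (∑ (filterᵇ q xs) f) (∑ (filterᵇ (λ x → not (q x)) xs) f)))
... | false = trans (cong (_+_ (f x)) (∑-split q xs f)) (lem (f x) (∑ (filterᵇ q xs) f) (∑ (filterᵇ (λ x → not (q x)) xs) f))
  where
  lem : ∀ a b c → a + (b + c) ≡ b + (a + c)
  lem = solve-∀

∑-filter-≤ : ∀ {X : Set} (q : X → Bool) xs f → ∑ (filterᵇ q xs) f ≤ ∑ xs f
∑-filter-≤ q xs f = subst (∑ (filterᵇ q xs) f ≤_) (sym (∑-split q xs f)) (m≤m+n _ _)

∑-filter-mono : ∀ {X : Set} (q : X → Bool) xs f g → (∀ x → q x ≡ true → f x ≤ g x) → ∑ (filterᵇ q xs) f ≤ ∑ (filterᵇ q xs) g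
∑-filter-mono q []       f g h = z≤n
∑-filter-mono q (x ∷ xs) f g h with q x in eq
... | true  = +-mono-≤ (h x eq) (∑-filter-mono q xs f g h)
... | false = ∑-filter-mono q xs f g h

-- A set S of vertices of degree far above average that carries a fixed
-- proportion of the edges spans, with the best |S| vertices on the other
-- side, a graph that is denser relative to its order.

module _ (r g : ℕ) (0<r : 0 < r) (r≤2g : r ≤ 2 * g) where

  -- Density means e / s^(1 + g/q), with q = r + g. Were it to drop, e′ ≥ σ x / s would give (x/e)^q
  -- ≤ (σ/s)^g, and σ/s ≤ x / (64 e) then 64^g x^r ≤ e^r. But e < 8 x, and 8^r ≤ 64^g because r ≤ 2
  -- g: this is how an eighth of the edges and the factor 64 fit together.
  denser : ∀ e x e′ s σ → 0 < s → 0 < σ → σ * x ≤ e′ * s → σ * (64 * e) ≤ s * x → e < 8 * x →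
    e ^ (r + g) * σ ^ (r + g + g) ≤ e′ ^ (r + g) * s ^ (r + g + g)
  denser e x e′ s σ 0<s 0<σ avg high e<8x with e′ ^ (r + g) * s ^ (r + g + g) <? e ^ (r + g) * σ ^ (r + g + g)
  ... | no  q = ≮⇒≥ q
  ... | yes lt = ⊥-elim (<⇒≱ final (≤-trans (≤-reflexive (lem₀ (x ^ r) (64 ^ g))) (*-cancelʳ-≤ _ _ (e ^ g) {{m^n≢0 e g {{>-nonZero 0<e}}}} step₃)))
    where
    open ≤-Reasoning
    q = r + g
    0<x : 0 < x
    0<x = n≢0⇒n>0 λ x≡0 → n≮0 (subst (e <_) (trans (cong (8 *_) x≡0) refl) e<8x)
    lem₀ : ∀ a b → a * b ≡ b * a
    lem₀ = *-comm
    0<e : 0 < e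
    0<e = n≢0⇒n>0 λ e≡0 → n≮0 (subst (λ e → e′ ^ q * s ^ (q + g) < e ^ q * σ ^ (q + g)) e≡0 lt ⟨≤⟩ (zero-power q (≤-trans 0<r (m≤m+n r g))))
      where
      _⟨≤⟩_ : ∀ {a b} → a < b → b ≤ 0 → a < 0
      _⟨≤⟩_ = <-≤-trans
      zero-power : ∀ q → 0 < q → 0 ^ q * σ ^ (q + g) ≤ 0
      zero-power (suc q) _ = z≤n
    step₁ : x ^ q * s ^ g ≤ e ^ q * σ ^ g
    step₁ = *-cancelˡ-≤ (σ ^ q) {{m^n≢0 σ q {{>-nonZero 0<σ}}}} (begin
      σ ^ q * (x ^ q * s ^ g)            ≡⟨ trans (sym (*-assoc (σ ^ q) _ _)) (cong (_* s ^ g) (sym (*-^ σ x q))) ⟩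
      (σ * x) ^ q * s ^ g                ≤⟨ *-monoˡ-≤ (s ^ g) (^-monoˡ-≤ q avg) ⟩
      (e′ * s) ^ q * s ^ g               ≡⟨ trans (cong (_* s ^ g) (*-^ e′ s q)) (trans (*-assoc (e′ ^ q) _ _) (cong (e′ ^ q *_) (sym (^-distribˡ-+-* s q g)))) ⟩
      e′ ^ q * s ^ (q + g)               ≤⟨ <⇒≤ lt ⟩
      e ^ q * σ ^ (q + g)                ≡⟨ trans (cong (e ^ q *_) (^-distribˡ-+-* σ q g)) (x∙yz≈y∙xz (e ^ q) (σ ^ q) (σ ^ g)) ⟩
      σ ^ q * (e ^ q * σ ^ g)            ∎)
    step₂ : x ^ q * (64 ^ g * e ^ g) ≤ e ^ q * x ^ g
    step₂ = *-cancelˡ-≤ (s ^ g) {{m^n≢0 s g {{>-nonZero 0<s}}}} (begin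
      s ^ g * (x ^ q * (64 ^ g * e ^ g))   ≡⟨ x∙yz≈yx∙z (s ^ g) (x ^ q) (64 ^ g * e ^ g) ⟩
      x ^ q * s ^ g * (64 ^ g * e ^ g)     ≤⟨ *-monoˡ-≤ _ step₁ ⟩
      e ^ q * σ ^ g * (64 ^ g * e ^ g)     ≡⟨ trans (*-assoc (e ^ q) _ _) (cong (e ^ q *_) (trans (cong (σ ^ g *_) (sym (*-^ 64 e g))) (sym (*-^ σ (64 * e) g)))) ⟩
      e ^ q * (σ * (64 * e)) ^ g           ≤⟨ *-monoʳ-≤ (e ^ q) (^-monoˡ-≤ g high) ⟩
      e ^ q * (s * x) ^ g                  ≡⟨ trans (cong (e ^ q *_) (*-^ s x g)) (x∙yz≈y∙xz (e ^ q) (s ^ g) (x ^ g)) ⟩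
      s ^ g * (e ^ q * x ^ g)              ∎)
    step₃ : 64 ^ g * x ^ r * e ^ g ≤ e ^ r * e ^ g
    step₃ = *-cancelʳ-≤ _ _ (x ^ g) {{m^n≢0 x g {{>-nonZero 0<x}}}} (begin
      64 ^ g * x ^ r * e ^ g * x ^ g       ≡⟨ lem₄ (64 ^ g) (x ^ r) (e ^ g) (x ^ g) ⟩
      x ^ r * x ^ g * (64 ^ g * e ^ g)     ≡⟨ cong (_* (64 ^ g * e ^ g)) (sym (^-distribˡ-+-* x r g)) ⟩
      x ^ q * (64 ^ g * e ^ g)             ≤⟨ step₂ ⟩
      e ^ q * x ^ g                        ≡⟨ cong (_* x ^ g) (^-distribˡ-+-* e r g) ⟩
      e ^ r * e ^ g * x ^ g                ∎)
      where
      lem₄ : ∀ a b c d → a * b * c * d ≡ b * d * (a * c)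
      lem₄ = solve-∀
    final : e ^ r < x ^ r * 64 ^ g
    final = begin-strict
      e ^ r               <⟨ ^-monoˡ-< r {{>-nonZero 0<r}} e<8x ⟩
      (8 * x) ^ r         ≡⟨ *-^ 8 x r ⟩
      8 ^ r * x ^ r       ≤⟨ *-monoˡ-≤ (x ^ r) (^-monoʳ-≤ 8 r≤2g) ⟩
      8 ^ (2 * g) * x ^ r ≡⟨ cong (_* x ^ r) (sym (^-*-assoc 8 2 g)) ⟩
      64 ^ g * x ^ r      ≡⟨ *-comm (64 ^ g) (x ^ r) ⟩
      x ^ r * 64 ^ g      ∎

-- Arithmetic of the exponents

module _ {k ℓ m K g q : ℕ} (m≡ : m ≡ k + k) (K≡ : K ≡ k * ℓ) (g≡ : g ≡ K + (ℓ + 16 * (k * k))) (q≡ : q ≡ 3 * K) where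

  private
    swap-factor : ∀ a b c d → a * (b * c * d) ≡ b * (c * (a * d))
    swap-factor = solve-∀

  -- The K-th power clears all roots: 2 K = m ℓ, so b^(2 K) and z^(2 K) are powers of b^m and of
  -- z^ℓ. The exponents of s add up to K + ℓ + 4 m², which is g as m = 2 k.
  root-bound : ∀ s b z → b ^ m ≤ 2 ^ m * s → z ^ ℓ ≤ 2 ^ ℓ * (s ^ m * s ^ m * (s ^ m * s ^ m)) →
    (s * (b * b * (z * z))) ^ K ≤ (2 ^ 4) ^ K * s ^ g
  root-bound s b z bᵐ≤ zˡ≤ = begin
    (s * (b * b * (z * z))) ^ K
      ≡⟨ trans (*-^ s (b * b * (z * z)) K) (cong (s ^ K *_) (trans (*-^ (b * b) (z * z) K) (cong₂ _*_ (trans (sq-^ b) (trans (cong (b ^_) exp₁) (sym (^-*-assoc b m ℓ))))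
           (trans (sq-^ z) (trans (cong (z ^_) exp₂) (sym (^-*-assoc z ℓ m))))))) ⟩
    s ^ K * ((b ^ m) ^ ℓ * (z ^ ℓ) ^ m)
      ≤⟨ *-monoʳ-≤ (s ^ K) (*-mono-≤ (^-monoˡ-≤ ℓ bᵐ≤) (^-monoˡ-≤ m zˡ≤)) ⟩
    s ^ K * ((2 ^ m * s) ^ ℓ * (2 ^ ℓ * s⁴ᵐ) ^ m)
      ≡⟨ cong (s ^ K *_) (cong₂ _*_ (trans (*-^ (2 ^ m) s ℓ) (cong (_* s ^ ℓ) (^-*-assoc 2 m ℓ)))
           (trans (*-^ (2 ^ ℓ) s⁴ᵐ m) (cong₂ _*_ (^-*-assoc 2 ℓ m) s⁴ᵐᵐ))) ⟩
    s ^ K * (2 ^ (m * ℓ) * s ^ ℓ * (2 ^ (ℓ * m) * s ^ v))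
      ≡⟨ lem (s ^ K) (2 ^ (m * ℓ)) (s ^ ℓ) (2 ^ (ℓ * m)) (s ^ v) ⟩
    2 ^ (m * ℓ) * 2 ^ (ℓ * m) * (s ^ K * (s ^ ℓ * s ^ v))
      ≡⟨ cong₂ _*_ (trans (sym (^-distribˡ-+-* 2 (m * ℓ) (ℓ * m))) (trans (cong (2 ^_) exp₃) (sym (^-*-assoc 2 4 K))))
           (trans (cong (s ^ K *_) (sym (^-distribˡ-+-* s ℓ v))) (trans (sym (^-distribˡ-+-* s K (ℓ + v))) (cong (s ^_) (sym g≡)))) ⟩
    (2 ^ 4) ^ K * s ^ g ∎
    where
    open ≤-Reasoning
    v = 16 * (k * k)
    s⁴ᵐ = s ^ m * s ^ m * (s ^ m * s ^ m)
    lem : ∀ a b c d e → a * (b * c * (d * e)) ≡ b * d * (a * (c * e))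
    lem = solve-∀
    sq-^ : ∀ x → (x * x) ^ K ≡ x ^ (K + K)
    sq-^ x = trans (*-^ x x K) (sym (^-distribˡ-+-* x K K))
    ex₁ : ∀ k ℓ → k * ℓ + k * ℓ ≡ (k + k) * ℓ
    ex₁ = solve-∀
    exp₁ : K + K ≡ m * ℓ
    exp₁ = trans (cong₂ _+_ K≡ K≡) (trans (ex₁ k ℓ) (cong (_* ℓ) (sym m≡)))
    exp₂ : K + K ≡ ℓ * m
    exp₂ = trans exp₁ (*-comm m ℓ)
    ex₃ : ∀ k → k + k + (k + k) ≡ 4 * k
    ex₃ = solve-∀
    exp₃ : m * ℓ + ℓ * m ≡ 4 * K
    exp₃ = trans (cong₂ _+_ (sym exp₁) (sym exp₂)) (ex₃ K)
    ex₄ : ∀ k → (k + k + (k + k) + (k + k + (k + k))) * (k + k) ≡ 16 * (k * k)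
    ex₄ = solve-∀
    s⁴ᵐᵐ : s⁴ᵐ ^ m ≡ s ^ v
    s⁴ᵐᵐ = trans (cong (_^ m) (trans (cong (λ t → t * t) (sym (^-distribˡ-+-* s m m))) (sym (^-distribˡ-+-* s (m + m) (m + m)))))
      (trans (^-*-assoc s (m + m + (m + m)) m) (cong (s ^_) (trans (cong (λ m → (m + m + (m + m)) * m) m≡) (ex₄ k))))

  degree-bound : ∀ c C s e Δ → .{{NonZero s}} → C ^ q * s ^ (q + g) ≤ e ^ q → c * e ≤ Δ * s → (c * C) ^ q * s ^ g ≤ Δ ^ q
  degree-bound c C s e Δ large ce≤ = *-cancelˡ-≤ (s ^ q) {{m^n≢0 s q}} (begin
    s ^ q * ((c * C) ^ q * s ^ g)        ≡⟨ trans (cong (λ t → s ^ q * (t * s ^ g)) (*-^ c C q)) (swap-factor (s ^ q) (c ^ q) (C ^ q) (s ^ g)) ⟩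
    c ^ q * (C ^ q * (s ^ q * s ^ g))    ≡⟨ cong (λ t → c ^ q * (C ^ q * t)) (sym (^-distribˡ-+-* s q g)) ⟩
    c ^ q * (C ^ q * s ^ (q + g))        ≤⟨ *-monoʳ-≤ (c ^ q) large ⟩
    c ^ q * e ^ q                        ≡⟨ *-^ c e q ⟨
    (c * e) ^ q                          ≤⟨ ^-monoˡ-≤ q ce≤ ⟩
    (Δ * s) ^ q                          ≡⟨ trans (*-^ Δ s q) (*-comm (Δ ^ q) (s ^ q)) ⟩
    s ^ q * Δ ^ q                        ∎)
    where open ≤-Reasoning

  cube-bound : ∀ D C Y s Δ → .{{NonZero K}} → Y ^ K ≤ (2 ^ 4) ^ K * s ^ g → C * 2 ^ 4 ≤ D ^ 3 → D ^ q * s ^ g ≤ Δ ^ q → C * Y ≤ Δ * Δ * Δ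
  cube-bound D C Y s Δ Yᴷ≤ C16≤ lower = ^-cancelˡ-≤ K (begin
    (C * Y) ^ K                       ≡⟨ *-^ C Y K ⟩
    C ^ K * Y ^ K                     ≤⟨ *-monoʳ-≤ (C ^ K) Yᴷ≤ ⟩
    C ^ K * ((2 ^ 4) ^ K * s ^ g)     ≡⟨ trans (sym (*-assoc (C ^ K) _ _)) (cong (_* s ^ g) (sym (*-^ C (2 ^ 4) K))) ⟩
    (C * 2 ^ 4) ^ K * s ^ g           ≤⟨ *-monoˡ-≤ (s ^ g) (^-monoˡ-≤ K C16≤) ⟩
    (D ^ 3) ^ K * s ^ g               ≡⟨ cong (_* s ^ g) (trans (^-*-assoc D 3 K) (cong (D ^_) (sym q≡))) ⟩
    D ^ q * s ^ g                     ≤⟨ lower ⟩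
    Δ ^ q                             ≡⟨ trans (cong (Δ ^_) q≡) (trans (sym (^-*-assoc Δ 3 K)) (cong (_^ K) (lem Δ))) ⟩
    (Δ * Δ * Δ) ^ K                   ∎)
    where
    open ≤-Reasoning
    lem : ∀ d → d * (d * (d * 1)) ≡ d * d * d
    lem = solve-∀

-- Reduction to bounded degree

module BoundedDegree {n : ℕ} (G : Graph (Fin n)) (cap : ℕ) where

  open Graph G

  E : Fin n → Fin n → Bool
  E a b = does (a ~? b)

  E-sym : ∀ a b → E a b ≡ E b a
  E-sym a b with a ~? b | b ~? a
  ... | yes _ | yes _ = refl
  ... | no  _ | no  _ = refl
  ... | yes e | no ¬e = ⊥-elim (¬e (~-sym e))
  ... | no ¬e | yes e = ⊥-elim (¬e (~-sym e))

  E⇒~ : ∀ {a b} → E a b ≡ true → a ~ b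
  E⇒~ {a} {b} h with a ~? b
  ... | yes e = e

  edges : List (Fin n) → List (Fin n) → ℕ
  edges A B = ∑[ a ∈ A ] ∑[ b ∈ B ] 𝟙 (E a b)

  edges-sym : ∀ A B → edges A B ≡ edges B A
  edges-sym A B = trans (∑-swap A B _) (∑-cong B λ b → ∑-cong A λ a → cong 𝟙 (E-sym a b))

  Once : List (Fin n) → Set
  Once A = ∀ v → (∑[ a ∈ A ] 𝟙 (does (a Finₚ.≟ v))) ≤ 1

  low : ℕ → ℕ → List (Fin n) → Fin n → Bool
  low s e B a = does (s * (∑[ b ∈ B ] 𝟙 (E a b)) ≤? cap * e)

  high-part : ℕ → List (Fin n) → List (Fin n) → List (Fin n)
  high-part s A B = filterᵇ (λ a → not (low s (edges A B) B a)) A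
  module RegularPair (A B : List (Fin n)) (s Δ : ℕ) (lenA : length A ≡ s) (lenB : length B ≡ s)
    (onceA : Once A) (onceB : Once B) (0<e : 0 < edges A B) (Δs≤ : Δ * s ≤ cap * edges A B)
    (low⇒≤Δ : ∀ d → s * d ≤ cap * edges A B → d ≤ Δ)
    (smallA : 8 * edges (high-part s A B) B ≤ edges A B) (smallB : 8 * edges (high-part s B A) A ≤ edges A B) where

    private
      e = edges A B

      lowA lowB : Fin n → Bool
      lowA = low s e B
      lowB = low s e A

      A′ = filterᵇ lowA A
      B′ = filterᵇ lowB B

      e′ = edges A′ B′

    -- A vertex of G may belong to both A and B; the tag tells the two copies apart. Edges are kept
    -- only between vertices of low degree.
    adj : Bool × Fin n → Bool × Fin n → Bool
    adj (true  , a) (false , b) = E a b ∧ (lowA a ∧ lowB b)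
    adj (false , b) (true  , a) = E a b ∧ (lowA a ∧ lowB b)
    adj (true  , _) (true  , _) = false
    adj (false , _) (false , _) = false

    adj-sym : ∀ x y → adj x y ≡ adj y x
    adj-sym (true  , _) (true  , _) = refl
    adj-sym (true  , _) (false , _) = refl
    adj-sym (false , _) (true  , _) = refl
    adj-sym (false , _) (false , _) = refl

    adj⇒~ : ∀ {x y} → adj x y ≡ true → proj₂ x ~ proj₂ y
    adj⇒~ {true  , a} {false , b} h = E⇒~ (proj₁ (∧-true h))
    adj⇒~ {false , b} {true  , a} h = ~-sym (E⇒~ (proj₁ (∧-true h)))

    tag₁ tag₂ : Fin n → Bool × Fin n
    tag₁ = true ,_
    tag₂ = false ,_

    os : List (Bool × Fin n)
    os = map tag₁ A′ ++ map tag₂ B′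

    ∑-os : ∀ (φ : Bool × Fin n → ℕ) → ∑ os φ ≡ ∑ A′ (λ a → φ (true , a)) + ∑ B′ (λ b → φ (false , b))
    ∑-os φ = trans (∑-++ (map tag₁ A′) _ φ) (cong₂ _+_ (∑-map tag₁ A′ φ) (∑-map tag₂ B′ φ))

    only-B : ∀ a (φ : Fin n → ℕ) → (∑[ y ∈ os ] 𝟙 (adj (true , a) y) * φ (proj₂ y)) ≡ (∑[ b ∈ B′ ] 𝟙 (E a b ∧ (lowA a ∧ lowB b)) * φ b)
    only-B a φ = trans (∑-os _) (cong (_+ (∑[ b ∈ B′ ] 𝟙 (E a b ∧ (lowA a ∧ lowB b)) * φ b)) (∑-0 A′))

    only-A : ∀ b (φ : Fin n → ℕ) → (∑[ y ∈ os ] 𝟙 (adj (false , b) y) * φ (proj₂ y)) ≡ (∑[ a ∈ A′ ] 𝟙 (E a b ∧ (lowA a ∧ lowB b)) * φ a)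
    only-A b φ = trans (∑-os _) (trans (cong (_+_ ((∑[ a ∈ A′ ] 𝟙 (E a b ∧ (lowA a ∧ lowB b)) * φ a))) (∑-0 B′)) (+-identityʳ _))

    once-filter : ∀ (p : Fin n → Bool) (w : Fin n → Bool) xs → Once xs → ∀ v → (∑[ x ∈ filterᵇ p xs ] 𝟙 (w x) * 𝟙 (does (x Finₚ.≟ v))) ≤ 1
    once-filter p w xs once v = ≤-trans (∑-mono (filterᵇ p xs) λ x → ≤-trans (*-monoˡ-≤ _ (𝟙≤1 (w x))) (≤-reflexive (*-identityˡ _)))
      (≤-trans (∑-filter-≤ p xs _) (once v))

    simple : ∀ x v → (∑[ y ∈ os ] 𝟙 (adj x y) * 𝟙 (does (proj₂ y Finₚ.≟ v))) ≤ 1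
    simple (true  , a) v = ≤-trans (≤-reflexive (only-B a _)) (once-filter lowB (λ b → E a b ∧ (lowA a ∧ lowB b)) B onceB v)
    simple (false , b) v = ≤-trans (≤-reflexive (only-A b _)) (once-filter lowA (λ a → E a b ∧ (lowA a ∧ lowB b)) A onceA v)

    times-1 : ∀ x → (∑[ y ∈ os ] 𝟙 (adj x y)) ≡ (∑[ y ∈ os ] 𝟙 (adj x y) * 1)
    times-1 x = ∑-cong os λ y → sym (*-identityʳ _)

    bounded : ∀ l d → (l ≡ true → d ≤ Δ) → 𝟙 l * d ≤ Δ
    bounded true  d h = ≤-trans (≤-reflexive (*-identityˡ d)) (h refl)
    bounded false d h = z≤n

    drop-right : ∀ x y z → 𝟙 (x ∧ (y ∧ z)) * 1 ≤ 𝟙 y * 𝟙 x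
    drop-right false y     z = z≤n
    drop-right true  false z = z≤n
    drop-right true  true  z = ≤-trans (≤-reflexive (*-identityʳ (𝟙 z))) (𝟙≤1 z)

    drop-left : ∀ x y z → 𝟙 (x ∧ (y ∧ z)) * 1 ≤ 𝟙 z * 𝟙 x
    drop-left false y     z     = z≤n
    drop-left true  false z     = z≤n
    drop-left true  true  false = z≤n
    drop-left true  true  true  = ≤-refl

    degree≤Δ : ∀ x → (∑[ y ∈ os ] 𝟙 (adj x y)) ≤ Δ
    degree≤Δ (true , a) = begin
      (∑[ y ∈ os ] 𝟙 (adj (true , a) y))             ≡⟨ trans (times-1 (true , a)) (only-B a (λ _ → 1)) ⟩
      (∑[ b ∈ B′ ] 𝟙 (E a b ∧ (lowA a ∧ lowB b)) * 1) ≤⟨ ∑-mono B′ (λ b → drop-right (E a b) (lowA a) (lowB b)) ⟩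
      (∑[ b ∈ B′ ] 𝟙 (lowA a) * 𝟙 (E a b))           ≤⟨ ∑-filter-≤ lowB B _ ⟩
      (∑[ b ∈ B ] 𝟙 (lowA a) * 𝟙 (E a b))            ≡⟨ ∑-*ˡ B (𝟙 (lowA a)) _ ⟩
      𝟙 (lowA a) * (∑[ b ∈ B ] 𝟙 (E a b))            ≤⟨ bounded (lowA a) _ (λ h → low⇒≤Δ _ (≤?-true _ _ h)) ⟩
      Δ                                              ∎
      where open ≤-Reasoning
    degree≤Δ (false , b) = begin
      (∑[ y ∈ os ] 𝟙 (adj (false , b) y))            ≡⟨ trans (times-1 (false , b)) (only-A b (λ _ → 1)) ⟩
      (∑[ a ∈ A′ ] 𝟙 (E a b ∧ (lowA a ∧ lowB b)) * 1) ≤⟨ ∑-mono A′ (λ a → drop-left (E a b) (lowA a) (lowB b)) ⟩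
      (∑[ a ∈ A′ ] 𝟙 (lowB b) * 𝟙 (E a b))           ≤⟨ ∑-filter-≤ lowA A _ ⟩
      (∑[ a ∈ A ] 𝟙 (lowB b) * 𝟙 (E a b))            ≡⟨ trans (∑-*ˡ A (𝟙 (lowB b)) _) (cong (𝟙 (lowB b) *_) (∑-cong A λ a → cong 𝟙 (E-sym a b))) ⟩
      𝟙 (lowB b) * (∑[ a ∈ A ] 𝟙 (E b a))            ≤⟨ bounded (lowB b) _ (λ h → low⇒≤Δ _ (≤?-true _ _ h)) ⟩
      Δ                                              ∎
      where open ≤-Reasoning

    cover : Cover G
    cover = record { O = Bool × Fin n ; os = os ; und = proj₂ ; adj = adj ; adj-sym = adj-sym ; adj⇒~ = λ {x} {y} → adj⇒~ {x} {y}
                   ; simple = simple ; Δ = Δ ; degree≤Δ = degree≤Δ }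

    keep : ∀ x y z → y ≡ true → z ≡ true → 𝟙 x ≤ 𝟙 (x ∧ (y ∧ z))
    keep false _ _ _    _    = z≤n
    keep true  _ _ refl refl = ≤-refl

    2e′≤ : e′ + e′ ≤ (∑[ x ∈ os ] ∑[ w ∈ os ] 𝟙 (adj x w))
    2e′≤ = begin
      e′ + e′
        ≤⟨ +-mono-≤ one′ (≤-trans one′ (≤-reflexive (∑-swap A′ B′ _))) ⟩
      (∑[ a ∈ A′ ] ∑[ b ∈ B′ ] 𝟙 (E a b ∧ (lowA a ∧ lowB b))) + (∑[ b ∈ B′ ] ∑[ a ∈ A′ ] 𝟙 (E a b ∧ (lowA a ∧ lowB b)))
        ≡⟨ sym (trans (∑-os _) (cong₂ _+_
             (∑-cong A′ λ a → trans (times-1 (true , a)) (trans (only-B a (λ _ → 1)) (∑-cong B′ λ b → *-identityʳ _)))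
             (∑-cong B′ λ b → trans (times-1 (false , b)) (trans (only-A b (λ _ → 1)) (∑-cong A′ λ a → *-identityʳ _))))) ⟩
      (∑[ x ∈ os ] ∑[ w ∈ os ] 𝟙 (adj x w)) ∎
      where
      open ≤-Reasoning
      one′ : e′ ≤ (∑[ a ∈ A′ ] ∑[ b ∈ B′ ] 𝟙 (E a b ∧ (lowA a ∧ lowB b)))
      one′ = ∑-filter-mono lowA A _ _ λ a la → ∑-filter-mono lowB B _ _ λ b lb → keep (E a b) _ _ la lb

    -- Either high part carries at most an eighth of the edges, so three quarters remain.
    3e≤4e′ : 3 * e ≤ 4 * e′
    3e≤4e′ = *-cancelˡ-≤ 2 (+-cancelʳ-≤ (2 * e) _ _ (begin
      2 * (3 * e) + 2 * e                                    ≡⟨ lem e ⟩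
      8 * e                                                  ≤⟨ *-monoʳ-≤ 8 split ⟩
      8 * (e′ + (xA + xB))                                   ≡⟨ lem₂ e′ xA xB ⟩
      2 * (4 * e′) + (8 * xA + 8 * xB)                       ≤⟨ +-monoʳ-≤ (2 * (4 * e′)) (+-mono-≤ smallA smallB) ⟩
      2 * (4 * e′) + (e + e)                                 ≡⟨ cong (λ t → 2 * (4 * e′) + (e + t)) (sym (+-identityʳ e)) ⟩
      2 * (4 * e′) + 2 * e                                   ∎))
      where
      open ≤-Reasoning
      A″ = filterᵇ (λ a → not (lowA a)) A
      B″ = filterᵇ (λ b → not (lowB b)) B
      xA = edges (high-part s A B) B
      xB = edges (high-part s B A) A
      lem : ∀ e → 2 * (3 * e) + 2 * e ≡ 8 * e
      lem = solve-∀
      lem₂ : ∀ a b c → 8 * (a + (b + c)) ≡ 2 * (4 * a) + (8 * b + 8 * c)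
      lem₂ = solve-∀
      xB≡ : edges A B″ ≡ xB
      xB≡ = trans (edges-sym A B″) (cong (λ t → edges (filterᵇ (λ b → not (low s t A b)) B) A) (edges-sym A B))
      split : e ≤ e′ + (xA + xB)
      split = begin
        e                                         ≡⟨ ∑-split lowA A _ ⟩
        edges A′ B + edges A″ B                   ≡⟨ cong (_+ edges A″ B) (trans (∑-cong A′ λ a → ∑-split lowB B _) (∑-+ A′ _ _)) ⟩
        e′ + edges A′ B″ + edges A″ B             ≤⟨ +-monoˡ-≤ (edges A″ B) (+-monoʳ-≤ e′ (≤-trans (∑-filter-≤ lowA A _) (≤-reflexive xB≡))) ⟩
        e′ + xB + edges A″ B                      ≡⟨ lem₃ e′ xB (edges A″ B) ⟩
        e′ + (xA + xB)                            ∎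
        where
        lem₃ : ∀ a b c → a + b + c ≡ a + (c + b)
        lem₃ = solve-∀

    0<e′ : 0 < e′
    0<e′ = n≢0⇒n>0 λ e′≡0 → <⇒≱ 0<e (*-cancelˡ-≤ 3 (≤-trans 3e≤4e′ (≤-reflexive (cong (4 *_) e′≡0))))

    os≤2s : length os ≤ 2 * s
    os≤2s = begin
      length os             ≡⟨ trans (length-++ (map tag₁ A′)) (cong₂ _+_ (length-map tag₁ A′) (length-map tag₂ B′)) ⟩
      length A′ + length B′ ≤⟨ +-mono-≤ (short lowA A lenA) (short lowB B lenB) ⟩
      s + s                 ≡⟨ cong (_+_ s) (+-identityʳ s) ⟨
      2 * s                 ∎
      where
      open ≤-Reasoning
      short : ∀ (p : Fin n → Bool) xs → length xs ≡ s → length (filterᵇ p xs) ≤ s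
      short p xs len = subst₂ _≤_ (sym (length-∑ (filterᵇ p xs))) (trans (sym (length-∑ xs)) len) (∑-filter-≤ p xs _)

    0<os : 0 < length os
    0<os = subst (0 <_) (sym (length-∑ os)) (n≢0⇒n>0 λ eq → <⇒≱ 0<e′ (≤-trans (m≤m+n e′ e′) (≤-trans 2e′≤ (begin
      (∑[ x ∈ os ] ∑[ w ∈ os ] 𝟙 (adj x w))      ≤⟨ ∑-mono os degree≤Δ ⟩
      (∑[ x ∈ os ] Δ)                            ≡⟨ trans (∑-const os Δ) (cong (_* Δ) (trans (length-∑ os) eq)) ⟩
      0                                          ∎))))
      where open ≤-Reasoning
    -- The order times Δ is at most 2 cap e, and e is at most 4/3 of the remaining e′. For `cap` =
    -- 64 the choice c = 50 satisfies 2 cap ≤ 3 c and gives the density constant 100 of the main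
    -- argument.
    dense : ∀ {c} → 2 * cap ≤ 3 * c → length os * Δ ≤ 2 * c * (∑[ x ∈ os ] ∑[ w ∈ os ] 𝟙 (adj x w))
    dense {c} c≤ = begin
      length os * Δ          ≤⟨ *-monoˡ-≤ Δ os≤2s ⟩
      2 * s * Δ              ≡⟨ lem₁ s Δ ⟩
      2 * (Δ * s)            ≤⟨ *-monoʳ-≤ 2 Δs≤ ⟩
      2 * (cap * e)          ≤⟨ ≤-trans (≤-reflexive (sym (*-assoc 2 cap e))) (*-monoˡ-≤ e c≤) ⟩
      3 * c * e              ≡⟨ lem₂ c e ⟩
      c * (3 * e)            ≤⟨ *-monoʳ-≤ c 3e≤4e′ ⟩
      c * (4 * e′)           ≡⟨ lem₃ c e′ ⟩
      2 * c * (e′ + e′)      ≤⟨ *-monoʳ-≤ (2 * c) 2e′≤ ⟩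
      2 * c * (∑[ x ∈ os ] ∑[ w ∈ os ] 𝟙 (adj x w)) ∎
      where
      open ≤-Reasoning
      lem₁ : ∀ s d → 2 * s * d ≡ 2 * (d * s)
      lem₁ = solve-∀
      lem₂ : ∀ c e → 3 * c * e ≡ c * (3 * e)
      lem₂ = solve-∀
      lem₃ : ∀ c e → c * (4 * e) ≡ 2 * c * (e + e)
      lem₃ = solve-∀

module Reduce (k′ p r g C₇ cap half : ℕ) (64≡ : 64 ≡ cap) (cap≡ : 2 * half ≡ cap) (16≤half : 2 ^ 4 ≤ half) (d : ℕ) (d≥ : 2 * cap ≤ 3 * d) (100≡ : 2 * d ≡ 100)
  (0<r : 0 < r) (r≤2g : r ≤ 2 * g)
  (K : ℕ) (K≡ : K ≡ suc k′ * suc (suc p)) (g≡ : g ≡ K + (suc (suc p) + 16 * (suc k′ * suc k′))) (q≡ : r + g ≡ 3 * K)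
  (sufficient : Sufficient k′ p C₇) {n : ℕ} (G : Graph (Fin n)) where

  open Graph G
  open BoundedDegree G cap

  private
    k = suc k′
    ℓ = suc (suc p)
    m = suc (k′ + suc k′)
    q = r + g

    0<q : 0 < q
    0<q = ≤-trans 0<r (m≤m+n r g)

    0<K : 0 < K
    0<K = subst (0 <_) (sym K≡) (s≤s z≤n)

  module Balanced (C₀ : ℕ) (C₇≤ : C₇ ≤ C₀) (0<C₀ : 0 < C₀) (A B : List (Fin n)) (s : ℕ) (0<s : 0 < s) (lenA : length A ≡ s) (lenB : length B ≡ s)
    (onceA : Once A) (onceB : Once B) (large : C₀ ^ q * s ^ (q + g) ≤ edges A B ^ q) where

    private
      instance
        nz-s = >-nonZero 0<s
        nz-q = >-nonZero 0<q
        nz-C = >-nonZero 0<C₀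
        nz-K = >-nonZero 0<K

      nz-half : NonZero half
      nz-half = >-nonZero (<-≤-trans (s≤s z≤n) 16≤half)

      e = edges A B

    s≤e : s ≤ e
    s≤e = ^-cancelˡ-≤ q (≤-trans (≤-trans (^-monoʳ-≤ s (m≤m+n q g)) (m≤n*m (s ^ (q + g)) (C₀ ^ q) {{m^n≢0 C₀ q}})) large)

    private
      quotient : ∃ λ Δ → Δ * s ≤ cap * e × (∀ d → s * d ≤ cap * e → d ≤ Δ) × half * e ≤ Δ * s
      -- Δ is the integer part of cap e / s. As s ≤ e this quotient is at least 1, so rounding down
      -- loses at most a factor 2, which turns `cap` into `half`.
      quotient = cap * e div s , m/n*n≤m (cap * e) s ,
        (λ d h → ≤-trans (≤-reflexive (sym (m*n/n≡m d s))) (/-monoˡ-≤ s (≤-trans (≤-reflexive (*-comm d s)) h))) ,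
        *-cancelˡ-≤ 2 (begin
          2 * (half * e)    ≡⟨ trans (sym (*-assoc 2 half e)) (cong (_* e) cap≡) ⟩
          cap * e        ≤⟨ <⇒≤ (m<[1+m/n]*n (cap * e) s) ⟩
          suc (cap * e div s) * s       ≤⟨ *-monoˡ-≤ s (+-monoˡ-≤ (cap * e div s) (m≥n⇒m/n>0 (≤-trans s≤e (m≤n*m e cap {{nz-cap}})))) ⟩
          (cap * e div s + cap * e div s) * s     ≡⟨ lem (cap * e div s) s ⟩
          2 * (cap * e div s * s)     ∎)
        where
        open ≤-Reasoning
        nz-cap = >-nonZero (subst (0 <_) 64≡ (s≤s z≤n))
        lem : ∀ d s → (d + d) * s ≡ 2 * (d * s)
        lem = solve-∀

      roots : ∃ λ b → ∃ λ z → 1 ≤ b × b ≤ s × s ≤ b ^ m × b ^ m ≤ 2 ^ m * s ×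
        1 ≤ z × s ^ m * s ^ m * (s ^ m * s ^ m) ≤ z ^ ℓ × z ^ ℓ ≤ 2 ^ ℓ * (s ^ m * s ^ m * (s ^ m * s ^ m))
      roots with b , 1≤b , b≤s , s≤ , ≤s ← least-root (k′ + suc k′) s 0<s
        with z , 1≤z , _ , s≤′ , ≤s′ ← least-root (suc p) (s ^ m * s ^ m * (s ^ m * s ^ m)) (*-mono-≤ (*-mono-≤ (m^n>0 s m) (m^n>0 s m)) (*-mono-≤ (m^n>0 s m) (m^n>0 s m)))
        = b , z , 1≤b , b≤s , s≤ , ≤s , 1≤z , s≤′ , ≤s′

    balanced-contains : 8 * edges (high-part s A B) B ≤ e → 8 * edges (high-part s B A) A ≤ e → Contains G (H k ℓ)
    balanced-contains smallA smallB = contains quotient roots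
      where
      contains : (∃ λ Δ → Δ * s ≤ cap * e × (∀ d → s * d ≤ cap * e → d ≤ Δ) × half * e ≤ Δ * s) →
        (∃ λ b → ∃ λ z → 1 ≤ b × b ≤ s × s ≤ b ^ m × b ^ m ≤ 2 ^ m * s ×
          1 ≤ z × s ^ m * s ^ m * (s ^ m * s ^ m) ≤ z ^ ℓ × z ^ ℓ ≤ 2 ^ ℓ * (s ^ m * s ^ m * (s ^ m * s ^ m))) → Contains G (H k ℓ)
      contains (Δ , Δs≤ , low⇒≤ , half≤) (b , z , 1≤b , b≤s , s≤bᵐ , bᵐ≤ , 1≤z , ≤zˡ , zˡ≤) =
        sufficient G cover s b z 1≤b b≤s 1≤z s≤bᵐ ≤zˡ 0<os os≤2s (≤-trans (dense {d} d≥) (≤-reflexive (cong (_* (∑[ x ∈ os ] ∑[ w ∈ os ] 𝟙 (adj x w))) 100≡))) cubic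
        where
        open RegularPair A B s Δ lenA lenB onceA onceB (<-≤-trans 0<s s≤e) Δs≤ low⇒≤ smallA smallB
        cubic : C₇ * (s * (b * b * (z * z))) ≤ Δ * Δ * Δ
        cubic = cube-bound {k} {ℓ} {m} refl K≡ g≡ q≡ (half * C₀) C₇ _ s Δ (root-bound {k} {ℓ} {m} refl K≡ g≡ q≡ s b z bᵐ≤ zˡ≤)
          (≤-trans (*-mono-≤ C₇≤ 16≤half) (≤-trans (≤-reflexive (*-comm C₀ half)) (m≤m*n (half * C₀) ((half * C₀) ^ 2) {{m^n≢0 (half * C₀) 2 {{m*n≢0 half C₀ {{nz-half}}}}}})))
          (degree-bound {k} {ℓ} {m} refl K≡ g≡ q≡ half C₀ s e Δ large half≤)

  Once-filter : ∀ (w : Fin n → Bool) A → Once A → Once (filterᵇ w A)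
  Once-filter w A once v = ≤-trans (∑-filter-≤ w A _) (once v)

  length-filter-≤ : ∀ (w : Fin n → Bool) A → length (filterᵇ w A) ≤ length A
  length-filter-≤ w A = subst₂ _≤_ (sym (length-∑ (filterᵇ w A))) (sym (length-∑ A)) (∑-filter-≤ w A _)

  high-heavy : ∀ s A B → length (high-part s A B) * (cap * edges A B) ≤ s * edges (high-part s A B) B
  high-heavy s A B = begin
    length S * (cap * e)        ≡⟨ trans (cong (_* (cap * e)) (length-∑ S)) (sym (∑-*ʳ S (cap * e) _)) ⟩
    (∑[ a ∈ S ] 1 * (cap * e))  ≤⟨ ∑-filter-mono _ A _ _ (λ a h → ≤-trans (≤-reflexive (*-identityˡ (cap * e))) (above a h)) ⟩
    (∑[ a ∈ S ] s * (∑[ b ∈ B ] 𝟙 (E a b))) ≡⟨ ∑-*ˡ S s _ ⟩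
    s * edges S B               ∎
    where
    open ≤-Reasoning
    e = edges A B
    S = high-part s A B
    above : ∀ a → not (low s e B a) ≡ true → cap * e ≤ s * (∑[ b ∈ B ] 𝟙 (E a b))
    above a h = <⇒≤ (≤?-false (s * (∑[ b ∈ B ] 𝟙 (E a b))) (cap * e) (trans (sym (not-involutive _)) (cong not h)))

  nonempty : ∀ (xs : List (Fin n)) f → 0 < ∑ xs f → 0 < length xs
  nonempty (x ∷ xs) f h = s≤s z≤n

  module _ (C₀ : ℕ) where

    Large : ℕ → List (Fin n) → List (Fin n) → Set
    Large s A B = C₀ ^ q * s ^ (q + g) ≤ edges A B ^ q

    Large-sym : ∀ s A B → Large s A B → Large s B A
    Large-sym s A B = subst (λ e → C₀ ^ q * s ^ (q + g) ≤ e ^ q) (edges-sym A B)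

    record DenserPair (s : ℕ) : Set where
      field
        σ      : ℕ
        σ<s    : σ < s
        0<σ    : 0 < σ
        S T    : List (Fin n)
        lenS   : length S ≡ σ
        lenT   : length T ≡ σ
        onceS  : Once S
        onceT  : Once T
        larger : Large σ S T

    densify : ∀ s A B → 0 < s → length A ≡ s → length B ≡ s → Once A → Once B → Large s A B →
      0 < edges A B → edges A B < 8 * edges (high-part s A B) B → DenserPair s
    densify s A B 0<s lenA lenB onceA onceB large 0<e e<8x = pair (heavy-sublist f σ (s ∸ σ) B (trans lenB (sym (m∸n+n≡m σ≤s))))
      where
      e = edges A B
      S = high-part s A B
      x = edges S B
      σ = length S
      f : Fin n → ℕ
      f b = ∑[ a ∈ S ] 𝟙 (E a b)
      σ≤s : σ ≤ s
      σ≤s = ≤-trans (length-filter-≤ _ A) (≤-reflexive lenA)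
      x≤e : x ≤ e
      x≤e = ∑-filter-≤ _ A _
      0<x : 0 < x
      0<x = n≢0⇒n>0 λ x≡0 → n≮0 (subst (e <_) (cong (8 *_) x≡0) e<8x)
      0<σ : 0 < σ
      0<σ = nonempty S _ 0<x
      high : σ * (cap * e) ≤ s * x
      high = high-heavy s A B
      -- If every vertex were high, the edges at them would number at least `cap` times e. The
      -- strict decrease is what lets the passage to denser pairs terminate.
      σ<s : σ < s
      σ<s = ≰⇒> λ s≤σ → <⇒≱ (m<m*n e cap {{>-nonZero 0<e}} 1<cap) (≤-trans (≤-reflexive (*-comm e cap))
        (*-cancelˡ-≤ s {{>-nonZero 0<s}} (≤-trans (*-monoˡ-≤ (cap * e) s≤σ) (≤-trans high (*-monoʳ-≤ s x≤e)))))
        where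
        1<cap : 1 < cap
        1<cap = subst (1 <_) 64≡ (s≤s (s≤s z≤n))
      pair : (∃ λ T → length T ≡ σ × (∀ h → ∑ T h ≤ ∑ B h) × σ * ∑ B f ≤ ∑ T f * length B) → DenserPair s
      pair (T , lenT , sub , avg) = record
        { σ = σ ; σ<s = σ<s ; 0<σ = 0<σ ; S = S ; T = T ; lenS = refl ; lenT = lenT
        ; onceS = Once-filter _ A onceA ; onceT = λ v → ≤-trans (sub _) (onceB v) ; larger = larger }
        where
        open ≤-Reasoning
        e′ = edges S T
        avg′ : σ * x ≤ e′ * s
        avg′ = subst₂ _≤_ (cong (σ *_) (∑-swap B S _)) (cong₂ _*_ (∑-swap T S _) lenB) avg
        larger : Large σ S T
        larger = *-cancelˡ-≤ (s ^ (q + g)) {{m^n≢0 s (q + g) {{>-nonZero 0<s}}}} (begin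
          s ^ (q + g) * (C₀ ^ q * σ ^ (q + g))   ≡⟨ x∙yz≈yx∙z (s ^ (q + g)) (C₀ ^ q) (σ ^ (q + g)) ⟩
          C₀ ^ q * s ^ (q + g) * σ ^ (q + g)     ≤⟨ *-monoˡ-≤ (σ ^ (q + g)) large ⟩
          e ^ q * σ ^ (q + g)                    ≤⟨ denser r g 0<r r≤2g e x e′ s σ 0<s 0<σ avg′ (≤-trans (≤-reflexive (cong (λ c → σ * (c * e)) 64≡)) high) e<8x ⟩
          e′ ^ q * s ^ (q + g)                   ≡⟨ *-comm (e′ ^ q) (s ^ (q + g)) ⟩
          s ^ (q + g) * e′ ^ q                   ∎)

    -- Passing to denser pairs terminates at one whose high-degree parts are negligible.
    dense-contains : C₇ ≤ C₀ → 0 < C₀ → ∀ s → Acc _<_ s → ∀ A B → 0 < s → length A ≡ s → length B ≡ s → Once A → Once B →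
      Large s A B → Contains G (H k ℓ)
    dense-contains C₇≤ 0<C₀ s (acc smaller) A B 0<s lenA lenB onceA onceB large =
      cases (8 * edges (high-part s A B) B ≤? edges A B) (8 * edges (high-part s B A) A ≤? edges A B)
      where
      open Balanced C₀ C₇≤ 0<C₀ A B s 0<s lenA lenB onceA onceB large
      0<e : 0 < edges A B
      0<e = <-≤-trans 0<s s≤e
      recurse : DenserPair s → Contains G (H k ℓ)
      recurse P = dense-contains C₇≤ 0<C₀ σ (smaller σ<s) S T 0<σ lenS lenT onceS onceT larger
        where open DenserPair P
      cases : Dec (8 * edges (high-part s A B) B ≤ edges A B) → Dec (8 * edges (high-part s B A) A ≤ edges A B) → Contains G (H k ℓ)
      cases (yes smallA) (yes smallB) = balanced-contains smallA smallB
      cases (no  bigA)   _            = recurse (densify s A B 0<s lenA lenB onceA onceB large 0<e (≰⇒> bigA))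
      cases (yes _)      (no bigB)    = recurse (densify s B A 0<s lenB lenA onceB onceA (Large-sym s A B large)
        (subst (0 <_) (edges-sym A B) 0<e) (subst (_< 8 * edges (high-part s B A) A) (edges-sym A B) (≰⇒> bigB)))

-- From the integer inequality to the real exponent

open ℝ

-- If n r < c for some rational r > ε, then n lies in the lower cut of c / ε, and by the hypothesis
-- n < n.
ratio≤⇒ : ∀ c n (ε : ℝ) (0<ε : 0ᵣ <ᵣ ε) → (c / ε [ 0<ε ]) ≤ᵣ fromℕ n → ∀ r → U ε r → + c / 1 ℚ.≤ + n / 1 ℚ.* r
ratio≤⇒ c n ε 0<ε h r Ur = ℚₚ.≮⇒≥ λ lt → ℚₚ.<-irrefl refl (h (+ n / 1) (r , Ur , lt))

upper-bound : ∀ x p q → (x ⊕ p) <ᵣ fromℚ q → U p (q ℚ.- x)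
upper-bound x ε q (u , Uu , u<q) = closedU ε (ℚₚ.+-monoˡ-< (ℚ.- x) u<q) Uu

toℚᵘ-/ : ∀ n d → ℚ.toℚᵘ (n / suc d) ℚᵘ.≃ mkℚᵘ n d
toℚᵘ-/ n d = ℚₚ.toℚᵘ-fromℚᵘ (mkℚᵘ n d)

clear-denominators : ∀ a b p q m d → + a / 1 ℚ.≤ + b / 1 ℚ.* (+ p / suc q ℚ.- + m / suc d) →
  a ℕ.* (suc q ℕ.* suc d) ℕ.+ b ℕ.* (m ℕ.* suc q) ℕ.≤ b ℕ.* (p ℕ.* suc d)
clear-denominators a b p q m d h = ℤₚ.drop‿+≤+ (subst₂ ℤ._≤_ left right (ℤₚ.+-monoˡ-≤ (+ b ℤ.* (+ m ℤ.* + suc q)) integral))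
  where
  unnormalised : mkℚᵘ (+ a) 0 ℚᵘ.≤ mkℚᵘ (+ b) 0 ℚᵘ.* (mkℚᵘ (+ p) q ℚᵘ.- mkℚᵘ (+ m) d)
  unnormalised = ℚᵘₚ.≤-respˡ-≃ (toℚᵘ-/ (+ a) 0) (ℚᵘₚ.≤-respʳ-≃ (ℚᵘₚ.≃-trans (ℚₚ.toℚᵘ-homo-* (+ b / 1) _)
    (ℚᵘₚ.*-cong (toℚᵘ-/ (+ b) 0) (ℚᵘₚ.≃-trans (ℚₚ.toℚᵘ-homo-+ (+ p / suc q) _) (ℚᵘₚ.+-cong (toℚᵘ-/ (+ p) q)
      (ℚᵘₚ.≃-trans (ℚₚ.toℚᵘ-homo‿- (+ m / suc d)) (ℚᵘₚ.-‿cong (toℚᵘ-/ (+ m) d))))))) (ℚₚ.toℚᵘ-mono-≤ h))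
  integral : + a ℤ.* (+ suc q ℤ.* + suc d) ℤ.≤ + b ℤ.* (+ p ℤ.* + suc d ℤ.+ ℤ.- + m ℤ.* + suc q)
  integral = subst₂ ℤ._≤_ (cong (+ a ℤ.*_) (ℤₚ.*-identityˡ _)) (ℤₚ.*-identityʳ _) (ℚᵘₚ.drop-*≤* unnormalised)
  left : + a ℤ.* (+ suc q ℤ.* + suc d) ℤ.+ + b ℤ.* (+ m ℤ.* + suc q) ≡ + (a ℕ.* (suc q ℕ.* suc d) ℕ.+ b ℕ.* (m ℕ.* suc q))
  left = trans (cong₂ ℤ._+_ (trans (cong (+ a ℤ.*_) (sym (ℤₚ.pos-* (suc q) (suc d)))) (sym (ℤₚ.pos-* a _)))
    (trans (cong (+ b ℤ.*_) (sym (ℤₚ.pos-* m (suc q)))) (sym (ℤₚ.pos-* b _)))) (sym (ℤₚ.pos-+ (a ℕ.* (suc q ℕ.* suc d)) _))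
  right : + b ℤ.* (+ p ℤ.* + suc d ℤ.+ ℤ.- + m ℤ.* + suc q) ℤ.+ + b ℤ.* (+ m ℤ.* + suc q) ≡ + (b ℕ.* (p ℕ.* suc d))
  right = trans (lem (+ b) (+ p) (+ suc d) (+ m) (+ suc q)) (trans (cong (+ b ℤ.*_) (sym (ℤₚ.pos-* p (suc d)))) (sym (ℤₚ.pos-* b _)))
    where
    lem : ∀ b p d m q → b ℤ.* (p ℤ.* d ℤ.+ ℤ.- m ℤ.* q) ℤ.+ b ℤ.* (m ℤ.* q) ≡ b ℤ.* (p ℤ.* d)
    lem = ℤ-solve-∀

unique⇒once : ∀ {n} {xs : List (Fin n)} → Unique xs → ∀ v → (∑[ a ∈ xs ] 𝟙 (does (a Finₚ.≟ v))) ≤ 1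
unique⇒once AllPairs.[]                     v = z≤n
unique⇒once {xs = x ∷ xs} (x∉ AllPairs.∷ unique) v with x Finₚ.≟ v
... | yes refl = ≤-reflexive (cong suc (absent x∉))
  where
  absent : ∀ {ys} → All.All (x ≢_) ys → (∑[ a ∈ ys ] 𝟙 (does (a Finₚ.≟ x))) ≡ 0
  absent All.[]                   = refl
  absent {y ∷ ys} (x≢y All.∷ x∉) with y Finₚ.≟ x
  ... | yes y≡x = ⊥-elim (x≢y (sym y≡x))
  ... | no  _   = absent x∉
... | no _ = unique⇒once unique v

length-filter≤ : ∀ {X : Set} {P : X → Set} (P? : ∀ x → Dec (P x)) (w : X → Bool) → (∀ x → does (P? x) ≡ true → w x ≡ true) →
  ∀ xs → length (filter P? xs) ≤ ∑ xs (λ x → 𝟙 (w x))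
length-filter≤ P? w h []       = z≤n
length-filter≤ P? w h (x ∷ xs) with does (P? x) in eq
... | true  rewrite h x eq = s≤s (length-filter≤ P? w h xs)
... | false = ≤-trans (length-filter≤ P? w h xs) (m≤n+m _ (𝟙 (w x)))

module _ {n : ℕ} (G : Graph (Fin n)) (cap : ℕ) where

  open Graph G
  open BoundedDegree G cap

  ∣E∣≤edges : ∣E G ∣ ≤ edges (allFin n) (allFin n)
  ∣E∣≤edges = ≤-trans count (≤-reflexive (∑∑-product (allFin n) (allFin n) _))
    where
    right : ∀ a b → a ∧ b ≡ true → b ≡ true
    right true b h = h
    count : length (filter (λ (i , j) → i Finₚ.<? j ×-dec i ~? j) (pairs n)) ≤ (∑[ x ∈ pairs n ] 𝟙 (E (proj₁ x) (proj₂ x)))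
    count = length-filter≤ (λ (i , j) → i Finₚ.<? j ×-dec i ~? j) (λ x → E (proj₁ x) (proj₂ x)) (λ x → right (does (proj₁ x Finₚ.<? proj₂ x)) _) (pairs n)

-- r is 3 K - g. That it is positive means that the exponent 1 + g / (3 K) is below 2, and r ≤ 2 g
-- that it is at least 4/3; the hypotheses on k and ℓ are needed for the former.
exponents : ∀ k ℓ → 2 ≤ k → 16 * k ≤ ℓ → let K = k * ℓ ; g = K + (ℓ + 16 * (k * k)) in
  ∃ λ r → 0 < r × r ≤ 2 * g × r + g ≡ 3 * K
exponents k ℓ 2≤k 16k≤ℓ = 2 * K ∸ v , m<n⇒0<n∸m v<2K ,
  ≤-trans (m∸n≤m (2 * K) v) (*-monoʳ-≤ 2 (m≤m+n K v)) ,
  trans (trans (lem₂ (2 * K ∸ v) K v) (cong (_+_ K) (m∸n+n≡m (<⇒≤ v<2K)))) refl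
  where
  open ≤-Reasoning
  K = k * ℓ
  v = ℓ + 16 * (k * k)
  lem₂ : ∀ a b c → a + (b + c) ≡ b + (a + c)
  lem₂ = solve-∀
  0<ℓ : 0 < ℓ
  0<ℓ = ≤-trans (*-mono-≤ {1} {16} (s≤s z≤n) (≤-trans (s≤s z≤n) 2≤k)) 16k≤ℓ
  v<2K : v < 2 * K
  v<2K = begin-strict
    ℓ + 16 * (k * k)  ≡⟨ cong (_+_ ℓ) (lem k) ⟩
    ℓ + k * (16 * k)  ≤⟨ +-monoʳ-≤ ℓ (*-monoʳ-≤ k 16k≤ℓ) ⟩
    ℓ + K             <⟨ +-monoˡ-< K (<-≤-trans (m<m+n ℓ 0<ℓ) (≤-trans (≤-reflexive (cong (_+_ ℓ) (sym (+-identityʳ ℓ)))) (*-monoˡ-≤ ℓ 2≤k))) ⟩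
    K + K             ≡⟨ cong (_+_ K) (+-identityʳ K) ⟨
    2 * K             ∎
    where
    lem : ∀ k → 16 * (k * k) ≡ k * (16 * k)
    lem = solve-∀

module FreeBound (k′ p r g C₇ cap half : ℕ) (64≡ : 64 ≡ cap) (cap≡ : 2 * half ≡ cap) (16≤half : 2 ^ 4 ≤ half) (d : ℕ) (d≥ : 2 * cap ≤ 3 * d) (100≡ : 2 * d ≡ 100)
  (0<r : 0 < r) (r≤2g : r ≤ 2 * g)
  (K : ℕ) (K≡ : K ≡ suc k′ * suc (suc p)) (g≡ : g ≡ K + (suc (suc p) + 16 * (suc k′ * suc k′))) (q≡ : r + g ≡ 3 * K)
  (sufficient : Sufficient k′ p C₇) where

  -- The descent to denser pairs starts with the whole vertex set on both sides, where `edges`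
  -- counts ordered pairs and is therefore at least the number of edges.
  free-bound : ∀ {n} (G : Graph (Fin n)) → 1 ≤ n → ¬ Contains G (H (suc k′) (suc (suc p))) → ∣E G ∣ ^ (r + g) < suc C₇ ^ (r + g) * n ^ (r + g + g)
  free-bound {n} G 1≤n free = ≰⇒> λ le → free (R.dense-contains (suc C₇) (n≤1+n C₇) (s≤s z≤n) n (<-wellFounded n) (allFin n) (allFin n) 1≤n
    (length-tabulate _) (length-tabulate _) (unique⇒once (allFin⁺ n)) (unique⇒once (allFin⁺ n))
    (≤-trans le (^-monoˡ-≤ (r + g) (∣E∣≤edges G cap))))
    where module R = Reduce k′ p r g C₇ cap half 64≡ cap≡ 16≤half d d≥ 100≡ 0<r r≤2g K K≡ g≡ q≡ sufficient G

module _ (k′ p : ℕ) where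

  private
    k = suc k′
    ℓ = suc (suc p)

  edge : FiniteGraph.graph (H k ℓ) .Graph._~_ (Fin.zero , Fin.zero) (Fin.zero , Fin.suc Fin.zero)
  edge = inj₁ (first refl refl (inj₁ refl))

  ex-bound : ∀ K g → K ≡ k * ℓ → g ≡ K + (ℓ + 16 * (k * k)) → (∃ λ r → 0 < r × r ≤ 2 * g × r + g ≡ 3 * K) →
    ∃ λ C → ∀ n → 1 ≤ n → ex n (H k ℓ) ^ (3 * K) ≤ C ^ (3 * K) * n ^ (3 * K + g)
  ex-bound K g K≡ g≡ (r , 0<r , r≤2g , q≡) = suc (proj₁ (constant k′ p)) , λ n 1≤n → bound n 1≤n (ex-isMaximum n (H k ℓ) edge)
    where
    open FreeBound k′ p r g (proj₁ (constant k′ p)) 64 32 refl refl (m≤m+n 16 16) 50 (m≤m+n 128 22) refl 0<r r≤2g K K≡ g≡ q≡ (proj₂ (constant k′ p))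
    bound : ∀ n → 1 ≤ n → IsMaximum (FreeWith n (H k ℓ)) (ex n (H k ℓ)) → ex n (H k ℓ) ^ (3 * K) ≤ suc (proj₁ (constant k′ p)) ^ (3 * K) * n ^ (3 * K + g)
    bound n 1≤n ((G , free , edges≡) , _) =
      subst₂ (λ q M → M ^ q ≤ suc (proj₁ (constant k′ p)) ^ q * n ^ (q + g)) q≡ edges≡ (<⇒≤ (free-bound G 1≤n free))

rescale : ∀ Q g p q C n M → .{{NonZero Q}} → .{{NonZero n}} → M ^ Q ≤ C ^ Q * n ^ (Q + g) → (Q + g) * q ≤ p * Q → M ^ q ≤ C ^ q * n ^ p
rescale Q g p q C n M M≤ exponent = ^-cancelˡ-≤ Q (begin
  (M ^ q) ^ Q                        ≡⟨ ^-swap M q Q ⟩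
  (M ^ Q) ^ q                        ≤⟨ ^-monoˡ-≤ q M≤ ⟩
  (C ^ Q * n ^ (Q + g)) ^ q          ≡⟨ *-^ (C ^ Q) _ q ⟩
  (C ^ Q) ^ q * (n ^ (Q + g)) ^ q    ≡⟨ cong₂ _*_ (^-swap C Q q) (^-*-assoc n (Q + g) q) ⟩
  (C ^ q) ^ Q * n ^ ((Q + g) * q)    ≤⟨ *-monoʳ-≤ ((C ^ q) ^ Q) (^-monoʳ-≤ n exponent) ⟩
  (C ^ q) ^ Q * n ^ (p * Q)          ≡⟨ cong ((C ^ q) ^ Q *_) (sym (^-*-assoc n p Q)) ⟩
  (C ^ q) ^ Q * (n ^ p) ^ Q          ≡⟨ *-^ (C ^ q) (n ^ p) Q ⟨
  (C ^ q * n ^ p) ^ Q                ∎)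
  where
  open ≤-Reasoning
  ^-swap : ∀ x a b → (x ^ a) ^ b ≡ (x ^ b) ^ a
  ^-swap x a b = trans (^-*-assoc x a b) (trans (cong (x ^_) (*-comm a b)) (sym (^-*-assoc x b a)))

-- With α = p / q, the hypotheses say 1/k ≤ α - 4/3 and 16 k / ℓ ≤ α - 4/3; the first also gives 0 ≤
-- α - 4/3. The sum of the three, multiplied by k ℓ, is the claim.
exponent≤ : ∀ k ℓ p q → .{{NonZero k}} → 1 * (q * 3) + k * (4 * q) ≤ k * (p * 3) → 16 * k * (q * 3) + ℓ * (4 * q) ≤ ℓ * (p * 3) →
  (3 * (k * ℓ) + (k * ℓ + (ℓ + 16 * (k * k)))) * q ≤ p * (3 * (k * ℓ))
exponent≤ k ℓ p q h₁ h₂ = *-cancelˡ-≤ 3 (begin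
  3 * ((3 * (k * ℓ) + (k * ℓ + (ℓ + 16 * (k * k)))) * q)  ≡⟨ lem₁ k ℓ q ⟩
  ℓ * (1 * (q * 3) + k * (4 * q)) + k * (16 * k * (q * 3) + ℓ * (4 * q)) + k * ℓ * (4 * q)
    ≤⟨ +-mono-≤ (+-mono-≤ (*-monoʳ-≤ ℓ h₁) (*-monoʳ-≤ k h₂)) (*-monoʳ-≤ (k * ℓ) (*-cancelˡ-≤ k (≤-trans (m≤n+m _ _) h₁))) ⟩
  ℓ * (k * (p * 3)) + k * (ℓ * (p * 3)) + k * ℓ * (p * 3)  ≡⟨ lem₂ k ℓ p ⟩
  3 * (p * (3 * (k * ℓ)))                                 ∎)
  where
  open ≤-Reasoning
  lem₁ : ∀ k ℓ q → 3 * ((3 * (k * ℓ) + (k * ℓ + (ℓ + 16 * (k * k)))) * q) ≡ ℓ * (1 * (q * 3) + k * (4 * q)) + k * (16 * k * (q * 3) + ℓ * (4 * q)) + k * ℓ * (4 * q)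
  lem₁ k ℓ q = lem₃ 16 k ℓ q
    where
    lem₃ : ∀ c k ℓ q → 3 * ((3 * (k * ℓ) + (k * ℓ + (ℓ + c * (k * k)))) * q) ≡ ℓ * (1 * (q * 3) + k * (4 * q)) + k * (c * k * (q * 3) + ℓ * (4 * q)) + k * ℓ * (4 * q)
    lem₃ = solve-∀
  lem₂ : ∀ k ℓ p → ℓ * (k * (p * 3)) + k * (ℓ * (p * 3)) + k * ℓ * (p * 3) ≡ 3 * (p * (3 * (k * ℓ)))
  lem₂ = solve-∀

-- The bounds 1/k and 16 k / ℓ ≤ p / (q + 1) - 4/3, with denominators cleared, at all rationals p /
-- (q + 1) above 4/3 + ε. This is the only form in which ε reaches the counting.
Admissible : ℕ → ℕ → ℝ → Set
Admissible k ℓ ε = ∀ p q → ℝ.U ε (+ p / suc q ℚ.- + 4 / 3) →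
  1 * (suc q * 3) + k * (4 * suc q) ≤ k * (p * 3) × 16 * k * (suc q * 3) + ℓ * (4 * suc q) ≤ ℓ * (p * 3)

admissible : ∀ k ℓ ε (0<ε : 0ᵣ <ᵣ ε) → (1 / ε [ 0<ε ]) ≤ᵣ fromℕ k → ((16 * k) / ε [ 0<ε ]) ≤ᵣ fromℕ ℓ → Admissible k ℓ ε
admissible k ℓ ε 0<ε 1/ε≤k 16k/ε≤ℓ p q U =
  clear-denominators 1 k p q 4 2 (ratio≤⇒ 1 k ε 0<ε 1/ε≤k _ U) ,
  clear-denominators (16 * k) ℓ p q 4 2 (ratio≤⇒ (16 * k) ℓ ε 0<ε 16k/ε≤ℓ _ U)

-- At the exponent 3/2 the constraints become 6 ≤ k and 96 k ≤ ℓ. Here the hypothesis ε < 1/6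
-- enters, to keep r in `exponents` positive.
separated : ∀ k ℓ → 1 * (2 * 3) + k * (4 * 2) ≤ k * (3 * 3) → 16 * k * (2 * 3) + ℓ * (4 * 2) ≤ ℓ * (3 * 3) → 2 ≤ k × 16 * k ≤ ℓ
separated k ℓ h₁ h₂ =
  ≤-trans (m≤m+n 2 4) (+-cancelʳ-≤ (k * 8) _ _ (≤-trans h₁ (≤-reflexive (lem k)))) ,
  ≤-trans (m≤m*n (16 * k) 6) (+-cancelʳ-≤ (ℓ * 8) _ _ (≤-trans h₂ (≤-reflexive (lem ℓ))))
  where
  lem : ∀ k → k * 9 ≡ k + k * 8
  lem = solve-∀

2+ : ∀ k ℓ → 2 ≤ k → 16 * k ≤ ℓ → ∃ λ p → ℓ ≡ suc (suc p)
2+ k ℓ 2≤k h = split ℓ (≤-trans 2≤k (≤-trans (m≤n*m k 16) h))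
  where
  split : ∀ ℓ → 2 ≤ ℓ → ∃ λ p → ℓ ≡ suc (suc p)
  split (suc (suc p)) _ = p , refl
  split (suc zero) (s≤s ())

module _ (k′ p : ℕ) (ε : ℝ) where

  private
    k = suc k′
    ℓ = suc (suc p)

  ex=O : (∃ λ C → ∀ n → 1 ≤ n → ex n (H k ℓ) ^ (3 * (k * ℓ)) ≤ C ^ (3 * (k * ℓ)) * n ^ (3 * (k * ℓ) + (k * ℓ + (ℓ + 16 * (k * k))))) →
    Admissible k ℓ ε → (λ n → ex n (H k ℓ)) =O[n^ (+ 4 / 3) ⊕ ε ]
  ex=O (C , bound) constraint = C , 1 , λ n 1≤n u v {{nz}} lt → rate n 1≤n u v {{nz}} lt
    where
    rate : ∀ n → 1 ≤ n → ∀ u v → .{{_ : NonZero v}} → ((+ 4 / 3) ⊕ ε) <ᵣ fromℚ (+ u / v) → ex n (H k ℓ) ^ v ≤ C ^ v * n ^ u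
    rate n 1≤n u (suc v) lt = conclude (constraint u v (upper-bound (+ 4 / 3) ε (+ u / suc v) lt))
      where
      conclude : 1 * (suc v * 3) + k * (4 * suc v) ≤ k * (u * 3) × 16 * k * (suc v * 3) + ℓ * (4 * suc v) ≤ ℓ * (u * 3) →
        ex n (H k ℓ) ^ suc v ≤ C ^ suc v * n ^ u
      conclude (h₁ , h₂) = rescale (3 * (k * ℓ)) (k * ℓ + (ℓ + 16 * (k * k))) u (suc v) C n (ex n (H k ℓ)) {{_}} {{>-nonZero 1≤n}} (bound n 1≤n) (exponent≤ k ℓ u (suc v) h₁ h₂)

theorem1p6 : (ε : ℝ) (0<ε : 0ᵣ <ᵣ ε) → ε <ᵣ fromℚ (+ 1 / 6) →
  (k ℓ : ℕ) → 1 ≤ k → 1 ≤ ℓ →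
  (1 / ε [ 0<ε ]) ≤ᵣ fromℕ k →
  ((16 * k) / ε [ 0<ε ]) ≤ᵣ fromℕ ℓ →
  (λ n → ex n (H k ℓ)) =O[n^ (+ 4 / 3) ⊕ ε ]
theorem1p6 ε 0<ε (r , Ur , r<1/6) k ℓ 1≤k _ 1/ε≤k 16k/ε≤ℓ = bounded k ℓ 1≤k constraint (separated k ℓ (proj₁ at-1/6) (proj₂ at-1/6))
  where
  constraint : Admissible k ℓ ε
  constraint = admissible k ℓ ε 0<ε 1/ε≤k 16k/ε≤ℓ

  -- 1/6 = 3/2 - 4/3
  at-1/6 : 1 * (2 * 3) + k * (4 * 2) ≤ k * (3 * 3) × 16 * k * (2 * 3) + ℓ * (4 * 2) ≤ ℓ * (3 * 3)
  at-1/6 = constraint 3 1 (ℝ.closedU ε r<1/6 Ur)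

  bounded : ∀ k ℓ → 1 ≤ k → Admissible k ℓ ε → 2 ≤ k × 16 * k ≤ ℓ → (λ n → ex n (H k ℓ)) =O[n^ (+ 4 / 3) ⊕ ε ]
  bounded (suc k′) ℓ _ constraint (2≤k , 16k≤ℓ) = go (2+ (suc k′) ℓ 2≤k 16k≤ℓ)
    where
    go : (∃ λ p → ℓ ≡ suc (suc p)) → (λ n → ex n (H (suc k′) ℓ)) =O[n^ (+ 4 / 3) ⊕ ε ]
    go (p , refl) = ex=O k′ p ε (ex-bound k′ p _ _ refl refl (exponents (suc k′) (suc (suc p)) 2≤k 16k≤ℓ)) constraint
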